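{- Fix an integer $d\geq 2$ and a partition $\mu=(\mu_1,\dots,\mu_l)$ of $d$. Then there are integers $C(\mu;k)\in\mathbb{Z}$, $1\leq k\leq \binom{d}{2}$, such that for every genus $g\in\mathbb{Z}_{\geq0}$, \[ H_{g;\mu}=\frac{2}{d!\cdot\mu_1\cdots\mu_l}\sum_{k=1}^{\binom{d}{2}}\Big(C(\mu;k)\cdot k^{d+2g-2+l}\Big). \] Moreover, $C(\mu;k)=0$ for all $k$ with $\binom{d-1}{2}<k<\binom{d}{2}$, $C(\mu;\binom{d}{2})=1$, and, when $d\geq 3$, $C(\mu;\binom{d-1}{2})=-d\cdot\#\{i : \mu_i=1\}$. Consequently, for fixed $\mu$, as $g\to\infty$, \[ H_{g;\mu}=\frac{2}{d!\cdot\mu_1\cdots\mu_l}\binom{d}{2}^{d+2g-2+l}-\frac{2\cdot\#\{i:\mu_i=1\}}{(d-1)!\cdot\mu_1\cdots\mu_l}\binom{d-1}{2}^{d+2g-2+l}+O\Bigg(\bigg(\binom{d-1}{2}-1\bigg)^{d+2g-2+l}\Bigg). \]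
   Context: A partition $\mu=(\mu_1,\dots,\mu_l)$ of $d$ is a weakly decreasing sequence of positive integers with sum $d$; $l=l(\mu)$ is its length. Let $m_j(\mu)=\#\{i:\mu_i=j\}$ and $|\mathrm{Aut}(\mu)|=\prod_{j\geq1} m_j(\mu)!$. For a partition $\mu$ of $d$, $C_\mu\subset S_d$ denotes the conjugacy class of permutations with cycle lengths $\mu_1,\dots,\mu_l$; $C_{(2,1^{d-2})}$ is the class of transpositions. For $g\geq 0$ set $b=2g-2+d+l(\mu)$. The connected simple Hurwitz number is \[ H_{g;\mu}=\frac{|\mathrm{Aut}(\mu)|}{d!}\cdot\#\{(\sigma_1,\dots,\sigma_{b+1}) : \sigma_1\in C_\mu,\ \sigma_i\in C_{(2,1^{d-2})}\ (2\leq i\leq b+1),\ \sigma_1\sigma_2\cdots\sigma_{b+1}=\mathrm{id},\ \langle\sigma_1,\dots,\sigma_{b+1}\rangle \text{ acts transitively on }\{1,\dots,d\}\}. \] (Equivalently, it is the weighted count, with weights $1/|\mathrm{Aut}|$, of connected genus-$g$ branched covers of $\mathbb{P}^1$ of degree $d$ with ramification type $\mu$ over $\infty$ and $b$ further simple branch points, automorphisms required to preserve the preimages of $\infty$.) -}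

module Defs where

open import Data.Bool using (Bool; true; false; _∧_; _∨_; not; if_then_else_)
open import Data.Nat as ℕ using (ℕ; zero; suc; _+_; _*_; _∸_; _≡ᵇ_; _!)
open import Data.Nat.Properties using (_!≢0)
open import Data.Fin as Fin using (Fin; _≟_)
open import Data.List using (List; []; _∷_; [_]; map; concatMap; length; filterᵇ; upTo; allFin)
open import Data.Nat.ListAction using (sum; product)
open import Data.Product using (_×_)
open import Data.List.Relation.Unary.All using (All)
open import Data.List.Relation.Unary.Linked using (Linked)
open import Data.Integer as ℤ using (ℤ; +_)
open import Data.Rational as ℚ using (ℚ; 0ℚ; _/_)
open import Relation.Nullary.Decidable using (⌊_⌋)
open import Relation.Binary.PropositionalEquality using (_≡_)

IsPartition : ℕ → List ℕ → Set
IsPartition d μ = All (λ x → 1 ℕ.≤ x) μ × Linked ℕ._≥_ μ × sum μ ≡ d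

mult : List ℕ → ℕ → ℕ
mult μ j = length (filterᵇ (λ x → x ≡ᵇ j) μ)

-- |Aut(μ)| = ∏_{j ≥ 1} m_j(μ)!  (for a partition of d only j ≤ d matter)
autSize : ℕ → List ℕ → ℕ
autSize d μ = product (map (λ i → (mult μ (suc i)) !) (upTo d))

allF : ∀ {n} → (Fin n → Bool) → Bool
allF {n} p = Data.List.foldr (λ x b → p x ∧ b) true (allFin n)

anyF : ∀ {n} → (Fin n → Bool) → Bool
anyF {n} p = Data.List.foldr (λ x b → p x ∨ b) false (allFin n)

anyL : ∀ {A : Set} → List A → (A → Bool) → Bool
anyL xs p = Data.List.foldr (λ x b → p x ∨ b) false xs

allL : ∀ {A : Set} → List A → (A → Bool) → Bool
allL xs p = Data.List.foldr (λ x b → p x ∧ b) true xs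

countF : ∀ {n} → (Fin n → Bool) → ℕ
countF {n} p = length (filterᵇ p (allFin n))

_==_ : ∀ {n} → Fin n → Fin n → Bool
x == y = ⌊ x ≟ y ⌋

Map : ℕ → Set
Map d = Fin d → Fin d

allMaps : ∀ n m → List (Fin n → Fin m)
allMaps zero    m = [ (λ ()) ]
allMaps (suc n) m =
  concatMap (λ f → map (λ a → λ { Fin.zero → a ; (Fin.suc i) → f i }) (allFin m))
            (allMaps n m)

-- injective (hence bijective, the set being finite)
isPerm : ∀ {d} → Map d → Bool
isPerm σ = allF λ x → allF λ y → not (σ x == σ y) ∨ (x == y)

perms : ∀ d → List (Map d)
perms d = filterᵇ isPerm (allMaps d d)

iter : ∀ {d} → Map d → ℕ → Fin d → Fin d
iter σ zero    x = x
iter σ (suc k) x = σ (iter σ k x)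

firstFrom : (ℕ → Bool) → ℕ → ℕ → ℕ
firstFrom p k zero       = 0
firstFrom p k (suc fuel) = if p k then k else firstFrom p (suc k) fuel

orbitLen : ∀ {d} → Map d → Fin d → ℕ
orbitLen {d} σ x = firstFrom (λ k → iter σ k x == x) 1 d

-- σ ∈ C_μ : for every j, the number of points lying on cycles of length j
-- is j · m_j(μ), i.e. σ has exactly m_j(μ) cycles of length j.
inClass : ∀ d → List ℕ → Map d → Bool
inClass d μ σ =
  allL (upTo d) λ i → countF (λ x → orbitLen σ x ≡ᵇ suc i) ≡ᵇ (suc i * mult μ (suc i))

transpositionType : ℕ → List ℕ
transpositionType d = 2 ∷ Data.List.replicate (d ∸ 2) 1

prodPerm : ∀ {d} → List (Map d) → Map d
prodPerm []       x = x
prodPerm (σ ∷ τs) x = σ (prodPerm τs x)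

isId : ∀ {d} → Map d → Bool
isId σ = allF λ x → σ x == x

reach : ∀ {d} → List (Map d) → ℕ → Fin d → Fin d → Bool
reach gens zero    x y = x == y
reach gens (suc n) x y =
  reach gens n x y ∨
  anyF (λ z → reach gens n x z ∧ anyL gens (λ σ → (σ z == y) ∨ (σ y == z)))

-- the group generated by gens acts transitively on Fin d
-- (words of length ≤ d suffice, since an orbit has at most d points)
isTransitive : ∀ {d} → List (Map d) → Bool
isTransitive {d} gens = allF λ x → allF λ y → reach gens d x y

tuples : ∀ d → ℕ → List (List (Map d))
tuples d zero    = [ [] ]
tuples d (suc n) = concatMap (λ σ → map (σ ∷_) (tuples d n)) (perms d)

goodTuple : ∀ d → List ℕ → List (Map d) → Bool
goodTuple d μ []       = false
goodTuple d μ (σ ∷ τs) =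
  inClass d μ σ ∧ allL τs (inClass d (transpositionType d)) ∧
  isId (prodPerm (σ ∷ τs)) ∧ isTransitive (σ ∷ τs)

-- b = 2g - 2 + d + l(μ)   (d ≥ 2, so this is the natural number below)
numBranch : ℕ → List ℕ → ℕ → ℕ
numBranch d μ g = 2 * g + (d ∸ 2) + length μ

hurwitzCount : ℕ → List ℕ → ℕ → ℕ
hurwitzCount d μ g = length (filterᵇ (goodTuple d μ) (tuples d (suc (numBranch d μ g))))

hurwitz : ℕ → List ℕ → ℕ → ℚ
hurwitz d μ g = (+ (autSize d μ * hurwitzCount d μ g) / (d !)) {{d !≢0}}

-- n / m as a rational; the junk value 0 for m = 0 is never used in the
-- theorem (all denominators there are positive).
_//_ : ℤ → ℕ → ℚ
n // zero  = 0ℚ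
n // suc m = n / suc m

fromℤ : ℤ → ℚ
fromℤ z = z / 1

sumFrom1 : ℕ → (ℕ → ℚ) → ℚ
sumFrom1 zero    f = 0ℚ
sumFrom1 (suc n) f = sumFrom1 n f ℚ.+ f (suc n)

{-# OPTIONS --safe #-}
-- Put N = d!.  For a set partition P of {1,…,d} let T_P be right multiplication by the sum of the
-- transpositions inside the blocks of P, acting on integer functions of colourings {1,…,d} → {1,…,d}; the
-- injective colourings carry the regular representation of S_d.  Operators that replace one colour by a
-- smaller one within a block commute with T_P, and on functions killed by all of them T_P is multiplication
-- by ct(c) = #{equally coloured pairs inside blocks} - Σ c(x).  So T_P is annihilated by a product of factors
-- T_P - ct(c), and the number c_n(σ) of words of n transpositions inside the blocks with product σ⁻¹
-- satisfies N c_n(σ) = Tr(A T_Pⁿ) = Σ a_k kⁿ, where A is translation by σ and a_k is the trace of A on the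
-- eigenlattice of k, hence an integer.
--
-- Möbius inversion over set partitions turns these counts into the transitive count.  The one-block partition
-- has top eigenvalue C(d,2) with a_k = 1 and no eigenvalue strictly between C(d,2) - d and C(d,2); the
-- partitions {x} | rest have top eigenvalue C(d-1,2) with a_k = d when σ fixes x, and Möbius weights summing
-- to -1; all others stay below C(d-1,2).  The coefficient at a top eigenvalue is constant on the stabiliser
-- of P because its Dirichlet form vanishes.  By parity a_{-k} = ± a_k, which produces the factor 2.  The class
-- of type μ is summed by counting the conjugators from a fixed permutation to σ.
module Submission where

-- Classically the counts are character sums whose eigenvalues are content sums of partitions. No
-- irreducible representation is built here. The regular representation alone has no operators that
-- single out eigenvectors. The functions of all colourings form the d-fold tensor power of ℤ^d,
-- where the lowering operators of gl_d act and their common kernel plays the part of the highest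
-- weight vectors. Lowering changes the sum of the colours, so enough repetitions of the product of
-- all factors T_P - ct(c) annihilate everything. Repeated factors do not exhibit T_P as
-- diagonalisable, and dividing by differences of eigenvalues would destroy integrality. So the
-- kernel of T_P - k is split off as a direct summand of the lattice and the remaining factors act
-- on a complement; all traces stay integers. The d! is not divided out either: the class sum is d!
-- c_n divided by |Aut(μ)| μ_1⋯μ_l, so the numbers a_k are exactly what the prefactor of the theorem
-- leaves over. Distinct exponentials are linearly independent, so every fact about a coefficient is
-- read off from an identity valid for all n.

module HurwitzNumbers where
  open import Data.Bool.Base using (Bool; true; false; _∧_; _∨_; not; if_then_else_) renaming (T to True)
  import Data.Bool.Properties as Boolₚ
  open import Data.Empty using (⊥-elim)
  open import Data.Fin.Base using (Fin; zero; suc; toℕ; fromℕ; fromℕ<; inject₁; punchOut; _↑ˡ_; _↑ʳ_; splitAt; join; combine; finToFun; funToFin)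
  open import Data.Fin.Permutation using (permutation)
  import Data.Fin.Properties as Finₚ
  open import Data.Fin.Relation.Unary.Top using (view; ‵fromℕ; ‵inject₁; view-fromℕ; view-inject₁)
  open import Data.Integer.Base as ℤ using (ℤ; +_; -[1+_]; _+_; _*_; _-_; -_; _^_; _≤_; _<_; +≤+; +<+; 0ℤ; 1ℤ; ∣_∣)
  import Data.Integer.Properties as ℤₚ
  open import Data.Integer.Tactic.RingSolver using (solve-∀)
  open import Data.List.Base as List using (List; []; _∷_; _++_; length; concatMap; filterᵇ; replicate; upTo)
  open import Data.List.Membership.Propositional using (_∈_)
  open import Data.List.Membership.Propositional.Properties using (∈-map⁺; ∈-allFin)
  open import Data.List.Properties using (map-applyUpTo; length-replicate)
  open import Data.List.Relation.Unary.All as All using (All; []; _∷_)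
  import Data.List.Relation.Unary.All.Properties as Allₚ
  open import Data.List.Relation.Unary.Any using (here; there)
  open import Data.Nat.Base as ℕ using (ℕ; zero; suc; _≡ᵇ_; _∸_; z≤n; s≤s; _!)
  open import Data.Nat.Combinatorics using (_C_; nCk+nC[k+1]≡[n+1]C[k+1]; nC1≡n)
  open import Data.Nat.Divisibility using (divides)
  open import Data.Nat.GCD using (module GCD; module Bézout)
  open import Data.Nat.ListAction using (sum; product)
  import Data.Nat.Properties as ℕₚ
  open import Data.Nat.Tactic.RingSolver using () renaming (solve-∀ to solveℕ-∀)
  open import Data.Product.Base using (_,_; _×_; proj₁; proj₂; ∃; ∃-syntax; Σ-syntax)
  open import Data.Sum.Base using (_⊎_; inj₁; inj₂; [_,_]′)
  open import Data.Unit.Base using (tt)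
  open import Defs
  open import Function.Base using (_∘_; id)
  open import Relation.Binary.Definitions using (tri<; tri≈; tri>)
  open import Relation.Binary.PropositionalEquality
  open import Relation.Nullary using (yes; no; ¬_; Dec; does)
  open import Relation.Nullary.Decidable using (⌊_⌋; ¬?; _×-dec_; _→-dec_; decidable-stable)
  import Algebra.Properties.AbelianGroup ℤₚ.+-0-abelianGroup as ℤG
  import Algebra.Properties.Semiring.Sum ℤₚ.+-*-semiring as S
  open ≡-Reasoning

  -- Finite sums

  -- Abstract, so that unification can invert ∑.
  abstract
    ∑ : ∀ {n} → (Fin n → ℤ) → ℤ
    ∑ = S.sum

    ∑-cong : ∀ {n} {f g : Fin n → ℤ} → (∀ i → f i ≡ g i) → ∑ f ≡ ∑ g
    ∑-cong = S.sum-cong-≗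

    ∑-zero : ∀ {n} {f : Fin n → ℤ} → (∀ i → f i ≡ 0ℤ) → ∑ f ≡ 0ℤ
    ∑-zero {n} h = trans (∑-cong h) (S.sum-replicate-zero n)

    ∑-+ : ∀ {n} (f g : Fin n → ℤ) → ∑ (λ i → f i + g i) ≡ ∑ f + ∑ g
    ∑-+ = S.∑-distrib-+

    ∑-comm : ∀ {m n} (f : Fin m → Fin n → ℤ) → ∑ (λ i → ∑ (f i)) ≡ ∑ (λ j → ∑ (λ i → f i j))
    ∑-comm = S.∑-comm

    ∑-*ˡ : ∀ {n} x (f : Fin n → ℤ) → ∑ (λ i → x * f i) ≡ x * ∑ f
    ∑-*ˡ x f = sym (S.*-distribˡ-sum x f)

    ∑-*ʳ : ∀ {n} x (f : Fin n → ℤ) → ∑ (λ i → f i * x) ≡ ∑ f * x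
    ∑-*ʳ x f = sym (S.*-distribʳ-sum x f)

    ∑-empty : (f : Fin 0 → ℤ) → ∑ f ≡ 0ℤ
    ∑-empty f = refl

    ∑-suc : ∀ {n} (f : Fin (suc n) → ℤ) → ∑ f ≡ f zero + ∑ (f ∘ suc)
    ∑-suc f = refl

    ∑-bij : ∀ {n} (f : Fin n → ℤ) (π π⁻ : Fin n → Fin n) →
            (∀ x → π (π⁻ x) ≡ x) → (∀ x → π⁻ (π x) ≡ x) → ∑ (f ∘ π) ≡ ∑ f
    ∑-bij f π π⁻ l r = sym (S.sum-permute f (permutation π π⁻ l r))

    ∑-mono : ∀ {n} {f g : Fin n → ℤ} → (∀ i → f i ≤ g i) → ∑ f ≤ ∑ g
    ∑-mono {zero} h = ℤₚ.≤-refl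
    ∑-mono {suc n} h = ℤₚ.+-mono-≤ (h zero) (∑-mono (h ∘ suc))

    ∑-nonneg : ∀ {n} {f : Fin n → ℤ} → (∀ i → 0ℤ ≤ f i) → 0ℤ ≤ ∑ f
    ∑-nonneg {zero} h = ℤₚ.≤-refl
    ∑-nonneg {suc n} h = ℤₚ.+-mono-≤ (h zero) (∑-nonneg (h ∘ suc))

  ∑-neg : ∀ {n} (f : Fin n → ℤ) → ∑ (λ i → - f i) ≡ - ∑ f
  ∑-neg f = trans (∑-cong (λ i → lem (f i))) (trans (∑-*ʳ (- 1ℤ) f) (sym (lem (∑ f))))
    where lem : ∀ x → - x ≡ x * (- 1ℤ)
          lem = solve-∀

  ∑-- : ∀ {n} (f g : Fin n → ℤ) → ∑ (λ i → f i - g i) ≡ ∑ f - ∑ g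
  ∑-- f g = trans (∑-+ f (λ i → - g i)) (cong (_+_ (∑ f)) (∑-neg g))

  ∑-nonneg-zero : ∀ {n} {f : Fin n → ℤ} → (∀ i → 0ℤ ≤ f i) → ∑ f ≡ 0ℤ → ∀ i → f i ≡ 0ℤ
  ∑-nonneg-zero {suc n} {f} h e i = go i
    where
    a≤ : f zero ≤ 0ℤ
    a≤ = subst₂ _≤_ (ℤₚ.+-identityʳ (f zero)) (trans (sym (∑-suc f)) e) (ℤₚ.+-monoʳ-≤ (f zero) (∑-nonneg (h ∘ suc)))
    a0 : f zero ≡ 0ℤ
    a0 = ℤₚ.≤-antisym a≤ (h zero)
    go : ∀ i → f i ≡ 0ℤ
    go zero = a0
    go (suc i) = ∑-nonneg-zero (h ∘ suc)
                   (trans (sym (trans (∑-suc f) (trans (cong (_+ ∑ (f ∘ suc)) a0) (ℤₚ.+-identityˡ _)))) e) i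

  ∑-const : ∀ {n} x → ∑ {n} (λ _ → x) ≡ + n * x
  ∑-const {zero} x = ∑-empty _
  ∑-const {suc n} x = trans (∑-suc _) (trans (cong (λ t → x + t) (∑-const {n} x)) (lem x (+ n)))
    where lem : ∀ x n → x + n * x ≡ (1ℤ + n) * x
          lem = solve-∀

  𝟙 : Bool → ℤ
  𝟙 true = 1ℤ
  𝟙 false = 0ℤ

  𝟙-∧ : ∀ a b → 𝟙 (a ∧ b) ≡ 𝟙 a * 𝟙 b
  𝟙-∧ true b = sym (ℤₚ.*-identityˡ (𝟙 b))
  𝟙-∧ false b = refl

  𝟙-not : ∀ a → 𝟙 (not a) ≡ 1ℤ - 𝟙 a
  𝟙-not true = refl
  𝟙-not false = refl

  𝟙-guard : ∀ b {x y : ℤ} → (b ≡ true → x ≡ y) → 𝟙 b * x ≡ 𝟙 b * y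
  𝟙-guard true h = cong (1ℤ *_) (h refl)
  𝟙-guard false h = refl

  𝟙≥0 : ∀ b → 0ℤ ≤ 𝟙 b
  𝟙≥0 true = +≤+ z≤n
  𝟙≥0 false = ℤₚ.≤-refl

  𝟙≤1 : ∀ b → 𝟙 b ≤ 1ℤ
  𝟙≤1 true = ℤₚ.≤-refl
  𝟙≤1 false = +≤+ z≤n

  ⇔→≡ : ∀ {a b : Bool} → (a ≡ true → b ≡ true) → (b ≡ true → a ≡ true) → a ≡ b
  ⇔→≡ {true} {b} f g = sym (f refl)
  ⇔→≡ {false} {true} f g = g refl
  ⇔→≡ {false} {false} f g = refl

  ==-refl : ∀ {n} (x : Fin n) → (x == x) ≡ true
  ==-refl x with x Finₚ.≟ x
  ... | yes _ = refl
  ... | no h = ⊥-elim (h refl)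

  ==⇒≡ : ∀ {n} {x y : Fin n} → (x == y) ≡ true → x ≡ y
  ==⇒≡ {x = x} {y} h with x Finₚ.≟ y
  ... | yes p = p
  ==⇒≡ () | no _

  ≡⇒== : ∀ {n} {x y : Fin n} → x ≡ y → (x == y) ≡ true
  ≡⇒== {x = x} refl = ==-refl x

  ≢⇒== : ∀ {n} {x y : Fin n} → ¬ x ≡ y → (x == y) ≡ false
  ≢⇒== {x = x} {y} h with x Finₚ.≟ y
  ... | yes p = ⊥-elim (h p)
  ... | no _ = refl

  ==-sym : ∀ {n} (x y : Fin n) → (x == y) ≡ (y == x)
  ==-sym x y = ⇔→≡ (λ e → ≡⇒== (sym (==⇒≡ e))) (λ e → ≡⇒== (sym (==⇒≡ e)))

  ==-suc : ∀ {n} (x y : Fin n) → (suc x == suc y) ≡ (x == y)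
  ==-suc x y = ⇔→≡ (λ e → ≡⇒== (Finₚ.suc-injective (==⇒≡ e))) (λ e → ≡⇒== (cong suc (==⇒≡ e)))

  ∑-δ : ∀ {n} (j : Fin n) (f : Fin n → ℤ) → ∑ (λ i → 𝟙 (i == j) * f i) ≡ f j
  ∑-δ {suc n} zero f = trans (∑-suc _) (trans (cong₂ _+_ (ℤₚ.*-identityˡ (f zero)) (∑-zero {n} (λ i → refl))) (ℤₚ.+-identityʳ (f zero)))
  ∑-δ {suc n} (suc j) f =
    trans (trans (∑-suc _) (ℤₚ.+-identityˡ _))
          (trans (∑-cong (λ i → cong (λ b → 𝟙 b * f (suc i)) (==-suc i j))) (∑-δ j (f ∘ suc)))

  ∑-δ′ : ∀ {n} (j : Fin n) (f : Fin n → ℤ) → ∑ (λ i → 𝟙 (j == i) * f i) ≡ f j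
  ∑-δ′ j f = trans (∑-cong (λ i → cong (λ b → 𝟙 b * f i) (==-sym j i))) (∑-δ j f)

  -- Summation over unordered pairs {x , y}, represented by x < y.

  lt : ∀ {n} → Fin n → Fin n → Bool
  lt x y = toℕ x ℕ.<ᵇ toℕ y

  ∑₂ : ∀ {n} → (Fin n → Fin n → ℤ) → ℤ
  ∑₂ φ = ∑ λ x → ∑ λ y → 𝟙 (lt x y) * φ x y

  ∑₂-cong : ∀ {n} {f g : Fin n → Fin n → ℤ} → (∀ x y → lt x y ≡ true → f x y ≡ g x y) → ∑₂ f ≡ ∑₂ g
  ∑₂-cong h = ∑-cong λ x → ∑-cong λ y → 𝟙-guard (lt x y) (h x y)

  ∑∑-+ : ∀ {m n} (f g : Fin m → Fin n → ℤ) →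
         ∑ (λ x → ∑ λ y → f x y + g x y) ≡ ∑ (λ x → ∑ (f x)) + ∑ (λ x → ∑ (g x))
  ∑∑-+ f g = trans (∑-cong (λ x → ∑-+ (f x) (g x))) (∑-+ (λ x → ∑ (f x)) (λ x → ∑ (g x)))

  ∑₂-+ : ∀ {n} (f g : Fin n → Fin n → ℤ) → ∑₂ (λ x y → f x y + g x y) ≡ ∑₂ f + ∑₂ g
  ∑₂-+ f g = trans (∑-cong λ x → ∑-cong λ y → ℤₚ.*-distribˡ-+ (𝟙 (lt x y)) (f x y) (g x y)) (∑∑-+ _ _)

  ∑₂-*ˡ : ∀ {n} k (f : Fin n → Fin n → ℤ) → ∑₂ (λ x y → k * f x y) ≡ k * ∑₂ f
  ∑₂-*ˡ k f =
    trans (∑-cong λ x → trans (∑-cong λ y → lem (𝟙 (lt x y)) k (f x y)) (∑-*ˡ k (λ y → 𝟙 (lt x y) * f x y)))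
          (∑-*ˡ k (λ x → ∑ λ y → 𝟙 (lt x y) * f x y))
    where lem : ∀ a b c → a * (b * c) ≡ b * (a * c)
          lem = solve-∀

  ∑₂-*ʳ : ∀ {n} k (f : Fin n → Fin n → ℤ) → ∑₂ (λ x y → f x y * k) ≡ ∑₂ f * k
  ∑₂-*ʳ k f = trans (∑₂-cong λ x y _ → ℤₚ.*-comm (f x y) k) (trans (∑₂-*ˡ k f) (ℤₚ.*-comm k (∑₂ f)))

  ∑₂-neg : ∀ {n} (f : Fin n → Fin n → ℤ) → ∑₂ (λ x y → - f x y) ≡ - ∑₂ f
  ∑₂-neg f = trans (∑₂-cong λ x y _ → lem (f x y)) (trans (∑₂-*ˡ (- 1ℤ) f) (sym (lem (∑₂ f))))
    where lem : ∀ x → - x ≡ (- 1ℤ) * x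
          lem = solve-∀

  ∑₂-- : ∀ {n} (f g : Fin n → Fin n → ℤ) → ∑₂ (λ x y → f x y - g x y) ≡ ∑₂ f - ∑₂ g
  ∑₂-- f g = trans (∑₂-+ f (λ x y → - g x y)) (cong (_+_ (∑₂ f)) (∑₂-neg g))

  ∑₂-zero : ∀ {n} {f : Fin n → Fin n → ℤ} → (∀ x y → lt x y ≡ true → f x y ≡ 0ℤ) → ∑₂ f ≡ 0ℤ
  ∑₂-zero h = trans (∑₂-cong h) (∑-zero λ x → ∑-zero λ y → ℤₚ.*-zeroʳ (𝟙 (lt x y)))

  ∑₂-∑ : ∀ {n m} (f : Fin n → Fin n → Fin m → ℤ) →
         ∑₂ (λ x y → ∑ (f x y)) ≡ ∑ (λ i → ∑₂ λ x y → f x y i)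
  ∑₂-∑ f = begin
    ∑₂ (λ x y → ∑ (f x y))
      ≡⟨ ∑-cong (λ x → ∑-cong λ y → sym (∑-*ˡ (𝟙 (lt x y)) (f x y))) ⟩
    ∑ (λ x → ∑ λ y → ∑ λ i → 𝟙 (lt x y) * f x y i)
      ≡⟨ ∑-cong (λ x → ∑-comm λ y i → 𝟙 (lt x y) * f x y i) ⟩
    ∑ (λ x → ∑ λ i → ∑ λ y → 𝟙 (lt x y) * f x y i)
      ≡⟨ ∑-comm (λ x i → ∑ λ y → 𝟙 (lt x y) * f x y i) ⟩
    ∑ (λ i → ∑₂ λ x y → f x y i) ∎

  ∑₂-mono : ∀ {n} {f g : Fin n → Fin n → ℤ} → (∀ x y → lt x y ≡ true → f x y ≤ g x y) → ∑₂ f ≤ ∑₂ g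
  ∑₂-mono {f = f} {g} h = ∑-mono λ x → ∑-mono λ y → go (lt x y) (h x y)
    where
    go : ∀ b {u v} → (b ≡ true → u ≤ v) → 𝟙 b * u ≤ 𝟙 b * v
    go true {u} {v} k = subst₂ _≤_ (sym (ℤₚ.*-identityˡ u)) (sym (ℤₚ.*-identityˡ v)) (k refl)
    go false k = ℤₚ.≤-refl

  lt⇒≢ : ∀ {n} (x y : Fin n) → lt x y ≡ true → ¬ x ≡ y
  lt⇒≢ x .x h refl = ℕₚ.<-irrefl refl (ℕₚ.<ᵇ⇒< (toℕ x) (toℕ x) (subst True (sym h) _))

  lt-trich : ∀ {n} (x y : Fin n) → 1ℤ ≡ 𝟙 (lt x y) + 𝟙 (lt y x) + 𝟙 (x == y)
  lt-trich zero zero = refl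
  lt-trich zero (suc y) = refl
  lt-trich (suc x) zero = refl
  lt-trich (suc x) (suc y) rewrite ==-suc x y = lt-trich x y

  ∑₂-double : ∀ {n} (φ : Fin n → Fin n → ℤ) → (∀ x y → φ x y ≡ φ y x) →
              ∑ (λ x → ∑ (φ x)) ≡ + 2 * ∑₂ φ + ∑ (λ x → φ x x)
  ∑₂-double φ s = begin
    ∑ (λ x → ∑ (φ x))
      ≡⟨ ∑-cong (λ x → ∑-cong λ y → step x y) ⟩
    ∑ (λ x → ∑ λ y → (𝟙 (lt x y) * φ x y + 𝟙 (lt y x) * φ y x) + 𝟙 (x == y) * φ x y)
      ≡⟨ ∑∑-+ _ _ ⟩
    ∑ (λ x → ∑ λ y → 𝟙 (lt x y) * φ x y + 𝟙 (lt y x) * φ y x) + ∑ (λ x → ∑ λ y → 𝟙 (x == y) * φ x y)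
      ≡⟨ cong₂ _+_ (∑∑-+ _ _) (∑-cong λ x → ∑-δ′ x (φ x)) ⟩
    (∑₂ φ + ∑ (λ x → ∑ λ y → 𝟙 (lt y x) * φ y x)) + ∑ (λ x → φ x x)
      ≡⟨ cong (λ t → ∑₂ φ + t + ∑ (λ x → φ x x)) (∑-comm λ x y → 𝟙 (lt y x) * φ y x) ⟩
    (∑₂ φ + ∑₂ φ) + ∑ (λ x → φ x x)
      ≡⟨ cong (_+ ∑ (λ x → φ x x)) (lem (∑₂ φ)) ⟩
    + 2 * ∑₂ φ + ∑ (λ x → φ x x) ∎
    where
    lem : ∀ a → a + a ≡ + 2 * a
    lem = solve-∀
    alg : ∀ a b c p → (a + b + c) * p ≡ (a * p + b * p) + c * p
    alg = solve-∀
    step : ∀ x y → φ x y ≡ (𝟙 (lt x y) * φ x y + 𝟙 (lt y x) * φ y x) + 𝟙 (x == y) * φ x y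
    step x y rewrite s y x = trans (trans (sym (ℤₚ.*-identityˡ (φ x y))) (cong (_* φ x y) (lt-trich x y)))
      (alg (𝟙 (lt x y)) (𝟙 (lt y x)) (𝟙 (x == y)) (φ x y))

  -- A bijection need not respect the order `x < y`, so the sum over pairs is compared with the sum
  -- over the full square, which reindexes freely; the diagonal cancels and the factor 2 is divided
  -- out.
  ∑₂-bij : ∀ {n} (φ : Fin n → Fin n → ℤ) → (∀ x y → φ x y ≡ φ y x) → (π π⁻ : Fin n → Fin n) →
           (∀ x → π (π⁻ x) ≡ x) → (∀ x → π⁻ (π x) ≡ x) → ∑₂ (λ x y → φ (π x) (π y)) ≡ ∑₂ φ
  ∑₂-bij φ s π π⁻ l r = ℤₚ.*-cancelˡ-≡ (+ 2) _ _ (ℤG.∙-cancelʳ (∑ (λ x → φ x x)) _ _ (begin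
    + 2 * ∑₂ (λ x y → φ (π x) (π y)) + ∑ (λ x → φ x x)
      ≡⟨ cong (_+_ (+ 2 * ∑₂ (λ x y → φ (π x) (π y)))) (sym (∑-bij (λ x → φ x x) π π⁻ l r)) ⟩
    + 2 * ∑₂ (λ x y → φ (π x) (π y)) + ∑ (λ x → φ (π x) (π x))
      ≡⟨ sym (∑₂-double (λ x y → φ (π x) (π y)) (λ x y → s (π x) (π y))) ⟩
    ∑ (λ x → ∑ λ y → φ (π x) (π y))
      ≡⟨ ∑-cong (λ x → ∑-bij (φ (π x)) π π⁻ l r) ⟩
    ∑ (λ x → ∑ λ y → φ (π x) y)
      ≡⟨ ∑-bij (λ x → ∑ (φ x)) π π⁻ l r ⟩
    ∑ (λ x → ∑ (φ x))
      ≡⟨ ∑₂-double φ s ⟩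
    + 2 * ∑₂ φ + ∑ (λ x → φ x x) ∎))

  ∑ᴸ : ∀ {A : Set} → List A → (A → ℤ) → ℤ
  ∑ᴸ [] f = 0ℤ
  ∑ᴸ (x ∷ xs) f = f x + ∑ᴸ xs f

  ∑ᴸ-cong : ∀ {A : Set} (xs : List A) {f g : A → ℤ} → (∀ x → f x ≡ g x) → ∑ᴸ xs f ≡ ∑ᴸ xs g
  ∑ᴸ-cong [] h = refl
  ∑ᴸ-cong (x ∷ xs) h = cong₂ _+_ (h x) (∑ᴸ-cong xs h)

  ∑ᴸ-++ : ∀ {A : Set} (xs ys : List A) (f : A → ℤ) → ∑ᴸ (xs ++ ys) f ≡ ∑ᴸ xs f + ∑ᴸ ys f
  ∑ᴸ-++ [] ys f = sym (ℤₚ.+-identityˡ _)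
  ∑ᴸ-++ (x ∷ xs) ys f = trans (cong (_+_ (f x)) (∑ᴸ-++ xs ys f)) (sym (ℤₚ.+-assoc (f x) _ _))

  ∑ᴸ-map : ∀ {A B : Set} (h : A → B) (xs : List A) (f : B → ℤ) → ∑ᴸ (List.map h xs) f ≡ ∑ᴸ xs (f ∘ h)
  ∑ᴸ-map h [] f = refl
  ∑ᴸ-map h (x ∷ xs) f = cong (_+_ (f (h x))) (∑ᴸ-map h xs f)

  ∑ᴸ-concatMap : ∀ {A B : Set} (h : A → List B) (xs : List A) (f : B → ℤ) →
                 ∑ᴸ (concatMap h xs) f ≡ ∑ᴸ xs (λ x → ∑ᴸ (h x) f)
  ∑ᴸ-concatMap h [] f = refl
  ∑ᴸ-concatMap h (x ∷ xs) f = trans (∑ᴸ-++ (h x) (concatMap h xs) f) (cong (_+_ (∑ᴸ (h x) f)) (∑ᴸ-concatMap h xs f))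

  ∑ᴸ-filter : ∀ {A : Set} (p : A → Bool) (xs : List A) (f : A → ℤ) →
              ∑ᴸ (filterᵇ p xs) f ≡ ∑ᴸ xs (λ x → 𝟙 (p x) * f x)
  ∑ᴸ-filter p [] f = refl
  ∑ᴸ-filter p (x ∷ xs) f with p x
  ... | true = cong₂ _+_ (sym (ℤₚ.*-identityˡ (f x))) (∑ᴸ-filter p xs f)
  ... | false = trans (∑ᴸ-filter p xs f) (sym (ℤₚ.+-identityˡ _))

  length-filter : ∀ {A : Set} (p : A → Bool) (xs : List A) → + length (filterᵇ p xs) ≡ ∑ᴸ xs (λ x → 𝟙 (p x))
  length-filter p [] = refl
  length-filter p (x ∷ xs) with p x
  ... | true = cong (_+_ 1ℤ) (length-filter p xs)
  ... | false = trans (length-filter p xs) (sym (ℤₚ.+-identityˡ _))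

  ∑ᴸ-+ : ∀ {A : Set} (xs : List A) (f g : A → ℤ) → ∑ᴸ xs (λ x → f x + g x) ≡ ∑ᴸ xs f + ∑ᴸ xs g
  ∑ᴸ-+ [] f g = refl
  ∑ᴸ-+ (x ∷ xs) f g = trans (cong (_+_ (f x + g x)) (∑ᴸ-+ xs f g)) (lem (f x) (g x) _ _)
    where lem : ∀ a b c d → a + b + (c + d) ≡ a + c + (b + d)
          lem = solve-∀

  ∑ᴸ-*ˡ : ∀ {A : Set} k (xs : List A) (f : A → ℤ) → ∑ᴸ xs (λ x → k * f x) ≡ k * ∑ᴸ xs f
  ∑ᴸ-*ˡ k [] f = sym (ℤₚ.*-zeroʳ k)
  ∑ᴸ-*ˡ k (x ∷ xs) f = trans (cong (_+_ (k * f x)) (∑ᴸ-*ˡ k xs f)) (sym (ℤₚ.*-distribˡ-+ k (f x) _))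

  ∑ᴸ-*ʳ : ∀ {A : Set} k (xs : List A) (f : A → ℤ) → ∑ᴸ xs (λ x → f x * k) ≡ ∑ᴸ xs f * k
  ∑ᴸ-*ʳ k xs f = trans (∑ᴸ-cong xs λ x → ℤₚ.*-comm (f x) k) (trans (∑ᴸ-*ˡ k xs f) (ℤₚ.*-comm k _))

  ∑ᴸ-zero : ∀ {A : Set} (xs : List A) {f : A → ℤ} → (∀ x → f x ≡ 0ℤ) → ∑ᴸ xs f ≡ 0ℤ
  ∑ᴸ-zero [] h = refl
  ∑ᴸ-zero (x ∷ xs) h = cong₂ _+_ (h x) (∑ᴸ-zero xs h)

  ∑ᴸ-∑ : ∀ {A : Set} {n} (xs : List A) (f : A → Fin n → ℤ) →
         ∑ᴸ xs (λ x → ∑ (f x)) ≡ ∑ (λ i → ∑ᴸ xs λ x → f x i)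
  ∑ᴸ-∑ [] f = sym (∑-zero λ i → refl)
  ∑ᴸ-∑ (x ∷ xs) f = trans (cong (_+_ (∑ (f x))) (∑ᴸ-∑ xs f)) (sym (∑-+ (f x) _))

  ∑ᴸ-∑ᴸ : ∀ {A B : Set} (xs : List A) (ys : List B) (f : A → B → ℤ) →
         ∑ᴸ xs (λ x → ∑ᴸ ys (f x)) ≡ ∑ᴸ ys (λ y → ∑ᴸ xs λ x → f x y)
  ∑ᴸ-∑ᴸ [] ys f = sym (∑ᴸ-zero ys λ _ → refl)
  ∑ᴸ-∑ᴸ (x ∷ xs) ys f = trans (cong (_+_ (∑ᴸ ys (f x))) (∑ᴸ-∑ᴸ xs ys f)) (sym (∑ᴸ-+ ys (f x) _))

  ∑ᴸ-tabulate : ∀ {A : Set} {n} (h : Fin n → A) (f : A → ℤ) → ∑ᴸ (List.tabulate h) f ≡ ∑ (f ∘ h)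
  ∑ᴸ-tabulate {n = zero} h f = sym (∑-empty _)
  ∑ᴸ-tabulate {n = suc n} h f = trans (cong (_+_ (f (h zero))) (∑ᴸ-tabulate (h ∘ suc) f)) (sym (∑-suc (f ∘ h)))

  ∑ᴸ-allFin : ∀ n (f : Fin n → ℤ) → ∑ᴸ (List.allFin n) f ≡ ∑ f
  ∑ᴸ-allFin n f = ∑ᴸ-tabulate id f

  inj⇒surj : ∀ {n} (π : Fin n → Fin n) → (∀ {x y} → π x ≡ π y → x ≡ y) → ∀ y → ∃ λ x → π x ≡ y
  inj⇒surj {suc n} π inj y with Finₚ.any? (λ x → π x Finₚ.≟ y)
  ... | yes p = p
  ... | no ¬p = ⊥-elim (ℕₚ.<-irrefl refl (Finₚ.injective⇒≤ {suc n} {n} {λ x → punchOut {i = y} {π x} (λ e → ¬p (x , sym e))}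
                   (λ {a} {b} e → inj (Finₚ.punchOut-injective {i = y} (λ e → ¬p (a , sym e)) (λ e → ¬p (b , sym e)) e))))

  -- Exponential sums

  infix 4 _==ᶻ_
  _==ᶻ_ : ℤ → ℤ → Bool
  x ==ᶻ y = ⌊ x ℤₚ.≟ y ⌋

  ==ᶻ-refl : ∀ x → (x ==ᶻ x) ≡ true
  ==ᶻ-refl x with x ℤₚ.≟ x
  ... | yes _ = refl
  ... | no h = ⊥-elim (h refl)

  ≢⇒==ᶻ : ∀ {x y} → ¬ x ≡ y → (x ==ᶻ y) ≡ false
  ≢⇒==ᶻ {x} {y} h with x ℤₚ.≟ y
  ... | yes p = ⊥-elim (h p)
  ... | no _ = refl

  ==ᶻ⇒≡ : ∀ {x y} → (x ==ᶻ y) ≡ true → x ≡ y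
  ==ᶻ⇒≡ {x} {y} h with x ℤₚ.≟ y
  ... | yes p = p
  ==ᶻ⇒≡ () | no _

  -- The list of pairs (t , k) stands for the function n ↦ Σ t kⁿ.
  Exp : Set
  Exp = List (ℤ × ℤ)

  eval : Exp → ℕ → ℤ
  eval es n = ∑ᴸ es λ (t , k) → t * k ^ n

  coef : Exp → ℤ → ℤ
  coef es k = ∑ᴸ es λ (t , κ) → 𝟙 (κ ==ᶻ k) * t

  scale : ℤ → Exp → Exp
  scale c = List.map λ (t , k) → c * t , k

  mulKey : Exp → Exp
  mulKey = List.map λ (t , k) → t * k , k

  negKey : Exp → Exp
  negKey = List.map λ (t , k) → t , - k

  eval-++ : ∀ es es′ n → eval (es ++ es′) n ≡ eval es n + eval es′ n
  eval-++ es es′ n = ∑ᴸ-++ es es′ _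

  coef-++ : ∀ es es′ k → coef (es ++ es′) k ≡ coef es k + coef es′ k
  coef-++ es es′ k = ∑ᴸ-++ es es′ _

  eval-scale : ∀ c es n → eval (scale c es) n ≡ c * eval es n
  eval-scale c es n = trans (∑ᴸ-map _ es _)
    (trans (∑ᴸ-cong es λ (t , k) → ℤₚ.*-assoc c t (k ^ n)) (∑ᴸ-*ˡ c es _))

  coef-scale : ∀ c es k → coef (scale c es) k ≡ c * coef es k
  coef-scale c es k = trans (∑ᴸ-map _ es _)
    (trans (∑ᴸ-cong es λ (t , κ) → lem (𝟙 (κ ==ᶻ k)) c t) (∑ᴸ-*ˡ c es _))
    where lem : ∀ a b c → a * (b * c) ≡ b * (a * c)
          lem = solve-∀

  eval-mulKey : ∀ es n → eval (mulKey es) n ≡ eval es (suc n)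
  eval-mulKey es n = trans (∑ᴸ-map _ es _) (∑ᴸ-cong es λ (t , k) → ℤₚ.*-assoc t k (k ^ n))

  coef-mulKey : ∀ es k → coef (mulKey es) k ≡ k * coef es k
  coef-mulKey es k = trans (∑ᴸ-map _ es _) (trans (∑ᴸ-cong es λ (t , κ) → lem t κ) (∑ᴸ-*ˡ k es _))
    where
    lem : ∀ t κ → 𝟙 (κ ==ᶻ k) * (t * κ) ≡ k * (𝟙 (κ ==ᶻ k) * t)
    lem t κ with κ ℤₚ.≟ k
    ... | yes refl = alg t k
      where alg : ∀ t k → 1ℤ * (t * k) ≡ k * (1ℤ * t)
            alg = solve-∀
    ... | no _ = sym (ℤₚ.*-zeroʳ k)

  neg-^ : ∀ k n → (- k) ^ n ≡ (- 1ℤ) ^ n * k ^ n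
  neg-^ k zero = refl
  neg-^ k (suc n) = trans (cong (- k *_) (neg-^ k n)) (lem k ((- 1ℤ) ^ n) (k ^ n))
    where lem : ∀ k a b → - k * (a * b) ≡ - 1ℤ * a * (k * b)
          lem = solve-∀

  eval-negKey : ∀ es n → eval (negKey es) n ≡ (- 1ℤ) ^ n * eval es n
  eval-negKey es n = trans (∑ᴸ-map _ es _) (trans (∑ᴸ-cong es λ (t , k) →
      trans (cong (t *_) (neg-^ k n)) (lem t ((- 1ℤ) ^ n) (k ^ n))) (∑ᴸ-*ˡ ((- 1ℤ) ^ n) es (λ (t , k) → t * k ^ n)))
    where lem : ∀ a b c → a * (b * c) ≡ b * (a * c)
          lem = solve-∀

  coef-negKey : ∀ es k → coef (negKey es) k ≡ coef es (- k)
  coef-negKey es k = trans (∑ᴸ-map _ es _) (∑ᴸ-cong es λ (t , κ) → cong (λ b → 𝟙 b * t)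
    (⇔→≡ (λ e → trans (cong (_==ᶻ - k) (trans (sym (ℤₚ.neg-involutive κ)) (cong -_ (==ᶻ⇒≡ e)))) (==ᶻ-refl (- k)))
         (λ e → trans (cong (λ z → - z ==ᶻ k) (==ᶻ⇒≡ e))
                      (trans (cong (_==ᶻ k) (ℤₚ.neg-involutive k)) (==ᶻ-refl k)))))

  coef-none : ∀ {es k} → All (λ tk → ¬ proj₂ tk ≡ k) es → coef es k ≡ 0ℤ
  coef-none [] = refl
  coef-none {(t , κ) ∷ es} {k} (h ∷ hs) rewrite ≢⇒==ᶻ h = trans (ℤₚ.+-identityˡ _) (coef-none hs)

  roots : List ℤ → ℤ → ℤ
  roots [] x = 1ℤ
  roots (j ∷ js) x = (x - j) * roots js x

  -- Raising `n` by one multiplies each term by its key, so a relation that holds for all `n`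
  -- survives weighting by any polynomial in the key. The polynomial is given by its roots.
  roots-kill : ∀ es → (∀ n → eval es n ≡ 0ℤ) → ∀ js n → ∑ᴸ es (λ (t , κ) → t * (roots js κ * κ ^ n)) ≡ 0ℤ
  roots-kill es z [] n = trans (∑ᴸ-cong es λ (t , κ) → cong (t *_) (ℤₚ.*-identityˡ (κ ^ n))) (z n)
  roots-kill es z (j ∷ js) n = begin
    ∑ᴸ es (λ (t , κ) → t * ((κ - j) * roots js κ * κ ^ n))
      ≡⟨ ∑ᴸ-cong es (λ (t , κ) → lem t κ j (roots js κ) (κ ^ n)) ⟩
    ∑ᴸ es (λ (t , κ) → t * (roots js κ * (κ * κ ^ n)) + (- j) * (t * (roots js κ * κ ^ n)))
      ≡⟨ ∑ᴸ-+ es _ _ ⟩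
    ∑ᴸ es (λ (t , κ) → t * (roots js κ * (κ * κ ^ n))) + ∑ᴸ es (λ (t , κ) → (- j) * (t * (roots js κ * κ ^ n)))
      ≡⟨ cong₂ _+_ (roots-kill es z js (suc n)) (trans (∑ᴸ-*ˡ (- j) es _) (cong (- j *_) (roots-kill es z js n))) ⟩
    0ℤ + (- j) * 0ℤ
      ≡⟨ trans (ℤₚ.+-identityˡ _) (ℤₚ.*-zeroʳ (- j)) ⟩
    0ℤ ∎
    where lem : ∀ t κ j r p → t * ((κ - j) * r * p) ≡ t * (r * (κ * p)) + (- j) * (t * (r * p))
          lem = solve-∀

  others : ℤ → Exp → List ℤ
  others k [] = []
  others k ((t , κ) ∷ es) with κ ℤₚ.≟ k
  ... | yes _ = others k es
  ... | no _ = κ ∷ others k es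

  minus-zero : ∀ {x y} → x - y ≡ 0ℤ → x ≡ y
  minus-zero {x} {y} e = trans (sym (lem x y)) (trans (cong (_+ y) e) (ℤₚ.+-identityˡ y))
    where lem : ∀ x y → (x - y) + y ≡ x
          lem = solve-∀

  *-nonzero : ∀ {x y} → ¬ x ≡ 0ℤ → ¬ y ≡ 0ℤ → ¬ x * y ≡ 0ℤ
  *-nonzero {x} {y} a b e with ℤₚ.i*j≡0⇒i≡0∨j≡0 x e
  ... | inj₁ p = a p
  ... | inj₂ p = b p

  others-k : ∀ k es → ¬ roots (others k es) k ≡ 0ℤ
  others-k k [] ()
  others-k k ((t , κ) ∷ es) with κ ℤₚ.≟ k
  ... | yes _ = others-k k es
  ... | no h = *-nonzero (λ e → h (sym (minus-zero {k} {κ} e))) (others-k k es)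

  others-all : ∀ k es → All (λ tk → proj₂ tk ≡ k ⊎ roots (others k es) (proj₂ tk) ≡ 0ℤ) es
  others-all k [] = []
  others-all k ((t , κ) ∷ es) with κ ℤₚ.≟ k
  ... | yes p = inj₁ p ∷ others-all k es
  ... | no h = inj₂ (trans (cong (_* roots (others k es) κ) (ℤₚ.+-inverseʳ κ)) refl)
             ∷ All.map (λ { (inj₁ p) → inj₁ p
                          ; {t , x} (inj₂ p) → inj₂ (trans (cong ((x - κ) *_) p) (ℤₚ.*-zeroʳ (x - κ))) })
                 (others-all k es)

  -- Linear independence of exponentials by interpolation: the polynomial whose roots are all keys
  -- other than `k` isolates the coefficient of `k`, and its value at `k` is nonzero.
  coef-zero : ∀ es → (∀ n → eval es n ≡ 0ℤ) → ∀ k → coef es k ≡ 0ℤ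
  coef-zero es z k with ℤₚ.i*j≡0⇒i≡0∨j≡0 (coef es k) {roots (others k es) k} (trans (sym (sel es (others-all k es))) (roots-kill es z (others k es) 0))
    where
    js = others k es
    sel : ∀ xs → All (λ tk → proj₂ tk ≡ k ⊎ roots js (proj₂ tk) ≡ 0ℤ) xs →
          ∑ᴸ xs (λ (t , κ) → t * (roots js κ * κ ^ 0)) ≡ coef xs k * roots js k
    sel [] [] = refl
    sel ((t , κ) ∷ xs) (h ∷ hs) = trans (cong₂ _+_ (one h) (sel xs hs)) (sym (ℤₚ.*-distribʳ-+ (roots js k) (𝟙 (κ ==ᶻ k) * t) (coef xs k)))
      where
      one : κ ≡ k ⊎ roots js κ ≡ 0ℤ → t * (roots js κ * κ ^ 0) ≡ 𝟙 (κ ==ᶻ k) * t * roots js k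
      one h with κ ℤₚ.≟ k
      one h | yes refl = lem t (roots js κ)
        where lem : ∀ t r → t * (r * 1ℤ) ≡ 1ℤ * t * r
              lem = solve-∀
      one (inj₁ p) | no q = ⊥-elim (q p)
      one (inj₂ p) | no q = trans (cong (λ r → t * (r * 1ℤ)) p) (ℤₚ.*-zeroʳ t)
  ... | inj₁ p = p
  ... | inj₂ p = ⊥-elim (others-k k es p)

  -- A coefficient depends only on the function of `n` and not on the list. Through this lemma
  -- extensionality, eigenvalue equations, totals and parity of coefficients are all reduced to
  -- identities between counts.
  coef-unique : ∀ es es′ → (∀ n → eval es n ≡ eval es′ n) → ∀ k → coef es k ≡ coef es′ k
  coef-unique es es′ h k = minus-zero (trans (sym (lem′ k)) (coef-zero (es ++ scale (- 1ℤ) es′) zeros k))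
    where
    lem : ∀ a b → a + (- 1ℤ) * b ≡ a - b
    lem = solve-∀
    lem′ : ∀ k → coef (es ++ scale (- 1ℤ) es′) k ≡ coef es k - coef es′ k
    lem′ k = trans (coef-++ es _ k) (trans (cong (_+_ (coef es k)) (coef-scale (- 1ℤ) es′ k)) (lem (coef es k) (coef es′ k)))
    zeros : ∀ n → eval (es ++ scale (- 1ℤ) es′) n ≡ 0ℤ
    zeros n = trans (eval-++ es _ n) (trans (cong (_+_ (eval es n)) (eval-scale (- 1ℤ) es′ n))
      (trans (cong (λ x → x + - 1ℤ * eval es′ n) (h n)) (canc (eval es′ n))))
      where canc : ∀ b → b + (- 1ℤ) * b ≡ 0ℤ
            canc = solve-∀

  -- Exponential sums grouped by the absolute value of the key.

  sumℤ : ℕ → (ℕ → ℤ) → ℤ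
  sumℤ zero f = 0ℤ
  sumℤ (suc M) f = sumℤ M f + f (suc M)

  sumℤ-+ : ∀ M (f g : ℕ → ℤ) → sumℤ M (λ k → f k + g k) ≡ sumℤ M f + sumℤ M g
  sumℤ-+ zero f g = refl
  sumℤ-+ (suc M) f g = trans (cong (_+ (f (suc M) + g (suc M))) (sumℤ-+ M f g)) (lem (sumℤ M f) (sumℤ M g) (f (suc M)) (g (suc M)))
    where lem : ∀ a b c d → a + b + (c + d) ≡ a + c + (b + d)
          lem = solve-∀

  sumℤ-cong : ∀ M {f g : ℕ → ℤ} → (∀ k → f k ≡ g k) → sumℤ M f ≡ sumℤ M g
  sumℤ-cong zero h = refl
  sumℤ-cong (suc M) h = cong₂ _+_ (sumℤ-cong M h) (h (suc M))

  sumℤ-zero : ∀ M {f : ℕ → ℤ} → (∀ k → 1 ℕ.≤ k → k ℕ.≤ M → f k ≡ 0ℤ) → sumℤ M f ≡ 0ℤ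
  sumℤ-zero zero h = refl
  sumℤ-zero (suc M) h = cong₂ _+_ (sumℤ-zero M (λ k a b → h k a (ℕₚ.m≤n⇒m≤1+n b))) (h (suc M) (s≤s z≤n) ℕₚ.≤-refl)

  sumℤ-*ˡ : ∀ M c (f : ℕ → ℤ) → sumℤ M (λ k → c * f k) ≡ c * sumℤ M f
  sumℤ-*ˡ zero c f = sym (ℤₚ.*-zeroʳ c)
  sumℤ-*ˡ (suc M) c f = trans (cong (_+ c * f (suc M)) (sumℤ-*ˡ M c f)) (sym (ℤₚ.*-distribˡ-+ c _ _))

  sumℤ-δ : ∀ M j (f : ℕ → ℤ) → 1 ℕ.≤ j → j ℕ.≤ M → sumℤ M (λ k → 𝟙 (+ j ==ᶻ + k) * f k) ≡ f j
  sumℤ-δ zero j f a b = ⊥-elim (ℕₚ.<-irrefl refl (ℕₚ.≤-trans a b))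
  sumℤ-δ (suc M) j f a b = go (j ℕₚ.≟ suc M)
    where
    go : Dec (j ≡ suc M) → sumℤ (suc M) (λ k → 𝟙 (+ j ==ᶻ + k) * f k) ≡ f j
    go (yes refl) = trans (cong₂ _+_ (sumℤ-zero M (λ k _ q → cong (λ b → 𝟙 b * f k) (≢⇒==ᶻ (λ e → ℕₚ.<-irrefl refl (ℕₚ.≤-trans (s≤s q) (ℕₚ.≤-reflexive (ℤₚ.+-injective e)))))))
                     (cong (λ b → 𝟙 b * f (suc M)) (==ᶻ-refl (+ suc M)))) (trans (ℤₚ.+-identityˡ _) (ℤₚ.*-identityˡ _))
    go (no h) = trans (cong₂ _+_ (sumℤ-δ M j f a (ℕ.s≤s⁻¹ (ℕₚ.≤∧≢⇒< b h))) (cong (λ b → 𝟙 b * f (suc M)) (≢⇒==ᶻ (h ∘ ℤₚ.+-injective)))) (ℤₚ.+-identityʳ _)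

  sumℤ-trunc : ∀ D M (f : ℕ → ℤ) → D ℕ.≤ M → (∀ k → D ℕ.< k → k ℕ.≤ M → f k ≡ 0ℤ) → sumℤ M f ≡ sumℤ D f
  sumℤ-trunc D zero f z≤n h = refl
  sumℤ-trunc D (suc M) f le h with D ℕₚ.≟ suc M
  ... | yes refl = refl
  ... | no n = trans (cong₂ _+_ (sumℤ-trunc D M f (ℕ.s≤s⁻¹ (ℕₚ.≤∧≢⇒< le n)) (λ k a b → h k a (ℕₚ.m≤n⇒m≤1+n b))) (h (suc M) (ℕₚ.≤∧≢⇒< le n) ℕₚ.≤-refl)) (ℤₚ.+-identityʳ _)

  -- The keys `k` and `- k` are kept together for the parity argument; key 0 stands apart because
  -- `sumℤ` starts at 1.
  eval-coef : ∀ M es → All (λ tk → ∣ proj₂ tk ∣ ℕ.≤ M) es → ∀ n →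
    eval es n ≡ sumℤ M (λ k → coef es (+ k) * (+ k) ^ n + coef es (- (+ k)) * (- (+ k)) ^ n) + coef es 0ℤ * 0ℤ ^ n
  eval-coef M [] [] n = sym (trans (ℤₚ.+-identityʳ _) (sumℤ-zero M λ k _ _ → refl))
  eval-coef M ((t , κ) ∷ es) (h ∷ hs) n = trans (cong₂ _+_ (single κ h) (eval-coef M es hs n)) (sym (begin
      sumℤ M (λ k → (c k + C k) * (+ k) ^ n + (c′ k + C′ k) * (- (+ k)) ^ n) + (c₀ + coef es 0ℤ) * 0ℤ ^ n
        ≡⟨ cong₂ _+_ (trans (sumℤ-cong M λ k → l1 (c k) (C k) (c′ k) (C′ k) ((+ k) ^ n) ((- (+ k)) ^ n)) (sumℤ-+ M _ _)) (ℤₚ.*-distribʳ-+ (0ℤ ^ n) c₀ (coef es 0ℤ)) ⟩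
      (S₁ + S₂) + (c₀ * 0ℤ ^ n + coef es 0ℤ * 0ℤ ^ n)
        ≡⟨ l2 S₁ S₂ (c₀ * 0ℤ ^ n) (coef es 0ℤ * 0ℤ ^ n) ⟩
      (S₁ + c₀ * 0ℤ ^ n) + (S₂ + coef es 0ℤ * 0ℤ ^ n) ∎))
    where
    c C c′ C′ : ℕ → ℤ
    c k = 𝟙 (κ ==ᶻ + k) * t
    c′ k = 𝟙 (κ ==ᶻ - (+ k)) * t
    C k = coef es (+ k)
    C′ k = coef es (- (+ k))
    c₀ = 𝟙 (κ ==ᶻ 0ℤ) * t
    S₁ = sumℤ M (λ k → c k * (+ k) ^ n + c′ k * (- (+ k)) ^ n)
    S₂ = sumℤ M (λ k → C k * (+ k) ^ n + C′ k * (- (+ k)) ^ n)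
    l1 : ∀ a b c d p q → (a + b) * p + (c + d) * q ≡ (a * p + c * q) + (b * p + d * q)
    l1 = solve-∀
    l2 : ∀ a b c d → (a + b) + (c + d) ≡ (a + c) + (b + d)
    l2 = solve-∀
    pos neg : ℤ → ℕ → ℤ
    pos κ k = 𝟙 (κ ==ᶻ + k) * t * (+ k) ^ n
    neg κ k = 𝟙 (κ ==ᶻ - (+ k)) * t * (- (+ k)) ^ n
    tm : ∀ κ → ℤ
    tm κ = sumℤ M (λ k → pos κ k + neg κ k) + 𝟙 (κ ==ᶻ 0ℤ) * t * 0ℤ ^ n
    single : ∀ κ → ∣ κ ∣ ℕ.≤ M → t * κ ^ n ≡ tm κ
    single (+ zero) le = sym (trans (cong₂ _+_ (sumℤ-zero M λ { (suc k) _ _ → refl }) (cong (_* 0ℤ ^ n) (ℤₚ.*-identityˡ t))) (ℤₚ.+-identityˡ _))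
    single (+ suc j) le = sym (trans (ℤₚ.+-identityʳ _) (trans (sumℤ-+ M (pos (+ suc j)) (neg (+ suc j))) (trans (cong₂ _+_
        (trans (sumℤ-cong M λ k → ℤₚ.*-assoc (𝟙 (+ suc j ==ᶻ + k)) t _) (sumℤ-δ M (suc j) (λ k → t * (+ k) ^ n) (s≤s z≤n) le))
        (sumℤ-zero M {neg (+ suc j)} λ { (suc k) _ _ → refl })) (ℤₚ.+-identityʳ _))))
    single -[1+ j ] le = sym (trans (ℤₚ.+-identityʳ _) (trans (sumℤ-+ M (pos -[1+ j ]) (neg -[1+ j ])) (trans (cong₂ _+_
        (sumℤ-zero M {pos -[1+ j ]} λ { (suc k) _ _ → refl })
        (trans (sumℤ-cong M λ k → trans (cong (λ b → 𝟙 b * t * (- (+ k)) ^ n) (flip k)) (ℤₚ.*-assoc (𝟙 (+ suc j ==ᶻ + k)) t _))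
               (sumℤ-δ M (suc j) (λ k → t * (- (+ k)) ^ n) (s≤s z≤n) le))) (ℤₚ.+-identityˡ _))))
      where
      flip : ∀ k → (-[1+ j ] ==ᶻ - (+ k)) ≡ (+ suc j ==ᶻ + k)
      flip k = ⇔→≡ (λ e → subst (λ z → (+ suc j ==ᶻ z) ≡ true) (trans (cong -_ (==ᶻ⇒≡ { -[1+ j ]} { - (+ k)} e)) (ℤₚ.neg-involutive (+ k))) (==ᶻ-refl (+ suc j)))
                   (λ e → subst (λ z → (-[1+ j ] ==ᶻ z) ≡ true) (cong -_ (==ᶻ⇒≡ {+ suc j} {+ k} e)) (==ᶻ-refl -[1+ j ]))

  -- Traces of commuting integer operators

  Vect : ℕ → Set
  Vect m = Fin m → ℤ

  δ : ∀ {m} → Fin m → Vect m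
  δ j i = 𝟙 (j == i)

  ⟨_,_⟩ : ∀ {m} → Vect m → Vect m → ℤ
  ⟨ b , f ⟩ = ∑ λ i → b i * f i

  -- Operators remain functions, so that they compose and apply directly. The matrix certifies
  -- linearity and also gives respect for pointwise equality (`ap-cong`), which an arbitrary
  -- function on vectors does not have.
  record Lin {m} (L : Vect m → Vect m) : Set where
    field
      mat : Fin m → Vect m
      rep : ∀ f i → L f i ≡ ⟨ mat i , f ⟩

    ap-cong : ∀ {f g} → (∀ i → f i ≡ g i) → ∀ i → L f i ≡ L g i
    ap-cong {f} {g} h i = trans (rep f i) (trans (∑-cong λ j → cong (mat i j *_) (h j)) (sym (rep g i)))

    ap-+ : ∀ f g i → L (λ j → f j + g j) i ≡ L f i + L g i
    ap-+ f g i = trans (rep _ i) (trans (∑-cong λ j → ℤₚ.*-distribˡ-+ (mat i j) (f j) (g j))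
      (trans (∑-+ _ _) (sym (cong₂ _+_ (rep f i) (rep g i)))))

    ap-* : ∀ c f i → L (λ j → c * f j) i ≡ c * L f i
    ap-* c f i = trans (rep _ i) (trans (∑-cong λ j → lem (mat i j) c (f j))
      (trans (∑-*ˡ c (λ j → mat i j * f j)) (cong (c *_) (sym (rep f i)))))
      where lem : ∀ a b c → a * (b * c) ≡ b * (a * c)
            lem = solve-∀

    ap-- : ∀ f g i → L (λ j → f j - g j) i ≡ L f i - L g i
    ap-- f g i = trans (ap-cong (λ j → lem (f j) (g j)) i) (trans (ap-+ f (λ j → - 1ℤ * g j) i)
      (trans (cong (_+_ (L f i)) (ap-* (- 1ℤ) g i)) (sym (lem (L f i) (L g i)))))
      where lem : ∀ a b → a - b ≡ a + (- 1ℤ) * b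
            lem = solve-∀

    ap-0 : ∀ {f} → (∀ i → f i ≡ 0ℤ) → ∀ i → L f i ≡ 0ℤ
    ap-0 {f} h i = trans (rep f i) (∑-zero λ j → trans (cong (mat i j *_) (h j)) (ℤₚ.*-zeroʳ (mat i j)))

  open Lin

  lin-id : ∀ {m} → Lin {m} id
  lin-id = record { mat = λ i j → 𝟙 (i == j) ; rep = λ f i → sym (∑-δ′ i f) }

  lin-0 : ∀ {m} → Lin {m} (λ f i → 0ℤ)
  lin-0 = record { mat = λ i j → 0ℤ ; rep = λ f i → sym (∑-zero λ j → refl) }

  lin-∘ : ∀ {m} {L M : Vect m → Vect m} → Lin L → Lin M → Lin (L ∘ M)
  lin-∘ {m} {L} {M} l k = record { mat = λ i j → ∑ λ h → mat l i h * mat k h j ; rep = λ f i → begin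
    L (M f) i ≡⟨ rep l (M f) i ⟩
    ∑ (λ h → mat l i h * M f h)
      ≡⟨ ∑-cong (λ h → trans (cong (mat l i h *_) (rep k f h)) (trans (sym (∑-*ˡ (mat l i h) (λ j → mat k h j * f j)))
          (∑-cong λ j → sym (ℤₚ.*-assoc (mat l i h) (mat k h j) (f j))))) ⟩
    ∑ (λ h → ∑ λ j → mat l i h * mat k h j * f j) ≡⟨ ∑-comm (λ h j → mat l i h * mat k h j * f j) ⟩
    ∑ (λ j → ∑ λ h → mat l i h * mat k h j * f j) ≡⟨ ∑-cong (λ j → ∑-*ʳ (f j) (λ h → mat l i h * mat k h j)) ⟩
    ∑ (λ j → ∑ (λ h → mat l i h * mat k h j) * f j) ∎ }

  lin-+ : ∀ {m} {L M : Vect m → Vect m} → Lin L → Lin M → Lin (λ f i → L f i + M f i)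
  lin-+ l k = record { mat = λ i j → mat l i j + mat k i j ; rep = λ f i →
    trans (cong₂ _+_ (rep l f i) (rep k f i)) (trans (sym (∑-+ _ _)) (∑-cong λ j → sym (ℤₚ.*-distribʳ-+ (f j) (mat l i j) (mat k i j)))) }

  lin-* : ∀ {m} {L : Vect m → Vect m} (c : Vect m) → Lin L → Lin (λ f i → c i * L f i)
  lin-* c l = record { mat = λ i j → c i * mat l i j ; rep = λ f i →
    trans (cong (c i *_) (rep l f i)) (trans (sym (∑-*ˡ (c i) (λ j → mat l i j * f j))) (∑-cong λ j → sym (ℤₚ.*-assoc (c i) (mat l i j) (f j)))) }

  lin-∑ : ∀ {m n} {L : Fin n → Vect m → Vect m} → (∀ x → Lin (L x)) → Lin (λ f i → ∑ λ x → L x f i)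
  lin-∑ {L = L} l = record { mat = λ i j → ∑ λ x → mat (l x) i j ; rep = λ f i →
    trans (∑-cong λ x → rep (l x) f i) (trans (∑-comm λ x j → mat (l x) i j * f j)
          (∑-cong λ j → ∑-*ʳ (f j) (λ x → mat (l x) i j))) }

  lin-pull : ∀ {m} (p : Fin m → Fin m) → Lin (λ f i → f (p i))
  lin-pull p = record { mat = λ i j → 𝟙 (p i == j) ; rep = λ f i → sym (∑-δ′ (p i) f) }

  lin-rank₁ : ∀ {m} (β v : Vect m) → Lin (λ f i → ⟨ β , f ⟩ * v i)
  lin-rank₁ β v = record { mat = λ i j → β j * v i ; rep = λ f i →
    trans (sym (∑-*ʳ (v i) (λ j → β j * f j))) (∑-cong λ j → lem (β j) (f j) (v i)) }
    where lem : ∀ a b c → a * b * c ≡ a * c * b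
          lem = solve-∀

  lin-shift : ∀ {m} {T : Vect m → Vect m} (k : ℤ) → Lin T → Lin (λ f i → T f i - k * f i)
  lin-shift {T = T} k l = record { mat = mat L ; rep = λ f i → trans (lem (T f i) k (f i)) (rep L f i) }
    where L = lin-+ l (lin-* (λ _ → - k) lin-id)
          lem : ∀ a k x → a - k * x ≡ a + (- k) * x
          lem = solve-∀

  Tr : ∀ {m} → (Vect m → Vect m) → ℤ
  Tr L = ∑ λ i → L (δ i) i

  entry : ∀ {m} {L : Vect m → Vect m} (l : Lin L) → ∀ i j → L (δ j) i ≡ mat l i j
  entry {L = L} l i j = trans (rep l (δ j) i) (trans (∑-cong λ h → ℤₚ.*-comm (mat l i h) (𝟙 (j == h))) (∑-δ′ j (mat l i)))

  Tr-comm : ∀ {m} {L M : Vect m → Vect m} → Lin L → Lin M → Tr (L ∘ M) ≡ Tr (M ∘ L)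
  Tr-comm l k = begin
    _ ≡⟨ ∑-cong (λ i → trans (rep l _ i) (∑-cong λ j → cong (mat l i j *_) (entry k j i))) ⟩
    ∑ (λ i → ∑ λ j → mat l i j * mat k j i) ≡⟨ ∑-comm (λ i j → mat l i j * mat k j i) ⟩
    ∑ (λ j → ∑ λ i → mat l i j * mat k j i) ≡⟨ ∑-cong (λ j → ∑-cong λ i → ℤₚ.*-comm (mat l i j) (mat k j i)) ⟩
    ∑ (λ j → ∑ λ i → mat k j i * mat l i j) ≡⟨ sym (∑-cong (λ i → trans (rep k _ i) (∑-cong λ j → cong (mat k i j *_) (entry l j i)))) ⟩
    _ ∎

  sign-split : ∀ a → ∃[ s ] (s * s ≡ 1ℤ × a ≡ s * + ∣ a ∣)
  sign-split (+ n) = 1ℤ , refl , sym (ℤₚ.*-identityˡ (+ n))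
  sign-split -[1+ n ] = - 1ℤ , refl , sym (ℤₚ.-1*i≡-i (+ suc n))

  -- Signs `σ`, `τ` of square 1 reduce the claim to absolute values. The last identity is the Bézout
  -- identity for `d` after cancelling the nonzero `d`.
  bezout : ∀ a g → ¬ g ≡ 0ℤ → ∃[ d ] ∃[ a′ ] ∃[ g′ ] ∃[ s ] ∃[ t ] (¬ d ≡ 0ℤ × a ≡ d * a′ × g ≡ d * g′ × a′ * s + g′ * t ≡ 1ℤ)
  bezout a g g≢0 with sign-split a | sign-split g | Bézout.lemma ∣ a ∣ ∣ g ∣
  ... | (σ , σσ , aσ) | (τ , ττ , gτ) | Bézout.result d gcd i with GCD.commonDivisor gcd
  ... | (divides p pe , divides q qe) = + d , σ * + p , τ * + q , proj₁ st , proj₁ (proj₂ st) , d≢0 , ea , eg , one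
    where
    ∣a∣≡ : + ∣ a ∣ ≡ + p * + d
    ∣a∣≡ = trans (cong +_ pe) (ℤₚ.pos-* p d)
    ∣g∣≡ : + ∣ g ∣ ≡ + q * + d
    ∣g∣≡ = trans (cong +_ qe) (ℤₚ.pos-* q d)
    lem : ∀ s p d → s * (p * d) ≡ d * (s * p)
    lem = solve-∀
    ea : a ≡ + d * (σ * + p)
    ea = trans aσ (trans (cong (σ *_) ∣a∣≡) (lem σ (+ p) (+ d)))
    eg : g ≡ + d * (τ * + q)
    eg = trans gτ (trans (cong (τ *_) ∣g∣≡) (lem τ (+ q) (+ d)))
    d≢0 : ¬ + d ≡ 0ℤ
    d≢0 e = g≢0 (trans eg (trans (cong (_* (τ * + q)) e) refl))
    st : ∃[ s ] ∃[ t ] + ∣ a ∣ * σ * s + + ∣ g ∣ * τ * t ≡ + d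
    st = go i
      where
      go : Bézout.Identity d ∣ a ∣ ∣ g ∣ → ∃[ s ] ∃[ t ] + ∣ a ∣ * σ * s + + ∣ g ∣ * τ * t ≡ + d
      go (Bézout.+- x y e) = σ * + x , - (τ * + y) , trans (alg (+ ∣ a ∣) (+ ∣ g ∣) σ τ (+ x) (+ y)) (trans (cong₂ (λ u v → + ∣ a ∣ * u * + x - + ∣ g ∣ * v * + y) σσ ττ)
        (trans (alg₂ (+ ∣ a ∣) (+ ∣ g ∣) (+ x) (+ y)) (trans (cong (_- (+ y * + ∣ g ∣)) (trans (sym (ℤₚ.pos-* x ∣ a ∣)) (trans (cong +_ (sym e)) (cong (λ z → + d + z) (ℤₚ.pos-* y ∣ g ∣))))) (alg₃ (+ d) (+ y * + ∣ g ∣)))))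
        where
        alg : ∀ A G σ τ x y → A * σ * (σ * x) + G * τ * (- (τ * y)) ≡ A * (σ * σ) * x - G * (τ * τ) * y
        alg = solve-∀
        alg₂ : ∀ A G x y → A * 1ℤ * x - G * 1ℤ * y ≡ x * A - y * G
        alg₂ = solve-∀
        alg₃ : ∀ d z → d + z - z ≡ d
        alg₃ = solve-∀
      go (Bézout.-+ x y e) = - (σ * + x) , τ * + y , trans (alg (+ ∣ a ∣) (+ ∣ g ∣) σ τ (+ x) (+ y)) (trans (cong₂ (λ u v → + ∣ g ∣ * v * + y - + ∣ a ∣ * u * + x) σσ ττ)
        (trans (alg₂ (+ ∣ a ∣) (+ ∣ g ∣) (+ x) (+ y)) (trans (cong (_- (+ x * + ∣ a ∣)) (trans (sym (ℤₚ.pos-* y ∣ g ∣)) (trans (cong +_ (sym e)) (cong (λ z → + d + z) (ℤₚ.pos-* x ∣ a ∣))))) (alg₃ (+ d) (+ x * + ∣ a ∣)))))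
        where
        alg : ∀ A G σ τ x y → A * σ * (- (σ * x)) + G * τ * (τ * y) ≡ G * (τ * τ) * y - A * (σ * σ) * x
        alg = solve-∀
        alg₂ : ∀ A G x y → G * 1ℤ * y - A * 1ℤ * x ≡ y * G - x * A
        alg₂ = solve-∀
        alg₃ : ∀ d z → d + z - z ≡ d
        alg₃ = solve-∀
    one : σ * + p * proj₁ st + τ * + q * proj₁ (proj₂ st) ≡ 1ℤ
    one with ℤₚ.i*j≡0⇒i≡0∨j≡0 (+ d) {σ * + p * proj₁ st + τ * + q * proj₁ (proj₂ st) - 1ℤ}
               (trans (alg (+ d) (+ p) (+ q) σ τ (proj₁ st) (proj₁ (proj₂ st)))
                 (trans (cong (_- + d) (trans (sym (cong₂ (λ u v → u * σ * proj₁ st + v * τ * proj₁ (proj₂ st)) ∣a∣≡ ∣g∣≡)) (proj₂ (proj₂ st)))) (ℤₚ.+-inverseʳ (+ d))))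
      where alg : ∀ d p q σ τ s t → d * (σ * p * s + τ * q * t - 1ℤ) ≡ (p * d * σ * s + q * d * τ * t) - d
            alg = solve-∀
    ... | inj₁ z = ⊥-elim (d≢0 z)
    ... | inj₂ z = minus-zero z

  -- The functional is its content times a primitive one, and `u` witnesses primitivity: subtracting
  -- `⟨ β , f ⟩` times `u` from `f` projects onto the kernel without division. Each further entry is
  -- merged with the content found so far by `bezout`.
  primitive-part : ∀ m (b : Vect m) → (∀ i → b i ≡ 0ℤ) ⊎
    (∃[ g ] ∃[ β ] ∃[ u ] (¬ g ≡ 0ℤ × (∀ i → b i ≡ g * β i) × ⟨ β , u ⟩ ≡ 1ℤ))
  primitive-part zero b = inj₁ λ ()
  primitive-part (suc m) b with primitive-part m (b ∘ suc)
  ... | inj₁ z with b zero ℤₚ.≟ 0ℤ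
  ...   | yes e = inj₁ λ { zero → e ; (suc i) → z i }
  ...   | no n = inj₂ (b zero , δ zero , δ zero , n ,
            (λ { zero → sym (ℤₚ.*-identityʳ (b zero)) ; (suc i) → trans (z i) (sym (ℤₚ.*-zeroʳ (b zero))) }) , ∑-δ′ zero (δ zero))
  primitive-part (suc m) b | inj₂ (g , β , u , g≢0 , bg , βu) with bezout (b zero) g g≢0
  ... | (d , a′ , g′ , s , t , d≢0 , ea , eg , one) = inj₂ (d , β′ , u′ , d≢0 , bβ , βu′)
    where
    β′ u′ : Vect (suc m)
    β′ zero = a′
    β′ (suc i) = g′ * β i
    u′ zero = s
    u′ (suc i) = t * u i
    bβ : ∀ i → b i ≡ d * β′ i
    bβ zero = ea
    bβ (suc i) = trans (bg i) (trans (cong (_* β i) eg) (ℤₚ.*-assoc d g′ (β i)))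
    βu′ : ⟨ β′ , u′ ⟩ ≡ 1ℤ
    βu′ = trans (∑-suc (λ i → β′ i * u′ i)) (trans (cong (_+_ (a′ * s)) (trans (∑-cong λ i → alg g′ (β i) t (u i))
       (trans (∑-*ˡ (g′ * t) (λ i → β i * u i)) (trans (cong (g′ * t *_) βu) (ℤₚ.*-identityʳ (g′ * t)))))) one)
      where alg : ∀ a b c d → a * b * (c * d) ≡ a * c * (b * d)
            alg = solve-∀

  -- An integral e that kills the kernel of the functionals and differs from the identity
  -- only by vectors of that kernel: 1 - e projects onto the kernel.
  record KerProj {m} (rows : List (Vect m)) : Set where
    field
      e : Vect m → Vect m
      lin-e : Lin e
      into : ∀ f → All (λ b → ⟨ b , (λ i → f i - e f i) ⟩ ≡ 0ℤ) rows
      kills : ∀ x → All (λ b → ⟨ b , x ⟩ ≡ 0ℤ) rows → ∀ i → e x i ≡ 0ℤ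

  -- One functional is added at a time. On the kernel reached so far `b` acts as `b′`, that is, `b`
  -- after `1 - e`. If `b′` is nonzero, write it as `g` times a primitive `β` with `⟨ β , u ⟩ ≡ 1`.
  -- The vector `w` obtained from `u` by `1 - e` already lies in the old kernel, so the correction
  -- by `⟨ β , f ⟩` times `w` removes the value of `b` and disturbs none of the earlier functionals.
  kerProj : ∀ {m} (rows : List (Vect m)) → KerProj rows
  kerProj [] = record { e = λ f i → 0ℤ ; lin-e = lin-0 ; into = λ f → [] ; kills = λ x _ i → refl }
  kerProj {m} (b ∷ rows) = go (primitive-part m b′)
    where
    open KerProj (kerProj rows)
    b′ : Vect m
    b′ j = ⟨ b , (λ i → δ j i - e (δ j) i) ⟩
    b′-ok : ∀ f → ⟨ b′ , f ⟩ ≡ ⟨ b , (λ i → f i - e f i) ⟩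
    b′-ok f = begin
      ∑ (λ j → ∑ (λ i → b i * (δ j i - e (δ j) i)) * f j)
        ≡⟨ ∑-cong (λ j → sym (∑-*ʳ (f j) (λ i → b i * (δ j i - e (δ j) i)))) ⟩
      ∑ (λ j → ∑ (λ i → b i * (δ j i - e (δ j) i) * f j))
        ≡⟨ ∑-comm (λ j i → b i * (δ j i - e (δ j) i) * f j) ⟩
      ∑ (λ i → ∑ (λ j → b i * (δ j i - e (δ j) i) * f j))
        ≡⟨ ∑-cong (λ i → trans (∑-cong λ j → alg (b i) (δ j i) (e (δ j) i) (f j)) (trans (∑-*ˡ (b i) (λ j → δ j i * f j - e (δ j) i * f j))
             (cong (b i *_) (trans (∑-- (λ j → δ j i * f j) (λ j → e (δ j) i * f j)) (cong₂ _-_ (∑-δ i f)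
               (trans (∑-cong λ j → cong (_* f j) (entry lin-e i j)) (sym (rep lin-e f i)))))))) ⟩
      ∑ (λ i → b i * (f i - e f i)) ∎
      where alg : ∀ b x y f → b * (x - y) * f ≡ b * (x * f - y * f)
            alg = solve-∀
    go : _ → KerProj (b ∷ rows)
    go (inj₁ z) = record { e = e ; lin-e = lin-e
      ; into = λ f → trans (sym (b′-ok f)) (∑-zero λ i → cong (_* f i) (z i)) ∷ into f
      ; kills = λ { x (_ ∷ h) → kills x h } }
    go (inj₂ (g , β , u , g≢0 , bg , βu)) = record { e = e′ ; lin-e = lin-+ lin-e (lin-rank₁ β w)
      ; into = λ f → first f ∷ All.map (λ {r} (h₁ , h₂) → shift r f h₁ h₂) (All.zip (into f , into u))
      ; kills = killed }
      where
      w : Vect m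
      w i = u i - e u i
      e′ : Vect m → Vect m
      e′ f i = e f i + ⟨ β , f ⟩ * w i
      b′-β : ∀ f → ⟨ b′ , f ⟩ ≡ g * ⟨ β , f ⟩
      b′-β f = trans (∑-cong λ i → trans (cong (_* f i) (bg i)) (ℤₚ.*-assoc g (β i) (f i))) (∑-*ˡ g (λ i → β i * f i))
      expand : ∀ r f → ⟨ r , (λ i → f i - e′ f i) ⟩ ≡ ⟨ r , (λ i → f i - e f i) ⟩ - ⟨ β , f ⟩ * ⟨ r , w ⟩
      expand r f = trans (∑-cong λ i → alg (r i) (f i) (e f i) ⟨ β , f ⟩ (w i)) (trans (∑-- (λ i → r i * (f i - e f i)) (λ i → ⟨ β , f ⟩ * (r i * w i)))
          (cong (λ z → ⟨ r , (λ i → f i - e f i) ⟩ - z) (∑-*ˡ ⟨ β , f ⟩ (λ i → r i * w i))))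
        where alg : ∀ r x y c w → r * (x - (y + c * w)) ≡ r * (x - y) - c * (r * w)
              alg = solve-∀
      first : ∀ f → ⟨ b , (λ i → f i - e′ f i) ⟩ ≡ 0ℤ
      first f = trans (expand b f) (trans (cong₂ (λ p q → p - ⟨ β , f ⟩ * q) (trans (sym (b′-ok f)) (b′-β f)) (trans (sym (b′-ok u)) (trans (b′-β u) (cong (g *_) βu)))) (alg g ⟨ β , f ⟩))
        where alg : ∀ g c → g * c - c * (g * 1ℤ) ≡ 0ℤ
              alg = solve-∀
      shift : ∀ r f → ⟨ r , (λ i → f i - e f i) ⟩ ≡ 0ℤ → ⟨ r , w ⟩ ≡ 0ℤ → ⟨ r , (λ i → f i - e′ f i) ⟩ ≡ 0ℤ
      shift r f h₁ h₂ = trans (expand r f) (trans (cong₂ (λ p q → p - ⟨ β , f ⟩ * q) h₁ h₂) (alg ⟨ β , f ⟩))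
        where alg : ∀ c → 0ℤ - c * 0ℤ ≡ 0ℤ
              alg = solve-∀
      killed : ∀ x → All (λ b → ⟨ b , x ⟩ ≡ 0ℤ) (b ∷ rows) → ∀ i → e′ x i ≡ 0ℤ
      killed x (hb ∷ h) i = trans (cong₂ (λ p q → p + q * w i) (kills x h i) βx) refl
        where
        gβ : g * ⟨ β , x ⟩ ≡ 0ℤ
        gβ = trans (sym (b′-β x)) (trans (b′-ok x) (trans (∑-cong λ j → trans (cong (λ z → b j * (x j - z)) (kills x h j)) (alg (b j) (x j))) hb))
          where alg : ∀ b x → b * (x - 0ℤ) ≡ b * x
                alg = solve-∀
        βx : ⟨ β , x ⟩ ≡ 0ℤ
        βx with ℤₚ.i*j≡0⇒i≡0∨j≡0 g gβ
        ... | inj₁ z = ⊥-elim (g≢0 z)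
        ... | inj₂ z = z

  pow : ∀ {m} → (Vect m → Vect m) → ℕ → Vect m → Vect m
  pow T zero f = f
  pow T (suc n) f = T (pow T n f)

  lin-pow : ∀ {m} {T : Vect m → Vect m} → Lin T → ∀ n → Lin (pow T n)
  lin-pow l zero = lin-id
  lin-pow l (suc n) = lin-∘ l (lin-pow l n)

  annih : ∀ {m} → (Vect m → Vect m) → List ℤ → Vect m → Vect m
  annih T [] f = f
  annih T (k ∷ ks) f = λ i → T (annih T ks f) i - k * annih T ks f i

  -- Splitting off the eigenlattice of k₁: with e as in KerProj for T - k₁,
  -- Tr (A Tⁿ) = k₁ⁿ Tr (A (1 - e)) + Tr ((e A) (e T)ⁿ), and e A is annihilated by the remaining factors.
  trace-exp : ∀ {m} ks {A T : Vect m → Vect m} → Lin A → Lin T → (∀ f i → A (T f) i ≡ T (A f) i) →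
    (∀ f i → annih T ks (A f) i ≡ 0ℤ) →
    ∃[ es ] (All (λ tk → proj₂ tk ∈ ks) es × (∀ n → Tr (λ f → A (pow T n f)) ≡ eval es n))
  trace-exp [] lA lT comm ann = [] , [] , λ n → ∑-zero λ i → ann _ i
  trace-exp {m} (k ∷ ks) {A} {T} lA lT comm ann = (Tr A₁ , k) ∷ es , here refl ∷ All.map there es∈ , tr
    where
    lB = lin-shift k lT
    B : Vect m → Vect m
    B f i = T f i - k * f i
    open KerProj (kerProj (List.tabulate (mat lB)))
    into-B : ∀ f i → B (λ i → f i - e f i) i ≡ 0ℤ
    into-B f i = trans (rep lB _ i) (Allₚ.tabulate⁻ (into f) i)
    kills-B : ∀ x → (∀ i → B x i ≡ 0ℤ) → ∀ i → e x i ≡ 0ℤ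
    kills-B x h = kills x (Allₚ.tabulate⁺ λ i → trans (sym (rep lB x i)) (h i))
    A₁ A′ T′ : Vect m → Vect m
    A₁ f = A (λ i → f i - e f i)
    A′ f = e (A f)
    T′ f = e (T f)
    -- Congruence modulo the eigenlattice, the kernel of `B`. The map `e` is constant on the classes
    -- and stays within them, so `A′` and `T′` model the action of `A` and `T` on the quotient
    -- lattice.
    _∼_ : Vect m → Vect m → Set
    f ∼ g = ∀ i → B (λ i → f i - g i) i ≡ 0ℤ
    ∼-e : ∀ {f g} → f ∼ g → ∀ i → e f i ≡ e g i
    ∼-e {f} {g} h i = minus-zero (trans (sym (ap-- lin-e f g i)) (kills-B _ h i))
    ∼-map : ∀ {L} → Lin L → (∀ f i → L (T f) i ≡ T (L f) i) → ∀ {f g} → f ∼ g → L f ∼ L g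
    ∼-map {L} l c {f} {g} h i = begin
      B (λ i → L f i - L g i) i ≡⟨ ap-cong lB (λ j → sym (ap-- l f g j)) i ⟩
      B (L x) i ≡⟨ cong₂ _-_ (sym (c x i)) (sym (ap-* l k x i)) ⟩
      L (T x) i - L (λ j → k * x j) i ≡⟨ sym (ap-- l (T x) (λ j → k * x j) i) ⟩
      L (B x) i ≡⟨ ap-0 l h i ⟩
      0ℤ ∎
      where x : Vect m
            x j = f j - g j
    ∼-trans : ∀ {f g h} → f ∼ g → g ∼ h → f ∼ h
    ∼-trans {f} {g} {h} p q i = trans (ap-cong lB (λ j → alg (f j) (g j) (h j)) i)
        (trans (ap-+ lB (λ j → f j - g j) (λ j → g j - h j) i) (cong₂ _+_ (p i) (q i)))
      where alg : ∀ x y z → x - z ≡ (x - y) + (y - z)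
            alg = solve-∀
    ∼-refl : ∀ {f} → f ∼ f
    ∼-refl {f} = ap-0 lB λ j → ℤₚ.+-inverseʳ (f j)
    ∼e : ∀ f → f ∼ e f
    ∼e = into-B
    comm′ : ∀ f i → A′ (T′ f) i ≡ T′ (A′ f) i
    comm′ f i = trans (sym (∼-e (∼-map lA comm (∼e (T f))) i)) (trans (ap-cong lin-e (comm f) i)
                  (∼-e (∼-map lT (λ _ _ → refl) (∼e (A f))) i))
    ann-e : ∀ js g i → annih T′ js (e g) i ≡ e (annih T js g) i
    ann-e [] g i = refl
    ann-e (j ∷ js) g i = trans (cong₂ (λ x y → x - j * y) (trans (ap-cong (lin-∘ lin-e lT) (ann-e js g) i)
        (sym (∼-e (∼-map lT (λ _ _ → refl) (∼e (annih T js g))) i))) (ann-e js g i))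
        (sym (trans (ap-- lin-e (T (annih T js g)) (λ i → j * annih T js g i) i) (cong (λ z → e (T (annih T js g)) i - z) (ap-* lin-e j (annih T js g) i))))
    -- The assumption with the factor of `k` in front says that `annih T ks (A f)` lies in the
    -- kernel of `B`, and `e` kills that kernel.
    ann′ : ∀ f i → annih T′ ks (A′ f) i ≡ 0ℤ
    ann′ f i = trans (ann-e ks (A f) i) (kills-B _ (ann f) i)
    rec = trace-exp ks (lin-∘ lin-e lA) (lin-∘ lin-e lT) comm′ ann′
    es = proj₁ rec
    es∈ = proj₁ (proj₂ rec)
    pow-∼ : ∀ n f → pow T n f ∼ pow T′ n f
    pow-∼ zero f = ∼-refl {f}
    pow-∼ (suc n) f = ∼-trans {T (pow T n f)} {T (pow T′ n f)} {e (T (pow T′ n f))} (∼-map lT (λ _ _ → refl) {pow T n f} {pow T′ n f} (pow-∼ n f)) (∼e (T (pow T′ n f)))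
    pow-ker : ∀ n f i → pow T n (λ i → f i - e f i) i ≡ k ^ n * (f i - e f i)
    pow-ker zero f i = sym (ℤₚ.*-identityˡ _)
    pow-ker (suc n) f i = trans (ap-cong lT (pow-ker n f) i) (trans (ap-* lT (k ^ n) (λ i → f i - e f i) i)
        (trans (cong (k ^ n *_) (minus-zero {T (λ i → f i - e f i) i} {k * (f i - e f i)} (into-B f i))) (alg (k ^ n) k (f i - e f i))))
      where alg : ∀ p k x → p * (k * x) ≡ k * p * x
            alg = solve-∀
    tr : ∀ n → Tr (λ f → A (pow T n f)) ≡ Tr A₁ * k ^ n + eval es n
    tr n = begin
      Tr AT ≡⟨ ∑-cong (λ i → trans (ap-cong lAT (λ j → alg (δ i j) (e (δ i) j)) i) (ap-+ lAT (λ j → δ i j - e (δ i) j) (e (δ i)) i)) ⟩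
      ∑ (λ i → AT (λ j → δ i j - e (δ i) j) i + AT (e (δ i)) i) ≡⟨ ∑-+ _ _ ⟩
      ∑ (λ i → AT (λ j → δ i j - e (δ i) j) i) + Tr (λ f → AT (e f)) ≡⟨ cong₂ _+_ s₁ s₂ ⟩
      Tr A₁ * k ^ n + eval es n ∎
      where
      AT : Vect m → Vect m
      AT f = A (pow T n f)
      lAT : Lin AT
      lAT = lin-∘ lA (lin-pow lT n)
      alg : ∀ x y → x ≡ (x - y) + y
      alg = solve-∀
      s₁ : ∑ (λ i → AT (λ j → δ i j - e (δ i) j) i) ≡ Tr A₁ * k ^ n
      s₁ = trans (∑-cong λ i → trans (ap-cong lA (pow-ker n (δ i)) i) (trans (ap-* lA (k ^ n) (λ j → δ i j - e (δ i) j) i) (ℤₚ.*-comm (k ^ n) (A₁ (δ i) i)))) (∑-*ʳ (k ^ n) (λ i → A₁ (δ i) i))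
      -- Cyclicity of the trace moves `e` to the front, where congruent vectors become equal and
      -- powers of `T` may be replaced by powers of `T′`.
      s₂ : Tr (λ f → AT (e f)) ≡ eval es n
      s₂ = trans (Tr-comm lAT lin-e) (trans (∑-cong λ i → ∼-e (∼-map lA comm (pow-∼ n (δ i))) i) (proj₂ (proj₂ rec) n))

  -- Maps and permutations of a finite set

  ∧-true : ∀ {a b} → a ∧ b ≡ true → a ≡ true × b ≡ true
  ∧-true {true} {true} _ = refl , refl

  ∧-intro : ∀ {a b} → a ≡ true → b ≡ true → a ∧ b ≡ true
  ∧-intro refl refl = refl

  ∨-true : ∀ {a b} → a ∨ b ≡ true → a ≡ true ⊎ b ≡ true
  ∨-true {true} _ = inj₁ refl
  ∨-true {false} h = inj₂ h

  ∨-introˡ : ∀ {a b} → a ≡ true → a ∨ b ≡ true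
  ∨-introˡ refl = refl

  ∨-introʳ : ∀ {a b} → b ≡ true → a ∨ b ≡ true
  ∨-introʳ {true} refl = refl
  ∨-introʳ {false} refl = refl

  false≢true : ¬ false ≡ true
  false≢true ()

  allF-cong : ∀ {n} {p q : Fin n → Bool} → (∀ x → p x ≡ q x) → allF p ≡ allF q
  allF-cong {n} {p} {q} h = go (List.allFin n)
    where
    go : ∀ xs → List.foldr (λ x b → p x ∧ b) true xs ≡ List.foldr (λ x b → q x ∧ b) true xs
    go [] = refl
    go (x ∷ xs) = cong₂ _∧_ (h x) (go xs)

  private
    all-tab : ∀ {n m} (p : Fin m → Bool) (g : Fin n → Fin m) →
              List.foldr (λ x b → p x ∧ b) true (List.tabulate g) ≡ true → ∀ x → p (g x) ≡ true
    all-tab {suc n} p g h zero = proj₁ (∧-true h)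
    all-tab {suc n} p g h (suc x) = all-tab p (g ∘ suc) (proj₂ (∧-true {p (g zero)} h)) x

    tab-all : ∀ {n m} (p : Fin m → Bool) (g : Fin n → Fin m) → (∀ x → p (g x) ≡ true) →
              List.foldr (λ x b → p x ∧ b) true (List.tabulate g) ≡ true
    tab-all {zero} p g h = refl
    tab-all {suc n} p g h = ∧-intro (h zero) (tab-all p (g ∘ suc) (h ∘ suc))

    any-tab : ∀ {n m} (p : Fin m → Bool) (g : Fin n → Fin m) →
              List.foldr (λ x b → p x ∨ b) false (List.tabulate g) ≡ true → ∃ λ x → p (g x) ≡ true
    any-tab {suc n} p g h with ∨-true {p (g zero)} h
    ... | inj₁ e = zero , e
    ... | inj₂ e with any-tab p (g ∘ suc) e
    ...   | x , q = suc x , q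

    tab-any : ∀ {n m} (p : Fin m → Bool) (g : Fin n → Fin m) x → p (g x) ≡ true →
              List.foldr (λ x b → p x ∨ b) false (List.tabulate g) ≡ true
    tab-any {suc n} p g zero h = ∨-introˡ h
    tab-any {suc n} p g (suc x) h = ∨-introʳ {p (g zero)} (tab-any p (g ∘ suc) x h)

  allF⇒ : ∀ {n} {p : Fin n → Bool} → allF p ≡ true → ∀ x → p x ≡ true
  allF⇒ {p = p} = all-tab p id

  ⇒allF : ∀ {n} {p : Fin n → Bool} → (∀ x → p x ≡ true) → allF p ≡ true
  ⇒allF {p = p} = tab-all p id

  anyF⇒ : ∀ {n} {p : Fin n → Bool} → anyF p ≡ true → ∃ λ x → p x ≡ true
  anyF⇒ {p = p} = any-tab p id

  ⇒anyF : ∀ {n} {p : Fin n → Bool} x → p x ≡ true → anyF p ≡ true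
  ⇒anyF {p = p} = tab-any p id

  Inj : ∀ {n m} → (Fin n → Fin m) → Set
  Inj f = ∀ {x y} → f x ≡ f y → x ≡ y

  isPerm⇒Inj : ∀ {d} {σ : Map d} → isPerm σ ≡ true → Inj σ
  isPerm⇒Inj {σ = σ} h {x} {y} e with ∨-true {not (σ x == σ y)} (allF⇒ (allF⇒ h x) y)
  ... | inj₂ q = ==⇒≡ q
  ... | inj₁ q rewrite ≡⇒== e = ⊥-elim (false≢true q)

  Inj⇒isPerm : ∀ {d} {σ : Map d} → Inj σ → isPerm σ ≡ true
  Inj⇒isPerm {σ = σ} inj = ⇒allF λ x → ⇒allF λ y → go x y (σ x Finₚ.≟ σ y)
    where
    go : ∀ x y → Dec (σ x ≡ σ y) → not (σ x == σ y) ∨ (x == y) ≡ true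
    go x y (yes e) = ∨-introʳ {not (σ x == σ y)} (≡⇒== (inj e))
    go x y (no n) = ∨-introˡ (cong not (≢⇒== n))

  isPerm-cong : ∀ {d} {σ τ : Map d} → (∀ x → σ x ≡ τ x) → isPerm σ ≡ isPerm τ
  isPerm-cong h = allF-cong λ x → allF-cong λ y → cong₂ (λ a b → not (a == b) ∨ (x == y)) (h x) (h y)

  isId⇒ : ∀ {d} {σ : Map d} → isId σ ≡ true → ∀ x → σ x ≡ x
  isId⇒ h x = ==⇒≡ (allF⇒ h x)

  ⇒isId : ∀ {d} {σ : Map d} → (∀ x → σ x ≡ x) → isId σ ≡ true
  ⇒isId h = ⇒allF λ x → ≡⇒== (h x)

  isId-cong : ∀ {d} {σ τ : Map d} → (∀ x → σ x ≡ τ x) → isId σ ≡ isId τ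
  isId-cong h = allF-cong λ x → cong (_== x) (h x)

  eqM : ∀ {n m} → (Fin n → Fin m) → (Fin n → Fin m) → Bool
  eqM f g = allF λ x → f x == g x

  eqM⇒ : ∀ {n m} {f g : Fin n → Fin m} → eqM f g ≡ true → ∀ x → f x ≡ g x
  eqM⇒ h x = ==⇒≡ (allF⇒ h x)

  ⇒eqM : ∀ {n m} {f g : Fin n → Fin m} → (∀ x → f x ≡ g x) → eqM f g ≡ true
  ⇒eqM h = ⇒allF λ x → ≡⇒== (h x)

  record Perm {d} (π : Map d) : Set where
    field
      inv : Map d
      right : ∀ x → π (inv x) ≡ x
      left : ∀ x → inv (π x) ≡ x

    injective : Inj π
    injective {x} {y} e = trans (sym (left x)) (trans (cong inv e) (left y))

    inverse : Perm inv
    inverse = record { inv = π ; right = left ; left = right }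

  toPerm : ∀ {d} {π : Map d} → Inj π → Perm π
  toPerm {π = π} inj = record
    { inv = λ y → proj₁ (inj⇒surj π inj y)
    ; right = λ y → proj₂ (inj⇒surj π inj y)
    ; left = λ x → inj (proj₂ (inj⇒surj π inj (π x))) }

  perm-∘ : ∀ {d} {π ρ : Map d} → Perm π → Perm ρ → Perm (π ∘ ρ)
  perm-∘ {π = π} {ρ} p q = record { inv = Q.inv ∘ P.inv
    ; right = λ x → trans (cong π (Q.right (P.inv x))) (P.right x)
    ; left = λ x → trans (cong Q.inv (P.left (ρ x))) (Q.left x) }
    where module P = Perm p
          module Q = Perm q

  isPerm-∘ʳ : ∀ {d} (σ : Map d) {π : Map d} → Perm π → isPerm (σ ∘ π) ≡ isPerm σ
  isPerm-∘ʳ σ {π} p = ⇔→≡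
    (λ h → Inj⇒isPerm λ {x} {y} e → trans (sym (right x)) (trans (cong π (isPerm⇒Inj h (trans (cong σ (right x)) (trans e (sym (cong σ (right y))))))) (right y)))
    (λ h → Inj⇒isPerm λ e → injective (isPerm⇒Inj h e))
    where open Perm p

  isPerm-∘ˡ : ∀ {d} (σ : Map d) {π : Map d} → Perm π → isPerm (π ∘ σ) ≡ isPerm σ
  isPerm-∘ˡ σ {π} p = ⇔→≡
    (λ h → Inj⇒isPerm λ e → isPerm⇒Inj h (cong π e))
    (λ h → Inj⇒isPerm λ e → isPerm⇒Inj h (injective e))
    where open Perm p

  sw : ∀ {d} → Fin d → Fin d → Map d
  sw x y z = if z == x then y else (if z == y then x else z)

  sw-l : ∀ {d} (x y : Fin d) → sw x y x ≡ y
  sw-l x y rewrite ==-refl x = refl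

  sw-r : ∀ {d} (x y : Fin d) → sw x y y ≡ x
  sw-r x y with y Finₚ.≟ x
  ... | yes e = e
  ... | no _ rewrite ==-refl y = refl

  sw-o : ∀ {d} {x y z : Fin d} → ¬ z ≡ x → ¬ z ≡ y → sw x y z ≡ z
  sw-o a b rewrite ≢⇒== a | ≢⇒== b = refl

  sw-rec : ∀ {d} (x y : Fin d) (P : Fin d → Fin d → Set) → P x y → P y x →
           (∀ z → ¬ z ≡ x → ¬ z ≡ y → P z z) → ∀ z → P z (sw x y z)
  sw-rec x y P a b c z with z Finₚ.≟ x
  ... | yes refl = a
  ... | no p with z Finₚ.≟ y
  ...   | yes refl = b
  ...   | no q = c z p q

  sw-inv : ∀ {d} (x y z : Fin d) → sw x y (sw x y z) ≡ z
  sw-inv x y = sw-rec x y (λ z w → sw x y w ≡ z) (sw-r x y) (sw-l x y) (λ z → sw-o)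

  sw-sym : ∀ {d} (x y z : Fin d) → sw x y z ≡ sw y x z
  sw-sym x y = sw-rec x y (λ z w → w ≡ sw y x z) (sym (sw-r y x)) (sym (sw-l y x)) (λ z p q → sym (sw-o q p))

  sw-refl : ∀ {d} (x z : Fin d) → sw x x z ≡ z
  sw-refl x = sw-rec x x (λ z w → w ≡ z) refl refl (λ _ _ _ → refl)

  sw-perm : ∀ {d} (x y : Fin d) → Perm (sw x y)
  sw-perm x y = record { inv = sw x y ; right = sw-inv x y ; left = sw-inv x y }

  sw-conj : ∀ {n m} {π : Fin n → Fin m} → Inj π → ∀ x y z → π (sw x y z) ≡ sw (π x) (π y) (π z)
  sw-conj {π = π} inj x y = sw-rec x y (λ z w → π w ≡ sw (π x) (π y) (π z))
    (sym (sw-l (π x) (π y))) (sym (sw-r (π x) (π y))) (λ z p q → sym (sw-o (p ∘ inj) (q ∘ inj)))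

  -- Two-transitivity of the symmetric group. The swap of `a` and `x` places `a`; the swap of `w`,
  -- the image of `b`, with `y` then places `b` and leaves `x` alone, since `x` differs from both.
  move-pair : ∀ {d} (a b x y : Fin d) → ¬ a ≡ b → ¬ x ≡ y → Σ[ π ∈ Map d ] Perm π × π a ≡ x × π b ≡ y
  move-pair a b x y a≢b x≢y = sw w y ∘ sw a x , perm-∘ (sw-perm w y) (sw-perm a x) ,
      trans (cong (sw w y) (sw-l a x)) (sw-o (λ r → a≢b (Perm.injective (sw-perm a x) (trans (sw-l a x) r))) x≢y) , sw-l w y
    where w = sw a x b

  -- Maps are coded by numbers, so that every function of codes respects pointwise equality.
  abstract
    #maps : ℕ → ℕ → ℕ
    #maps n m = m ℕ.^ n

    app : ∀ {n m} → Fin (#maps n m) → Fin n → Fin m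
    app = finToFun

    code : ∀ {n m} → (Fin n → Fin m) → Fin (#maps n m)
    code = funToFin

    app-code : ∀ {n m} (f : Fin n → Fin m) x → app (code f) x ≡ f x
    app-code = Finₚ.finToFun-funToFin

    code-app : ∀ {n m} (i : Fin (#maps n m)) → code (app {n} {m} i) ≡ i
    code-app {n} {m} = Finₚ.funToFin-finToFin {n} {m}

    code-cong : ∀ {n m} {f g : Fin n → Fin m} → (∀ x → f x ≡ g x) → code f ≡ code g
    code-cong {zero} h = refl
    code-cong {suc n} h = cong₂ combine (h zero) (code-cong (h ∘ suc))

  Ext : ∀ {n m} → ((Fin n → Fin m) → ℤ) → Set
  Ext F = ∀ {f g} → (∀ x → f x ≡ g x) → F f ≡ F g

  ∑ₘ : ∀ {n m} → ((Fin n → Fin m) → ℤ) → ℤ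
  ∑ₘ F = ∑ λ i → F (app i)

  ∑ₚ : ∀ {d} → (Map d → ℤ) → ℤ
  ∑ₚ F = ∑ₘ λ σ → 𝟙 (isPerm σ) * F σ

  ∑-split : ∀ m {n} (f : Fin (m ℕ.+ n) → ℤ) → ∑ f ≡ ∑ (λ i → f (i ↑ˡ n)) + ∑ (λ j → f (m ↑ʳ j))
  ∑-split zero f = sym (trans (cong (_+ ∑ f) (∑-empty _)) (ℤₚ.+-identityˡ _))
  ∑-split (suc m) {n} f = trans (∑-suc f) (trans (cong (_+_ (f zero)) (∑-split m (f ∘ suc)))
    (trans (sym (ℤₚ.+-assoc (f zero) _ _)) (cong (_+ ∑ (λ j → f (suc m ↑ʳ j))) (sym (∑-suc (λ i → f (i ↑ˡ n)))))))

  ∑-combine : ∀ m n (f : Fin (m ℕ.* n) → ℤ) → ∑ f ≡ ∑ (λ a → ∑ λ i → f (combine {m} {n} a i))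
  ∑-combine zero n f = trans (∑-empty f) (sym (∑-empty _))
  ∑-combine (suc m) n f = trans (∑-split n f)
    (trans (cong (_+_ (∑ λ i → f (i ↑ˡ (m ℕ.* n)))) (∑-combine m n (λ j → f (n ↑ʳ j)))) (sym (∑-suc _)))

  infixr 5 _∷ᶠ_
  _∷ᶠ_ : ∀ {n m} → Fin m → (Fin n → Fin m) → Fin (suc n) → Fin m
  (a ∷ᶠ f) zero = a
  (a ∷ᶠ f) (suc i) = f i

  abstract
    ∑ₘ-suc : ∀ {n m} (F : (Fin (suc n) → Fin m) → ℤ) → Ext F → ∑ₘ F ≡ ∑ λ a → ∑ₘ λ f → F (a ∷ᶠ f)
    ∑ₘ-suc {n} {m} F ext = trans (∑-combine m (m ℕ.^ n) (λ i → F (app i)))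
      (∑-cong λ a → ∑-cong λ i → ext λ { zero → cong proj₁ (Finₚ.remQuot-combine {m} a i)
                                       ; (suc x) → cong (λ r → app {n} {m} (proj₂ r) x) (Finₚ.remQuot-combine {m} a i) })

    ∑ₘ-zero : ∀ {m} (F : (Fin 0 → Fin m) → ℤ) → Ext F → ∀ f → ∑ₘ F ≡ F f
    ∑ₘ-zero F ext f = trans (∑-suc {0} (λ i → F (app i))) (trans (cong₂ _+_ (ext λ ()) (∑-empty (λ i → F (app (suc i))))) (ℤₚ.+-identityʳ (F f)))

  -- Passes from the list enumeration in the definitions to sums over codes, which can be reindexed
  -- by bijections.
  allMaps-sum : ∀ n m (F : (Fin n → Fin m) → ℤ) → Ext F → ∑ᴸ (allMaps n m) F ≡ ∑ₘ F
  allMaps-sum zero m F ext = trans (ℤₚ.+-identityʳ _) (sym (∑ₘ-zero F ext _))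
  allMaps-sum (suc n) m F ext = begin
    ∑ᴸ (allMaps (suc n) m) F ≡⟨ ∑ᴸ-concatMap _ (allMaps n m) F ⟩
    ∑ᴸ (allMaps n m) (λ f → ∑ᴸ (List.map _ (List.allFin m)) F)
      ≡⟨ ∑ᴸ-cong (allMaps n m) (λ f → trans (∑ᴸ-map _ (List.allFin m) F) (trans (∑ᴸ-allFin m _)
           (∑-cong λ a → ext {g = a ∷ᶠ f} λ { zero → refl ; (suc i) → refl }))) ⟩
    ∑ᴸ (allMaps n m) (λ f → ∑ λ a → F (a ∷ᶠ f)) ≡⟨ ∑ᴸ-∑ (allMaps n m) (λ f a → F (a ∷ᶠ f)) ⟩
    ∑ (λ a → ∑ᴸ (allMaps n m) λ f → F (a ∷ᶠ f))
      ≡⟨ ∑-cong (λ a → allMaps-sum n m (λ f → F (a ∷ᶠ f)) (λ h → ext λ { zero → refl ; (suc i) → h i })) ⟩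
    ∑ (λ a → ∑ₘ λ f → F (a ∷ᶠ f)) ≡⟨ sym (∑ₘ-suc F ext) ⟩
    ∑ₘ F ∎

  perms-sum : ∀ d (F : Map d → ℤ) → Ext F → ∑ᴸ (perms d) F ≡ ∑ₚ F
  perms-sum d F ext = trans (∑ᴸ-filter isPerm (allMaps d d) F)
    (allMaps-sum d d _ (λ h → cong₂ (λ b z → 𝟙 b * z) (isPerm-cong h) (ext h)))

  ∑ₘ-bij : ∀ {n m} (F : (Fin n → Fin m) → ℤ) → Ext F → (h h⁻ : (Fin n → Fin m) → Fin n → Fin m) →
           (∀ {f g} → (∀ x → f x ≡ g x) → ∀ x → h f x ≡ h g x) → (∀ {f g} → (∀ x → f x ≡ g x) → ∀ x → h⁻ f x ≡ h⁻ g x) →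
           (∀ f x → h (h⁻ f) x ≡ f x) → (∀ f x → h⁻ (h f) x ≡ f x) → ∑ₘ (F ∘ h) ≡ ∑ₘ F
  ∑ₘ-bij F ext h h⁻ c c⁻ r l = trans (∑-cong λ i → ext λ x → sym (app-code (h (app i)) x))
    (∑-bij (λ i → F (app i)) (λ i → code (h (app i))) (λ i → code (h⁻ (app i)))
      (λ i → trans (code-cong λ x → trans (c (app-code (h⁻ (app i))) x) (r (app i) x)) (code-app i))
      (λ i → trans (code-cong λ x → trans (c⁻ (app-code (h (app i))) x) (l (app i) x)) (code-app i)))

  ∑ₘ-∘ʳ : ∀ {n m} (F : (Fin n → Fin m) → ℤ) → Ext F → {π : Map n} → Perm π → ∑ₘ (λ f → F (f ∘ π)) ≡ ∑ₘ F
  ∑ₘ-∘ʳ F ext {π} p = ∑ₘ-bij F ext (_∘ π) (_∘ inv) (λ h x → h (π x)) (λ h x → h (inv x))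
    (λ f x → cong f (left x)) (λ f x → cong f (right x))
    where open Perm p

  ∑ₘ-∘ˡ : ∀ {n m} (F : (Fin n → Fin m) → ℤ) → Ext F → {π : Map m} → Perm π → ∑ₘ (λ f → F (π ∘ f)) ≡ ∑ₘ F
  ∑ₘ-∘ˡ F ext {π} p = ∑ₘ-bij F ext (π ∘_) (inv ∘_) (λ h x → cong π (h x)) (λ h x → cong inv (h x))
    (λ f x → right (f x)) (λ f x → left (f x))
    where open Perm p

  Ext-perm : ∀ {d} {F : Map d → ℤ} → Ext F → Ext (λ σ → 𝟙 (isPerm σ) * F σ)
  Ext-perm ext h = cong₂ (λ b z → 𝟙 b * z) (isPerm-cong h) (ext h)

  ∑ₚ-∘ˡ : ∀ {d} (F : Map d → ℤ) → Ext F → {π : Map d} → Perm π → ∑ₚ (λ f → F (π ∘ f)) ≡ ∑ₚ F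
  ∑ₚ-∘ˡ F ext {π} p = trans (∑-cong λ i → cong (λ b → 𝟙 b * F (π ∘ app i)) (sym (isPerm-∘ˡ (app i) p)))
    (∑ₘ-∘ˡ _ (Ext-perm ext) p)

  ∑ₚ-cong : ∀ {d} {F G : Map d → ℤ} → (∀ σ → Perm σ → F σ ≡ G σ) → ∑ₚ F ≡ ∑ₚ G
  ∑ₚ-cong {d} h = ∑-cong λ i → 𝟙-guard (isPerm {d} (app i)) (λ e → h (app i) (toPerm (isPerm⇒Inj e)))

  ∑ₘ-δ : ∀ {n m} (g : Fin n → Fin m) (F : (Fin n → Fin m) → ℤ) → Ext F → ∑ₘ (λ f → 𝟙 (eqM f g) * F f) ≡ F g
  ∑ₘ-δ g F ext = begin
    ∑ₘ (λ f → 𝟙 (eqM f g) * F f)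
      ≡⟨ ∑-cong (λ i → cong (λ b → 𝟙 b * F (app i)) (⇔→≡
           (λ e → ≡⇒== (trans (sym (code-app i)) (code-cong (eqM⇒ {f = app i} {g} e))))
           (λ e → ⇒eqM λ x → trans (cong (λ j → app j x) (==⇒≡ {x = i} {code g} e)) (app-code g x)))) ⟩
    ∑ (λ i → 𝟙 (i == code g) * F (app i)) ≡⟨ ∑-δ (code g) (λ i → F (app i)) ⟩
    F (app (code g)) ≡⟨ ext (app-code g) ⟩
    F g ∎

  -- Block transpositions acting on colourings

  ≡ᵇ⇒≡ : ∀ {m n} → (m ≡ᵇ n) ≡ true → m ≡ n
  ≡ᵇ⇒≡ {m} {n} h = ℕₚ.≡ᵇ⇒≡ m n (subst True (sym h) tt)

  ≡ᵇ-refl : ∀ n → (n ≡ᵇ n) ≡ true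
  ≡ᵇ-refl zero = refl
  ≡ᵇ-refl (suc n) = ≡ᵇ-refl n

  ≡⇒≡ᵇ : ∀ {m n} → m ≡ n → (m ≡ᵇ n) ≡ true
  ≡⇒≡ᵇ {m} refl = ≡ᵇ-refl m

  ≡ᵇ-sym : ∀ m n → (m ≡ᵇ n) ≡ (n ≡ᵇ m)
  ≡ᵇ-sym m n = ⇔→≡ (λ e → ≡⇒≡ᵇ (sym (≡ᵇ⇒≡ {m} e))) (λ e → ≡⇒≡ᵇ (sym (≡ᵇ⇒≡ {n} e)))

  <⇒lt : ∀ {n} {x y : Fin n} → toℕ x ℕ.< toℕ y → lt x y ≡ true
  <⇒lt {x = x} {y} h = go (lt x y) (ℕₚ.<⇒<ᵇ h)
    where
    go : ∀ b → True b → b ≡ true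
    go true _ = refl

  lt⇒< : ∀ {n} {x y : Fin n} → lt x y ≡ true → toℕ x ℕ.< toℕ y
  lt⇒< {x = x} {y} h = ℕₚ.<ᵇ⇒< (toℕ x) (toℕ y) (subst True (sym h) tt)

  ∑₂-sym : ∀ {n} (φ : Fin n → Fin n → ℤ) →
           ∑ (λ x → ∑ (φ x)) ≡ ∑₂ (λ x y → φ x y + φ y x) + ∑ (λ x → φ x x)
  ∑₂-sym φ = ℤₚ.*-cancelˡ-≡ (+ 2) _ _ (begin
    + 2 * S ≡⟨ alg₁ S ⟩
    S + S ≡⟨ cong (_+_ S) (∑-comm φ) ⟩
    S + ∑ (λ x → ∑ λ y → φ y x) ≡⟨ sym (∑∑-+ φ (λ x y → φ y x)) ⟩
    ∑ (λ x → ∑ λ y → φ x y + φ y x) ≡⟨ ∑₂-double (λ x y → φ x y + φ y x) (λ x y → ℤₚ.+-comm (φ x y) (φ y x)) ⟩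
    + 2 * P + ∑ (λ x → φ x x + φ x x) ≡⟨ cong (_+_ (+ 2 * P)) (∑-+ (λ x → φ x x) (λ x → φ x x)) ⟩
    + 2 * P + (∑ (λ x → φ x x) + ∑ (λ x → φ x x)) ≡⟨ alg₂ P (∑ (λ x → φ x x)) ⟩
    + 2 * (P + ∑ (λ x → φ x x)) ∎)
    where
    S = ∑ (λ x → ∑ (φ x))
    P = ∑₂ (λ x y → φ x y + φ y x)
    alg₁ : ∀ s → + 2 * s ≡ s + s
    alg₁ = solve-∀
    alg₂ : ∀ p q → + 2 * p + (q + q) ≡ + 2 * (p + q)
    alg₂ = solve-∀

  count-lt : ∀ {n} (q : Fin n) → ∑ (λ p → 𝟙 (lt p q)) ≡ + toℕ q
  count-lt {suc n} zero = ∑-zero λ p → refl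
  count-lt {suc n} (suc q) = trans (∑-suc (λ p → 𝟙 (lt p (suc q)))) (cong (_+_ 1ℤ) (count-lt q))

  module _ {d : ℕ} where

    V : Set
    V = Vect (#maps d d)

    same : (Fin d → ℕ) → Fin d → Fin d → Bool
    same ℓ x y = ℓ x ≡ᵇ ℓ y

    same-sym : ∀ ℓ x y → same ℓ x y ≡ same ℓ y x
    same-sym ℓ x y = ≡ᵇ-sym (ℓ x) (ℓ y)

    sw-label : ∀ (ℓ : Fin d → ℕ) {x y} → ℓ x ≡ ℓ y → ∀ z → ℓ (sw x y z) ≡ ℓ z
    sw-label ℓ {x} {y} e = sw-rec x y (λ z w → ℓ w ≡ ℓ z) (sym e) e (λ _ _ _ → refl)

    -- Right multiplication by the sum of the transpositions inside the blocks of ℓ.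
    T : (Fin d → ℕ) → V → V
    T ℓ f i = ∑₂ λ x y → 𝟙 (same ℓ x y) * f (code (app i ∘ sw x y))

    lin-T : ∀ ℓ → Lin (T ℓ)
    lin-T ℓ = lin-∑ λ x → lin-∑ λ y → lin-* (λ _ → 𝟙 (lt x y)) (lin-* (λ _ → 𝟙 (same ℓ x y)) (lin-pull λ i → code (app i ∘ sw x y)))

    T-at : ∀ ℓ f c → T ℓ f (code c) ≡ ∑₂ λ x y → 𝟙 (same ℓ x y) * f (code (c ∘ sw x y))
    T-at ℓ f c = ∑₂-cong λ x y _ → cong (λ i → 𝟙 (same ℓ x y) * f i) (code-cong λ z → app-code c (sw x y z))

    at-code : (P : Fin (#maps d d) → Set) → (∀ c → P (code c)) → ∀ i → P i
    at-code P h i = subst P (code-app i) (h (app i))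

    -- For a single block in which colour i, counted from 0, occurs λ_i times, this is Σ λ_i(λ_i -
    -- 1)/2 - Σ i λ_i. When λ is a partition, that is the sum of the contents of its Young diagram,
    -- the classical eigenvalue of the sum of all transpositions. Several blocks contribute
    -- additively.
    ct : (Fin d → ℕ) → Map d → ℤ
    ct ℓ c = ∑₂ (λ x y → 𝟙 (same ℓ x y) * 𝟙 (c x == c y)) - ∑ (λ x → + toℕ (c x))

    ct-ext : ∀ ℓ → Ext (ct ℓ)
    ct-ext ℓ h = cong₂ _-_ (∑₂-cong λ x y _ → cong₂ (λ a b → 𝟙 (same ℓ x y) * 𝟙 (a == b)) (h x) (h y))
                           (∑-cong λ x → cong (λ a → + toℕ a) (h x))

    ct-sw : ∀ ℓ c {x y} → ℓ x ≡ ℓ y → ct ℓ (c ∘ sw x y) ≡ ct ℓ c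
    ct-sw ℓ c {x} {y} e = cong₂ _-_
      (trans (∑₂-cong λ z w _ → cong₂ (λ a b → 𝟙 (a ≡ᵇ b) * 𝟙 (c (sw x y z) == c (sw x y w))) (sym (sw-label ℓ e z)) (sym (sw-label ℓ e w)))
        (∑₂-bij (λ z w → 𝟙 (same ℓ z w) * 𝟙 (c z == c w)) (λ z w → cong₂ (λ a b → 𝟙 a * 𝟙 b) (same-sym ℓ z w) (==-sym (c z) (c w))) (sw x y) (sw x y) (sw-inv x y) (sw-inv x y)))
      (∑-bij (λ z → + toℕ (c z)) (sw x y) (sw x y) (sw-inv x y) (sw-inv x y))

    upd : Map d → Fin d → Fin d → Map d
    upd c x j z = if z == x then j else c z

    -- The lowering operator replacing one entry q of the block b by p, in transposed form.
    R : (Fin d → ℕ) → ℕ → Fin d → Fin d → V → V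
    R ℓ b p q f i = ∑ λ x → 𝟙 (ℓ x ≡ᵇ b) * (𝟙 (app i x == p) * f (code (upd (app i) x q)))

    R-at : ∀ ℓ b p q f c → R ℓ b p q f (code c) ≡ ∑ λ x → 𝟙 (ℓ x ≡ᵇ b) * (𝟙 (c x == p) * f (code (upd c x q)))
    R-at ℓ b p q f c = ∑-cong λ x → cong₂ (λ a i → 𝟙 (ℓ x ≡ᵇ b) * (𝟙 (a == p) * f i)) (app-code c x)
      (code-cong λ z → cong (λ a → if z == x then q else a) (app-code c z))

    lin-R : ∀ ℓ b p q → Lin (R ℓ b p q)
    lin-R ℓ b p q = lin-∑ λ x → lin-* (λ _ → 𝟙 (ℓ x ≡ᵇ b)) (lin-* (λ i → 𝟙 (app i x == p)) (lin-pull λ i → code (upd (app i) x q)))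

    sw-== : ∀ (x y z w : Fin d) → (z == sw x y w) ≡ (sw x y z == w)
    sw-== x y z w = ⇔→≡ (λ e → ≡⇒== (trans (cong (sw x y) (==⇒≡ e)) (sw-inv x y w)))
                         (λ e → ≡⇒== (trans (sym (sw-inv x y z)) (cong (sw x y) (==⇒≡ e))))

    -- `R` sums over all points of the block `b`, and a transposition inside a block maps every
    -- block to itself, so passing it through `R` merely reindexes that sum.
    R-T : ∀ ℓ b p q f i → R ℓ b p q (T ℓ f) i ≡ T ℓ (R ℓ b p q f) i
    R-T ℓ b p q f = at-code _ λ c → begin
      R ℓ b p q (T ℓ f) (code c)
        ≡⟨ R-at ℓ b p q (T ℓ f) c ⟩
      ∑ (λ z → 𝟙 (ℓ z ≡ᵇ b) * (𝟙 (c z == p) * T ℓ f (code (upd c z q))))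
        ≡⟨ ∑-cong (λ z → trans (cong (λ t → 𝟙 (ℓ z ≡ᵇ b) * (𝟙 (c z == p) * t)) (T-at ℓ f (upd c z q)))
             (trans (sym (ℤₚ.*-assoc (𝟙 (ℓ z ≡ᵇ b)) (𝟙 (c z == p)) _))
               (trans (sym (∑₂-*ˡ (𝟙 (ℓ z ≡ᵇ b) * 𝟙 (c z == p)) (λ x y → 𝟙 (same ℓ x y) * f (code (upd c z q ∘ sw x y)))))
                 (∑₂-cong λ x y _ → alg (𝟙 (ℓ z ≡ᵇ b)) (𝟙 (c z == p)) (𝟙 (same ℓ x y)) (f (code (upd c z q ∘ sw x y))))))) ⟩
      ∑ (λ z → ∑₂ λ x y → 𝟙 (same ℓ x y) * g c x y z)
        ≡⟨ sym (∑₂-∑ (λ x y z → 𝟙 (same ℓ x y) * g c x y z)) ⟩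
      ∑₂ (λ x y → ∑ λ z → 𝟙 (same ℓ x y) * g c x y z)
        ≡⟨ ∑₂-cong (λ x y _ → trans (∑-*ˡ (𝟙 (same ℓ x y)) (g c x y)) (𝟙-guard (same ℓ x y) λ e → move c x y (≡ᵇ⇒≡ {ℓ x} e))) ⟩
      ∑₂ (λ x y → 𝟙 (same ℓ x y) * R ℓ b p q f (code (c ∘ sw x y)))
        ≡⟨ sym (T-at ℓ (R ℓ b p q f) c) ⟩
      T ℓ (R ℓ b p q f) (code c) ∎
      where
      alg : ∀ a b c d → a * b * (c * d) ≡ c * (a * (b * d))
      alg = solve-∀
      g : Map d → Fin d → Fin d → Fin d → ℤ
      g c x y z = 𝟙 (ℓ z ≡ᵇ b) * (𝟙 (c z == p) * f (code (upd c z q ∘ sw x y)))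
      move : ∀ c x y → ℓ x ≡ ℓ y → ∑ (g c x y) ≡ R ℓ b p q f (code (c ∘ sw x y))
      move c x y e = trans (trans (∑-cong λ z → cong₂ (λ m h → 𝟙 (m ≡ᵇ b) * h) (sym (sw-label ℓ e z))
          (cong₂ (λ m h → 𝟙 (m == p) * f h) (cong c (sym (sw-inv x y z)))
            (code-cong λ w → cong (λ t → if t then q else c (sw x y w)) (sym (sw-== x y w z)))))
        (∑-bij (λ z → 𝟙 (ℓ z ≡ᵇ b) * (𝟙 (c (sw x y z) == p) * f (code (upd (c ∘ sw x y) z q)))) (sw x y) (sw x y) (sw-inv x y) (sw-inv x y)))
        (sym (R-at ℓ b p q f (c ∘ sw x y)))

    R-annih : ∀ ℓ b p q js f i → R ℓ b p q (annih (T ℓ) js f) i ≡ annih (T ℓ) js (R ℓ b p q f) i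
    R-annih ℓ b p q [] f i = refl
    R-annih ℓ b p q (j ∷ js) f i = trans (Lin.ap-- r (T ℓ h) (λ i → j * h i) i) (cong₂ _-_
        (trans (R-T ℓ b p q h i) (Lin.ap-cong (lin-T ℓ) (R-annih ℓ b p q js f) i))
        (trans (Lin.ap-* r j h i) (cong (j *_) (R-annih ℓ b p q js f i))))
      where r = lin-R ℓ b p q
            h = annih (T ℓ) js f

    Prim : (Fin d → ℕ) → V → Set
    Prim ℓ f = ∀ b p q → lt p q ≡ true → ∀ i → R ℓ b p q f i ≡ 0ℤ

    -- On primitive functions the Casimir operator Σ_x Σ_{p < c x} vanishes, which evaluates T.
    prim-eigen : ∀ ℓ f → Prim ℓ f → ∀ c → T ℓ f (code c) ≡ ct ℓ c * f (code c)
    prim-eigen ℓ f prim c = begin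
      T ℓ f (code c)
        ≡⟨ T-at ℓ f c ⟩
      ∑₂ (λ x y → 𝟙 (same ℓ x y) * f (code (c ∘ sw x y)))
        ≡⟨ ∑₂-cong (λ x y _ → split x y) ⟩
      ∑₂ (λ x y → 𝟙 (same ℓ x y) * 𝟙 (c x == c y) * f (code c) + (φ x y + φ y x))
        ≡⟨ ∑₂-+ (λ x y → 𝟙 (same ℓ x y) * 𝟙 (c x == c y) * f (code c)) (λ x y → φ x y + φ y x) ⟩
      ∑₂ (λ x y → 𝟙 (same ℓ x y) * 𝟙 (c x == c y) * f (code c)) + ∑₂ (λ x y → φ x y + φ y x)
        ≡⟨ cong₂ _+_ (∑₂-*ʳ (f (code c)) (λ x y → 𝟙 (same ℓ x y) * 𝟙 (c x == c y))) off ⟩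
      P * f (code c) + - (W * f (code c))
        ≡⟨ alg P W (f (code c)) ⟩
      ct ℓ c * f (code c) ∎
      where
      P = ∑₂ (λ x y → 𝟙 (same ℓ x y) * 𝟙 (c x == c y))
      W = ∑ (λ x → + toℕ (c x))
      alg : ∀ p w f → p * f + - (w * f) ≡ (p - w) * f
      alg = solve-∀
      -- A swap of two points of equal colour fixes `c` and goes into the main term. A pair of
      -- different colours is recorded by `φ`, with the point of larger colour as first argument.
      φ : Fin d → Fin d → ℤ
      φ x y = 𝟙 (lt (c y) (c x)) * (𝟙 (same ℓ y x) * f (code (c ∘ sw x y)))
      sw≈ : ∀ x y → c x ≡ c y → ∀ z → c (sw x y z) ≡ c z
      sw≈ x y e = sw-rec x y (λ z w → c w ≡ c z) (sym e) e (λ _ _ _ → refl)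
      split : ∀ x y → 𝟙 (same ℓ x y) * f (code (c ∘ sw x y)) ≡ 𝟙 (same ℓ x y) * 𝟙 (c x == c y) * f (code c) + (φ x y + φ y x)
      split x y = begin
        s * F ≡⟨ sym (ℤₚ.*-identityˡ (s * F)) ⟩
        1ℤ * (s * F) ≡⟨ cong (_* (s * F)) (lt-trich (c x) (c y)) ⟩
        (𝟙 (lt (c x) (c y)) + 𝟙 (lt (c y) (c x)) + 𝟙 (c x == c y)) * (s * F)
          ≡⟨ alg′ (𝟙 (lt (c x) (c y))) (𝟙 (lt (c y) (c x))) (𝟙 (c x == c y)) s F ⟩
        s * (𝟙 (c x == c y) * F) + (𝟙 (lt (c y) (c x)) * (s * F) + 𝟙 (lt (c x) (c y)) * (s * F))
          ≡⟨ cong₂ _+_ (trans (cong (s *_) (𝟙-guard (c x == c y) λ e → cong f (code-cong (sw≈ x y (==⇒≡ e))))) (sym (ℤₚ.*-assoc s (𝟙 (c x == c y)) (f (code c)))))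
               (cong₂ _+_ (cong (λ b → 𝟙 (lt (c y) (c x)) * (𝟙 b * F)) (same-sym ℓ x y))
                          (cong (λ i → 𝟙 (lt (c x) (c y)) * (s * f i)) (code-cong λ z → cong c (sw-sym x y z)))) ⟩
        s * 𝟙 (c x == c y) * f (code c) + (φ x y + φ y x) ∎
        where
        s = 𝟙 (same ℓ x y)
        F = f (code (c ∘ sw x y))
        alg′ : ∀ a b e s f → (a + b + e) * (s * f) ≡ s * (e * f) + (b * (s * f) + a * (s * f))
        alg′ = solve-∀
      ltirr : ∀ {n} (x : Fin n) → lt x x ≡ false
      ltirr zero = refl
      ltirr (suc x) = ltirr x
      -- Lower the colour of `x` to `p`, then let `R` raise a point `y` of the same block from `p`
      -- to the old colour of `x`. The choice `y = x` restores `c`; any other `y` of colour `p`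
      -- produces `c` with `x` and `y` exchanged.
      inner : ∀ x p → 𝟙 (lt p (c x)) * R ℓ (ℓ x) p (c x) f (code (upd c x p)) ≡
              𝟙 (lt p (c x)) * f (code c) + ∑ (λ y → 𝟙 (c y == p) * φ x y)
      inner x p = begin
        𝟙 (lt p (c x)) * R ℓ (ℓ x) p (c x) f (code (upd c x p))
          ≡⟨ cong (𝟙 (lt p (c x)) *_) (trans (R-at ℓ (ℓ x) p (c x) f (upd c x p))
               (trans (∑-cong λ y → term y (y Finₚ.≟ x)) (trans (∑-+ (λ y → 𝟙 (y == x) * f (code c)) (λ y → 𝟙 (not (y == x)) * (𝟙 (c y == p) * (𝟙 (same ℓ y x) * f (code (c ∘ sw x y))))))
                 (cong (_+ ∑ λ y → 𝟙 (not (y == x)) * (𝟙 (c y == p) * (𝟙 (same ℓ y x) * f (code (c ∘ sw x y))))) (∑-δ x (λ _ → f (code c))))))) ⟩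
        𝟙 (lt p (c x)) * (f (code c) + ∑ λ y → 𝟙 (not (y == x)) * (𝟙 (c y == p) * (𝟙 (same ℓ y x) * f (code (c ∘ sw x y)))))
          ≡⟨ trans (ℤₚ.*-distribˡ-+ (𝟙 (lt p (c x))) (f (code c)) _) (cong (_+_ (𝟙 (lt p (c x)) * f (code c)))
               (trans (sym (∑-*ˡ (𝟙 (lt p (c x))) (λ y → 𝟙 (not (y == x)) * (𝟙 (c y == p) * (𝟙 (same ℓ y x) * f (code (c ∘ sw x y)))))))
                  (∑-cong λ y → off-diag y (y Finₚ.≟ x) (c y Finₚ.≟ p)))) ⟩
        𝟙 (lt p (c x)) * f (code c) + ∑ (λ y → 𝟙 (c y == p) * φ x y) ∎
        where
        off-diag : ∀ y → Dec (y ≡ x) → Dec (c y ≡ p) → 𝟙 (lt p (c x)) * (𝟙 (not (y == x)) * (𝟙 (c y == p) * (𝟙 (same ℓ y x) * f (code (c ∘ sw x y))))) ≡ 𝟙 (c y == p) * φ x y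
        off-diag y _ (no n) rewrite ≢⇒== n = trans (cong (𝟙 (lt p (c x)) *_) (ℤₚ.*-zeroʳ (𝟙 (not (y == x))))) (ℤₚ.*-zeroʳ (𝟙 (lt p (c x))))
        off-diag y (yes refl) (yes refl) rewrite ltirr (c x) | ==-refl (c x) = refl
        off-diag y (no n) (yes refl) rewrite ≢⇒== n | ==-refl (c y) = alg″ (𝟙 (lt (c y) (c x))) (𝟙 (same ℓ y x) * f (code (c ∘ sw x y)))
          where alg″ : ∀ a b → a * (1ℤ * (1ℤ * b)) ≡ 1ℤ * (a * b)
                alg″ = solve-∀
        term : ∀ y → Dec (y ≡ x) → 𝟙 (ℓ y ≡ᵇ ℓ x) * (𝟙 (upd c x p y == p) * f (code (upd (upd c x p) y (c x)))) ≡
               𝟙 (y == x) * f (code c) + 𝟙 (not (y == x)) * (𝟙 (c y == p) * (𝟙 (same ℓ y x) * f (code (c ∘ sw x y))))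
        term y (yes refl) rewrite ≡ᵇ-refl (ℓ x) | ==-refl x | ==-refl p = trans (cong (λ i → 1ℤ * (1ℤ * f i)) (code-cong restore)) (alg″ (f (code c)))
          where
          restore : ∀ z → upd (upd c x p) x (c x) z ≡ c z
          restore z with z Finₚ.≟ x
          ... | yes refl = refl
          ... | no _ = refl
          alg″ : ∀ f → 1ℤ * (1ℤ * f) ≡ 1ℤ * f + 0ℤ
          alg″ = solve-∀
        term y (no n) rewrite ≢⇒== n = (trans (alg″ (𝟙 (same ℓ y x)) (𝟙 (c y == p)) (f (code (upd (upd c x p) y (c x))))) (cong (λ t → 0ℤ + 1ℤ * t)
            (𝟙-guard (c y == p) λ e → cong (λ i → 𝟙 (same ℓ y x) * f i) (code-cong (swapped (==⇒≡ e))))))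
          where
          alg″ : ∀ a b f → a * (b * f) ≡ 0ℤ + 1ℤ * (b * (a * f))
          alg″ = solve-∀
          swapped : c y ≡ p → ∀ z → upd (upd c x p) y (c x) z ≡ c (sw x y z)
          swapped e z with z Finₚ.≟ y | z Finₚ.≟ x
          ... | yes refl | yes e′ = ⊥-elim (n e′)
          ... | yes refl | no _ = refl
          ... | no _ | yes refl = sym e
          ... | no _ | no _ = refl
      off : ∑₂ (λ x y → φ x y + φ y x) ≡ - (W * f (code c))
      off = begin
        ∑₂ (λ x y → φ x y + φ y x)
          ≡⟨ sym (trans (∑₂-sym φ) (trans (cong (_+_ (∑₂ λ x y → φ x y + φ y x)) (∑-zero λ x → cong (λ b → 𝟙 b * (𝟙 (same ℓ x x) * f (code (c ∘ sw x x)))) (ltirr (c x)))) (ℤₚ.+-identityʳ _))) ⟩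
        ∑ (λ x → ∑ (φ x))
          ≡⟨ negate (∑ (λ x → ∑ (φ x))) (W * f (code c)) total ⟩
        - (W * f (code c)) ∎
        where
        negate : ∀ a b → b + a ≡ 0ℤ → a ≡ - b
        negate a b h = trans (alg₃ a b) (trans (cong (_- b) h) (ℤₚ.+-identityˡ (- b)))
          where alg₃ : ∀ a b → a ≡ (b + a) - b
                alg₃ = solve-∀
        total : W * f (code c) + ∑ (λ x → ∑ (φ x)) ≡ 0ℤ
        total = begin
          W * f (code c) + ∑ (λ x → ∑ (φ x))
            ≡⟨ cong (_+ ∑ (λ x → ∑ (φ x))) (sym (∑-*ʳ (f (code c)) (λ x → + toℕ (c x)))) ⟩
          ∑ (λ x → + toℕ (c x) * f (code c)) + ∑ (λ x → ∑ (φ x))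
            ≡⟨ sym (∑-+ (λ x → + toℕ (c x) * f (code c)) (λ x → ∑ (φ x))) ⟩
          ∑ (λ x → + toℕ (c x) * f (code c) + ∑ (φ x))
            ≡⟨ ∑-cong (λ x → sym (cong₂ _+_ (trans (∑-*ʳ (f (code c)) (λ p → 𝟙 (lt p (c x)))) (cong (_* f (code c)) (count-lt (c x))))
                 (trans (∑-comm λ p y → 𝟙 (c y == p) * φ x y) (∑-cong λ y → ∑-δ′ (c y) (λ _ → φ x y))))) ⟩
          ∑ (λ x → ∑ (λ p → 𝟙 (lt p (c x)) * f (code c)) + ∑ (λ p → ∑ λ y → 𝟙 (c y == p) * φ x y))
            ≡⟨ ∑-cong (λ x → sym (∑-+ (λ p → 𝟙 (lt p (c x)) * f (code c)) (λ p → ∑ λ y → 𝟙 (c y == p) * φ x y))) ⟩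
          ∑ (λ x → ∑ λ p → 𝟙 (lt p (c x)) * f (code c) + ∑ (λ y → 𝟙 (c y == p) * φ x y))
            ≡⟨ ∑-cong (λ x → ∑-cong λ p → sym (inner x p)) ⟩
          ∑ (λ x → ∑ λ p → 𝟙 (lt p (c x)) * R ℓ (ℓ x) p (c x) f (code (upd c x p)))
            ≡⟨ ∑-zero (λ x → ∑-zero λ p → trans (𝟙-guard (lt p (c x)) (λ e → prim (ℓ x) p (c x) e (code (upd c x p)))) (ℤₚ.*-zeroʳ (𝟙 (lt p (c x))))) ⟩
          0ℤ ∎

    -- `ct ℓ` does not change along block transpositions (`ct-sw`), so a primitive function
    -- multiplied by a function of `ct ℓ` is again scaled pointwise by `ct ℓ` under `T ℓ`. The
    -- factors therefore act one after the other as numbers.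
    prim-annih : ∀ ℓ f → Prim ℓ f → ∀ js i → annih (T ℓ) js f i ≡ roots js (ct ℓ (app i)) * f i
    prim-annih ℓ f prim [] i = sym (ℤₚ.*-identityˡ (f i))
    prim-annih ℓ f prim (j ∷ js) = at-code _ λ c → begin
      T ℓ h (code c) - j * h (code c)
        ≡⟨ cong₂ (λ a b → a - j * b) (step c) (trans (prim-annih ℓ f prim js (code c)) (cong (λ k → roots js k * f (code c)) (ct-ext ℓ (app-code c)))) ⟩
      roots js (ct ℓ c) * (ct ℓ c * f (code c)) - j * (roots js (ct ℓ c) * f (code c))
        ≡⟨ alg (roots js (ct ℓ c)) (ct ℓ c) j (f (code c)) ⟩
      roots (j ∷ js) (ct ℓ c) * f (code c)
        ≡⟨ cong (λ k → roots (j ∷ js) k * f (code c)) (sym (ct-ext ℓ (app-code c))) ⟩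
      roots (j ∷ js) (ct ℓ (app (code c))) * f (code c) ∎
      where
      h = annih (T ℓ) js f
      alg : ∀ r k j f → r * (k * f) - j * (r * f) ≡ (k - j) * r * f
      alg = solve-∀
      alg₂ : ∀ a b c → a * (b * c) ≡ b * (a * c)
      alg₂ = solve-∀
      step : ∀ c → T ℓ h (code c) ≡ roots js (ct ℓ c) * (ct ℓ c * f (code c))
      step c = begin
        T ℓ h (code c) ≡⟨ T-at ℓ h c ⟩
        ∑₂ (λ x y → 𝟙 (same ℓ x y) * h (code (c ∘ sw x y)))
          ≡⟨ ∑₂-cong (λ x y _ → trans (𝟙-guard (same ℓ x y) λ e → trans (prim-annih ℓ f prim js (code (c ∘ sw x y)))
               (cong (λ k → roots js k * f (code (c ∘ sw x y))) (trans (ct-ext ℓ (app-code (c ∘ sw x y))) (ct-sw ℓ c (≡ᵇ⇒≡ {ℓ x} e)))))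
               (alg₂ (𝟙 (same ℓ x y)) (roots js (ct ℓ c)) (f (code (c ∘ sw x y))))) ⟩
        ∑₂ (λ x y → roots js (ct ℓ c) * (𝟙 (same ℓ x y) * f (code (c ∘ sw x y))))
          ≡⟨ ∑₂-*ˡ (roots js (ct ℓ c)) (λ x y → 𝟙 (same ℓ x y) * f (code (c ∘ sw x y))) ⟩
        roots js (ct ℓ c) * ∑₂ (λ x y → 𝟙 (same ℓ x y) * f (code (c ∘ sw x y)))
          ≡⟨ cong (roots js (ct ℓ c) *_) (trans (sym (T-at ℓ f c)) (prim-eigen ℓ f prim c)) ⟩
        roots js (ct ℓ c) * (ct ℓ c * f (code c)) ∎

    roots-∈ : ∀ {x js} → x ∈ js → roots js x ≡ 0ℤ
    roots-∈ {x} {j ∷ js} (here refl) = cong (_* roots js x) (ℤₚ.+-inverseʳ x)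
    roots-∈ {x} {j ∷ js} (there p) = trans (cong ((x - j) *_) (roots-∈ p)) (ℤₚ.*-zeroʳ (x - j))

    contents : (Fin d → ℕ) → List ℤ
    contents ℓ = List.map (λ i → ct ℓ (app i)) (List.allFin (#maps d d))

    prim-kill : ∀ ℓ f → Prim ℓ f → ∀ i → annih (T ℓ) (contents ℓ) f i ≡ 0ℤ
    prim-kill ℓ f prim i = trans (prim-annih ℓ f prim (contents ℓ) i)
      (cong (_* f i) (roots-∈ (∈-map⁺ (λ i → ct ℓ (app i)) (∈-allFin i))))

    -- Annihilation of all functions by induction on the total colour.

    wt : Map d → ℤ
    wt c = ∑ λ x → + toℕ (c x)

    wt-upd : ∀ c x q → wt (upd c x q) ≡ wt c + (+ toℕ q - + toℕ (c x))
    wt-upd c x q = trans (∑-cong λ z → go z (z Finₚ.≟ x)) (trans (∑-+ (λ z → + toℕ (c z)) (λ z → 𝟙 (z == x) * (+ toℕ q - + toℕ (c z))))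
        (cong (_+_ (wt c)) (∑-δ x (λ z → + toℕ q - + toℕ (c z)))))
      where
      alg : ∀ a b → a ≡ b + 1ℤ * (a - b)
      alg = solve-∀
      go : ∀ z → Dec (z ≡ x) → + toℕ (upd c x q z) ≡ + toℕ (c z) + 𝟙 (z == x) * (+ toℕ q - + toℕ (c z))
      go z (yes refl) rewrite ==-refl x = alg (+ toℕ q) (+ toℕ (c x))
      go z (no n) rewrite ≢⇒== n = sym (ℤₚ.+-identityʳ _)

    Supp : ℕ → V → Set
    Supp s f = ∀ c → + s < wt c → f (code c) ≡ 0ℤ

    -- `R` evaluates `f` at colourings in which one colour has risen from `p` to a larger `q`, so
    -- the bound on the support drops by at least one. Writing the new bound as `+ s < 1ℤ + wt c`
    -- avoids a predecessor of 0.
    supp-R : ∀ ℓ b p q f s → lt p q ≡ true → Supp s f → ∀ c → + s < 1ℤ + wt c → R ℓ b p q f (code c) ≡ 0ℤ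
    supp-R ℓ b p q f s pq supp c h = trans (R-at ℓ b p q f c) (∑-zero λ x →
        trans (cong (𝟙 (ℓ x ≡ᵇ b) *_) (trans (𝟙-guard (c x == p) (λ e → supp (upd c x q) (bound x (==⇒≡ e)))) (ℤₚ.*-zeroʳ (𝟙 (c x == p))))) (ℤₚ.*-zeroʳ (𝟙 (ℓ x ≡ᵇ b))))
      where
      bound : ∀ x → c x ≡ p → + s < wt (upd c x q)
      bound x refl = ℤₚ.<-≤-trans h (subst (_≤_ (1ℤ + wt c)) (sym (wt-upd c x q))
        (subst (_≤ wt c + (+ toℕ q - + toℕ (c x))) (ℤₚ.+-comm (wt c) 1ℤ) (ℤₚ.+-monoʳ-≤ (wt c)
          (subst₂ _≤_ (alg (+ toℕ (c x))) refl (ℤₚ.+-monoˡ-≤ (- (+ toℕ (c x))) (+≤+ (lt⇒< {x = p} {q} pq)))))))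
        where alg : ∀ a → (1ℤ + a) - a ≡ 1ℤ
              alg = solve-∀

    -- One copy of `contents ℓ` for each of the possible weights 0, ..., `s`, since every descent by
    -- lowering operators uses up one copy.
    factors : (Fin d → ℕ) → ℕ → List ℤ
    factors ℓ zero = contents ℓ
    factors ℓ (suc s) = contents ℓ ++ factors ℓ s

    annih-++ : ∀ (U : V → V) → Lin U → ∀ ks js f i → annih U (ks ++ js) f i ≡ annih U ks (annih U js f) i
    annih-++ U l [] js f i = refl
    annih-++ U l (k ∷ ks) js f i = cong₂ (λ a b → a - k * b) (Lin.ap-cong l (annih-++ U l ks js f) i) (annih-++ U l ks js f i)

    -- Every `R` commutes with the factors and shrinks the support, so by induction the factors for
    -- `s` leave a function that all lowering operators kill, and one more copy of `contents ℓ`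
    -- kills that. For `s = 0` a lowered function has no room left and `f` is primitive from the
    -- start.
    supp-kill : ∀ ℓ s f → Supp s f → ∀ i → annih (T ℓ) (factors ℓ s) f i ≡ 0ℤ
    supp-kill ℓ zero f supp = prim-kill ℓ f λ b p q pq → at-code _ λ c →
      supp-R ℓ b p q f 0 pq supp c (ℤₚ.<-≤-trans (+<+ (s≤s z≤n)) (ℤₚ.+-monoʳ-≤ 1ℤ (∑-nonneg λ x → +≤+ z≤n)))
    supp-kill ℓ (suc s) f supp i = trans (annih-++ (T ℓ) (lin-T ℓ) (contents ℓ) (factors ℓ s) f i)
      (prim-kill ℓ (annih (T ℓ) (factors ℓ s) f) (λ b p q pq j → trans (R-annih ℓ b p q (factors ℓ s) f j)
        (supp-kill ℓ s (R ℓ b p q f) (λ c h → supp-R ℓ b p q f (suc s) pq supp c (ℤₚ.+-monoʳ-< 1ℤ h)) j)) i)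

    all-factors : ∀ ℓ s → All (λ k → ∃[ c ] k ≡ ct ℓ c) (factors ℓ s)
    all-factors ℓ zero = Allₚ.map⁺ (All.universal (λ i → app i , refl) _)
    all-factors ℓ (suc s) = Allₚ.++⁺ (Allₚ.map⁺ (All.universal (λ i → app i , refl) _)) (all-factors ℓ s)

    -- There are `d` points with colours below `d`, so no weight exceeds `d ℕ.* d` and the support
    -- condition holds vacuously for every function.
    T-annihilated : ∀ ℓ f i → annih (T ℓ) (factors ℓ (d ℕ.* d)) f i ≡ 0ℤ
    T-annihilated ℓ f = supp-kill ℓ (d ℕ.* d) f λ c h → ⊥-elim (ℤₚ.<-irrefl refl (ℤₚ.<-≤-trans h
      (subst (wt c ≤_) (trans (∑-const (+ d)) (sym (ℤₚ.pos-* d d))) (∑-mono λ x → +≤+ (ℕₚ.<⇒≤ (Finₚ.toℕ<n (c x)))))))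

    -- The number of words of n transpositions inside the blocks of ℓ whose product is inverse to σ.
    cw : (Fin d → ℕ) → ℕ → Map d → ℤ
    cw ℓ zero σ = 𝟙 (isId σ)
    cw ℓ (suc n) σ = ∑₂ λ x y → 𝟙 (same ℓ x y) * cw ℓ n (σ ∘ sw x y)

    cw-ext : ∀ ℓ n → Ext (cw ℓ n)
    cw-ext ℓ zero h = cong 𝟙 (isId-cong h)
    cw-ext ℓ (suc n) h = ∑₂-cong λ x y _ → cong (𝟙 (same ℓ x y) *_) (cw-ext ℓ n (λ z → h (sw x y z)))

    cw-conj : ∀ ℓ n σ {π} (P : Perm π) → cw ℓ n (π ∘ σ ∘ Perm.inv P) ≡ cw (ℓ ∘ π) n σ
    cw-conj ℓ zero σ {π} P = cong 𝟙 (⇔→≡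
        (λ e → ⇒isId λ x → injective (trans (cong (π ∘ σ) (sym (left x))) (isId⇒ e (π x))))
        (λ e → ⇒isId λ x → trans (cong π (isId⇒ {σ = σ} e (inv x))) (right x)))
      where open Perm P
    cw-conj ℓ (suc n) σ {π} P = trans (sym (∑₂-bij (λ x y → 𝟙 (same ℓ x y) * cw ℓ n (π ∘ σ ∘ inv ∘ sw x y))
          (λ x y → cong₂ (λ a b → 𝟙 a * b) (same-sym ℓ x y) (cw-ext ℓ n λ z → cong (π ∘ σ ∘ inv) (sw-sym x y z))) π inv right left))
        (∑₂-cong λ x y _ → cong (𝟙 (same ℓ (π x) (π y)) *_) (trans
          (cw-ext ℓ n λ z → cong (π ∘ σ) (injective (trans (right (sw (π x) (π y) z)) (trans (cong (sw (π x) (π y)) (sym (right z)))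
             (sym (sw-conj injective x y (inv z)))))))
          (cw-conj ℓ n (σ ∘ sw x y) P)))
      where open Perm P

    -- The number d!, kept as a sum: it meets itself when a class sum is matched with the spectral
    -- expansion, and it cancels against orders of stabilisers in the leading coefficients.
    #perms : ℤ
    #perms = ∑ₚ {d} (λ _ → 1ℤ)

    -- Every injective colouring contributes the same number `cw ℓ n σ` to the trace, whence the
    -- factor `#perms`. Since σ preserves the blocks, conjugation by it permutes the block
    -- transpositions, so precomposition with σ commutes with `T ℓ`.
    spectral : ∀ ℓ σ → Perm σ → (∀ x → ℓ (σ x) ≡ ℓ x) →
      ∃[ es ] (All (λ tk → ∃[ c ] proj₂ tk ≡ ct ℓ c) es × (∀ n → #perms * cw ℓ n σ ≡ eval es n))
    spectral ℓ σ P inv-ℓ = proj₁ te , All.map (All.lookup (all-factors ℓ (d ℕ.* d))) (proj₁ (proj₂ te)) ,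
        λ n → trans (sym (tr n)) (proj₂ (proj₂ te) n)
      where
      open Perm P
      A : V → V
      A f i = 𝟙 (isPerm (app i)) * f (code (app i ∘ σ))
      lA : Lin A
      lA = lin-* (λ i → 𝟙 (isPerm {d} (app i))) (lin-pull λ i → code (app i ∘ σ))
      A-at : ∀ f c → A f (code c) ≡ 𝟙 (isPerm c) * f (code (c ∘ σ))
      A-at f c = cong₂ (λ b i → 𝟙 b * f i) (isPerm-cong (app-code c)) (code-cong λ x → app-code c (σ x))
      alg : ∀ a b c → a * (b * c) ≡ b * (a * c)
      alg = solve-∀
      comm : ∀ f i → A (T ℓ f) i ≡ T ℓ (A f) i
      comm f = at-code _ λ c → begin
        A (T ℓ f) (code c) ≡⟨ trans (A-at (T ℓ f) c) (cong (𝟙 (isPerm c) *_) (T-at ℓ f (c ∘ σ))) ⟩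
        𝟙 (isPerm c) * ∑₂ (λ x y → 𝟙 (same ℓ x y) * f (code (c ∘ σ ∘ sw x y)))
          ≡⟨ cong (𝟙 (isPerm c) *_) (∑₂-cong λ x y _ → cong₂ (λ a i → 𝟙 a * f i) (cong₂ _≡ᵇ_ (sym (inv-ℓ x)) (sym (inv-ℓ y)))
               (code-cong λ z → cong c (sw-conj injective x y z))) ⟩
        𝟙 (isPerm c) * ∑₂ (λ x y → φ c (σ x) (σ y))
          ≡⟨ cong (𝟙 (isPerm c) *_) (∑₂-bij (φ c) (λ x y → cong₂ (λ a i → 𝟙 a * f i) (same-sym ℓ x y) (code-cong λ z → cong c (sw-sym x y (σ z)))) σ inv right left) ⟩
        𝟙 (isPerm c) * ∑₂ (φ c)
          ≡⟨ sym (∑₂-*ˡ (𝟙 (isPerm c)) (φ c)) ⟩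
        ∑₂ (λ x y → 𝟙 (isPerm c) * φ c x y)
          ≡⟨ ∑₂-cong (λ x y _ → trans (alg (𝟙 (isPerm c)) (𝟙 (same ℓ x y)) (f (code (c ∘ sw x y ∘ σ))))
               (cong (𝟙 (same ℓ x y) *_) (sym (trans (A-at f (c ∘ sw x y)) (cong (λ b → 𝟙 b * f (code (c ∘ sw x y ∘ σ))) (isPerm-∘ʳ c (sw-perm x y))))))) ⟩
        ∑₂ (λ x y → 𝟙 (same ℓ x y) * A f (code (c ∘ sw x y)))
          ≡⟨ sym (T-at ℓ (A f) c) ⟩
        T ℓ (A f) (code c) ∎
        where
        φ : Map d → Fin d → Fin d → ℤ
        φ c x y = 𝟙 (same ℓ x y) * f (code (c ∘ sw x y ∘ σ))
      te = trace-exp (factors ℓ (d ℕ.* d)) lA (lin-T ℓ) comm (λ f → T-annihilated ℓ (A f))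
      -- An injective colouring identifies the colourings `app i ∘ ρ` with the maps `ρ`, so the
      -- recursion of powers of `T ℓ` starting from `δ i` becomes the recursion of `cw`.
      orbit : ∀ n i → Inj (app i) → ∀ ρ → pow (T ℓ) n (δ i) (code (app i ∘ ρ)) ≡ cw ℓ n ρ
      orbit zero i inj ρ = cong 𝟙 (⇔→≡
        (λ e → ⇒isId λ x → inj (trans (sym (app-code (app i ∘ ρ) x)) (cong (λ j → app j x) (sym (==⇒≡ {x = i} e)))))
        (λ e → ≡⇒== (trans (sym (code-app i)) (code-cong λ x → cong (app i) (sym (isId⇒ {σ = ρ} e x))))))
      orbit (suc n) i inj ρ = trans (T-at ℓ (pow (T ℓ) n (δ i)) (app i ∘ ρ))
        (∑₂-cong λ x y _ → cong (𝟙 (same ℓ x y) *_) (orbit n i inj (ρ ∘ sw x y)))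
      tr : ∀ n → Tr (λ f → A (pow (T ℓ) n f)) ≡ #perms * cw ℓ n σ
      tr n = trans (∑-cong λ i → trans (𝟙-guard (isPerm {d} (app i)) (λ e → orbit n i (isPerm⇒Inj e) σ))
          (cong (_* cw ℓ n σ) (sym (ℤₚ.*-identityʳ (𝟙 (isPerm {d} (app i)))))))
        (∑-*ʳ (cw ℓ n σ) (λ i → 𝟙 (isPerm {d} (app i)) * 1ℤ))

  -- The leading eigenvalue

  ∑ᴱ : ∀ {n} → (Fin n → Exp) → Exp
  ∑ᴱ f = List.concatMap f (List.allFin _)

  eval-∑ᴱ : ∀ {n} (f : Fin n → Exp) k → eval (∑ᴱ f) k ≡ ∑ (λ x → eval (f x) k)
  eval-∑ᴱ {n} f k = trans (∑ᴸ-concatMap f (List.allFin n) (λ (t , κ) → t * κ ^ k)) (∑ᴸ-allFin n (λ x → eval (f x) k))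

  coef-∑ᴱ : ∀ {n} (f : Fin n → Exp) k → coef (∑ᴱ f) k ≡ ∑ (λ x → coef (f x) k)
  coef-∑ᴱ {n} f k = trans (∑ᴸ-concatMap f (List.allFin n) (λ (t , κ) → 𝟙 (κ ==ᶻ k) * t)) (∑ᴸ-allFin n (λ x → coef (f x) k))

  square≥0 : ∀ x → 0ℤ ≤ x * x
  square≥0 (+ n) = subst (0ℤ ≤_) (ℤₚ.pos-* n n) (+≤+ z≤n)
  square≥0 -[1+ n ] = +≤+ z≤n

  *-cancel : ∀ n a b → ¬ n ≡ 0ℤ → n * a ≡ n * b → a ≡ b
  *-cancel n a b n≢0 e with ℤₚ.i*j≡0⇒i≡0∨j≡0 n {a - b} (trans (lem n a b) (trans (cong (_- n * b) e) (ℤₚ.+-inverseʳ (n * b))))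
    where lem : ∀ n a b → n * (a - b) ≡ n * a - n * b
          lem = solve-∀
  ... | inj₁ z = ⊥-elim (n≢0 z)
  ... | inj₂ z = minus-zero z

  module _ {d : ℕ} where

    preserves : (Fin d → ℕ) → Map d → Bool
    preserves ℓ σ = allF λ x → ℓ (σ x) ≡ᵇ ℓ x

    preserves⇒ : ∀ ℓ σ → preserves ℓ σ ≡ true → ∀ x → ℓ (σ x) ≡ ℓ x
    preserves⇒ ℓ σ h x = ≡ᵇ⇒≡ {ℓ (σ x)} (allF⇒ h x)

    ⇒preserves : ∀ ℓ σ → (∀ x → ℓ (σ x) ≡ ℓ x) → preserves ℓ σ ≡ true
    ⇒preserves ℓ σ h = ⇒allF λ x → ≡⇒≡ᵇ (h x)

    preserves-cong : ∀ ℓ {σ τ} → (∀ x → σ x ≡ τ x) → preserves ℓ σ ≡ preserves ℓ τ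
    preserves-cong ℓ h = allF-cong λ x → cong (λ a → ℓ a ≡ᵇ ℓ x) (h x)

    st : (Fin d → ℕ) → Map d → Bool
    st ℓ σ = isPerm σ ∧ preserves ℓ σ

    st-sw : ∀ ℓ σ {x y} → ℓ x ≡ ℓ y → st ℓ (σ ∘ sw x y) ≡ st ℓ σ
    st-sw ℓ σ {x} {y} e = cong₂ _∧_ (isPerm-∘ʳ σ (sw-perm x y)) (⇔→≡
      (λ h → ⇒preserves ℓ σ λ z → trans (cong (ℓ ∘ σ) (sym (sw-inv x y z))) (trans (preserves⇒ ℓ (σ ∘ sw x y) h (sw x y z)) (sw-label ℓ e z)))
      (λ h → ⇒preserves ℓ (σ ∘ sw x y) λ z → trans (preserves⇒ ℓ σ h (sw x y z)) (sw-label ℓ e z)))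

    cw-zero : ∀ ℓ n σ → st ℓ σ ≡ false → cw ℓ n σ ≡ 0ℤ
    cw-zero ℓ zero σ h = go (isId σ) refl
      where
      go : ∀ b → isId σ ≡ b → 𝟙 b ≡ 0ℤ
      go false _ = refl
      go true e = ⊥-elim (false≢true (trans (sym h) (∧-intro
        (Inj⇒isPerm λ {x} {y} q → trans (sym (isId⇒ {σ = σ} e x)) (trans q (isId⇒ {σ = σ} e y))) (⇒preserves ℓ σ λ x → cong ℓ (isId⇒ {σ = σ} e x)))))
    cw-zero ℓ (suc n) σ h = ∑₂-zero λ x y _ → trans (𝟙-guard (same ℓ x y) (λ e →
        cw-zero ℓ n (σ ∘ sw x y) (trans (st-sw ℓ σ (≡ᵇ⇒≡ {ℓ x} e)) h))) (ℤₚ.*-zeroʳ (𝟙 (same ℓ x y)))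

    HasExp : (Fin d → ℕ) → Map d → Set
    HasExp ℓ σ = Σ[ es ∈ Exp ] (All (λ tk → Σ[ c ∈ Map d ] proj₂ tk ≡ ct {d} ℓ c) es × (∀ n → #perms {d} * cw {d} ℓ n σ ≡ eval es n))

    abstract
      -- Outside the stabiliser of the blocks all counts vanish, so the empty exponential sum serves
      -- there. Being total in σ, the coefficients can be summed over all maps.
      spectral′ : ∀ ℓ σ → HasExp ℓ σ
      spectral′ ℓ σ = go (st ℓ σ) refl
        where
        go : ∀ b → st ℓ σ ≡ b → HasExp ℓ σ
        go true e = spectral ℓ σ (toPerm (isPerm⇒Inj {σ = σ} (proj₁ (∧-true {isPerm σ} e)))) (preserves⇒ ℓ σ (proj₂ (∧-true {isPerm σ} e)))
        go false e = [] , [] , λ n → trans (cong (#perms {d} *_) (cw-zero ℓ n σ e)) (ℤₚ.*-zeroʳ (#perms {d}))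

    #perms≢0 : ¬ #perms {d} ≡ 0ℤ
    #perms≢0 e = absurd (trans (cong (λ b → 𝟙 b * 1ℤ) (sym (Inj⇒isPerm {d} {app (code id)} λ {x} {y} h → trans (sym (app-code id x)) (trans h (app-code id y)))))
        (∑-nonneg-zero (λ i → subst (0ℤ ≤_) (sym (ℤₚ.*-identityʳ (𝟙 (isPerm {d} (app i))))) (𝟙≥0 (isPerm {d} (app i)))) e (code id)))
      where absurd : ¬ 1ℤ * 1ℤ ≡ 0ℤ
            absurd ()

    module _ (ℓ : Fin d → ℕ) where

      N : ℤ
      N = #perms {d}

      es : Map d → Exp
      es σ = proj₁ (spectral′ ℓ σ)

      es-eval : ∀ σ n → N * cw ℓ n σ ≡ eval (es σ) n
      es-eval σ = proj₂ (proj₂ (spectral′ ℓ σ))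

      -- The degree of the Cayley graph generated by the block transpositions, and its largest
      -- eigenvalue. A function with this eigenvalue is harmonic, which is what pins down `h`.
      K : ℤ
      K = ∑₂ λ x y → 𝟙 (same ℓ x y)

      h : Map d → ℤ
      h σ = coef (es σ) K

      h-ext : Ext h
      h-ext {σ} {τ} e = coef-unique (es σ) (es τ) (λ n → trans (sym (es-eval σ n)) (trans (cong (N *_) (cw-ext ℓ n e)) (es-eval τ n))) K

      h-zero : ∀ σ → st ℓ σ ≡ false → h σ ≡ 0ℤ
      h-zero σ e = coef-zero (es σ) (λ n → trans (sym (es-eval σ n)) (trans (cong (N *_) (cw-zero ℓ n σ e)) (ℤₚ.*-zeroʳ N))) K

      -- This is the recursion of `cw` in `n`, compared at the key `K`: raising `n` by one
      -- multiplies the coefficient at a key by that key.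
      h-eigen : ∀ σ → ∑₂ (λ x y → 𝟙 (same ℓ x y) * h (σ ∘ sw x y)) ≡ K * h σ
      h-eigen σ = trans (sym cf) (trans (coef-unique all (mulKey (es σ)) agree K) (coef-mulKey (es σ) K))
        where
        g : Fin d → Fin d → Exp
        g x y = scale (𝟙 (lt x y)) (scale (𝟙 (same ℓ x y)) (es (σ ∘ sw x y)))
        all = ∑ᴱ λ x → ∑ᴱ (g x)
        cf : coef all K ≡ ∑₂ (λ x y → 𝟙 (same ℓ x y) * h (σ ∘ sw x y))
        cf = trans (coef-∑ᴱ (λ x → ∑ᴱ (g x)) K) (∑-cong λ x → trans (coef-∑ᴱ (g x) K) (∑-cong λ y →
          trans (coef-scale (𝟙 (lt x y)) (scale (𝟙 (same ℓ x y)) (es (σ ∘ sw x y))) K) (cong (𝟙 (lt x y) *_) (coef-scale (𝟙 (same ℓ x y)) (es (σ ∘ sw x y)) K))))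
        alg : ∀ a b c → a * (b * c) ≡ b * (a * c)
        alg = solve-∀
        agree : ∀ n → eval all n ≡ eval (mulKey (es σ)) n
        agree n = begin
          eval all n ≡⟨ trans (eval-∑ᴱ (λ x → ∑ᴱ (g x)) n) (∑-cong λ x → trans (eval-∑ᴱ (g x) n) (∑-cong λ y →
            trans (eval-scale (𝟙 (lt x y)) (scale (𝟙 (same ℓ x y)) (es (σ ∘ sw x y))) n) (cong (𝟙 (lt x y) *_) (eval-scale (𝟙 (same ℓ x y)) (es (σ ∘ sw x y)) n)))) ⟩
          ∑₂ (λ x y → 𝟙 (same ℓ x y) * eval (es (σ ∘ sw x y)) n)
            ≡⟨ ∑₂-cong (λ x y _ → trans (cong (𝟙 (same ℓ x y) *_) (sym (es-eval (σ ∘ sw x y) n))) (alg (𝟙 (same ℓ x y)) N (cw ℓ n (σ ∘ sw x y)))) ⟩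
          ∑₂ (λ x y → N * (𝟙 (same ℓ x y) * cw ℓ n (σ ∘ sw x y)))
            ≡⟨ ∑₂-*ˡ N (λ x y → 𝟙 (same ℓ x y) * cw ℓ n (σ ∘ sw x y)) ⟩
          N * cw ℓ (suc n) σ ≡⟨ trans (es-eval σ (suc n)) (sym (eval-mulKey (es σ) n)) ⟩
          eval (mulKey (es σ)) n ∎

      sum-sw : ∀ (F : Map d → ℤ) → Ext F → ∑ₘ (λ σ → ∑₂ λ x y → 𝟙 (same ℓ x y) * F (σ ∘ sw x y)) ≡ K * ∑ₘ F
      sum-sw F ext = begin
        ∑ₘ (λ σ → ∑₂ λ x y → 𝟙 (same ℓ x y) * F (σ ∘ sw x y))
          ≡⟨ sym (∑₂-∑ (λ x y i → 𝟙 (same ℓ x y) * F (app i ∘ sw x y))) ⟩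
        ∑₂ (λ x y → ∑ₘ λ σ → 𝟙 (same ℓ x y) * F (σ ∘ sw x y))
          ≡⟨ ∑₂-cong (λ x y _ → trans (∑-*ˡ (𝟙 (same ℓ x y)) (λ i → F (app i ∘ sw x y))) (cong (𝟙 (same ℓ x y) *_) (∑ₘ-∘ʳ F ext (sw-perm x y)))) ⟩
        ∑₂ (λ x y → 𝟙 (same ℓ x y) * ∑ₘ F)
          ≡⟨ ∑₂-*ʳ (∑ₘ F) (λ x y → 𝟙 (same ℓ x y)) ⟩
        K * ∑ₘ F ∎

      cw-total : ∀ n → ∑ₘ (cw ℓ n) ≡ K ^ n
      cw-total zero = trans (∑-cong λ i → sym (ℤₚ.*-identityʳ (𝟙 (isId {d} (app i))))) (∑ₘ-δ {d} {d} id (λ _ → 1ℤ) (λ _ → refl))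
      cw-total (suc n) = trans (sum-sw (cw ℓ n) (cw-ext ℓ n)) (cong (K *_) (cw-total n))

      -- All words together number `K ^ n`, a single exponential; this normalises the harmonic
      -- function.
      h-total : ∑ₘ h ≡ N
      h-total = trans (sym (coef-∑ᴱ (λ i → es (app i)) K)) (trans (coef-unique (∑ᴱ λ i → es (app i)) ((N , K) ∷ []) agree K)
          (trans (ℤₚ.+-identityʳ _) (trans (cong (λ b → 𝟙 b * N) (==ᶻ-refl K)) (ℤₚ.*-identityˡ N))))
        where
        agree : ∀ n → eval (∑ᴱ λ i → es (app i)) n ≡ N * K ^ n + 0ℤ
        agree n = trans (eval-∑ᴱ (λ i → es (app i)) n) (trans (∑-cong λ i → sym (es-eval (app i) n)) (trans (∑-*ˡ N (λ i → cw ℓ n (app i)))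
          (trans (cong (N *_) (cw-total n)) (sym (ℤₚ.+-identityʳ _)))))

      -- The Dirichlet form of h is K Σh² - 2K Σh² + K Σh² = 0.
      dirichlet : ∑ₘ (λ σ → ∑₂ λ x y → 𝟙 (same ℓ x y) * ((h (σ ∘ sw x y) - h σ) * (h (σ ∘ sw x y) - h σ))) ≡ 0ℤ
      dirichlet = begin
        ∑ₘ (λ σ → ∑₂ λ x y → 𝟙 (same ℓ x y) * ((h (σ ∘ sw x y) - h σ) * (h (σ ∘ sw x y) - h σ)))
          ≡⟨ ∑-cong (λ i → expand (app i)) ⟩
        ∑ₘ (λ σ → ∑₂ (λ x y → 𝟙 (same ℓ x y) * (h (σ ∘ sw x y) * h (σ ∘ sw x y))) - K * (h σ * h σ))
          ≡⟨ ∑-- (λ i → ∑₂ (λ x y → 𝟙 (same ℓ x y) * (h (app i ∘ sw x y) * h (app i ∘ sw x y)))) (λ i → K * (h (app i) * h (app i))) ⟩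
        ∑ₘ (λ σ → ∑₂ (λ x y → 𝟙 (same ℓ x y) * (h (σ ∘ sw x y) * h (σ ∘ sw x y)))) - ∑ₘ (λ σ → K * (h σ * h σ))
          ≡⟨ cong₂ _-_ (sum-sw (λ σ → h σ * h σ) (λ e → cong₂ _*_ (h-ext e) (h-ext e))) (∑-*ˡ K (λ i → h (app i) * h (app i))) ⟩
        K * ∑ₘ (λ σ → h σ * h σ) - K * ∑ₘ (λ σ → h σ * h σ)
          ≡⟨ ℤₚ.+-inverseʳ (K * ∑ₘ (λ σ → h σ * h σ)) ⟩
        0ℤ ∎
        where
        alg : ∀ s a b → s * ((a - b) * (a - b)) ≡ (s * (a * a) + (- (+ 2) * b) * (s * a)) + s * (b * b)
        alg = solve-∀
        alg₂ : ∀ q k b → q + (- (+ 2) * b) * (k * b) + k * (b * b) ≡ q - k * (b * b)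
        alg₂ = solve-∀
        expand : ∀ σ → ∑₂ (λ x y → 𝟙 (same ℓ x y) * ((h (σ ∘ sw x y) - h σ) * (h (σ ∘ sw x y) - h σ))) ≡
                 ∑₂ (λ x y → 𝟙 (same ℓ x y) * (h (σ ∘ sw x y) * h (σ ∘ sw x y))) - K * (h σ * h σ)
        expand σ = begin
          _ ≡⟨ ∑₂-cong (λ x y _ → alg (𝟙 (same ℓ x y)) (h (σ ∘ sw x y)) (h σ)) ⟩
          ∑₂ (λ x y → (sq x y + (- (+ 2) * h σ) * cr x y) + 𝟙 (same ℓ x y) * (h σ * h σ))
            ≡⟨ trans (∑₂-+ (λ x y → sq x y + (- (+ 2) * h σ) * cr x y) (λ x y → 𝟙 (same ℓ x y) * (h σ * h σ)))
                 (cong₂ _+_ (trans (∑₂-+ sq (λ x y → (- (+ 2) * h σ) * cr x y)) (cong (_+_ (∑₂ sq)) (trans (∑₂-*ˡ (- (+ 2) * h σ) cr) (cong (λ t → (- (+ 2) * h σ) * t) (h-eigen σ)))))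
                   (∑₂-*ʳ (h σ * h σ) (λ x y → 𝟙 (same ℓ x y)))) ⟩
          ∑₂ sq + (- (+ 2) * h σ) * (K * h σ) + K * (h σ * h σ) ≡⟨ alg₂ (∑₂ sq) K (h σ) ⟩
          ∑₂ sq - K * (h σ * h σ) ∎
          where
          sq cr : Fin d → Fin d → ℤ
          sq x y = 𝟙 (same ℓ x y) * (h (σ ∘ sw x y) * h (σ ∘ sw x y))
          cr x y = 𝟙 (same ℓ x y) * h (σ ∘ sw x y)

      sq-zero : ∀ z → 1ℤ * (1ℤ * (z * z)) ≡ 0ℤ → z ≡ 0ℤ
      sq-zero z q with ℤₚ.i*j≡0⇒i≡0∨j≡0 z {z} (trans (sym (trans (ℤₚ.*-identityˡ (1ℤ * (z * z))) (ℤₚ.*-identityˡ (z * z)))) q)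
      ... | inj₁ r = r
      ... | inj₂ r = r
      nn : ∀ a b z → 0ℤ ≤ 𝟙 a * (𝟙 b * (z * z))
      nn false b z = ℤₚ.≤-refl
      nn true false z = ℤₚ.≤-refl
      nn true true z = subst (0ℤ ≤_) (sym (trans (ℤₚ.*-identityˡ (1ℤ * (z * z))) (ℤₚ.*-identityˡ (z * z)))) (square≥0 z)
      h-sw< : ∀ σ x y → lt x y ≡ true → ℓ x ≡ ℓ y → h (σ ∘ sw x y) ≡ h σ
      h-sw< σ x y p e = trans (h-ext λ z → sym (app-code σ (sw x y z))) (trans (minus-zero (sq-zero (D c x y) (trans (cong₂ (λ a b → 𝟙 a * (𝟙 b * (D c x y * D c x y))) (sym p) (sym (≡⇒≡ᵇ e)))
          (∑-nonneg-zero (λ y → nn (lt x y) (same ℓ x y) (D c x y))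
            (∑-nonneg-zero (λ x → ∑-nonneg λ y → nn (lt x y) (same ℓ x y) (D c x y))
              (∑-nonneg-zero (λ i → ∑-nonneg λ x → ∑-nonneg λ y → nn (lt x y) (same ℓ x y) (D (app i) x y)) dirichlet (code σ)) x) y)))) (h-ext (app-code σ)))
        where
        c = app (code σ)
        D : Map d → Fin d → Fin d → ℤ
        D σ x y = h (σ ∘ sw x y) - h σ

      h-sw : ∀ σ x y → ℓ x ≡ ℓ y → h (σ ∘ sw x y) ≡ h σ
      h-sw σ x y e with Finₚ.<-cmp x y
      ... | tri< p _ _ = h-sw< σ x y (<⇒lt p) e
      ... | tri≈ _ refl _ = h-ext λ z → cong σ (sw-refl x z)
      ... | tri> _ _ q = trans (h-ext λ z → cong σ (sw-sym x y z)) (h-sw< σ y x (<⇒lt q) (sym e))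

      -- Connectedness of the Cayley graph on the stabiliser. If σ fixes all points above the point
      -- number `m`, then composing it with the swap of that point and its preimage, which share a
      -- block, makes that point fixed too, and `h` is unchanged by the swap.
      h-const : ∀ m σ → st ℓ σ ≡ true → (∀ x → m ℕ.≤ toℕ x → σ x ≡ x) → h σ ≡ h id
      h-const zero σ s fix = h-ext λ x → fix x z≤n
      h-const (suc m) σ s fix with m ℕₚ.<? d
      ... | no m≮d = h-const m σ s (λ x m≤x → ⊥-elim (m≮d (ℕₚ.≤-<-trans m≤x (Finₚ.toℕ<n x))))
      ... | yes m<d = trans (sym (h-sw σ x y ℓxy)) (h-const m (σ ∘ sw x y) (trans (st-sw ℓ σ ℓxy) s) fix′)
        where
        open Perm (toPerm (isPerm⇒Inj {σ = σ} (proj₁ (∧-true {isPerm σ} s))))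
        x y : Fin d
        x = fromℕ< m<d
        y = inv x
        ℓxy : ℓ x ≡ ℓ y
        ℓxy = trans (cong ℓ (sym (right x))) (preserves⇒ ℓ σ (proj₂ (∧-true {isPerm σ} s)) y)
        fix′ : ∀ z → m ℕ.≤ toℕ z → σ (sw x y z) ≡ z
        fix′ z m≤z with z Finₚ.≟ x
        ... | yes refl = right x
        ... | no z≢x with z Finₚ.≟ y
        ...   | yes refl = ⊥-elim (z≢x (trans (sym (fix y above)) (right x)))
          where above = ℕₚ.≤∧≢⇒< m≤z (λ e → z≢x (Finₚ.toℕ-injective (trans (sym e) (sym (Finₚ.toℕ-fromℕ< m<d)))))
        ...   | no _ = fix z (ℕₚ.≤∧≢⇒< m≤z (λ e → z≢x (Finₚ.toℕ-injective (trans (sym e) (sym (Finₚ.toℕ-fromℕ< m<d))))))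

      h-value : ∀ σ → h σ ≡ 𝟙 (st ℓ σ) * h id
      h-value σ = go (st ℓ σ) refl
        where
        go : ∀ b → st ℓ σ ≡ b → h σ ≡ 𝟙 b * h id
        go true e = trans (h-const d σ e (λ x d≤x → ⊥-elim (ℕₚ.<⇒≱ (Finₚ.toℕ<n x) d≤x))) (sym (ℤₚ.*-identityˡ (h id)))
        go false e = h-zero σ e

      h-id : ∑ₘ (λ σ → 𝟙 (st ℓ σ)) * h id ≡ N
      h-id = trans (sym (∑-*ʳ (h id) (λ i → 𝟙 (st ℓ (app i))))) (trans (∑-cong λ i → sym (h-value (app i))) h-total)

    top-coef : ∀ ℓ → (∀ x y → ℓ x ≡ ℓ y) → ∀ σ → Perm σ → h ℓ σ ≡ 1ℤ
    top-coef ℓ const σ P = trans (h-value ℓ σ) (trans (cong (λ b → 𝟙 b * h ℓ id) (stable σ (Inj⇒isPerm (Perm.injective P)))) (trans (ℤₚ.*-identityˡ (h ℓ id)) one))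
      where
      stable : ∀ σ → isPerm σ ≡ true → st ℓ σ ≡ true
      stable σ e = ∧-intro e (⇒preserves ℓ σ λ x → const (σ x) x)
      count : ∑ₘ (λ σ → 𝟙 (st ℓ σ)) ≡ N ℓ
      count = ∑-cong λ i → trans (cong 𝟙 (⇔→≡ (λ e → proj₁ (∧-true e)) (stable (app i)))) (sym (ℤₚ.*-identityʳ (𝟙 (isPerm {d} (app i)))))
      one : h ℓ id ≡ 1ℤ
      one = *-cancel (#perms {d}) (h ℓ id) 1ℤ #perms≢0
        (trans (cong (_* h ℓ id) (sym count)) (trans (h-id ℓ) (sym (ℤₚ.*-identityʳ (#perms {d})))))

    IsPoint : (Fin d → ℕ) → Fin d → Set
    IsPoint ℓ w = (∀ x → ℓ x ≡ ℓ w → x ≡ w) × (∀ x y → ¬ x ≡ w → ¬ y ≡ w → ℓ x ≡ ℓ y)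

    -- The stabiliser of such a partition consists of the permutations fixing `w` and has index `d`.
    -- By `h-id` the constant value of `h` on a stabiliser is its index.
    point-coef : ∀ ℓ w → IsPoint ℓ w → ∀ σ → Perm σ → h ℓ σ ≡ 𝟙 (σ w == w) * + d
    point-coef ℓ w (lone , rest) σ P = trans (h-value ℓ σ) (cong₂ (λ b t → 𝟙 b * t) (trans (st-char σ) (cong (_∧ (σ w == w)) (Inj⇒isPerm (Perm.injective P)))) value)
      where
      st-char : ∀ σ → st ℓ σ ≡ isPerm σ ∧ (σ w == w)
      st-char σ = ⇔→≡
        (λ e → ∧-intro (proj₁ (∧-true e)) (≡⇒== (lone (σ w) (preserves⇒ ℓ σ (proj₂ (∧-true {isPerm σ} e)) w))))
        (λ e → ∧-intro (proj₁ (∧-true e)) (⇒preserves ℓ σ λ x → go (isPerm⇒Inj {σ = σ} (proj₁ (∧-true {isPerm σ} e))) (==⇒≡ (proj₂ (∧-true {isPerm σ} e))) x (x Finₚ.≟ w)))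
        where
        go : Inj σ → σ w ≡ w → ∀ x → Dec (x ≡ w) → ℓ (σ x) ≡ ℓ x
        go inj e x (yes refl) = cong ℓ e
        go inj e x (no n) = rest (σ x) x (λ q → n (inj (trans q (sym e)))) n
      S : ℤ
      S = ∑ₘ (λ σ → 𝟙 (st ℓ σ))
      fibre : ∀ y → ∑ₚ {d} (λ σ → 𝟙 (σ w == y)) ≡ S
      fibre y = trans (sym (∑ₚ-∘ˡ (λ σ → 𝟙 (σ w == y)) (λ e → cong (λ a → 𝟙 (a == y)) (e w)) (sw-perm w y)))
        (∑-cong λ i → trans (cong (𝟙 (isPerm {d} (app i)) *_) (cong 𝟙 (trans (⇔→≡
            (λ e → ≡⇒== (trans (sym (sw-inv w y (app i w))) (trans (cong (sw w y) (==⇒≡ {x = sw w y (app i w)} e)) (sw-r w y))))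
            (λ e → ≡⇒== (trans (cong (sw w y) (==⇒≡ {x = app i w} e)) (sw-l w y)))) (refl {x = app i w == w}))))
          (trans (sym (𝟙-∧ (isPerm {d} (app i)) (app i w == w))) (cong 𝟙 (sym (st-char (app i))))))
      count : #perms {d} ≡ + d * S
      count = trans (∑-cong λ i → cong (𝟙 (isPerm {d} (app i)) *_) (sym (trans (∑-cong λ y → sym (ℤₚ.*-identityʳ (𝟙 (app i w == y)))) (∑-δ′ (app i w) (λ _ → 1ℤ)))))
        (trans (∑-cong λ i → sym (∑-*ˡ (𝟙 (isPerm {d} (app i))) (λ y → 𝟙 (app i w == y))))
          (trans (∑-comm λ i y → 𝟙 (isPerm {d} (app i)) * 𝟙 (app i w == y)) (trans (∑-cong fibre) (∑-const S))))
      value : h ℓ id ≡ + d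
      value = *-cancel S (h ℓ id) (+ d)
        (λ z → #perms≢0 (trans count (trans (cong (+ d *_) z) (ℤₚ.*-zeroʳ (+ d)))))
        (trans (h-id ℓ) (trans count (ℤₚ.*-comm (+ d) S)))

  -- Möbius inversion over set partitions

  Rel : ℕ → Set
  Rel d = Fin d → Fin d → Bool

  record Equiv {d} (q : Rel d) : Set where
    field
      rfl : ∀ x → q x x ≡ true
      symm : ∀ {x y} → q x y ≡ true → q y x ≡ true
      trns : ∀ {x y z} → q x y ≡ true → q y z ≡ true → q x z ≡ true

  total : ∀ {d} → Rel d → Bool
  total q = allF λ x → allF λ y → q x y

  total⇒ : ∀ {d} (q : Rel d) → total q ≡ true → ∀ x y → q x y ≡ true
  total⇒ q h x y = allF⇒ {p = q x} (allF⇒ {p = λ x → allF (q x)} h x) y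

  ⇒total : ∀ {d} (q : Rel d) → (∀ x y → q x y ≡ true) → total q ≡ true
  ⇒total q h = ⇒allF {p = λ x → allF (q x)} λ x → ⇒allF {p = q x} (h x)

  abstract
    refines : ∀ {d} → Rel d → (Fin d → ℕ) → Bool
    refines q ℓ = allF λ x → allF λ y → not (q x y) ∨ (ℓ x ≡ᵇ ℓ y)

    refines⇒ : ∀ {d} {q : Rel d} {ℓ} → refines q ℓ ≡ true → ∀ {x y} → q x y ≡ true → ℓ x ≡ ℓ y
    refines⇒ {q = q} {ℓ} h {x} {y} e with ∨-true {not (q x y)} (allF⇒ (allF⇒ h x) y)
    ... | inj₁ p rewrite e = ⊥-elim (false≢true p)
    ... | inj₂ p = ≡ᵇ⇒≡ {ℓ x} p

    ⇒refines : ∀ {d} {q : Rel d} {ℓ} → (∀ {x y} → q x y ≡ true → ℓ x ≡ ℓ y) → refines q ℓ ≡ true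
    ⇒refines {q = q} {ℓ} h = ⇒allF λ x → ⇒allF λ y → go (q x y) (λ e → ≡⇒≡ᵇ (h e))
      where
      go : ∀ b {c} → (b ≡ true → c ≡ true) → not b ∨ c ≡ true
      go true f = f refl
      go false f = refl

  Weighted : ℕ → Set
  Weighted d = List (ℤ × (Fin d → ℕ))

  weigh : ∀ {d} → Weighted d → ((Fin d → ℕ) → Bool) → ℤ
  weigh L p = ∑ᴸ L λ (w , ℓ) → w * 𝟙 (p ℓ)

  weigh-cong : ∀ {d} (L : Weighted d) {p p′ : (Fin d → ℕ) → Bool} → (∀ ℓ → p ℓ ≡ p′ ℓ) → weigh L p ≡ weigh L p′
  weigh-cong L h = ∑ᴸ-cong L λ (w , ℓ) → cong (λ b → w * 𝟙 b) (h ℓ)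

  -- Weights on set partitions (kernels of labelings) inverting summation over the coarsenings of an equivalence.
  Moebius : ∀ {d} → Weighted d → Set
  Moebius L = ∀ q → Equiv q → weigh L (refines q) ≡ 𝟙 (total q)

  -- The partitions of {0,…,n} with j blocks get the weight (-1)^(j-1) (j-1)!;
  -- a new element 0 either forms a block or joins one of the j old blocks.
  parts : ∀ n → List (Σ[ j ∈ ℕ ] ℤ × (Fin (suc n) → Fin j))
  parts zero = (1 , 1ℤ , λ _ → zero) ∷ []
  parts (suc n) = concatMap (λ (j , w , ℓ) → (suc j , (- (+ j)) * w , (zero ∷ᶠ (suc ∘ ℓ)))
                              ∷ List.map (λ b → j , w , (b ∷ᶠ ℓ)) (List.allFin j)) (parts n)

  labelings : ∀ d → Weighted d
  labelings zero = []
  labelings (suc n) = List.map (λ (j , w , ℓ) → w , toℕ ∘ ℓ) (parts n)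

  -- If 0 is related to an old element `x`, the only admissible extension of an old partition puts 0
  -- into the block of `x`, so the sum reduces to `q′`. If 0 is related to no other element, all
  -- extensions are admissible or none is, and the weight `- j` of the new block cancels the `j`
  -- ways to join an old one; then `q` is not total.
  parts-moebius : ∀ n (q : Rel (suc n)) → Equiv q →
    ∑ᴸ (parts n) (λ (j , w , ℓ) → w * 𝟙 (refines q (toℕ ∘ ℓ))) ≡ 𝟙 (total q)
  parts-moebius zero q eq = trans (ℤₚ.+-identityʳ _) (trans (ℤₚ.*-identityˡ _) (cong 𝟙 (trans (⇒refines {q = q} {λ _ → 0} (λ _ → refl))
      (sym (⇒total q λ { zero zero → Equiv.rfl eq zero })))))
  parts-moebius (suc n) q eq = trans (∑ᴸ-concatMap _ (parts n) _) (go (Finₚ.any? λ x → q zero (suc x) Boolₚ.≟ true))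
    where
    open Equiv eq
    q′ : Rel (suc n)
    q′ x y = q (suc x) (suc y)
    eq′ : Equiv q′
    eq′ = record { rfl = rfl ∘ suc ; symm = symm ; trns = trns }
    refines-∷ : ∀ {j} (ℓ : Fin (suc (suc n)) → Fin j) → refines q (toℕ ∘ ℓ) ≡ true → refines q′ (toℕ ∘ ℓ ∘ suc) ≡ true
    refines-∷ ℓ h = ⇒refines {q = q′} (refines⇒ {q = q} h)
    item : Σ[ j ∈ ℕ ] ℤ × (Fin (suc n) → Fin j) → ℤ
    item (j , w , ℓ) = ((- (+ j)) * w) * 𝟙 (refines q (toℕ ∘ (zero ∷ᶠ (suc ∘ ℓ)))) +
                       ∑ᴸ (List.map (λ b → j , w , (b ∷ᶠ ℓ)) (List.allFin j)) (λ (j , w , ℓ) → w * 𝟙 (refines q (toℕ ∘ ℓ)))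
    joins : ∀ j w (ℓ : Fin (suc n) → Fin j) → ∑ᴸ (List.map (λ b → j , w , (b ∷ᶠ ℓ)) (List.allFin j)) (λ (j , w , ℓ) → w * 𝟙 (refines q (toℕ ∘ ℓ)))
            ≡ ∑ (λ b → w * 𝟙 (refines q (toℕ ∘ (b ∷ᶠ ℓ))))
    joins j w ℓ = trans (∑ᴸ-map (λ b → j , w , (b ∷ᶠ ℓ)) (List.allFin j) (λ (j , w , ℓ) → w * 𝟙 (refines q (toℕ ∘ ℓ)))) (∑ᴸ-allFin j (λ b → w * 𝟙 (refines q (toℕ ∘ (b ∷ᶠ ℓ)))))
    go : Dec (∃ λ x → q zero (suc x) ≡ true) → ∑ᴸ (parts n) item ≡ 𝟙 (total q)
    go (yes (x , qx)) = trans (∑ᴸ-cong (parts n) λ (j , w , ℓ) → one j w ℓ) (trans (parts-moebius n q′ eq′) (cong 𝟙 (⇔→≡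
        (λ h → ⇒total q (conn h)) (λ h → ⇒total q′ λ u v → total⇒ q h (suc u) (suc v)))))
      where
      conn : total q′ ≡ true → ∀ u v → q u v ≡ true
      conn h zero zero = rfl zero
      conn h zero (suc v) = trns qx (total⇒ q′ h x v)
      conn h (suc u) zero = symm (conn h zero (suc u))
      conn h (suc u) (suc v) = total⇒ q′ h u v
      one : ∀ j w (ℓ : Fin (suc n) → Fin j) → item (j , w , ℓ) ≡ w * 𝟙 (refines q′ (toℕ ∘ ℓ))
      one j w ℓ = trans (cong₂ (λ b s → ((- (+ j)) * w) * 𝟙 b + s) new (joins j w ℓ)) (trans (cong₂ _+_ (ℤₚ.*-zeroʳ ((- (+ j)) * w))
          (trans (∑-cong λ b → trans (cong (λ t → w * 𝟙 t) (joined b)) (trans (cong (w *_) (𝟙-∧ (b == ℓ x) r)) (alg w (𝟙 (b == ℓ x)) (𝟙 r)))) (∑-δ (ℓ x) (λ _ → w * 𝟙 r)))) (ℤₚ.+-identityˡ _))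
        where
        r = refines q′ (toℕ ∘ ℓ)
        alg : ∀ a b c → a * (b * c) ≡ b * (a * c)
        alg = solve-∀
        new : refines q (toℕ ∘ (zero ∷ᶠ (suc ∘ ℓ))) ≡ false
        new = ⇔→≡ {b = false} (λ h → ⊥-elim (0≢s (refines⇒ {q = q} h qx))) (λ ())
          where 0≢s : ∀ {m} → ¬ 0 ≡ suc m
                0≢s ()
        joined : ∀ b → refines q (toℕ ∘ (b ∷ᶠ ℓ)) ≡ (b == ℓ x) ∧ r
        joined b = ⇔→≡
          (λ h → ∧-intro (≡⇒== (Finₚ.toℕ-injective (refines⇒ {q = q} h qx))) (refines-∷ (b ∷ᶠ ℓ) h))
          (λ h → ⇒refines {q = q} (ext (==⇒≡ {x = b} {ℓ x} (proj₁ (∧-true h))) (proj₂ (∧-true {b == ℓ x} h))))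
          where
          ext : b ≡ ℓ x → r ≡ true → ∀ {u v} → q u v ≡ true → toℕ ((b ∷ᶠ ℓ) u) ≡ toℕ ((b ∷ᶠ ℓ) v)
          ext e h {zero} {zero} _ = refl
          ext e h {zero} {suc v} p = trans (cong toℕ e) (refines⇒ {q = q′} h (trns (symm qx) p))
          ext e h {suc u} {zero} p = trans (refines⇒ {q = q′} h (trns p qx)) (cong toℕ (sym e))
          ext e h {suc u} {suc v} p = refines⇒ {q = q′} h p
    go (no ¬x) = trans (∑ᴸ-zero (parts n) λ (j , w , ℓ) → one j w ℓ) (cong 𝟙 (sym (⇔→≡ {total q} {false}
        (λ h → ⊥-elim (¬x (zero , total⇒ q h zero (suc zero)))) (λ ()))))
      where
      one : ∀ j w (ℓ : Fin (suc n) → Fin j) → item (j , w , ℓ) ≡ 0ℤ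
      one j w ℓ = trans (cong₂ (λ b s → ((- (+ j)) * w) * 𝟙 b + s) new (trans (joins j w ℓ) (trans (∑-cong λ b → cong (λ t → w * 𝟙 t) (joined b)) (∑-const {j} (w * 𝟙 r)))))
          (alg (+ j) w (𝟙 r))
        where
        r = refines q′ (toℕ ∘ ℓ)
        alg : ∀ j w r → (- j) * w * r + j * (w * r) ≡ 0ℤ
        alg = solve-∀
        new : refines q (toℕ ∘ (zero ∷ᶠ (suc ∘ ℓ))) ≡ r
        new = ⇔→≡ (λ h → ⇒refines {q = q′} (λ p → ℕₚ.suc-injective (refines⇒ {q = q} h p))) (λ h → ⇒refines {q = q} (ext h))
          where
          ext : r ≡ true → ∀ {u v} → q u v ≡ true → toℕ ((zero ∷ᶠ (suc ∘ ℓ)) u) ≡ toℕ ((zero ∷ᶠ (suc ∘ ℓ)) v)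
          ext h {zero} {zero} _ = refl
          ext h {zero} {suc v} p = ⊥-elim (¬x (v , p))
          ext h {suc u} {zero} p = ⊥-elim (¬x (u , symm p))
          ext h {suc u} {suc v} p = cong suc (refines⇒ {q = q′} h p)
        joined : ∀ b → refines q (toℕ ∘ (b ∷ᶠ ℓ)) ≡ r
        joined b = ⇔→≡ (refines-∷ (b ∷ᶠ ℓ)) (λ h → ⇒refines {q = q} (ext h))
          where
          ext : r ≡ true → ∀ {u v} → q u v ≡ true → toℕ ((b ∷ᶠ ℓ) u) ≡ toℕ ((b ∷ᶠ ℓ) v)
          ext h {zero} {zero} _ = refl
          ext h {zero} {suc v} p = ⊥-elim (¬x (v , p))
          ext h {suc u} {zero} p = ⊥-elim (¬x (u , symm p))
          ext h {suc u} {suc v} p = refines⇒ {q = q′} h p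

  labelings-moebius : ∀ d → Moebius (labelings (suc d))
  labelings-moebius d q eq = trans (∑ᴸ-map (λ (j , w , ℓ) → w , toℕ ∘ ℓ) (parts d) (λ (w , ℓ) → w * 𝟙 (refines q ℓ))) (parts-moebius d q eq)

  pullback : ∀ {d} → Map d → Weighted d → Weighted d
  pullback π = List.map λ (w , ℓ) → w , ℓ ∘ π

  -- The Möbius property does not depend on the names of the points. This serves to compare the
  -- expansions at conjugate permutations.
  pullback-moebius : ∀ {d} (L : Weighted d) {π : Map d} → Perm π → Moebius L → Moebius (pullback π L)
  pullback-moebius L {π} P M q eq = begin
    weigh (pullback π L) (refines q) ≡⟨ ∑ᴸ-map _ L _ ⟩
    weigh L (λ ℓ → refines q (ℓ ∘ π)) ≡⟨ weigh-cong L (λ ℓ → ⇔→≡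
        (λ h → ⇒refines {q = q′} λ {x} {y} e → trans (cong ℓ (sym (right x))) (trans (refines⇒ {q = q} h e) (cong ℓ (right y))))
        (λ h → ⇒refines {q = q} λ {x} {y} e → refines⇒ {q = q′} h (trans (cong₂ q (left x) (left y)) e))) ⟩
    weigh L (refines q′) ≡⟨ M q′ (record { rfl = rfl ∘ inv ; symm = symm ; trns = trns }) ⟩
    𝟙 (total q′) ≡⟨ cong 𝟙 (⇔→≡
        (λ h → ⇒total q λ x y → trans (sym (cong₂ q (left x) (left y))) (total⇒ q′ h (π x) (π y)))
        (λ h → ⇒total q′ λ x y → total⇒ q h (inv x) (inv y))) ⟩
    𝟙 (total q) ∎
    where
    open Perm P
    open Equiv eq
    q′ : Rel _
    q′ x y = q (inv x) (inv y)

  isConst : ∀ {d} → (Fin d → ℕ) → Bool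
  isConst ℓ = refines (λ _ _ → true) ℓ

  weigh-const : ∀ {d} (L : Weighted d) → Moebius L → weigh L isConst ≡ 1ℤ
  weigh-const {d} L M = trans (M (λ _ _ → true) (record { rfl = λ _ → refl ; symm = λ _ → refl ; trns = λ _ _ → refl }))
    (cong 𝟙 (⇒total {d} (λ _ _ → true) λ _ _ → refl))

  _≡ᴮ_ : Bool → Bool → Bool
  true ≡ᴮ b = b
  false ≡ᴮ b = not b

  ≡ᴮ⇒ : ∀ {a b} → a ≡ᴮ b ≡ true → a ≡ b
  ≡ᴮ⇒ {true} {true} _ = refl
  ≡ᴮ⇒ {false} {false} _ = refl

  ⇒≡ᴮ : ∀ {a b} → a ≡ b → a ≡ᴮ b ≡ true
  ⇒≡ᴮ {true} refl = refl
  ⇒≡ᴮ {false} refl = refl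

  split-off : ∀ {d} → Fin d → Rel d
  split-off w x y = (x == w) ≡ᴮ (y == w)

  isPoint : ∀ {d} → Fin d → (Fin d → ℕ) → Bool
  isPoint w ℓ = refines (split-off w) ℓ ∧ not (isConst ℓ)

  -- The coarsenings of {w} | rest are that partition and the one-block partition. Because of `w′`
  -- the relation `split-off w` is not total, so their weights add to 0, and the one block alone
  -- weighs 1.
  weigh-point : ∀ {d} (L : Weighted d) → Moebius L → (w w′ : Fin d) → ¬ w′ ≡ w → weigh L (isPoint w) ≡ - 1ℤ
  weigh-point L M w w′ w≢ = begin
    weigh L (isPoint w)
      ≡⟨ ∑ᴸ-cong L (λ (v , ℓ) → trans (cong (v *_) (split ℓ)) (alg v (𝟙 (refines (split-off w) ℓ)) (𝟙 (isConst ℓ)))) ⟩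
    ∑ᴸ L (λ (v , ℓ) → v * 𝟙 (refines (split-off w) ℓ) + (- 1ℤ) * (v * 𝟙 (isConst ℓ)))
      ≡⟨ trans (∑ᴸ-+ L _ _) (cong (_+_ (weigh L (refines (split-off w)))) (∑ᴸ-*ˡ (- 1ℤ) L (λ (v , ℓ) → v * 𝟙 (isConst ℓ)))) ⟩
    weigh L (refines (split-off w)) + (- 1ℤ) * weigh L isConst
      ≡⟨ cong₂ (λ a b → a + (- 1ℤ) * b) (trans (M (split-off w) eqv) (cong 𝟙 nontotal)) (weigh-const L M) ⟩
    - 1ℤ ∎
    where
    alg : ∀ v a b → v * (a - b) ≡ v * a + (- 1ℤ) * (v * b)
    alg = solve-∀
    eqv : Equiv (split-off w)
    eqv = record { rfl = λ x → ⇒≡ᴮ {x == w} refl ; symm = λ {x} {y} e → ⇒≡ᴮ {y == w} (sym (≡ᴮ⇒ {x == w} e))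
                 ; trns = λ {x} {y} {z} e f → ⇒≡ᴮ {x == w} (trans (≡ᴮ⇒ {x == w} e) (≡ᴮ⇒ {y == w} f)) }
    nontotal : total (split-off w) ≡ false
    nontotal = ⇔→≡ {b = false} (λ h → ⊥-elim (false≢true (trans (sym (≢⇒== w≢)) (trans (sym (≡ᴮ⇒ {w == w} (total⇒ (split-off w) h w w′))) (==-refl w))))) (λ ())
    split : ∀ ℓ → 𝟙 (isPoint w ℓ) ≡ 𝟙 (refines (split-off w) ℓ) - 𝟙 (isConst ℓ)
    split ℓ = go (refines (split-off w) ℓ) (isConst ℓ) (λ e → ⇒refines {q = split-off w} {ℓ} λ {x} {y} _ → refines⇒ {q = λ _ _ → true} {ℓ} e {x} {y} refl)
      where
      go : ∀ a b → (b ≡ true → a ≡ true) → 𝟙 (a ∧ not b) ≡ 𝟙 a - 𝟙 b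
      go true true _ = refl
      go true false _ = refl
      go false true f = ⊥-elim (false≢true (f refl))
      go false false _ = refl

  isPoint⇒ : ∀ {d} {w : Fin d} {ℓ} → isPoint w ℓ ≡ true → IsPoint ℓ w
  isPoint⇒ {w = w} {ℓ} h = lone , rest
    where
    off : ∀ x y → ¬ x ≡ w → ¬ y ≡ w → split-off w x y ≡ true
    off x y a b = ⇒≡ᴮ {x == w} (trans (≢⇒== a) (sym (≢⇒== b)))
    rest : ∀ x y → ¬ x ≡ w → ¬ y ≡ w → ℓ x ≡ ℓ y
    rest x y a b = refines⇒ {q = split-off w} (proj₁ (∧-true h)) (off x y a b)
    const : ∀ x → ¬ x ≡ w → ℓ x ≡ ℓ w → isConst ℓ ≡ true
    const x x≢ e = ⇒refines {q = λ _ _ → true} λ {u} {v} _ → trans (all u (u Finₚ.≟ w)) (sym (all v (v Finₚ.≟ w)))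
      where
      all : ∀ u → Dec (u ≡ w) → ℓ u ≡ ℓ w
      all u (yes refl) = refl
      all u (no n) = trans (rest u x n x≢) e
    lone : ∀ x → ℓ x ≡ ℓ w → x ≡ w
    lone x e with x Finₚ.≟ w
    ... | yes p = p
    ... | no n = ⊥-elim (false≢true (trans (cong not (sym (const x n e))) (proj₂ (∧-true {refines (split-off w) ℓ} h))))

  ⇒isPoint : ∀ {d} {w w′ : Fin d} {ℓ} → ¬ w′ ≡ w → IsPoint ℓ w → isPoint w ℓ ≡ true
  ⇒isPoint {w = w} {w′} {ℓ} w≢ (lone , rest) = ∧-intro
    (⇒refines {q = split-off w} λ {x} {y} e → go x y (x Finₚ.≟ w) (y Finₚ.≟ w) (≡ᴮ⇒ {x == w} e))
    (cong not (⇔→≡ {b = false} (λ h → ⊥-elim (w≢ (lone w′ (refines⇒ {q = λ _ _ → true} {ℓ} h {w′} {w} refl)))) (λ ())))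
    where
    go : ∀ x y → Dec (x ≡ w) → Dec (y ≡ w) → (x == w) ≡ (y == w) → ℓ x ≡ ℓ y
    go x y (yes refl) (yes refl) _ = refl
    go x y (yes refl) (no n) e = ⊥-elim (false≢true (trans (sym (≢⇒== n)) (trans (sym e) (==-refl w))))
    go x y (no n) (yes refl) e = ⊥-elim (false≢true (trans (sym (≢⇒== n)) (trans e (==-refl w))))
    go x y (no m) (no n) _ = rest x y m n

  -- Orbits by bounded reachability, and the indicator of transitivity.

  module _ {d : ℕ} (gens : List (Map d)) where

    edge : Rel d
    edge z y = anyL gens λ σ → (σ z == y) ∨ (σ y == z)

    edge-sym : ∀ {z y} → edge z y ≡ true → edge y z ≡ true
    edge-sym {z} {y} h = trans (sym (go gens)) h
      where
      ∨-comm : ∀ a b → a ∨ b ≡ b ∨ a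
      ∨-comm true true = refl
      ∨-comm true false = refl
      ∨-comm false true = refl
      ∨-comm false false = refl
      go : ∀ gs → anyL gs (λ σ → (σ z == y) ∨ (σ y == z)) ≡ anyL gs (λ σ → (σ y == z) ∨ (σ z == y))
      go [] = refl
      go (σ ∷ gs) = cong₂ _∨_ (∨-comm (σ z == y) (σ y == z)) (go gs)

    reach-refl : ∀ n x → reach gens n x x ≡ true
    reach-refl zero x = ==-refl x
    reach-refl (suc n) x = ∨-introˡ (reach-refl n x)

    reach-step : ∀ n {x z y} → reach gens n x z ≡ true → edge z y ≡ true → reach gens (suc n) x y ≡ true
    reach-step n {x} {z} {y} r e = ∨-introʳ {reach gens n x y} (⇒anyF z (∧-intro r e))

    Stable : ℕ → Fin d → Set
    Stable n x = ∀ y → reach gens (suc n) x y ≡ true → reach gens n x y ≡ true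

    stable-suc : ∀ n x → Stable n x → Stable (suc n) x
    stable-suc n x s y h with ∨-true {reach gens (suc n) x y} h
    ... | inj₁ p = p
    ... | inj₂ p with anyF⇒ {p = λ z → reach gens (suc n) x z ∧ edge z y} p
    ...   | z , q = reach-step n (s z (proj₁ (∧-true q))) (proj₂ (∧-true {reach gens (suc n) x z} q))

    size : ℕ → Fin d → ℤ
    size n x = ∑ λ y → 𝟙 (reach gens n x y)

    -- A step that reaches nothing new makes all later steps idle, and any other step adds a point.
    -- As `d` points cannot hold `d + 1`, the relation `reach gens d` is closed under edges
    -- (`stable`).
    growth : ∀ n x → Stable n x ⊎ + suc n ≤ size n x
    growth zero x = inj₂ (ℤₚ.≤-reflexive (sym (trans (∑-cong λ y → sym (ℤₚ.*-identityʳ (𝟙 (x == y)))) (∑-δ′ x (λ _ → 1ℤ)))))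
    growth (suc n) x with growth n x
    ... | inj₁ s = inj₁ (stable-suc n x s)
    ... | inj₂ le with allF (λ y → not (reach gens (suc n) x y) ∨ reach gens n x y) in eq
    ...   | true = inj₁ (stable-suc n x λ y h → out (reach gens (suc n) x y) h (allF⇒ {p = λ y → not (reach gens (suc n) x y) ∨ reach gens n x y} eq y))
      where
      out : ∀ b {c} → b ≡ true → not b ∨ c ≡ true → c ≡ true
      out true _ h = h
    ...   | false with Finₚ.any? (λ y → reach gens (suc n) x y ∧ not (reach gens n x y) Boolₚ.≟ true)
    ...     | no none = ⊥-elim (false≢true (trans (sym eq) (⇒allF λ y → imp (reach gens (suc n) x y) (reach gens n x y) (λ h → none (y , h)))))
      where
      imp : ∀ a b → ¬ a ∧ not b ≡ true → not a ∨ b ≡ true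
      imp true true _ = refl
      imp true false h = ⊥-elim (h refl)
      imp false b _ = refl
    ...     | yes (y , h) = inj₂ (ℤₚ.≤-trans (ℤₚ.≤-trans (ℤₚ.+-monoʳ-≤ 1ℤ le) (ℤₚ.≤-reflexive (trans (ℤₚ.+-comm 1ℤ (size n x))
          (sym (trans (∑-+ (λ z → 𝟙 (reach gens n x z)) (λ z → 𝟙 (z == y))) (cong (_+_ (size n x)) (trans (∑-cong λ z → sym (ℤₚ.*-identityʳ (𝟙 (z == y)))) (∑-δ y (λ _ → 1ℤ)))))))))
        (∑-mono {f = λ z → 𝟙 (reach gens n x z) + 𝟙 (z == y)} {λ z → 𝟙 (reach gens (suc n) x z)} λ z → point z (z Finₚ.≟ y)))
      where
      mono : ∀ a b → 𝟙 a ≤ 𝟙 (a ∨ b)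
      mono true b = ℤₚ.≤-refl
      mono false b = 𝟙≥0 b
      point : ∀ z → Dec (z ≡ y) → 𝟙 (reach gens n x z) + 𝟙 (z == y) ≤ 𝟙 (reach gens (suc n) x z)
      point z (yes refl) = subst₂ _≤_ (sym (cong₂ (λ a b → 𝟙 a + 𝟙 b) (notf (reach gens n x z) (proj₂ (∧-true {reach gens (suc n) x z} h))) (==-refl z))) (cong 𝟙 (sym (proj₁ (∧-true {reach gens (suc n) x z} h)))) ℤₚ.≤-refl
        where notf : ∀ a → not a ≡ true → a ≡ false
              notf false _ = refl
      point z (no n′) = subst (_≤ 𝟙 (reach gens (suc n) x z)) (sym (trans (cong (λ b → 𝟙 (reach gens n x z) + 𝟙 b) (≢⇒== n′)) (ℤₚ.+-identityʳ _))) (mono (reach gens n x z) _)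

    stable : ∀ x → Stable d x
    stable x with growth d x
    ... | inj₁ s = s
    ... | inj₂ le = ⊥-elim (ℕₚ.<-irrefl refl (ℤₚ.drop‿+≤+ (ℤₚ.≤-trans le (subst (size d x ≤_) (trans (∑-const {d} 1ℤ) (ℤₚ.*-identityʳ (+ d))) (∑-mono λ y → 𝟙≤1 (reach gens d x y))))))

    reach-trans : ∀ {x y} m {z} → reach gens d x y ≡ true → reach gens m y z ≡ true → reach gens d x z ≡ true
    reach-trans {x} zero r h = subst (λ z → reach gens d x z ≡ true) (==⇒≡ h) r
    reach-trans {x} {y} (suc m) {z} r h with ∨-true {reach gens m y z} h
    ... | inj₁ p = reach-trans m r p
    ... | inj₂ p with anyF⇒ {p = λ w → reach gens m y w ∧ edge w z} p
    ...   | w , q = stable x z (reach-step d (reach-trans m r (proj₁ (∧-true q))) (proj₂ (∧-true {reach gens m y w} q)))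

    reach-edge : ∀ {x y} → edge x y ≡ true → reach gens d x y ≡ true
    reach-edge {x} {y} e = stable x y (reach-step d (reach-refl d x) e)

    reach-sym : ∀ m {x y} → reach gens m x y ≡ true → reach gens d y x ≡ true
    reach-sym zero {x} h = subst (λ z → reach gens d z x ≡ true) (==⇒≡ h) (reach-refl d x)
    reach-sym (suc m) {x} {y} h with ∨-true {reach gens m x y} h
    ... | inj₁ p = reach-sym m p
    ... | inj₂ p with anyF⇒ {p = λ w → reach gens m x w ∧ edge w y} p
    ...   | w , q = reach-trans d (reach-edge (edge-sym {w} {y} (proj₂ (∧-true {reach gens m x w} q)))) (reach-sym m (proj₁ (∧-true q)))

    reach-equiv : Equiv (reach gens d)
    reach-equiv = record { rfl = reach-refl d ; symm = reach-sym d ; trns = reach-trans d }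

    reach-label : ∀ ℓ → allL gens (preserves ℓ) ≡ true → ∀ m {x y} → reach gens m x y ≡ true → ℓ x ≡ ℓ y
    reach-label ℓ all zero h = cong ℓ (==⇒≡ h)
    reach-label ℓ all (suc m) {x} {y} h with ∨-true {reach gens m x y} h
    ... | inj₁ p = reach-label ℓ all m p
    ... | inj₂ p with anyF⇒ {p = λ w → reach gens m x w ∧ edge w y} p
    ...   | w , q = trans (reach-label ℓ all m (proj₁ (∧-true q))) (go gens all (proj₂ (∧-true {reach gens m x w} q)))
      where
      go : ∀ gs → allL gs (preserves ℓ) ≡ true → anyL gs (λ σ → (σ w == y) ∨ (σ y == w)) ≡ true → ℓ w ≡ ℓ y
      go (σ ∷ gs) a e with ∨-true {(σ w == y) ∨ (σ y == w)} e
      ... | inj₂ e′ = go gs (proj₂ (∧-true {preserves ℓ σ} a)) e′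
      ... | inj₁ e′ with ∨-true {σ w == y} e′
      ...   | inj₁ f = trans (sym (preserves⇒ ℓ σ (proj₁ (∧-true {preserves ℓ σ} a)) w)) (cong ℓ (==⇒≡ f))
      ...   | inj₂ f = trans (cong ℓ (sym (==⇒≡ f))) (preserves⇒ ℓ σ (proj₁ (∧-true {preserves ℓ σ} a)) y)

    refines-gens : ∀ ℓ → refines (reach gens d) ℓ ≡ allL gens (preserves ℓ)
    refines-gens ℓ = ⇔→≡ (λ h → go h gens (λ _ _ e → e)) (λ h → ⇒refines {q = reach gens d} (reach-label ℓ h d))
      where
      go : refines (reach gens d) ℓ ≡ true → ∀ gs → (∀ z y → anyL gs (λ σ → (σ z == y) ∨ (σ y == z)) ≡ true → edge z y ≡ true) → allL gs (preserves ℓ) ≡ true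
      go h [] sub = refl
      go h (σ ∷ gs) sub = ∧-intro
        (⇒preserves ℓ σ λ x → sym (refines⇒ {q = reach gens d} h (reach-edge (sub x (σ x) (∨-introˡ (∨-introˡ (==-refl (σ x))))))))
        (go h gs (λ z y e → sub z y (∨-introʳ {(σ z == y) ∨ (σ y == z)} e)))

    -- The Möbius property is applied to the orbit relation: it is total exactly for transitive
    -- tuples, and a labelling is constant on orbits exactly when every generator preserves it.
    transitive-weigh : ∀ L → Moebius L → 𝟙 (isTransitive gens) ≡ weigh L (λ ℓ → allL gens (preserves ℓ))
    transitive-weigh L M = trans (sym (M (reach gens d) reach-equiv)) (weigh-cong L refines-gens)

  -- Conjugators from a block cycle

  χ : ∀ {P : Set} → Dec P → ℤ
  χ p = 𝟙 (does p)

  χ-yes : ∀ {P : Set} (p : Dec P) → P → χ p ≡ 1ℤ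
  χ-yes (yes _) _ = refl
  χ-yes (no n) h = ⊥-elim (n h)

  χ-no : ∀ {P : Set} (p : Dec P) → ¬ P → χ p ≡ 0ℤ
  χ-no (yes h) n = ⊥-elim (n h)
  χ-no (no _) _ = refl

  χ-cong : ∀ {P Q : Set} (p : Dec P) (q : Dec Q) → (P → Q) → (Q → P) → χ p ≡ χ q
  χ-cong (yes h) q f g = sym (χ-yes q (f h))
  χ-cong (no n) q f g = sym (χ-no q (n ∘ g))

  χ-× : ∀ {P Q : Set} (p : Dec P) (q : Dec Q) → χ (p ×-dec q) ≡ χ p * χ q
  χ-× (yes _) (yes _) = refl
  χ-× (yes _) (no _) = refl
  χ-× (no _) q = refl

  χ-guard : ∀ {P : Set} (p : Dec P) {x y : ℤ} → (P → x ≡ y) → χ p * x ≡ χ p * y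
  χ-guard (yes h) f = cong (1ℤ *_) (f h)
  χ-guard (no _) f = refl

  cyc : ∀ {n} → Fin n → Fin n
  cyc {suc n} i with view i
  ... | ‵fromℕ = zero
  ... | ‵inject₁ j = suc j

  cyc-top : ∀ n → cyc (fromℕ n) ≡ zero
  cyc-top n rewrite view-fromℕ n = refl

  cyc-inject : ∀ {n} (j : Fin n) → cyc (inject₁ j) ≡ suc j
  cyc-inject j rewrite view-inject₁ j = refl

  top-cases : ∀ {n} (P : Fin (suc n) → Set) → P (fromℕ n) → (∀ j → P (inject₁ j)) → ∀ i → P i
  top-cases P a b i with view i
  ... | ‵fromℕ = a
  ... | ‵inject₁ j = b j

  split-cases : ∀ m {n} (P : Fin (m ℕ.+ n) → Set) → (∀ i → P (i ↑ˡ n)) → (∀ j → P (m ↑ʳ j)) → ∀ x → P x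
  split-cases m {n} P a b x = subst P (Finₚ.join-splitAt m n x) (go (splitAt m x))
    where
    go : ∀ s → P (join m n s)
    go (inj₁ i) = a i
    go (inj₂ j) = b j

  infixr 5 _⧺_
  _⧺_ : ∀ {m n} {X : Set} → (Fin m → X) → (Fin n → X) → Fin (m ℕ.+ n) → X
  _⧺_ {m} p q x = [ p , q ]′ (splitAt m x)

  ⧺-ˡ : ∀ {m n} {X : Set} (p : Fin m → X) (q : Fin n → X) i → (p ⧺ q) (i ↑ˡ n) ≡ p i
  ⧺-ˡ {m} {n} p q i = cong [ p , q ]′ (Finₚ.splitAt-↑ˡ m i n)

  ⧺-ʳ : ∀ {m n} {X : Set} (p : Fin m → X) (q : Fin n → X) j → (p ⧺ q) (m ↑ʳ j) ≡ q j
  ⧺-ʳ {m} {n} p q j = cong [ p , q ]′ (Finₚ.splitAt-↑ʳ m n j)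

  ⧺-cong : ∀ {m n} {X : Set} {p p′ : Fin m → X} {q q′ : Fin n → X} → (∀ i → p i ≡ p′ i) → (∀ j → q j ≡ q′ j) → ∀ x → (p ⧺ q) x ≡ (p′ ⧺ q′) x
  ⧺-cong {m} {n} {p = p} {p′} {q} {q′} a b = split-cases m _
    (λ i → trans (⧺-ˡ p q i) (trans (a i) (sym (⧺-ˡ p′ q′ i)))) (λ j → trans (⧺-ʳ p q j) (trans (b j) (sym (⧺-ʳ p′ q′ j))))

  ∑ₘ-⧺ : ∀ m {n D} (F : (Fin (m ℕ.+ n) → Fin D) → ℤ) → Ext F → ∑ₘ F ≡ ∑ₘ {m} λ p → ∑ₘ {n} λ q → F (p ⧺ q)
  ∑ₘ-⧺ zero {n} {D} F ext = sym (∑ₘ-zero {D} (λ p → ∑ₘ {n} λ q → F (p ⧺ q)) (λ h → ∑-cong λ i → ext (⧺-cong h (λ _ → refl))) (λ ()))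
  ∑ₘ-⧺ (suc m) {n} {D} F ext = begin
    ∑ₘ F ≡⟨ ∑ₘ-suc F ext ⟩
    ∑ (λ a → ∑ₘ λ f → F (a ∷ᶠ f))
      ≡⟨ ∑-cong (λ a → ∑ₘ-⧺ m (λ f → F (a ∷ᶠ f)) (λ h → ext λ { zero → refl ; (suc i) → h i })) ⟩
    ∑ (λ a → ∑ₘ {m} λ p → ∑ₘ {n} λ q → F (a ∷ᶠ (p ⧺ q)))
      ≡⟨ ∑-cong (λ a → ∑-cong λ i → ∑-cong λ j → ext (reassoc a (app i) (app j))) ⟩
    ∑ (λ a → ∑ₘ {m} λ p → ∑ₘ {n} λ q → F ((a ∷ᶠ p) ⧺ q))
      ≡⟨ sym (∑ₘ-suc (λ p → ∑ₘ {n} λ q → F (p ⧺ q)) (λ h → ∑-cong λ i → ext (⧺-cong h (λ _ → refl)))) ⟩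
    ∑ₘ {suc m} (λ p → ∑ₘ {n} λ q → F (p ⧺ q)) ∎
    where
    reassoc : ∀ a (p : Fin m → Fin D) (q : Fin n → Fin D) x → (a ∷ᶠ (p ⧺ q)) x ≡ ((a ∷ᶠ p) ⧺ q) x
    reassoc a p q = split-cases (suc m) _ (λ { zero → refl ; (suc i) → trans (⧺-ˡ p q i) (sym (⧺-ˡ (a ∷ᶠ p) q (suc i))) })
                      (λ j → trans (⧺-ʳ p q j) (sym (⧺-ʳ (a ∷ᶠ p) q j)))

  -- The permutation of {0,…,d-1} whose cycles are consecutive blocks of lengths μ₁, μ₂, ….
  blk : ∀ μ → Map (sum μ)
  blk [] x = x
  blk (m ∷ μ) = (λ i → cyc i ↑ˡ sum μ) ⧺ (λ j → m ↑ʳ blk μ j)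

  firstFrom-complete : ∀ p fuel k m → k ℕ.≤ m → m ℕ.< k ℕ.+ fuel → p m ≡ true →
    (∀ i → k ℕ.≤ i → i ℕ.< m → p i ≡ false) → firstFrom p k fuel ≡ m
  firstFrom-complete p zero k m k≤m m<k pm f = ⊥-elim (ℕₚ.<-irrefl refl (ℕₚ.<-≤-trans m<k (subst (ℕ._≤ m) (sym (ℕₚ.+-identityʳ k)) k≤m)))
  firstFrom-complete p (suc fuel) k m k≤m m<k pm f with k ℕₚ.≟ m
  ... | yes refl rewrite pm = refl
  ... | no k≢m rewrite f k ℕₚ.≤-refl (ℕₚ.≤∧≢⇒< k≤m k≢m) =
    firstFrom-complete p fuel (suc k) m (ℕₚ.≤∧≢⇒< k≤m k≢m) (subst (m ℕ.<_) (ℕₚ.+-suc k fuel) m<k) pm (λ i a b → f i (ℕₚ.<⇒≤ a) b)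

  -- Asking for `1 ℕ.≤ m` excludes the value 0 that an exhausted search returns, so `m` really is
  -- the first hit.
  firstFrom-sound : ∀ p fuel k m → 1 ℕ.≤ m → firstFrom p k fuel ≡ m →
    p m ≡ true × (∀ i → k ℕ.≤ i → i ℕ.< m → p i ≡ false) × m ℕ.< k ℕ.+ fuel
  firstFrom-sound p zero k m 1≤m refl = ⊥-elim (ℕₚ.<-irrefl refl 1≤m)
  firstFrom-sound p (suc fuel) k m 1≤m e with p k in eq
  ... | true = subst (λ z → p z ≡ true) e eq , (λ i a b → ⊥-elim (ℕₚ.<-irrefl refl (ℕₚ.≤-<-trans a (subst (i ℕ.<_) (sym e) b)))) ,
               subst (ℕ._< k ℕ.+ suc fuel) e (subst (suc k ℕ.≤_) (sym (ℕₚ.+-suc k fuel)) (s≤s (ℕₚ.m≤m+n k fuel)))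
  ... | false with firstFrom-sound p fuel (suc k) m 1≤m e
  ...   | pm , below , bound = pm , below′ , subst (m ℕ.<_) (sym (ℕₚ.+-suc k fuel)) bound
    where
    below′ : ∀ i → k ℕ.≤ i → i ℕ.< m → p i ≡ false
    below′ i k≤i i<m with k ℕₚ.≟ i
    ... | yes refl = eq
    ... | no k≢i = below i (ℕₚ.≤∧≢⇒< k≤i k≢i) i<m

  firstFrom-cong : ∀ {p q} → (∀ i → p i ≡ q i) → ∀ k fuel → firstFrom p k fuel ≡ firstFrom q k fuel
  firstFrom-cong h k zero = refl
  firstFrom-cong h k (suc fuel) rewrite h k = cong (if_then_else_ _ k) (firstFrom-cong h (suc k) fuel)

  -- The order of the centraliser of a permutation of cycle type μ, the product of j^{m_j} m_j! over
  -- all j, built one part at a time: `suc (mult μ m)` is the multiplicity of `m` once this part is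
  -- added.
  zf : List ℕ → ℕ
  zf [] = 1
  zf (m ∷ μ) = m ℕ.* suc (mult μ m) ℕ.* zf μ

  mult-∷ : ∀ m μ j → + mult (m ∷ μ) j ≡ 𝟙 (m ≡ᵇ j) + + mult μ j
  mult-∷ m μ j with m ≡ᵇ j
  ... | true = refl
  ... | false = refl

  -- Intertwiners from the block cycle to a permutation, counted cycle by cycle.

  module Frames {D : ℕ} (σ : Map D) (P : Perm σ) where
    open Perm P

    iter-+ : ∀ a b x → iter σ (a ℕ.+ b) x ≡ iter σ a (iter σ b x)
    iter-+ zero b x = refl
    iter-+ (suc a) b x = cong σ (iter-+ a b x)

    iter-inj : ∀ k {x y} → iter σ k x ≡ iter σ k y → x ≡ y
    iter-inj zero e = e
    iter-inj (suc k) e = iter-inj k (injective e)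

    iter-σ : ∀ k x → iter σ k (σ x) ≡ σ (iter σ k x)
    iter-σ zero x = refl
    iter-σ (suc k) x = cong σ (iter-σ k x)

    len : Fin D → ℕ
    len = orbitLen σ

    len-σ : ∀ x → len (σ x) ≡ len x
    len-σ x = firstFrom-cong (λ k → ⇔→≡ (λ e → ≡⇒== (injective (trans (sym (iter-σ k x)) (==⇒≡ e))))
      (λ e → ≡⇒== (trans (iter-σ k x) (cong σ (==⇒≡ e))))) 1 D

    len-iter : ∀ k x → len (iter σ k x) ≡ len x
    len-iter zero x = refl
    len-iter (suc k) x = trans (len-σ (iter σ k x)) (len-iter k x)

    len≤ : ∀ x → len x ℕ.≤ D
    len≤ x with len x in e
    ... | zero = z≤n
    ... | suc m = ℕ.s≤s⁻¹ (proj₂ (proj₂ (firstFrom-sound (λ k → iter σ k x == x) D 1 (suc m) (s≤s z≤n) e)))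

    frame : ∀ m → Fin D → Fin m → Fin D
    frame m y i = iter σ (toℕ i) y

    returns : ∀ m y → 1 ℕ.≤ m → len y ≡ m → iter σ m y ≡ y
    returns m y 1≤m e = ==⇒≡ (proj₁ (firstFrom-sound (λ k → iter σ k y == y) D 1 m 1≤m e))

    frame-distinct : ∀ m y → 1 ℕ.≤ m → len y ≡ m → ∀ i j → toℕ i ℕ.< toℕ j → ¬ frame m y i ≡ frame m y j
    frame-distinct m y 1≤m e i j q h = false≢true (trans (sym (proj₁ (proj₂ (firstFrom-sound (λ k → iter σ k y == y) D 1 m 1≤m e)) (toℕ j ℕ.∸ toℕ i)
      (ℕₚ.m<n⇒0<n∸m q) (ℕₚ.≤-<-trans (ℕₚ.m∸n≤m (toℕ j) (toℕ i)) (Finₚ.toℕ<n j))))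
      (≡⇒== (iter-inj (toℕ i) (trans (sym (iter-+ (toℕ i) (toℕ j ℕ.∸ toℕ i) y))
        (trans (cong (λ k → iter σ k y) (ℕₚ.m+[n∸m]≡n (ℕₚ.<⇒≤ q))) (sym h))))))

    frame-inj : ∀ m y → 1 ℕ.≤ m → len y ≡ m → ∀ i j → frame m y i ≡ frame m y j → i ≡ j
    frame-inj m y 1≤m e i j h with ℕₚ.<-cmp (toℕ i) (toℕ j)
    ... | tri≈ _ q _ = Finₚ.toℕ-injective q
    ... | tri< q _ _ = ⊥-elim (frame-distinct m y 1≤m e i j q h)
    ... | tri> _ _ q = ⊥-elim (frame-distinct m y 1≤m e j i q (sym h))

    Equivar : ∀ {n} → (Fin n → Fin n) → (Fin n → Fin D) → Set
    Equivar τ p = ∀ i → p (τ i) ≡ σ (p i)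

    equivar-frame : ∀ {n} (p : Fin (suc n) → Fin D) → Equivar cyc p → ∀ i → p i ≡ frame (suc n) (p zero) i
    equivar-frame {n} p h i = go (toℕ i) i refl
      where
      go : ∀ k i → toℕ i ≡ k → p i ≡ iter σ (toℕ i) (p zero)
      go zero zero e = refl
      go (suc k) (suc j) e = trans (cong p (sym (cyc-inject j))) (trans (h (inject₁ j)) (cong σ (trans (go k (inject₁ j) (trans (Finₚ.toℕ-inject₁ j) (ℕₚ.suc-injective e)))
        (cong (λ k → iter σ k (p zero)) (Finₚ.toℕ-inject₁ j)))))

    frame-equivar : ∀ n y → iter σ (suc n) y ≡ y → Equivar cyc (frame (suc n) y)
    frame-equivar n y e = top-cases _
      (trans (cong (frame (suc n) y) (cyc-top n)) (trans (sym e) (cong (λ k → σ (iter σ k y)) (sym (Finₚ.toℕ-fromℕ n)))))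
      (λ j → trans (cong (frame (suc n) y) (cyc-inject j)) (cong (λ k → σ (iter σ k y)) (sym (Finₚ.toℕ-inject₁ j))))

    equivar-returns : ∀ n y → Equivar cyc (frame (suc n) y) → iter σ (suc n) y ≡ y
    equivar-returns n y h = sym (trans (sym (cong (frame (suc n) y) (cyc-top n))) (trans (h (fromℕ n)) (cong (λ k → σ (iter σ k y)) (Finₚ.toℕ-fromℕ n))))

    -- An intertwiner for the remaining parts μ, whose image must avoid the set `U` of points used
    -- by earlier parts. For the full list and empty `U` it is a permutation that conjugates `blk μ`
    -- to σ.
    record Good (U : Fin D → Bool) (μ : List ℕ) (q : Fin (sum μ) → Fin D) : Set where
      constructor good
      field
        inj : ∀ x y → q x ≡ q y → x ≡ y
        equivar : Equivar (blk μ) q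
        avoids : ∀ x → U (q x) ≡ false

    good? : ∀ U μ q → Dec (Good U μ q)
    good? U μ q with Finₚ.all? (λ x → Finₚ.all? λ y → (q x Finₚ.≟ q y) →-dec (x Finₚ.≟ y))
                   | Finₚ.all? (λ x → q (blk μ x) Finₚ.≟ σ (q x)) | Finₚ.all? (λ x → U (q x) Boolₚ.≟ false)
    ... | no n | _ | _ = no (n ∘ Good.inj)
    ... | yes _ | no n | _ = no (n ∘ Good.equivar)
    ... | yes _ | yes _ | no n = no (n ∘ Good.avoids)
    ... | yes a | yes b | yes c = yes (good a b c)

    good-ext : ∀ {U μ q q′} → (∀ x → q x ≡ q′ x) → Good U μ q → Good U μ q′
    good-ext {U} {μ} h (good a b c) = good (λ x y e → a x y (trans (h x) (trans e (sym (h y)))))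
      (λ x → trans (sym (h (blk μ x))) (trans (b x) (cong σ (h x)))) (λ x → trans (cong U (sym (h x))) (c x))

    cnt : (Fin D → Bool) → List ℕ → ℤ
    cnt U μ = ∑ₘ λ q → χ (good? U μ q)

    good-Ext : ∀ U μ → Ext (λ q → χ (good? U μ q))
    good-Ext U μ h = χ-cong (good? U μ _) (good? U μ _) (good-ext h) (good-ext (sym ∘ h))

    orb : ℕ → Fin D → Fin D → Bool
    orb m y z = anyF λ i → frame m y i == z

    _∪_ : (Fin D → Bool) → (Fin D → Bool) → Fin D → Bool
    (U ∪ W) z = U z ∨ W z

    ∨-false : ∀ {a b} → a ∨ b ≡ false → a ≡ false × b ≡ false
    ∨-false {false} h = refl , h

    ¬true→false : ∀ {b} → ¬ b ≡ true → b ≡ false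
    ¬true→false {true} h = ⊥-elim (h refl)
    ¬true→false {false} h = refl

    Stab : (Fin D → Bool) → Set
    Stab U = ∀ x → U (σ x) ≡ U x

    stab-iter : ∀ {U} → Stab U → ∀ k x → U (iter σ k x) ≡ U x
    stab-iter s zero x = refl
    stab-iter s (suc k) x = trans (s (iter σ k x)) (stab-iter s k x)

    Start : (Fin D → Bool) → ℕ → Fin D → Set
    Start U m y = U y ≡ false × len y ≡ m

    start? : ∀ U m y → Dec (Start U m y)
    start? U m y = (U y Boolₚ.≟ false) ×-dec (len y ℕₚ.≟ m)

    good⇒ : ∀ U n μ y q → Good U (suc n ∷ μ) (frame (suc n) y ⧺ q) → Start U (suc n) y × Good (U ∪ orb (suc n) y) μ q
    good⇒ U n μ y q (good inj eqv av) = (subst (λ z → U z ≡ false) (⧺-ˡ f q zero) (av (zero ↑ˡ sum μ)) , ly) ,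
        good (λ x z e → Finₚ.↑ʳ-injective m x z (inj (m ↑ʳ x) (m ↑ʳ z) (trans (⧺-ʳ f q x) (trans e (sym (⧺-ʳ f q z))))))
          (λ x → trans (sym (trans (cong (f ⧺ q) (⧺-ʳ (λ i → cyc i ↑ˡ sum μ) (λ j → m ↑ʳ blk μ j) x)) (⧺-ʳ f q (blk μ x)))) (trans (eqv (m ↑ʳ x)) (cong σ (⧺-ʳ f q x))))
          (λ x → cong₂ _∨_ (trans (cong U (sym (⧺-ʳ f q x))) (av (m ↑ʳ x))) (¬true→false λ h → clash x (anyF⇒ {p = λ i → f i == q x} h)))
      where
      m = suc n
      f = frame m y
      f-inj : ∀ {i j} → f i ≡ f j → i ≡ j
      f-inj {i} {j} e = Finₚ.↑ˡ-injective (sum μ) i j (inj (i ↑ˡ sum μ) (j ↑ˡ sum μ) (trans (⧺-ˡ f q i) (trans e (sym (⧺-ˡ f q j)))))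
      f-eqv : Equivar cyc f
      f-eqv i = trans (sym (trans (cong (f ⧺ q) (⧺-ˡ (λ i → cyc i ↑ˡ sum μ) (λ j → m ↑ʳ blk μ j) i)) (⧺-ˡ f q (cyc i)))) (trans (eqv (i ↑ˡ sum μ)) (cong σ (⧺-ˡ f q i)))
      ↑-distinct : ∀ i x → ¬ i ↑ˡ sum μ ≡ m ↑ʳ x
      ↑-distinct i x e with trans (sym (Finₚ.splitAt-↑ˡ m i (sum μ))) (trans (cong (splitAt m) e) (Finₚ.splitAt-↑ʳ m (sum μ) x))
      ... | ()
      clash : ∀ x → ∃ (λ i → (f i == q x) ≡ true) → _
      clash x (i , e) = ↑-distinct i x (inj (i ↑ˡ sum μ) (m ↑ʳ x) (trans (⧺-ˡ f q i) (trans (==⇒≡ e) (sym (⧺-ʳ f q x)))))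
      -- Equivariance closes the frame after `m` steps, and injectivity forbids an earlier return.
      -- Injectivity also gives `m` at most `D`, within the range that `orbitLen` searches.
      ly : len y ≡ m
      ly = firstFrom-complete (λ k → iter σ k y == y) D 1 m (s≤s z≤n) (s≤s (Finₚ.injective⇒≤ {f = f} f-inj)) (≡⇒== (equivar-returns n y f-eqv))
        (λ i 1≤i i<m → ≢⇒== λ e → ℕₚ.<⇒≢ 1≤i (sym (trans (sym (Finₚ.toℕ-fromℕ< i<m)) (cong toℕ (f-inj {fromℕ< i<m} {zero}
           (trans (cong (λ k → iter σ k y) (Finₚ.toℕ-fromℕ< i<m)) e))))))

    ⇒good : ∀ U n μ y q → Stab U → Start U (suc n) y → Good (U ∪ orb (suc n) y) μ q → Good U (suc n ∷ μ) (frame (suc n) y ⧺ q)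
    ⇒good U n μ y q st (Uy , ly) (good inj eqv av) = good
        (split-cases m _ (λ i → split-cases m _ (λ j e → cong (_↑ˡ sum μ) (frame-inj m y (s≤s z≤n) ly i j (trans (sym (⧺-ˡ f q i)) (trans e (⧺-ˡ f q j)))))
                                                (λ x e → ⊥-elim (disj i x (trans (sym (⧺-ˡ f q i)) (trans e (⧺-ʳ f q x))))))
                         (λ x → split-cases m _ (λ j e → ⊥-elim (disj j x (trans (sym (⧺-ˡ f q j)) (trans (sym e) (⧺-ʳ f q x)))))
                                                (λ z e → cong (m ↑ʳ_) (inj x z (trans (sym (⧺-ʳ f q x)) (trans e (⧺-ʳ f q z)))))))
        (split-cases m _ (λ i → trans (trans (cong (f ⧺ q) (⧺-ˡ (λ i → cyc i ↑ˡ sum μ) (λ j → m ↑ʳ blk μ j) i)) (⧺-ˡ f q (cyc i)))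
                                  (trans (frame-equivar n y (returns m y (s≤s z≤n) ly) i) (cong σ (sym (⧺-ˡ f q i)))))
                         (λ x → trans (trans (cong (f ⧺ q) (⧺-ʳ (λ i → cyc i ↑ˡ sum μ) (λ j → m ↑ʳ blk μ j) x)) (⧺-ʳ f q (blk μ x)))
                                  (trans (eqv x) (cong σ (sym (⧺-ʳ f q x))))))
        (split-cases m _ (λ i → trans (cong U (⧺-ˡ f q i)) (trans (stab-iter {U} st (toℕ i) y) Uy))
                         (λ x → trans (cong U (⧺-ʳ f q x)) (proj₁ (∨-false (av x)))))
      where
      m = suc n
      f = frame m y
      disj : ∀ i x → ¬ f i ≡ q x
      disj i x e = false≢true (trans (sym (proj₂ (∨-false {U (q x)} (av x)))) (⇒anyF {p = λ i → f i == q x} i (≡⇒== e)))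

    cnt-step : ∀ U n μ → Stab U → cnt U (suc n ∷ μ) ≡ ∑ λ y → χ (start? U (suc n) y) * cnt (U ∪ orb (suc n) y) μ
    cnt-step U n μ st = begin
      cnt U (suc n ∷ μ)
        ≡⟨ ∑ₘ-⧺ (suc n) (λ r → χ (good? U (suc n ∷ μ) r)) (good-Ext U (suc n ∷ μ)) ⟩
      ∑ₘ G
        ≡⟨ ∑-cong (λ i → spread (app i)) ⟩
      ∑ₘ (λ p → ∑ λ y → 𝟙 (eqM p (frame (suc n) y)) * G p)
        ≡⟨ ∑-comm (λ i y → 𝟙 (eqM (app i) (frame (suc n) y)) * G (app i)) ⟩
      ∑ (λ y → ∑ₘ λ p → 𝟙 (eqM p (frame (suc n) y)) * G p)
        ≡⟨ ∑-cong (λ y → ∑ₘ-δ (frame (suc n) y) G G-ext) ⟩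
      ∑ (λ y → G (frame (suc n) y))
        ≡⟨ ∑-cong (λ y → trans (∑-cong λ i → trans (χ-cong (good? U (suc n ∷ μ) (frame (suc n) y ⧺ app i)) (start? U (suc n) y ×-dec good? (U ∪ orb (suc n) y) μ (app i))
                (good⇒ U n μ y (app i)) (λ (s , g) → ⇒good U n μ y (app i) st s g)) (χ-× (start? U (suc n) y) (good? (U ∪ orb (suc n) y) μ (app i))))
              (∑-*ˡ (χ (start? U (suc n) y)) (λ i → χ (good? (U ∪ orb (suc n) y) μ (app i))))) ⟩
      ∑ (λ y → χ (start? U (suc n) y) * cnt (U ∪ orb (suc n) y) μ) ∎
      where
      G : (Fin (suc n) → Fin D) → ℤ
      G p = ∑ₘ λ q → χ (good? U (suc n ∷ μ) (p ⧺ q))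
      G-ext : Ext G
      G-ext h = ∑-cong λ i → good-Ext U (suc n ∷ μ) (⧺-cong h (λ _ → refl))
      G-zero : ∀ p → ¬ (∀ i → p i ≡ frame (suc n) (p zero) i) → G p ≡ 0ℤ
      G-zero p h = ∑-zero λ j → χ-no (good? U (suc n ∷ μ) (p ⧺ app j)) λ g → h (equivar-frame p λ i →
        trans (sym (trans (cong (p ⧺ app j) (⧺-ˡ (λ i → cyc i ↑ˡ sum μ) (λ j → suc n ↑ʳ blk μ j) i)) (⧺-ˡ p (app j) (cyc i)))) (trans (Good.equivar g (i ↑ˡ sum μ)) (cong σ (⧺-ˡ p (app j) i))))
      -- `G p` vanishes unless `p` is the frame of its own first value, so inserting the sum over
      -- all `y` adds a single nonzero indicator wherever it matters.
      spread : ∀ p → G p ≡ ∑ λ y → 𝟙 (eqM p (frame (suc n) y)) * G p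
      spread p = go (Finₚ.all? λ i → p i Finₚ.≟ frame (suc n) (p zero) i)
        where
        go : Dec (∀ i → p i ≡ frame (suc n) (p zero) i) → G p ≡ ∑ λ y → 𝟙 (eqM p (frame (suc n) y)) * G p
        go (no h) = trans (G-zero p h) (sym (∑-zero λ y → trans (cong (𝟙 (eqM p (frame (suc n) y)) *_) (G-zero p h)) (ℤₚ.*-zeroʳ (𝟙 (eqM p (frame (suc n) y))))))
        go (yes h) = sym (trans (∑-cong λ y → cong (λ b → 𝟙 b * G p) (⇔→≡
            (λ e → ≡⇒== (sym (eqM⇒ {f = p} {frame (suc n) y} e zero)))
            (λ e → ⇒eqM {f = p} {frame (suc n) y} λ i → trans (h i) (cong (iter σ (toℕ i)) (sym (==⇒≡ {x = y} e)))))) (∑-δ (p zero) (λ _ → G p)))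

    𝟙-anyF : ∀ {m} (f : Fin m → Fin D) → (∀ i j → f i ≡ f j → i ≡ j) → ∀ z → 𝟙 (anyF λ i → f i == z) ≡ ∑ λ i → 𝟙 (f i == z)
    𝟙-anyF f inj z with Finₚ.any? (λ i → f i Finₚ.≟ z)
    ... | yes (i , refl) = trans (cong 𝟙 (⇒anyF {p = λ j → f j == f i} i (==-refl (f i)))) (sym (trans (∑-cong λ j → trans (cong 𝟙 (⇔→≡
        (λ e → ≡⇒== (inj j i (==⇒≡ e))) (λ e → ≡⇒== (cong f (==⇒≡ {x = j} e))))) (sym (ℤₚ.*-identityʳ (𝟙 (j == i))))) (∑-δ i (λ _ → 1ℤ))))
    ... | no n = trans (cong 𝟙 (¬true→false λ h → n (proj₁ (anyF⇒ {p = λ i → f i == z} h) , ==⇒≡ (proj₂ (anyF⇒ {p = λ i → f i == z} h)))))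
        (sym (∑-zero λ i → cong 𝟙 (≢⇒== λ e → n (i , e))))

    free : (Fin D → Bool) → (Fin D → ℤ) → ℤ
    free U w = ∑ λ y → 𝟙 (not (U y)) * w y

    free-step : ∀ U n y (w : Fin D → ℤ) → Stab U → Start U (suc n) y → (∀ x → w (σ x) ≡ w x) →
      free U w ≡ free (U ∪ orb (suc n) y) w + + suc n * w y
    free-step U n y w st (Uy , ly) wσ = sym (begin
      free (U ∪ O) w + + m * w y
        ≡⟨ cong (_+_ (free (U ∪ O) w)) (trans (sym (∑-const {m} (w y))) (trans (∑-cong λ i → trans (sym (w-iter (toℕ i))) (sym (∑-δ′ (frame m y i) w)))
             (trans (∑-comm λ i z → 𝟙 (frame m y i == z) * w z) (∑-cong λ z → trans (∑-*ʳ (w z) (λ i → 𝟙 (frame m y i == z)))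
                (cong (_* w z) (sym (𝟙-anyF (frame m y) (frame-inj m y (s≤s z≤n) ly) z))))))) ⟩
      free (U ∪ O) w + ∑ (λ z → 𝟙 (O z) * w z)
        ≡⟨ sym (∑-+ (λ z → 𝟙 (not ((U ∪ O) z)) * w z) (λ z → 𝟙 (O z) * w z)) ⟩
      ∑ (λ z → 𝟙 (not (U z ∨ O z)) * w z + 𝟙 (O z) * w z)
        ≡⟨ ∑-cong (λ z → trans (sym (ℤₚ.*-distribʳ-+ (w z) (𝟙 (not (U z ∨ O z))) (𝟙 (O z)))) (cong (_* w z) (excl (U z) (O z) (disj z)))) ⟩
      free U w ∎)
      where
      m = suc n
      O = orb m y
      w-iter : ∀ k → w (iter σ k y) ≡ w y
      w-iter zero = refl
      w-iter (suc k) = trans (wσ (iter σ k y)) (w-iter k)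
      disj : ∀ z → O z ≡ true → U z ≡ false
      disj z h with anyF⇒ {p = λ i → frame m y i == z} h
      ... | i , e = trans (cong U (sym (==⇒≡ e))) (trans (stab-iter {U} st (toℕ i) y) Uy)
      excl : ∀ a b → (b ≡ true → a ≡ false) → 𝟙 (not (a ∨ b)) + 𝟙 b ≡ 𝟙 (not a)
      excl true true h = ⊥-elim (false≢true (sym (h refl)))
      excl true false h = refl
      excl false true h = refl
      excl false false h = refl

    stab-∪ : ∀ U n y → Stab U → Start U (suc n) y → Stab (U ∪ orb (suc n) y)
    stab-∪ U n y st (Uy , ly) x = cong₂ _∨_ (st x) (⇔→≡
        (λ h → let (i , e) = anyF⇒ {p = λ i → frame m y i == σ x} h in back i (==⇒≡ e))
        (λ h → let (i , e) = anyF⇒ {p = λ i → frame m y i == x} h in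
          ⇒anyF {p = λ i → frame m y i == σ x} (cyc i) (≡⇒== (trans (frame-equivar n y ret i) (cong σ (==⇒≡ e))))))
      where
      m = suc n
      ret = returns m y (s≤s z≤n) ly
      back : ∀ i → frame m y i ≡ σ x → orb m y x ≡ true
      -- The predecessor of `y` under σ is the last entry of its frame.
      back zero e = ⇒anyF {p = λ i → frame m y i == x} (fromℕ n) (≡⇒== (injective (trans (trans (cong (λ k → σ (iter σ k y)) (Finₚ.toℕ-fromℕ n)) ret) e)))
      back (suc i) e = ⇒anyF {p = λ i → frame m y i == x} (inject₁ i) (≡⇒== (trans (cong (λ k → iter σ k y) (Finₚ.toℕ-inject₁ i)) (injective e)))

    census : (Fin D → Bool) → ℕ → ℤ
    census U j = free U (λ x → 𝟙 (len x ≡ᵇ j))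

    census-step : ∀ U n y j → Stab U → Start U (suc n) y → census U j ≡ census (U ∪ orb (suc n) y) j + + suc n * 𝟙 (suc n ≡ᵇ j)
    census-step U n y j st s = trans (free-step U n y (λ x → 𝟙 (len x ≡ᵇ j)) st s (λ x → cong (λ l → 𝟙 (l ≡ᵇ j)) (len-σ x)))
      (cong (λ l → census (U ∪ orb (suc n) y) j + + suc n * 𝟙 (l ≡ᵇ j)) (proj₂ s))

    target : List ℕ → ℕ → ℤ
    target μ j = + j * + mult μ j

    target-∷ : ∀ m μ j → target (m ∷ μ) j ≡ target μ j + + m * 𝟙 (m ≡ᵇ j)
    target-∷ m μ j = trans (cong (+ j *_) (mult-∷ m μ j)) (trans (alg (+ j) (𝟙 (m ≡ᵇ j)) (+ mult μ j)) (cong (_+_ (target μ j)) (key (m ≡ᵇ j) refl)))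
      where
      alg : ∀ a b c → a * (b + c) ≡ a * c + a * b
      alg = solve-∀
      key : ∀ b → (m ≡ᵇ j) ≡ b → + j * 𝟙 b ≡ + m * 𝟙 b
      key true e = cong (λ k → + k * 1ℤ) (sym (≡ᵇ⇒≡ {m} e))
      key false e = trans (ℤₚ.*-zeroʳ (+ j)) (sym (ℤₚ.*-zeroʳ (+ m)))

    starts : ∀ U m → ∑ (λ y → χ (start? U m y)) ≡ census U m
    starts U m = ∑-cong λ y → trans (χ-× (U y Boolₚ.≟ false) (len y ℕₚ.≟ m)) (cong₂ _*_ (a (U y)) (b (len y)))
      where
      a : ∀ u → χ (u Boolₚ.≟ false) ≡ 𝟙 (not u)
      a true = refl
      a false = refl
      b : ∀ l → χ (l ℕₚ.≟ m) ≡ 𝟙 (l ≡ᵇ m)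
      b l = refl

    -- The number of admissible starts for the next part is the census at its length. Using up a
    -- cycle lowers census and target by the same amount, so the match persists and the choices
    -- multiply to `zf μ`.
    cnt-match : ∀ U μ → Stab U → All (1 ℕ.≤_) μ → (∀ j → 1 ℕ.≤ j → census U j ≡ target μ j) → cnt U μ ≡ + zf μ
    cnt-match U [] st [] match = trans (∑ₘ-zero (λ q → χ (good? U [] q)) (good-Ext U []) (λ ())) (χ-yes (good? U [] (λ ())) (good (λ ()) (λ ()) (λ ())))
    cnt-match U (suc n ∷ μ) st (_ ∷ pos) match = begin
      cnt U (suc n ∷ μ)
        ≡⟨ cnt-step U n μ st ⟩
      ∑ (λ y → χ (start? U (suc n) y) * cnt (U ∪ orb (suc n) y) μ)
        ≡⟨ ∑-cong (λ y → χ-guard (start? U (suc n) y) (λ s → cnt-match (U ∪ orb (suc n) y) μ (stab-∪ U n y st s) pos λ j 1≤j →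
             ℤG.∙-cancelʳ (+ suc n * 𝟙 (suc n ≡ᵇ j)) _ _ (trans (sym (census-step U n y j st s)) (trans (match j 1≤j) (target-∷ (suc n) μ j))))) ⟩
      ∑ (λ y → χ (start? U (suc n) y) * + zf μ)
        ≡⟨ trans (∑-*ʳ (+ zf μ) (λ y → χ (start? U (suc n) y))) (cong (_* + zf μ) (trans (starts U (suc n)) (match (suc n) (s≤s z≤n)))) ⟩
      + suc n * + mult (suc n ∷ μ) (suc n) * + zf μ
        ≡⟨ cong (λ t → + suc n * t * + zf μ) (trans (mult-∷ (suc n) μ (suc n)) (cong (λ b → 𝟙 b + + mult μ (suc n)) (≡ᵇ-refl (suc n)))) ⟩
      + suc n * + suc (mult μ (suc n)) * + zf μ
        ≡⟨ trans (cong (_* + zf μ) (sym (ℤₚ.pos-* (suc n) (suc (mult μ (suc n)))))) (sym (ℤₚ.pos-* (suc n ℕ.* suc (mult μ (suc n))) (zf μ))) ⟩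
      + zf (suc n ∷ μ) ∎

    cnt-mismatch : ∀ U μ → Stab U → All (1 ℕ.≤_) μ → free U (λ _ → 1ℤ) ≡ + sum μ → ∀ j → ¬ census U j ≡ target μ j → cnt U μ ≡ 0ℤ
    cnt-mismatch U [] st [] size j mis = ⊥-elim (mis (trans (∑-zero λ y → trans (cong (_* 𝟙 (len y ≡ᵇ j)) (trans (sym (ℤₚ.*-identityʳ (𝟙 (not (U y)))))
        (∑-nonneg-zero (λ y → subst (0ℤ ≤_) (sym (ℤₚ.*-identityʳ (𝟙 (not (U y))))) (𝟙≥0 (not (U y)))) size y))) refl) (sym (ℤₚ.*-zeroʳ (+ j)))))
    cnt-mismatch U (suc n ∷ μ) st (_ ∷ pos) size j mis = trans (cnt-step U n μ st) (∑-zero λ y → trans (χ-guard (start? U (suc n) y) λ s →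
        cnt-mismatch (U ∪ orb (suc n) y) μ (stab-∪ U n y st s) pos
          (ℤG.∙-cancelʳ (+ suc n) _ _ (trans (cong (_+_ (free (U ∪ orb (suc n) y) (λ _ → 1ℤ))) (sym (ℤₚ.*-identityʳ (+ suc n)))) (trans (sym (free-step U n y (λ _ → 1ℤ) st s (λ _ → refl))) (trans size (ℤₚ.+-comm (+ suc n) (+ sum μ))))))
          j (λ e → mis (trans (census-step U n y j st s) (trans (cong (_+ + suc n * 𝟙 (suc n ≡ᵇ j)) e) (sym (target-∷ (suc n) μ j)))))) (ℤₚ.*-zeroʳ (χ (start? U (suc n) y))))

  open Frames using (good; good?)

  mult-big : ∀ μ j → sum μ ℕ.< j → mult μ j ≡ 0
  mult-big [] j h = refl
  mult-big (m ∷ μ) j h = ℤₚ.+-injective (trans (mult-∷ m μ j) (cong₂ (λ b k → 𝟙 b + + k) (≢ᵇ (λ e → ℕₚ.<-irrefl e (ℕₚ.≤-<-trans (ℕₚ.m≤m+n m (sum μ)) h)))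
      (mult-big μ j (ℕₚ.≤-<-trans (ℕₚ.m≤n+m (sum μ) m) h))))
    where
    ≢ᵇ : ∀ {m n} → ¬ m ≡ n → (m ≡ᵇ n) ≡ false
    ≢ᵇ {m} {n} h with m ≡ᵇ n in e
    ... | false = refl
    ... | true = ⊥-elim (h (≡ᵇ⇒≡ e))

  countF-sum : ∀ {n} (p : Fin n → Bool) → + countF p ≡ ∑ λ x → 𝟙 (p x)
  countF-sum {n} p = trans (length-filter p (List.allFin n)) (∑ᴸ-allFin n (λ x → 𝟙 (p x)))

  allL-upTo⇒ : ∀ (p : ℕ → Bool) n → allL (List.upTo n) p ≡ true → ∀ i → i ℕ.< n → p i ≡ true
  allL-upTo⇒ p n h i i<n = go id n h i i<n
    where
    go : ∀ (f : ℕ → ℕ) n → allL (List.applyUpTo f n) p ≡ true → ∀ i → i ℕ.< n → p (f i) ≡ true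
    go f (suc n) h zero _ = proj₁ (∧-true h)
    go f (suc n) h (suc i) (s≤s l) = go (f ∘ suc) n (proj₂ (∧-true {p (f 0)} h)) i l

  allL-upTo-no : ∀ (p : ℕ → Bool) n → allL (List.upTo n) p ≡ false → ∃[ i ] (i ℕ.< n × p i ≡ false)
  allL-upTo-no p n h = go id n h
    where
    go : ∀ (f : ℕ → ℕ) n → allL (List.applyUpTo f n) p ≡ false → ∃[ i ] (i ℕ.< n × p (f i) ≡ false)
    go f (suc n) h with p (f 0) in e
    ... | false = 0 , s≤s z≤n , e
    ... | true with go (f ∘ suc) n h
    ...   | i , l , q = suc i , s≤s l , q

  -- The set of conjugators from `blk μ` to σ is either empty or a coset of the centraliser. Here
  -- this is obtained by direct counting: `cnt-match` when the cycle lengths agree with μ,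
  -- `cnt-mismatch` when some length disagrees.
  conj-count : ∀ μ (σ : Map (sum μ)) → Perm σ → All (1 ℕ.≤_) μ →
    ∑ₚ (λ π → 𝟙 (eqM (π ∘ blk μ) (σ ∘ π))) ≡ + zf μ * 𝟙 (inClass (sum μ) μ σ)
  conj-count μ σ P pos = trans (∑-cong λ i → trans (sym (𝟙-∧ (isPerm {d} (app i)) (eqM (app i ∘ blk μ) (σ ∘ app i)))) (toχ (app i))) (go (inClass d μ σ) refl)
    where
    open Frames σ P hiding (good; good?)
    d = sum μ
    U : Fin d → Bool
    U _ = false
    toχ : ∀ π → 𝟙 (isPerm π ∧ eqM (π ∘ blk μ) (σ ∘ π)) ≡ χ (good? σ P U μ π)
    toχ π with isPerm π ∧ eqM (π ∘ blk μ) (σ ∘ π) in e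
    ... | true = sym (χ-yes (good? σ P U μ π) (good (λ x y → isPerm⇒Inj {σ = π} (proj₁ (∧-true e))) (eqM⇒ {f = π ∘ blk μ} {σ ∘ π} (proj₂ (∧-true {isPerm π} e))) (λ _ → refl)))
    ... | false = sym (χ-no (good? σ P U μ π) λ (good a b c) → false≢true (trans (sym e) (∧-intro (Inj⇒isPerm {σ = π} λ {x} {y} → a x y) (⇒eqM {f = π ∘ blk μ} {σ ∘ π} b))))
    censusU : ∀ j → census U j ≡ + countF (λ x → orbitLen σ x ≡ᵇ j)
    censusU j = trans (∑-cong λ y → ℤₚ.*-identityˡ (𝟙 (len y ≡ᵇ j))) (sym (countF-sum (λ x → orbitLen σ x ≡ᵇ j)))
    go : ∀ b → inClass d μ σ ≡ b → cnt U μ ≡ + zf μ * 𝟙 b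
    go true e = trans (cnt-match U μ (λ _ → refl) pos match) (sym (ℤₚ.*-identityʳ (+ zf μ)))
      where
      match : ∀ j → 1 ℕ.≤ j → census U j ≡ target μ j
      match (suc j) _ with j ℕₚ.<? d
      ... | yes j<d = trans (censusU (suc j)) (trans (cong +_ (≡ᵇ⇒≡ (allL-upTo⇒ (λ i → countF (λ x → orbitLen σ x ≡ᵇ suc i) ≡ᵇ (suc i ℕ.* mult μ (suc i))) d e j j<d))) (ℤₚ.pos-* (suc j) (mult μ (suc j))))
      -- Lengths beyond `d`, which `inClass` does not test: no orbit and no part is that long, so
      -- both sides are 0.
      ... | no j≮d = trans (∑-zero λ y → trans (ℤₚ.*-identityˡ (𝟙 (len y ≡ᵇ suc j))) (cong 𝟙 (¬true→false λ h → j≮d (subst (ℕ._≤ d) (≡ᵇ⇒≡ {len y} h) (len≤ y)))))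
                       (sym (trans (cong (λ k → + suc j * + k) (mult-big μ (suc j) (s≤s (ℕₚ.≮⇒≥ j≮d)))) (ℤₚ.*-zeroʳ (+ suc j))))
    go false e with allL-upTo-no (λ i → countF (λ x → orbitLen σ x ≡ᵇ suc i) ≡ᵇ (suc i ℕ.* mult μ (suc i))) d e
    ... | i , i<d , q = trans (cnt-mismatch U μ (λ _ → refl) pos (trans (∑-cong λ y → ℤₚ.*-identityˡ 1ℤ) (trans (∑-const {d} 1ℤ) (ℤₚ.*-identityʳ (+ d)))) (suc i)
         (λ h → false≢true (trans (sym q) (≡⇒≡ᵇ (ℤₚ.+-injective (trans (sym (censusU (suc i))) (trans h (sym (ℤₚ.pos-* (suc i) (mult μ (suc i)))))))))))
        (sym (ℤₚ.*-zeroʳ (+ zf μ)))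

  -- Sums over conjugacy classes

  ∏ : (ℕ → ℕ) → ℕ → ℕ
  ∏ f n = product (List.map f (List.upTo n))

  ∏-suc : ∀ f n → ∏ f (suc n) ≡ f 0 ℕ.* ∏ (f ∘ suc) n
  ∏-suc f n = cong (λ l → f 0 ℕ.* product l) (trans (map-applyUpTo suc f n) (sym (map-applyUpTo id (f ∘ suc) n)))

  ∏-cong : ∀ {f g} n → (∀ i → f i ≡ g i) → ∏ f n ≡ ∏ g n
  ∏-cong zero h = refl
  ∏-cong {f} {g} (suc n) h = trans (∏-suc f n) (trans (cong₂ ℕ._*_ (h 0) (∏-cong n (h ∘ suc))) (sym (∏-suc g n)))

  ∏-one : ∀ {f} n → (∀ i → f i ≡ 1) → ∏ f n ≡ 1
  ∏-one zero h = refl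
  ∏-one {f} (suc n) h = trans (∏-suc f n) (cong₂ ℕ._*_ (h 0) (∏-one n (h ∘ suc)))

  ∏-at : ∀ {f g} n i₀ c → i₀ ℕ.< n → f i₀ ≡ c ℕ.* g i₀ → (∀ i → ¬ i ≡ i₀ → f i ≡ g i) → ∏ f n ≡ c ℕ.* ∏ g n
  ∏-at {f} {g} (suc n) zero c _ e h = trans (∏-suc f n) (trans (cong₂ ℕ._*_ e (∏-cong n λ i → h (suc i) λ ()))
    (trans (ℕₚ.*-assoc c (g 0) (∏ (g ∘ suc) n)) (cong (c ℕ.*_) (sym (∏-suc g n)))))
  ∏-at {f} {g} (suc n) (suc i₀) c (s≤s l) e h = trans (∏-suc f n) (trans (cong₂ ℕ._*_ (h 0 λ ()) (∏-at n i₀ c l e λ i ne → h (suc i) (ne ∘ ℕₚ.suc-injective)))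
    (trans (alg (g 0) c (∏ (g ∘ suc) n)) (cong (c ℕ.*_) (sym (∏-suc g n)))))
    where alg : ∀ a b c → a ℕ.* (b ℕ.* c) ≡ b ℕ.* (a ℕ.* c)
          alg = solveℕ-∀

  mult-self : ∀ m μ → mult (m ∷ μ) m ≡ suc (mult μ m)
  mult-self m μ = ℤₚ.+-injective (trans (mult-∷ m μ m) (cong (λ b → 𝟙 b + + mult μ m) (≡ᵇ-refl m)))

  mult-other : ∀ m μ j → ¬ m ≡ j → mult (m ∷ μ) j ≡ mult μ j
  mult-other m μ j n with m ≡ᵇ j in e
  ... | true = ⊥-elim (n (≡ᵇ⇒≡ e))
  ... | false = refl

  -- A new part multiplies a factorial by the new multiplicity and the product of the parts by
  -- itself, which is the step of `zf`. From here comes the μ_1⋯μ_l in the denominator of the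
  -- theorem.
  aut-product : ∀ d μ → All (1 ℕ.≤_) μ → All (ℕ._≤ d) μ → autSize d μ ℕ.* product μ ≡ zf μ
  aut-product d [] [] [] = trans (ℕₚ.*-identityʳ _) (∏-one d λ i → refl)
  aut-product d (suc i ∷ μ) (_ ∷ pos) (le ∷ les) = begin
    autSize d (suc i ∷ μ) ℕ.* (suc i ℕ.* product μ)
      ≡⟨ cong (ℕ._* (suc i ℕ.* product μ)) (∏-at {λ j → mult (suc i ∷ μ) (suc j) !} {λ j → mult μ (suc j) !} d i (suc (mult μ (suc i))) le
           (cong _! (mult-self (suc i) μ)) (λ j ne → cong _! (mult-other (suc i) μ (suc j) (λ e → ne (sym (ℕₚ.suc-injective e)))))) ⟩
    suc (mult μ (suc i)) ℕ.* autSize d μ ℕ.* (suc i ℕ.* product μ)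
      ≡⟨ alg (suc (mult μ (suc i))) (autSize d μ) (suc i) (product μ) ⟩
    suc i ℕ.* suc (mult μ (suc i)) ℕ.* (autSize d μ ℕ.* product μ)
      ≡⟨ cong (suc i ℕ.* suc (mult μ (suc i)) ℕ.*_) (aut-product d μ pos les) ⟩
    zf (suc i ∷ μ) ∎
    where alg : ∀ a b c p → a ℕ.* b ℕ.* (c ℕ.* p) ≡ c ℕ.* a ℕ.* (b ℕ.* p)
          alg = solveℕ-∀

  cyc-inj : ∀ {n} {i j : Fin n} → cyc i ≡ cyc j → i ≡ j
  cyc-inj {suc n} {i} {j} = top-cases (λ i → ∀ j → cyc i ≡ cyc j → i ≡ j)
    (top-cases _ (λ _ → refl) (λ k e → ⊥-elim (0≢ k (trans (sym (cyc-top n)) (trans e (cyc-inject k))))))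
    (λ k → top-cases _ (λ e → ⊥-elim (0≢ k (trans (sym (cyc-top n)) (trans (sym e) (cyc-inject k)))))
                       (λ l e → cong inject₁ (Finₚ.suc-injective (trans (sym (cyc-inject k)) (trans e (cyc-inject l)))))) i j
    where 0≢ : ∀ {n} (k : Fin n) → ¬ zero ≡ suc k
          0≢ k ()

  ↑-disjoint : ∀ {m n} (i : Fin m) (j : Fin n) → ¬ i ↑ˡ n ≡ m ↑ʳ j
  ↑-disjoint {m} {n} i j e with trans (sym (Finₚ.splitAt-↑ˡ m i n)) (trans (cong (splitAt m) e) (Finₚ.splitAt-↑ʳ m n j))
  ... | ()

  blk-ˡ : ∀ m μ i → blk (m ∷ μ) (i ↑ˡ sum μ) ≡ cyc i ↑ˡ sum μ
  blk-ˡ m μ i = ⧺-ˡ (λ i → cyc i ↑ˡ sum μ) (λ j → m ↑ʳ blk μ j) i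

  blk-ʳ : ∀ m μ j → blk (m ∷ μ) (m ↑ʳ j) ≡ m ↑ʳ blk μ j
  blk-ʳ m μ j = ⧺-ʳ (λ i → cyc i ↑ˡ sum μ) (λ j → m ↑ʳ blk μ j) j

  blk-inj : ∀ μ → Inj (blk μ)
  blk-inj [] e = e
  blk-inj (m ∷ μ) {x} {y} = split-cases m (λ x → ∀ y → blk (m ∷ μ) x ≡ blk (m ∷ μ) y → x ≡ y)
    (λ i → split-cases m _ (λ j e → cong (_↑ˡ sum μ) (cyc-inj (Finₚ.↑ˡ-injective (sum μ) (cyc i) (cyc j) (trans (sym (blk-ˡ m μ i)) (trans e (blk-ˡ m μ j))))))
                           (λ j e → ⊥-elim (↑-disjoint (cyc i) (blk μ j) (trans (sym (blk-ˡ m μ i)) (trans e (blk-ʳ m μ j))))))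
    (λ i → split-cases m _ (λ j e → ⊥-elim (↑-disjoint (cyc j) (blk μ i) (trans (sym (blk-ˡ m μ j)) (trans (sym e) (blk-ʳ m μ i)))))
                           (λ j e → cong (m ↑ʳ_) (blk-inj μ (Finₚ.↑ʳ-injective m (blk μ i) (blk μ j) (trans (sym (blk-ʳ m μ i)) (trans e (blk-ʳ m μ j))))))) x y

  -- Double counting of the pairs (σ, π) with π ∘ `blk μ` = σ ∘ π. A member σ of the class has
  -- `zf μ` partners; every permutation π has exactly one partner, the conjugate of `blk μ` by π,
  -- and there `F` takes its value at `blk μ`.
  class-sum : ∀ μ (F : Map (sum μ) → ℤ) → Ext F → All (1 ℕ.≤_) μ →
    (∀ {π} (P : Perm π) → F (π ∘ blk μ ∘ Perm.inv P) ≡ F (blk μ)) →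
    + zf μ * ∑ₚ (λ σ → 𝟙 (inClass (sum μ) μ σ) * F σ) ≡ #perms {sum μ} * F (blk μ)
  class-sum μ F ext pos inv-F = begin
    + zf μ * ∑ₚ (λ σ → 𝟙 (inClass d μ σ) * F σ)
      ≡⟨ sym (∑-*ˡ (+ zf μ) (λ i → 𝟙 (isPerm {d} (app i)) * (𝟙 (inClass d μ (app i)) * F (app i)))) ⟩
    ∑ₘ (λ σ → + zf μ * (𝟙 (isPerm σ) * (𝟙 (inClass d μ σ) * F σ)))
      ≡⟨ ∑-cong (λ i → trans (alg (+ zf μ) (𝟙 (isPerm {d} (app i))) (𝟙 (inClass d μ (app i))) (F (app i)))
           (trans (𝟙-guard (isPerm {d} (app i)) λ e → cong (_* F (app i)) (sym (conj-count μ (app i) (toPerm (isPerm⇒Inj {σ = app i} e)) pos)))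
              (trans (cong (𝟙 (isPerm {d} (app i)) *_) (sym (∑-*ʳ (F (app i)) (λ j → 𝟙 (isPerm {d} (app j)) * 𝟙 (eqM (app j ∘ blk μ) (app i ∘ app j))))))
                (sym (∑-*ˡ (𝟙 (isPerm {d} (app i))) (λ j → 𝟙 (isPerm {d} (app j)) * 𝟙 (eqM (app j ∘ blk μ) (app i ∘ app j)) * F (app i))))))) ⟩
    ∑ₘ (λ σ → ∑ₘ λ π → 𝟙 (isPerm σ) * (𝟙 (isPerm π) * 𝟙 (eqM (π ∘ blk μ) (σ ∘ π)) * F σ))
      ≡⟨ ∑-comm (λ i j → 𝟙 (isPerm {d} (app i)) * (𝟙 (isPerm {d} (app j)) * 𝟙 (eqM (app j ∘ blk μ) (app i ∘ app j)) * F (app i))) ⟩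
    ∑ₘ (λ π → ∑ₘ λ σ → 𝟙 (isPerm σ) * (𝟙 (isPerm π) * 𝟙 (eqM (π ∘ blk μ) (σ ∘ π)) * F σ))
      ≡⟨ ∑-cong (λ j → trans (∑-cong λ i → alg₂ (𝟙 (isPerm {d} (app i))) (𝟙 (isPerm {d} (app j))) (𝟙 (eqM (app j ∘ blk μ) (app i ∘ app j))) (F (app i)))
           (∑-*ˡ (𝟙 (isPerm {d} (app j))) (λ i → 𝟙 (eqM (app j ∘ blk μ) (app i ∘ app j)) * (𝟙 (isPerm {d} (app i)) * F (app i))))) ⟩
    ∑ₚ (λ π → ∑ₘ λ σ → 𝟙 (eqM (π ∘ blk μ) (σ ∘ π)) * (𝟙 (isPerm σ) * F σ))
      ≡⟨ ∑ₚ-cong conj ⟩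
    ∑ₚ {d} (λ π → F (blk μ))
      ≡⟨ trans (∑-cong λ i → cong (_* F (blk μ)) (sym (ℤₚ.*-identityʳ (𝟙 (isPerm {d} (app i)))))) (∑-*ʳ (F (blk μ)) (λ i → 𝟙 (isPerm {d} (app i)) * 1ℤ)) ⟩
    #perms {d} * F (blk μ) ∎
    where
    d = sum μ
    alg : ∀ z a b f → z * (a * (b * f)) ≡ a * (z * b * f)
    alg = solve-∀
    alg₂ : ∀ a b c f → a * (b * c * f) ≡ b * (c * (a * f))
    alg₂ = solve-∀
    conj : ∀ π → Perm π → ∑ₘ (λ σ → 𝟙 (eqM (π ∘ blk μ) (σ ∘ π)) * (𝟙 (isPerm σ) * F σ)) ≡ F (blk μ)
    conj π P = begin
      ∑ₘ (λ σ → 𝟙 (eqM (π ∘ blk μ) (σ ∘ π)) * (𝟙 (isPerm σ) * F σ))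
        ≡⟨ ∑-cong (λ i → cong (λ b → 𝟙 b * (𝟙 (isPerm {d} (app i)) * F (app i))) (⇔→≡
             (λ e → ⇒eqM {f = app i} {ρ} λ x → trans (cong (app i) (sym (right x))) (sym (eqM⇒ {f = π ∘ blk μ} {app i ∘ π} e (inv x))))
             (λ e → ⇒eqM {f = π ∘ blk μ} {app i ∘ π} λ x → trans (cong (π ∘ blk μ) (sym (left x))) (sym (eqM⇒ {f = app i} {ρ} e (π x)))))) ⟩
      ∑ₘ (λ σ → 𝟙 (eqM σ ρ) * (𝟙 (isPerm σ) * F σ))
        ≡⟨ ∑ₘ-δ ρ (λ σ → 𝟙 (isPerm σ) * F σ) (Ext-perm ext) ⟩
      𝟙 (isPerm ρ) * F ρ
        ≡⟨ cong (λ b → 𝟙 b * F ρ) (Inj⇒isPerm {σ = ρ} λ {x} {y} e → Perm.injective inverse (blk-inj μ (injective e))) ⟩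
      1ℤ * F ρ ≡⟨ ℤₚ.*-identityˡ (F ρ) ⟩
      F ρ ≡⟨ inv-F P ⟩
      F (blk μ) ∎
      where
      open Perm P
      ρ : Map d
      ρ = π ∘ blk μ ∘ inv

  -- The class of transpositions as the set of swaps.

  sum-ones : ∀ k → sum (replicate k 1) ≡ k
  sum-ones zero = refl
  sum-ones (suc k) = cong suc (sum-ones k)

  ones-pos : ∀ k → All (1 ℕ.≤_) (replicate k 1)
  ones-pos zero = []
  ones-pos (suc k) = s≤s z≤n ∷ ones-pos k

  mult-ones : ∀ k → mult (replicate k 1) 1 ≡ k
  mult-ones zero = refl
  mult-ones (suc k) = cong suc (mult-ones k)

  zf-ones : ∀ k → zf (replicate k 1) ≡ k !
  zf-ones zero = refl
  zf-ones (suc k) = cong₂ (λ a b → (suc a ℕ.+ 0) ℕ.* b) (mult-ones k) (zf-ones k) ⟨trans⟩ cong (ℕ._* k !) (ℕₚ.+-identityʳ (suc k))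
    where
    _⟨trans⟩_ : ∀ {x y z : ℕ} → x ≡ y → y ≡ z → x ≡ z
    _⟨trans⟩_ = trans

  cyc₁ : ∀ (i : Fin 1) → cyc i ≡ i
  cyc₁ zero = refl

  blk-ones : ∀ k x → blk (replicate k 1) x ≡ x
  blk-ones zero ()
  blk-ones (suc k) = split-cases 1 _ (λ i → trans (blk-ˡ 1 (replicate k 1) i) (cong (_↑ˡ sum (replicate k 1)) (cyc₁ i)))
                                     (λ j → trans (blk-ʳ 1 (replicate k 1) j) (cong (1 ↑ʳ_) (blk-ones k j)))

  ∑-nonzero : ∀ {n} (f : Fin n → ℤ) → ¬ ∑ f ≡ 0ℤ → ∃[ i ] ¬ f i ≡ 0ℤ
  ∑-nonzero f h with Finₚ.any? (λ i → ¬? (f i ℤₚ.≟ 0ℤ))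
  ... | yes p = p
  ... | no n = ⊥-elim (h (∑-zero λ i → decidable-stable (f i ℤₚ.≟ 0ℤ) (λ q → n (i , q))))

  sw-unique : ∀ {d} {a b x y : Fin d} → lt a b ≡ true → lt x y ≡ true → (∀ z → sw a b z ≡ sw x y z) → x ≡ a × y ≡ b
  sw-unique {d} {a} {b} {x} {y} ab xy h with x Finₚ.≟ a
  ... | yes refl = refl , trans (sym (sw-l x y)) (trans (sym (h x)) (sw-l x b))
  ... | no x≢a with x Finₚ.≟ b
  ...   | no x≢b = ⊥-elim (lt⇒≢ x y xy (trans (sym (sw-o x≢a x≢b)) (trans (h x) (sw-l x y))))
  ...   | yes refl = ⊥-elim (ℕₚ.<-asym (lt⇒< {x = a} {x} ab) (subst (λ w → toℕ x ℕ.< toℕ w) (trans (sym (sw-l x y)) (trans (sym (h x)) (sw-r a x))) (lt⇒< {x = x} {y} xy)))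

  swaps-count : ∀ {d} (τ : Map d) (a b : Fin d) → lt a b ≡ true → (∀ z → τ z ≡ sw a b z) → ∑₂ (λ x y → 𝟙 (eqM τ (sw x y))) ≡ 1ℤ
  swaps-count τ a b ab h = begin
    ∑₂ (λ x y → 𝟙 (eqM τ (sw x y)))
      ≡⟨ ∑-cong (λ x → ∑-cong λ y → trans (sym (𝟙-∧ (lt x y) (eqM τ (sw x y)))) (trans (cong 𝟙 (⇔→≡
           (λ e → let (p , q) = sw-unique ab (proj₁ (∧-true {lt x y} e)) (λ z → trans (sym (h z)) (eqM⇒ {f = τ} {sw x y} (proj₂ (∧-true {lt x y} e)) z))
                  in ∧-intro (≡⇒== p) (≡⇒== q))
           (λ e → back x y (==⇒≡ (proj₁ (∧-true {x == a} e))) (==⇒≡ (proj₂ (∧-true {x == a} e)))))) (trans (𝟙-∧ (x == a) (y == b)) (cong (𝟙 (x == a) *_) (sym (ℤₚ.*-identityʳ (𝟙 (y == b)))))))) ⟩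
    ∑ (λ x → ∑ λ y → 𝟙 (x == a) * (𝟙 (y == b) * 1ℤ))
      ≡⟨ ∑-cong (λ x → trans (∑-*ˡ (𝟙 (x == a)) (λ y → 𝟙 (y == b) * 1ℤ)) (cong (𝟙 (x == a) *_) (∑-δ b (λ _ → 1ℤ)))) ⟩
    ∑ (λ x → 𝟙 (x == a) * 1ℤ) ≡⟨ ∑-δ a (λ _ → 1ℤ) ⟩
    1ℤ ∎
    where
    back : ∀ x y → x ≡ a → y ≡ b → lt x y ∧ eqM τ (sw x y) ≡ true
    back x y refl refl = ∧-intro ab (⇒eqM {f = τ} {sw x y} h)

  swaps-count′ : ∀ {d} (τ : Map d) (a b : Fin d) → ¬ a ≡ b → (∀ z → τ z ≡ sw a b z) → ∑₂ (λ x y → 𝟙 (eqM τ (sw x y))) ≡ 1ℤ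
  swaps-count′ τ a b ne h with Finₚ.<-cmp a b
  ... | tri< p _ _ = swaps-count τ a b (<⇒lt p) h
  ... | tri≈ _ q _ = ⊥-elim (ne q)
  ... | tri> _ _ p = swaps-count τ b a (<⇒lt p) (λ z → trans (h z) (sw-sym a b z))

  blk-transposition : ∀ k x → blk (2 ∷ replicate k 1) x ≡ sw zero (suc zero) x
  blk-transposition k = split-cases 2 _
    (λ { zero → trans (blk-ˡ 2 μ zero) refl ; (suc zero) → trans (blk-ˡ 2 μ (suc zero)) refl })
    (λ j → trans (blk-ʳ 2 μ j) (cong (2 ↑ʳ_) (blk-ones k j)))
    where μ = replicate k 1

  conj-count≢0 : ∀ {d} (σ₀ τ : Map d) → ¬ ∑ₚ (λ π → 𝟙 (eqM (π ∘ σ₀) (τ ∘ π))) ≡ 0ℤ →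
    Σ[ π ∈ Map d ] Perm π × (∀ z → π (σ₀ z) ≡ τ (π z))
  conj-count≢0 {d} σ₀ τ h = π , toPerm (isPerm⇒Inj {σ = π} (proj₁ ok)) , eqM⇒ {f = π ∘ σ₀} {τ ∘ π} (proj₂ ok)
    where
    split : ∀ a b → ¬ 𝟙 a * 𝟙 b ≡ 0ℤ → a ≡ true × b ≡ true
    split true true _ = refl , refl
    split true false n = ⊥-elim (n refl)
    split false b n = ⊥-elim (n refl)
    found = ∑-nonzero (λ i → 𝟙 (isPerm {d} (app i)) * 𝟙 (eqM (app i ∘ σ₀) (τ ∘ app i))) h
    π : Map d
    π = app (proj₁ found)
    ok = split (isPerm π) (eqM (π ∘ σ₀) (τ ∘ π)) (proj₂ found)

  conj-count≡0 : ∀ {d} (σ₀ τ : Map d) → ∑ₚ (λ π → 𝟙 (eqM (π ∘ σ₀) (τ ∘ π))) ≡ 0ℤ →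
    ∀ π → Perm π → ¬ (∀ z → π (σ₀ z) ≡ τ (π z))
  conj-count≡0 {d} σ₀ τ h π P rel = 1≢0 (trans (sym (cong₂ (λ a b → 𝟙 a * 𝟙 b)
      (trans (isPerm-cong (app-code π)) (Inj⇒isPerm {σ = π} (Perm.injective P)))
      (⇒eqM {f = app (code π) ∘ σ₀} {τ ∘ app (code π)} λ z → trans (app-code π (σ₀ z)) (trans (rel z) (cong τ (sym (app-code π z)))))))
      (∑-nonneg-zero (λ i → subst (0ℤ ℤ.≤_) (𝟙-∧ (isPerm {d} (app i)) (eqM (app i ∘ σ₀) (τ ∘ app i))) (𝟙≥0 (isPerm {d} (app i) ∧ eqM (app i ∘ σ₀) (τ ∘ app i)))) h (code π)))
    where
    1≢0 : ¬ 1ℤ * 1ℤ ≡ 0ℤ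
    1≢0 ()

  conj-swap-one : ∀ {d} {σ₀ τ π : Map d} {x₀ y₀ : Fin d} → ¬ x₀ ≡ y₀ → (∀ z → σ₀ z ≡ sw x₀ y₀ z) → Perm π →
    (∀ z → π (σ₀ z) ≡ τ (π z)) → ∑₂ (λ x y → 𝟙 (eqM τ (sw x y))) ≡ 1ℤ
  conj-swap-one {σ₀ = σ₀} {τ} {π} {x₀} {y₀} ne s P rel = swaps-count′ τ (π x₀) (π y₀) (λ q → ne (injective q)) λ z → begin
    τ z ≡⟨ cong τ (sym (right z)) ⟩
    τ (π (inv z)) ≡⟨ sym (rel (inv z)) ⟩
    π (σ₀ (inv z)) ≡⟨ cong π (s (inv z)) ⟩
    π (sw x₀ y₀ (inv z)) ≡⟨ sw-conj injective x₀ y₀ (inv z) ⟩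
    sw (π x₀) (π y₀) (π (inv z)) ≡⟨ cong (sw (π x₀) (π y₀)) (right z) ⟩
    sw (π x₀) (π y₀) z ∎
    where open Perm P

  conj-swap-none : ∀ {d} {σ₀ τ : Map d} {x₀ y₀ : Fin d} → ¬ x₀ ≡ y₀ → (∀ z → σ₀ z ≡ sw x₀ y₀ z) →
    (∀ π → Perm π → ¬ (∀ z → π (σ₀ z) ≡ τ (π z))) → ∑₂ (λ x y → 𝟙 (eqM τ (sw x y))) ≡ 0ℤ
  conj-swap-none {d} {σ₀} {τ} {x₀} {y₀} ne s none = ∑₂-zero λ x y xy → zero-if x y xy (eqM τ (sw x y)) refl
    where
    zero-if : ∀ x y → lt x y ≡ true → ∀ b → eqM τ (sw x y) ≡ b → 𝟙 b ≡ 0ℤ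
    zero-if x y xy false _ = refl
    zero-if x y xy true q with move-pair x₀ y₀ x y ne (lt⇒≢ x y xy)
    ... | π , P , πx₀ , πy₀ = ⊥-elim (none π P λ z → trans (cong π (s z)) (trans (sw-conj (Perm.injective P) x₀ y₀ z)
          (trans (cong₂ (λ a b → sw a b (π z)) πx₀ πy₀) (sym (eqM⇒ {f = τ} {sw x y} q (π z))))))

  zf-transposition : ∀ k → ¬ + zf (2 ∷ replicate k 1) ≡ 0ℤ
  zf-transposition k e = nonzero (mult (replicate k 1) 2) (zf (replicate k 1)) (λ z → ℕ.≢-nonZero⁻¹ (k !) {{ℕₚ._!≢0 k}} (trans (sym (zf-ones k)) z))
      (ℤₚ.+-injective e)
    where
    nonzero : ∀ m z → ¬ z ≡ 0 → ¬ 2 ℕ.* suc m ℕ.* z ≡ 0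
    nonzero m zero n _ = n refl

  -- Kept general in d: for d = 2 + k the Boolean quantifiers over Fin d would unfold.
  swap-class : ∀ d (σ₀ τ : Map d) (x₀ y₀ : Fin d) → ¬ x₀ ≡ y₀ → (∀ z → σ₀ z ≡ sw x₀ y₀ z) → ∀ (c : ℤ) → ¬ c ≡ 0ℤ → ∀ b →
    ∑ₚ (λ π → 𝟙 (eqM (π ∘ σ₀) (τ ∘ π))) ≡ c * 𝟙 b → 𝟙 b ≡ ∑₂ (λ x y → 𝟙 (eqM τ (sw x y)))
  swap-class d σ₀ τ x₀ y₀ ne s c c≢0 true e with conj-count≢0 σ₀ τ (λ z → c≢0 (trans (sym (ℤₚ.*-identityʳ c)) (trans (sym e) z)))
  ... | π , P , rel = sym (conj-swap-one ne s P rel)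
  swap-class d σ₀ τ x₀ y₀ ne s c c≢0 false e = sym (conj-swap-none ne s (conj-count≡0 σ₀ τ (trans e (ℤₚ.*-zeroʳ c))))

  private
    transposition-class′ : ∀ k (τ : Map (sum (2 ∷ replicate k 1))) → Perm τ →
      𝟙 (inClass (sum (2 ∷ replicate k 1)) (2 ∷ replicate k 1) τ) ≡ ∑₂ (λ x y → 𝟙 (eqM τ (sw x y)))
    transposition-class′ k τ T = swap-class (sum (2 ∷ replicate k 1)) (blk (2 ∷ replicate k 1)) τ zero (suc zero) (λ ()) (blk-transposition k)
      (+ zf (2 ∷ replicate k 1)) (zf-transposition k) (inClass (sum (2 ∷ replicate k 1)) (2 ∷ replicate k 1) τ) (conj-count (2 ∷ replicate k 1) τ T (s≤s z≤n ∷ ones-pos k))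

  -- By `conj-count`, membership means that a conjugator from the swap of 0 and 1 exists. Conjugates
  -- of swaps are swaps, and `move-pair` reaches all of them. The transport is there because the
  -- parts 2, 1, ..., 1 add up to `d` only propositionally.
  transposition-class : ∀ d → 2 ℕ.≤ d → (τ : Map d) → Perm τ →
    𝟙 (inClass d (transpositionType d) τ) ≡ ∑₂ (λ x y → 𝟙 (eqM τ (sw x y)))
  transposition-class (suc (suc k)) (s≤s (s≤s z≤n)) =
    subst (λ n → (τ : Map n) → Perm τ → 𝟙 (inClass n (2 ∷ replicate k 1) τ) ≡ ∑₂ (λ x y → 𝟙 (eqM τ (sw x y))))
          (cong (2 ℕ.+_) (sum-ones k)) (transposition-class′ k)

  transposition-sum : ∀ d → 2 ℕ.≤ d → (F : Map d → ℤ) → Ext F →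
    ∑ₚ (λ τ → 𝟙 (inClass d (transpositionType d) τ) * F τ) ≡ ∑₂ (λ x y → F (sw x y))
  transposition-sum d 2≤d F ext = begin
    ∑ₚ (λ τ → 𝟙 (inClass d (transpositionType d) τ) * F τ)
      ≡⟨ ∑ₚ-cong (λ τ T → trans (cong (_* F τ) (transposition-class d 2≤d τ T)) (sym (∑₂-*ʳ (F τ) (λ x y → 𝟙 (eqM τ (sw x y)))))) ⟩
    ∑ₚ (λ τ → ∑₂ λ x y → 𝟙 (eqM τ (sw x y)) * F τ)
      ≡⟨ ∑-cong (λ i → trans (sym (∑₂-*ˡ (𝟙 (isPerm {d} (app i))) (λ x y → 𝟙 (eqM (app i) (sw x y)) * F (app i))))
           (∑₂-cong λ x y _ → alg (𝟙 (isPerm {d} (app i))) (𝟙 (eqM (app i) (sw x y))) (F (app i)))) ⟩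
    ∑ₘ (λ τ → ∑₂ λ x y → 𝟙 (eqM τ (sw x y)) * (𝟙 (isPerm τ) * F τ))
      ≡⟨ sym (∑₂-∑ (λ x y i → 𝟙 (eqM (app i) (sw x y)) * (𝟙 (isPerm {d} (app i)) * F (app i)))) ⟩
    ∑₂ (λ x y → ∑ₘ λ τ → 𝟙 (eqM τ (sw x y)) * (𝟙 (isPerm τ) * F τ))
      ≡⟨ ∑₂-cong (λ x y _ → trans (∑ₘ-δ (sw x y) (λ τ → 𝟙 (isPerm τ) * F τ) (Ext-perm ext))
           (trans (cong (λ b → 𝟙 b * F (sw x y)) (Inj⇒isPerm {σ = sw x y} (Perm.injective (sw-perm x y)))) (ℤₚ.*-identityˡ (F (sw x y))))) ⟩
    ∑₂ (λ x y → F (sw x y)) ∎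
    where alg : ∀ a b c → a * (b * c) ≡ b * (a * c)
          alg = solve-∀

  -- Signs

  inversions : ∀ {d} → Map d → ℤ
  inversions f = ∑₂ λ x y → 𝟙 (lt (f y) (f x))

  inversions-ext : ∀ {d} → Ext (inversions {d})
  inversions-ext h = ∑₂-cong λ x y _ → cong₂ (λ a b → 𝟙 (lt a b)) (h y) (h x)

  inversions≥0 : ∀ {d} (f : Map d) → 0ℤ ≤ inversions f
  inversions≥0 f = ∑-nonneg λ x → ∑-nonneg λ y → subst (0ℤ ≤_) (𝟙-∧ (lt x y) (lt (f y) (f x))) (𝟙≥0 (lt x y ∧ lt (f y) (f x)))

  lt-asym : ∀ {n} (x y : Fin n) → lt x y ≡ true → lt y x ≡ false
  lt-asym zero (suc y) _ = refl
  lt-asym (suc x) (suc y) h = lt-asym x y h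

  lt-total : ∀ {n} (x y : Fin n) → ¬ x ≡ y → 𝟙 (lt x y) ≡ 1ℤ - 𝟙 (lt y x)
  lt-total x y n = trans (alg (𝟙 (lt x y)) (𝟙 (lt y x)) (𝟙 (x == y))) (trans (cong (λ t → t - 𝟙 (lt y x) - 𝟙 (x == y)) (sym (lt-trich x y)))
    (trans (cong (λ b → 1ℤ - 𝟙 (lt y x) - 𝟙 b) (≢⇒== n)) (ℤₚ.+-identityʳ _)))
    where alg : ∀ a b c → a ≡ (a + b + c) - b - c
          alg = solve-∀

  -- Additivity of the inversion number modulo 2; the minus sign is a convenient choice. `φ` is the
  -- symmetric indicator that `f` inverts an unordered pair, so `π` may reindex it. A pair is
  -- inverted by `f ∘ π` when exactly one of the two maps inverts it, and `ab` is the overlap.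
  inversions-∘ : ∀ {d} {f π : Map d} → Inj f → Perm π → ∃[ m ] inversions (f ∘ π) ≡ inversions f - inversions π + + 2 * m
  inversions-∘ {d} {f} {π} f-inj P = M , (begin
    inversions (f ∘ π)
      ≡⟨ ∑₂-cong split ⟩
    ∑₂ (λ x y → (φ (π x) (π y) - 𝟙 (lt (π y) (π x))) + + 2 * ab x y)
      ≡⟨ trans (∑₂-+ (λ x y → φ (π x) (π y) - 𝟙 (lt (π y) (π x))) (λ x y → + 2 * ab x y))
           (cong₂ _+_ (∑₂-- (λ x y → φ (π x) (π y)) (λ x y → 𝟙 (lt (π y) (π x)))) (∑₂-*ˡ (+ 2) ab)) ⟩
    ∑₂ (λ x y → φ (π x) (π y)) - inversions π + + 2 * M
      ≡⟨ cong (λ t → t - inversions π + + 2 * M) (trans (∑₂-bij φ φ-sym π inv right left) (∑₂-cong λ x y h → φ-lt x y h)) ⟩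
    inversions f - inversions π + + 2 * M ∎)
    where
    open Perm P
    ab φ : Fin d → Fin d → ℤ
    ab x y = 𝟙 (lt (f (π y)) (f (π x))) * 𝟙 (lt (π y) (π x))
    φ x y = 𝟙 (lt x y) * 𝟙 (lt (f y) (f x)) + 𝟙 (lt y x) * 𝟙 (lt (f x) (f y))
    M = ∑₂ ab
    φ-sym : ∀ x y → φ x y ≡ φ y x
    φ-sym x y = ℤₚ.+-comm (𝟙 (lt x y) * 𝟙 (lt (f y) (f x))) (𝟙 (lt y x) * 𝟙 (lt (f x) (f y)))
    φ-lt : ∀ x y → lt x y ≡ true → φ x y ≡ 𝟙 (lt (f y) (f x))
    φ-lt x y h rewrite h | lt-asym x y h = trans (ℤₚ.+-identityʳ _) (ℤₚ.*-identityˡ _)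
    split : ∀ x y → lt x y ≡ true → 𝟙 (lt (f (π y)) (f (π x))) ≡ (φ (π x) (π y) - 𝟙 (lt (π y) (π x))) + + 2 * ab x y
    split x y h = sym (trans (cong₂ (λ u v → (u * a + b * v - b) + + 2 * (a * b)) (lt-total (π x) (π y) ne) (lt-total (f (π x)) (f (π y)) (ne ∘ f-inj))) (alg a b))
      where
      a = 𝟙 (lt (f (π y)) (f (π x)))
      b = 𝟙 (lt (π y) (π x))
      ne : ¬ π x ≡ π y
      ne e = lt⇒≢ x y h (injective e)
      alg : ∀ a b → ((1ℤ - b) * a + b * (1ℤ - a) - b) + + 2 * (a * b) ≡ a
      alg = solve-∀

  ∑-last : ∀ {n} (f : Fin (suc n) → ℤ) → ∑ f ≡ ∑ (f ∘ inject₁) + f (fromℕ n)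
  ∑-last {zero} f = trans (∑-suc f) (trans (cong (_+_ (f zero)) (∑-empty _)) (trans (ℤₚ.+-comm (f zero) 0ℤ) (cong (_+ f zero) (sym (∑-empty _)))))
  ∑-last {suc n} f = trans (∑-suc f) (trans (cong (_+_ (f zero)) (∑-last (f ∘ suc))) (trans (sym (ℤₚ.+-assoc (f zero) _ _)) (cong (_+ f (fromℕ (suc n))) (sym (∑-suc (f ∘ inject₁))))))

  lt-inject : ∀ {n} (x y : Fin n) → lt (inject₁ x) (inject₁ y) ≡ lt x y
  lt-inject x y = cong₂ ℕ._<ᵇ_ (Finₚ.toℕ-inject₁ x) (Finₚ.toℕ-inject₁ y)

  lt-inject-top : ∀ {n} (x : Fin n) → lt (inject₁ x) (fromℕ n) ≡ true
  lt-inject-top zero = refl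
  lt-inject-top (suc x) = lt-inject-top x

  lt-top : ∀ {n} (x : Fin (suc n)) → lt (fromℕ n) x ≡ false
  lt-top {zero} zero = refl
  lt-top {suc n} zero = refl
  lt-top {suc n} (suc x) = lt-top x

  inversions-cyc : ∀ n → inversions (cyc {suc n}) ≡ + n
  inversions-cyc n = trans (∑-last (λ x → ∑ λ y → t x y)) (trans (cong₂ _+_ (∑-cong λ x → trans (∑-last (t (inject₁ x))) (cong₂ _+_ (∑-zero (low x)) (high x)))
      (∑-zero λ y → cong (λ b → 𝟙 b * 𝟙 (lt (cyc y) (cyc (fromℕ n)))) (lt-top y))) (trans (ℤₚ.+-identityʳ _) (trans (∑-const {n} 1ℤ) (ℤₚ.*-identityʳ (+ n)))))
    where
    t : Fin (suc n) → Fin (suc n) → ℤ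
    t x y = 𝟙 (lt x y) * 𝟙 (lt (cyc y) (cyc x))
    anti : ∀ (x y : Fin n) b → lt x y ≡ b → 𝟙 b * 𝟙 (lt y x) ≡ 0ℤ
    anti x y true h = cong (λ b → 1ℤ * 𝟙 b) (lt-asym x y h)
    anti x y false h = refl
    low : ∀ x y → t (inject₁ x) (inject₁ y) ≡ 0ℤ
    low x y = trans (cong₂ (λ a b → 𝟙 a * 𝟙 b) (lt-inject x y) (cong₂ lt (cyc-inject y) (cyc-inject x))) (anti x y (lt x y) refl)
    high : ∀ x → t (inject₁ x) (fromℕ n) ≡ 1ℤ
    high x = cong₂ (λ a b → 𝟙 a * 𝟙 b) (lt-inject-top x) (cong₂ lt (cyc-top n) (cyc-inject x))

  lt-↑ˡ : ∀ {m} n (i j : Fin m) → lt (i ↑ˡ n) (j ↑ˡ n) ≡ lt i j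
  lt-↑ˡ n i j = cong₂ ℕ._<ᵇ_ (Finₚ.toℕ-↑ˡ i n) (Finₚ.toℕ-↑ˡ j n)

  lt-↑ʳ : ∀ m {n} (i j : Fin n) → lt (m ↑ʳ i) (m ↑ʳ j) ≡ lt i j
  lt-↑ʳ zero i j = refl
  lt-↑ʳ (suc m) i j = lt-↑ʳ m i j

  lt-↑ˡʳ : ∀ {m n} (i : Fin m) (j : Fin n) → lt (i ↑ˡ n) (m ↑ʳ j) ≡ true
  lt-↑ˡʳ zero j = refl
  lt-↑ˡʳ (suc i) j = lt-↑ˡʳ i j

  lt-↑ʳˡ : ∀ {m n} (i : Fin m) (j : Fin n) → lt (m ↑ʳ j) (i ↑ˡ n) ≡ false
  lt-↑ʳˡ {m} {n} i j = lt-asym (i ↑ˡ n) (m ↑ʳ j) (lt-↑ˡʳ i j)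

  -- Points of different blocks are never inverted, and a cyclic shift of `m` points inverts the
  -- `m - 1` pairs that contain the top point.
  inversions-blk : ∀ μ → All (1 ℕ.≤_) μ → inversions (blk μ) + + length μ ≡ + sum μ
  inversions-blk [] [] = trans (ℤₚ.+-identityʳ _) (∑-empty _)
  inversions-blk (suc n ∷ μ) (_ ∷ pos) = begin
    inversions (blk (m ∷ μ)) + + suc (length μ)
      ≡⟨ cong (_+ + suc (length μ)) (trans (∑-split m (λ x → ∑ (t x))) (cong₂ _+_
           (trans (∑-cong λ i → trans (∑-split m (t (i ↑ˡ s))) (trans (cong₂ _+_ (∑-cong (ll i)) (∑-zero (lr i))) (ℤₚ.+-identityʳ _))) (inversions-cyc n))
           (∑-cong λ j → trans (∑-split m (t (m ↑ʳ j))) (trans (cong₂ _+_ (∑-zero (rl j)) (∑-cong (rr j))) (ℤₚ.+-identityˡ _))))) ⟩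
    (+ n + inversions (blk μ)) + (1ℤ + + length μ)
      ≡⟨ alg (+ n) (inversions (blk μ)) (+ length μ) ⟩
    (1ℤ + + n) + (inversions (blk μ) + + length μ)
      ≡⟨ cong (_+_ (+ suc n)) (inversions-blk μ pos) ⟩
    + sum (m ∷ μ) ∎
    where
    m = suc n
    s = sum μ
    B = blk (m ∷ μ)
    alg : ∀ n i l → (n + i) + (1ℤ + l) ≡ (1ℤ + n) + (i + l)
    alg = solve-∀
    t : Fin (m ℕ.+ s) → Fin (m ℕ.+ s) → ℤ
    t x y = 𝟙 (lt x y) * 𝟙 (lt (B y) (B x))
    ll : ∀ i j → t (i ↑ˡ s) (j ↑ˡ s) ≡ 𝟙 (lt i j) * 𝟙 (lt (cyc j) (cyc i))
    ll i j = cong₂ (λ a b → 𝟙 a * 𝟙 b) (lt-↑ˡ s i j) (trans (cong₂ lt (blk-ˡ m μ j) (blk-ˡ m μ i)) (lt-↑ˡ s (cyc j) (cyc i)))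
    lr : ∀ i j → t (i ↑ˡ s) (m ↑ʳ j) ≡ 0ℤ
    lr i j = trans (cong (λ b → 𝟙 (lt (i ↑ˡ s) (m ↑ʳ j)) * 𝟙 b) (trans (cong₂ lt (blk-ʳ m μ j) (blk-ˡ m μ i)) (lt-↑ʳˡ (cyc i) (blk μ j)))) (ℤₚ.*-zeroʳ (𝟙 (lt (i ↑ˡ s) (m ↑ʳ j))))
    rl : ∀ j i → t (m ↑ʳ j) (i ↑ˡ s) ≡ 0ℤ
    rl j i = cong (λ b → 𝟙 b * 𝟙 (lt (B (i ↑ˡ s)) (B (m ↑ʳ j)))) (lt-↑ʳˡ i j)
    rr : ∀ i j → t (m ↑ʳ i) (m ↑ʳ j) ≡ 𝟙 (lt i j) * 𝟙 (lt (blk μ j) (blk μ i))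
    rr i j = cong₂ (λ a b → 𝟙 a * 𝟙 b) (lt-↑ʳ m i j) (trans (cong₂ lt (blk-ʳ m μ j) (blk-ʳ m μ i)) (lt-↑ʳ m (blk μ j) (blk μ i)))

  Odd : ℤ → Set
  Odd z = ∃[ k ] z ≡ 1ℤ + + 2 * k

  -- The swap of 0 and 1 is a block cycle with one inversion. Any other swap is its conjugate by
  -- some π, and the two ways of writing the same map, (π0 π1) ∘ π and π ∘ (0 1), transfer the
  -- parity through `inversions-∘`.
  inversions-sw : ∀ d (x y : Fin d) → ¬ x ≡ y → Odd (inversions (sw x y))
  inversions-sw zero () y n
  inversions-sw (suc zero) zero zero n = ⊥-elim (n refl)
  inversions-sw (suc (suc k)) = subst (λ n → (x y : Fin n) → ¬ x ≡ y → Odd (inversions (sw x y))) (cong (2 ℕ.+_) (sum-ones k)) conj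
    where
    μ = 2 ∷ replicate k 1
    d = sum μ
    base : inversions (sw {d} zero (suc zero)) ≡ 1ℤ
    base = trans (sym (inversions-ext (blk-transposition k))) (ℤG.∙-cancelʳ (+ length μ) (inversions (blk μ)) 1ℤ
      (trans (inversions-blk μ (s≤s z≤n ∷ ones-pos k)) (cong +_ (trans (cong (2 ℕ.+_) (sum-ones k)) (cong (2 ℕ.+_) (sym (length-replicate k)))))))
    conj : (x y : Fin d) → ¬ x ≡ y → Odd (inversions (sw x y))
    conj x y n with move-pair {d} zero (suc zero) x y (λ ()) n
    ... | π , P , refl , refl = I - 1ℤ + (m′ - m) , (begin
          inversions (sw (π zero) (π (suc zero)))
            ≡⟨ alg₁ (inversions (sw (π zero) (π (suc zero)))) I (+ 2 * m) ⟩
          (inversions (sw (π zero) (π (suc zero))) - I + + 2 * m) + I - + 2 * m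
            ≡⟨ cong (λ t → t + I - + 2 * m) (trans (sym e) (trans (inversions-ext (λ z → sym (sw-conj injective zero (suc zero) z))) e′)) ⟩
          (I - inversions (sw {d} zero (suc zero)) + + 2 * m′) + I - + 2 * m
            ≡⟨ cong (λ t → (I - t + + 2 * m′) + I - + 2 * m) base ⟩
          (I - 1ℤ + + 2 * m′) + I - + 2 * m
            ≡⟨ alg₂ I m m′ ⟩
          1ℤ + + 2 * (I - 1ℤ + (m′ - m)) ∎)
      where
      open Perm P
      I = inversions π
      s₁ = inversions-∘ {f = sw (π zero) (π (suc zero))} {π} (Perm.injective (sw-perm (π zero) (π (suc zero)))) P
      m = proj₁ s₁
      e = proj₂ s₁
      s₂ = inversions-∘ {f = π} {sw zero (suc zero)} injective (sw-perm zero (suc zero))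
      m′ = proj₁ s₂
      e′ = proj₂ s₂
      alg₁ : ∀ a i m → a ≡ (a - i + m) + i - m
      alg₁ = solve-∀
      alg₂ : ∀ i m m′ → (i - 1ℤ + + 2 * m′) + i - + 2 * m ≡ 1ℤ + + 2 * (i - 1ℤ + (m′ - m))
      alg₂ = solve-∀

  sgn : ∀ {d} → Map d → ℤ
  sgn σ = (- 1ℤ) ^ ∣ inversions σ ∣

  -1^-+2 : ∀ a k → (- 1ℤ) ^ (a ℕ.+ 2 ℕ.* k) ≡ (- 1ℤ) ^ a
  -1^-+2 a k = trans (ℤₚ.^-distribˡ-+-* (- 1ℤ) a (2 ℕ.* k)) (trans (cong ((- 1ℤ) ^ a *_) (trans (sym (ℤₚ.^-*-assoc (- 1ℤ) 2 k)) (ℤₚ.^-zeroˡ k))) (ℤₚ.*-identityʳ _))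

  odd-flip : ∀ {a b} → 0ℤ ≤ a → 0ℤ ≤ b → Odd (a - b) → (- 1ℤ) ^ ∣ a ∣ ≡ - ((- 1ℤ) ^ ∣ b ∣)
  odd-flip {+ a} {+ b} _ _ (+ k , e) = trans (cong ((- 1ℤ) ^_) a≡) (trans (-1^-+2 (suc b) k) (ℤₚ.-1*i≡-i ((- 1ℤ) ^ b)))
    where
    alg : ∀ a b → a ≡ b + (a - b)
    alg = solve-∀
    alg₂ : ∀ b k → b + (1ℤ + k) ≡ (1ℤ + b) + k
    alg₂ = solve-∀
    a≡ : a ≡ suc b ℕ.+ 2 ℕ.* k
    a≡ = ℤₚ.+-injective (trans (alg (+ a) (+ b)) (trans (cong (_+_ (+ b)) e) (trans (alg₂ (+ b) (+ 2 * + k)) (cong (λ z → (1ℤ + + b) + z) (sym (ℤₚ.pos-* 2 k))))))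
  odd-flip {+ a} {+ b} _ _ (-[1+ k ] , e) = sym (trans (cong (λ n → - ((- 1ℤ) ^ n)) b≡) (trans (cong -_ (trans (-1^-+2 (suc a) k) (ℤₚ.-1*i≡-i ((- 1ℤ) ^ a)))) (ℤₚ.neg-involutive ((- 1ℤ) ^ a))))
    where
    alg : ∀ a b → b ≡ a - (a - b)
    alg = solve-∀
    alg₂ : ∀ a k → a - (1ℤ + + 2 * (- (1ℤ + k))) ≡ (1ℤ + a) + + 2 * k
    alg₂ = solve-∀
    b≡ : b ≡ suc a ℕ.+ 2 ℕ.* k
    b≡ = ℤₚ.+-injective (trans (alg (+ a) (+ b)) (trans (cong (λ z → + a - z) e) (trans (alg₂ (+ a) (+ k)) (cong (λ z → (1ℤ + + a) + z) (sym (ℤₚ.pos-* 2 k))))))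

  sgn-ext : ∀ {d} → Ext (sgn {d})
  sgn-ext h = cong (λ z → (- 1ℤ) ^ ∣ z ∣) (inversions-ext h)

  sgn-sw : ∀ {d} (σ : Map d) → Perm σ → ∀ x y → ¬ x ≡ y → sgn (σ ∘ sw x y) ≡ - sgn σ
  sgn-sw {d} σ P x y n = odd-flip (inversions≥0 (σ ∘ sw x y)) (inversions≥0 σ) (m - 1ℤ - k , trans (cong (_- inversions σ) e) (trans (cong (λ t → inversions σ - t + + 2 * m - inversions σ) o) (alg (inversions σ) k m)))
    where
    s₁ = inversions-∘ {f = σ} {sw x y} (Perm.injective P) (sw-perm x y)
    m = proj₁ s₁
    e = proj₂ s₁
    k = proj₁ (inversions-sw d x y n)
    o = proj₂ (inversions-sw d x y n)
    alg : ∀ i k m → i - (1ℤ + + 2 * k) + + 2 * m - i ≡ 1ℤ + + 2 * (m - 1ℤ - k)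
    alg = solve-∀

  sgn-id : ∀ {d} → sgn {d} id ≡ 1ℤ
  sgn-id {d} = cong (λ z → (- 1ℤ) ^ ∣ z ∣) (∑₂-zero {d} λ x y h → cong 𝟙 (lt-asym x y h))

  -- Equivalent to the vanishing of the count when `sgn σ` differs from (-1)^n. In the form of an
  -- equation it passes through the Möbius combination.
  cw-sgn : ∀ {d} ℓ n (σ : Map d) → Perm σ → (- 1ℤ) ^ n * sgn σ * cw ℓ n σ ≡ cw ℓ n σ
  cw-sgn ℓ zero σ P = go (isId σ) refl
    where
    go : ∀ b → isId σ ≡ b → 1ℤ * sgn σ * 𝟙 b ≡ 𝟙 b
    go true e = cong (λ z → 1ℤ * z * 1ℤ) (trans (sgn-ext (isId⇒ {σ = σ} e)) sgn-id)
    go false e = ℤₚ.*-zeroʳ (1ℤ * sgn σ)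
  cw-sgn ℓ (suc n) σ P = begin
    (- 1ℤ) * (- 1ℤ) ^ n * sgn σ * cw ℓ (suc n) σ
      ≡⟨ sym (∑₂-*ˡ ((- 1ℤ) * (- 1ℤ) ^ n * sgn σ) (λ x y → 𝟙 (same ℓ x y) * cw ℓ n (σ ∘ sw x y))) ⟩
    ∑₂ (λ x y → (- 1ℤ) * (- 1ℤ) ^ n * sgn σ * (𝟙 (same ℓ x y) * cw ℓ n (σ ∘ sw x y)))
      ≡⟨ ∑₂-cong (λ x y h → trans (alg ((- 1ℤ) ^ n) (sgn σ) (𝟙 (same ℓ x y)) (cw ℓ n (σ ∘ sw x y))) (cong (𝟙 (same ℓ x y) *_)
           (trans (cong (λ z → (- 1ℤ) ^ n * z * cw ℓ n (σ ∘ sw x y)) (sym (sgn-sw σ P x y (lt⇒≢ x y h)))) (cw-sgn ℓ n (σ ∘ sw x y) (perm-∘ P (sw-perm x y)))))) ⟩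
    cw ℓ (suc n) σ ∎
    where alg : ∀ p s a c → (- 1ℤ) * p * s * (a * c) ≡ a * (p * (- s) * c)
          alg = solve-∀

  -- Gaps in the spectrum

  #pairs : ℕ → ℤ
  #pairs d = ∑₂ {d} λ _ _ → 1ℤ

  ∑₂-suc : ∀ {n} (φ : Fin (suc n) → Fin (suc n) → ℤ) →
           ∑₂ φ ≡ ∑ (λ y → φ zero (suc y)) + ∑₂ (λ x y → φ (suc x) (suc y))
  ∑₂-suc φ = trans (∑-suc (λ x → ∑ λ y → 𝟙 (lt x y) * φ x y)) (cong₂ _+_
    (trans (∑-suc (λ y → 𝟙 (lt zero y) * φ zero y)) (trans (ℤₚ.+-identityˡ _) (∑-cong λ y → ℤₚ.*-identityˡ (φ zero (suc y)))))
    (∑-cong λ x → trans (∑-suc (λ y → 𝟙 (lt (suc x) y) * φ (suc x) y)) (ℤₚ.+-identityˡ _)))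

  #pairs-suc : ∀ d → #pairs (suc d) ≡ + d + #pairs d
  #pairs-suc d = trans (∑₂-suc (λ _ _ → 1ℤ)) (cong (_+ #pairs d) (trans (∑-const {d} 1ℤ) (ℤₚ.*-identityʳ (+ d))))

  #pairs-C : ∀ d → #pairs d ≡ + (d C 2)
  #pairs-C zero = ∑-empty _
  #pairs-C (suc d) = trans (#pairs-suc d) (trans (cong (_+_ (+ d)) (#pairs-C d))
    (cong +_ (trans (cong (ℕ._+ d C 2) (sym (nC1≡n d))) (nCk+nC[k+1]≡[n+1]C[k+1] d 1))))

  star-sum : ∀ {d} (w : Fin d) (u : Fin d → ℤ) →
    ∑₂ (λ x y → 𝟙 (y == w) * u x + 𝟙 (x == w) * u y) ≡ ∑ λ x → 𝟙 (not (x == w)) * u x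
  star-sum w u = begin
    ∑₂ (λ x y → φ x y + φ y x)
      ≡⟨ alg (∑₂ (λ x y → φ x y + φ y x)) (∑ λ x → φ x x) ⟩
    (∑₂ (λ x y → φ x y + φ y x) + ∑ (λ x → φ x x)) - ∑ (λ x → φ x x)
      ≡⟨ cong (_- ∑ (λ x → φ x x)) (trans (sym (∑₂-sym φ)) (∑-cong λ x → ∑-δ w (λ _ → u x))) ⟩
    ∑ u - ∑ (λ x → 𝟙 (x == w) * u x)
      ≡⟨ sym (∑-- u (λ x → 𝟙 (x == w) * u x)) ⟩
    ∑ (λ x → u x - 𝟙 (x == w) * u x)
      ≡⟨ ∑-cong (λ x → trans (alg₂ (u x) (𝟙 (x == w))) (cong (_* u x) (sym (𝟙-not (x == w))))) ⟩
    ∑ (λ x → 𝟙 (not (x == w)) * u x) ∎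
    where
    φ : Fin _ → Fin _ → ℤ
    φ x y = 𝟙 (y == w) * u x
    alg : ∀ a b → a ≡ (a + b) - b
    alg = solve-∀
    alg₂ : ∀ u b → u - b * u ≡ (1ℤ - b) * u
    alg₂ = solve-∀

  star-≤ : ∀ {d} (w : Fin d) (ψ : Fin d → Fin d → ℤ) → (∀ x y → 0ℤ ≤ ψ x y) → (∀ x y → ψ x y ≡ ψ y x) → ψ w w ≡ 0ℤ →
    ∑ (λ x → ψ x w) ≤ ∑₂ ψ
  star-≤ w ψ nn s diag = subst (_≤ ∑₂ ψ) (trans (star-sum w (λ x → ψ x w)) (∑-cong λ x → off x (x Finₚ.≟ w)))
      (∑₂-mono λ x y h → le x y h (x Finₚ.≟ w) (y Finₚ.≟ w))
    where
    off : ∀ x → Dec (x ≡ w) → 𝟙 (not (x == w)) * ψ x w ≡ ψ x w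
    off x (yes refl) rewrite ==-refl x = sym diag
    off x (no n) rewrite ≢⇒== n = ℤₚ.*-identityˡ (ψ x w)
    le : ∀ x y → lt x y ≡ true → Dec (x ≡ w) → Dec (y ≡ w) → 𝟙 (y == w) * ψ x w + 𝟙 (x == w) * ψ y w ≤ ψ x y
    le x y h (yes refl) (yes refl) = ⊥-elim (lt⇒≢ x y h refl)
    le x y h (yes refl) (no n) = ℤₚ.≤-reflexive (trans (cong₂ (λ a b → 𝟙 a * ψ x x + 𝟙 b * ψ y x) (≢⇒== n) (==-refl x)) (trans (ℤₚ.+-identityˡ _) (trans (ℤₚ.*-identityˡ (ψ y x)) (s y x))))
    le x y h (no n) (yes refl) = ℤₚ.≤-reflexive (trans (cong₂ (λ a b → 𝟙 a * ψ x y + 𝟙 b * ψ y y) (==-refl y) (≢⇒== n)) (trans (ℤₚ.+-identityʳ _) (ℤₚ.*-identityˡ (ψ x y))))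
    le x y h (no n) (no m) = subst (_≤ ψ x y) (sym (cong₂ (λ a b → 𝟙 a * ψ x w + 𝟙 b * ψ y w) (≢⇒== m) (≢⇒== n))) (nn x y)

  module _ {d : ℕ} where

    ct≤K : ∀ (ℓ : Fin d → ℕ) c → ct ℓ c ≤ K ℓ
    ct≤K ℓ c = subst (ct ℓ c ≤_) (ℤₚ.+-identityʳ (K ℓ)) (ℤₚ.+-mono-≤
      (∑₂-mono λ x y _ → le (same ℓ x y) (c x == c y))
      (ℤₚ.neg-mono-≤ (∑-nonneg λ x → +≤+ z≤n)))
      where
      le : ∀ a b → 𝟙 a * 𝟙 b ≤ 𝟙 a
      le true b = subst (_≤ 1ℤ) (sym (ℤₚ.*-identityˡ (𝟙 b))) (𝟙≤1 b)
      le false b = ℤₚ.≤-refl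

    -- Each of the `d` points costs at least one. A point `x` of nonzero colour costs its colour; a
    -- point of colour 0 differs in colour from `y₀`, so the pair of `x` and `y₀` is not counted.
    ct-gap : ∀ (ℓ : Fin d → ℕ) c y₀ → ¬ toℕ (c y₀) ≡ 0 → ct ℓ c + + d ≤ #pairs d
    ct-gap ℓ c y₀ pos = ℤₚ.≤-trans (ℤₚ.+-mono-≤ (ℤₚ.+-monoˡ-≤ (- W) (∑₂-mono {f = λ x y → 𝟙 (same ℓ x y) * 𝟙 (c x == c y)} {λ x y → 1ℤ - ψ x y} λ x y _ → le (same ℓ x y) (c x == c y)))
        (ℤₚ.≤-trans many (ℤₚ.+-monoˡ-≤ W (star-≤ y₀ ψ (λ x y → 𝟙≥0 (not (c x == c y))) (λ x y → cong (λ b → 𝟙 (not b)) (==-sym (c x) (c y))) (cong (λ b → 𝟙 (not b)) (==-refl (c y₀)))))))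
        (ℤₚ.≤-reflexive (trans (cong (λ t → t - W + (∑₂ ψ + W)) (∑₂-- (λ _ _ → 1ℤ) ψ)) (alg (#pairs d) (∑₂ ψ) W)))
      where
      W = ∑ (λ x → + toℕ (c x))
      ψ : Fin d → Fin d → ℤ
      ψ x y = 𝟙 (not (c x == c y))
      alg : ∀ p s w → p - s - w + (s + w) ≡ p
      alg = solve-∀
      le : ∀ a b → 𝟙 a * 𝟙 b ≤ 1ℤ - 𝟙 (not b)
      le true true = ℤₚ.≤-refl
      le true false = ℤₚ.≤-refl
      le false true = +≤+ z≤n
      le false false = ℤₚ.≤-refl
      one : ∀ x → 1ℤ ≤ ψ x y₀ + + toℕ (c x)
      one x with toℕ (c x) in e
      ... | zero = ℤₚ.≤-reflexive (sym (trans (ℤₚ.+-identityʳ _) (cong (λ b → 𝟙 (not b)) (≢⇒== λ q → pos (trans (cong toℕ (sym q)) e)))))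
      ... | suc k = ℤₚ.+-mono-≤ (𝟙≥0 (not (c x == c y₀))) (+≤+ (s≤s (z≤n {k})))
      many : + d ≤ ∑ (λ x → ψ x y₀) + W
      many = subst₂ _≤_ (trans (∑-const {d} 1ℤ) (ℤₚ.*-identityʳ (+ d))) (∑-+ (λ x → ψ x y₀) (λ x → + toℕ (c x))) (∑-mono one)

    ct-zero : ∀ (ℓ : Fin d → ℕ) c → (∀ x → toℕ (c x) ≡ 0) → (∀ x y → ℓ x ≡ ℓ y) → ct ℓ c ≡ #pairs d
    ct-zero ℓ c z const = trans (cong₂ _-_ (∑₂-cong λ x y _ → cong₂ (λ a b → 𝟙 a * 𝟙 b) (≡⇒≡ᵇ (const x y)) (≡⇒== (Finₚ.toℕ-injective (trans (z x) (sym (z y))))))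
        (∑-zero λ x → cong +_ (z x))) (ℤₚ.+-identityʳ (#pairs d))

    K-split : ∀ (ℓ : Fin d → ℕ) → K ℓ ≡ #pairs d - ∑₂ (λ x y → 𝟙 (not (same ℓ x y)))
    K-split ℓ = trans (∑₂-cong λ x y _ → flip (same ℓ x y)) (∑₂-- (λ _ _ → 1ℤ) (λ x y → 𝟙 (not (same ℓ x y))))
      where
      flip : ∀ b → 𝟙 b ≡ 1ℤ - 𝟙 (not b)
      flip true = refl
      flip false = refl

    K-const : ∀ (ℓ : Fin d → ℕ) → (∀ x y → ℓ x ≡ ℓ y) → K ℓ ≡ #pairs d
    K-const ℓ const = ∑₂-cong λ x y _ → cong 𝟙 (≡⇒≡ᵇ (const x y))

    K-point : ∀ (ℓ : Fin d → ℕ) w → IsPoint ℓ w → K ℓ ≡ #pairs d - (+ d - 1ℤ)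
    K-point ℓ w (lone , rest) = trans (K-split ℓ) (cong (_-_ (#pairs d)) (trans (∑₂-cong λ x y h → split x y (lt⇒≢ x y h) (x Finₚ.≟ w) (y Finₚ.≟ w))
        (trans (star-sum w (λ _ → 1ℤ)) (trans (∑-cong λ x → trans (ℤₚ.*-identityʳ (𝟙 (not (x == w)))) (trans (𝟙-not (x == w)) (cong (_-_ 1ℤ) (sym (ℤₚ.*-identityʳ (𝟙 (x == w)))))))
          (trans (∑-- (λ _ → 1ℤ) (λ x → 𝟙 (x == w) * 1ℤ)) (cong₂ _-_ (trans (∑-const {d} 1ℤ) (ℤₚ.*-identityʳ (+ d))) (∑-δ w (λ _ → 1ℤ))))))))
      where
      ns : ∀ x y → ¬ ℓ x ≡ ℓ y → same ℓ x y ≡ false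
      ns x y n with same ℓ x y in e
      ... | true = ⊥-elim (n (≡ᵇ⇒≡ e))
      ... | false = refl
      split : ∀ x y → ¬ x ≡ y → Dec (x ≡ w) → Dec (y ≡ w) → 𝟙 (not (same ℓ x y)) ≡ 𝟙 (y == w) * 1ℤ + 𝟙 (x == w) * 1ℤ
      split x y n (yes refl) (yes refl) = ⊥-elim (n refl)
      split x y n (yes refl) (no m) rewrite ==-refl x | ≢⇒== m | ns x y (λ e → m (lone y (sym e))) = refl
      split x y n (no m) (yes refl) rewrite ==-refl y | ≢⇒== m | ns x y (λ e → m (lone x e)) = refl
      split x y n (no m) (no k) rewrite ≢⇒== m | ≢⇒== k | ≡⇒≡ᵇ (rest x y m k) = refl

    data Kind (ℓ : Fin d → ℕ) : Set where
      constant : (∀ x y → ℓ x ≡ ℓ y) → Kind ℓ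
      point : ∀ w → IsPoint ℓ w → Kind ℓ
      small : K ℓ + + d ≤ #pairs d → Kind ℓ

    -- Summing over z the number of points outside the block of z counts every split pair twice.
    kind : ∀ ℓ → Kind ℓ
    kind ℓ with Finₚ.all? (λ z → + 2 ℤₚ.≤? ∑ (λ w → 𝟙 (not (same ℓ z w))))
    ... | yes big = small (subst (_≤ #pairs d) (cong (_+ + d) (sym (K-split ℓ))) (subst (#pairs d - S + + d ≤_) (alg (#pairs d) S)
          (ℤₚ.+-monoʳ-≤ (#pairs d - S) (ℤₚ.*-cancelˡ-≤-pos (+ d) S (+ 2) (subst₂ _≤_ (trans (∑-const {d} (+ 2)) (ℤₚ.*-comm (+ d) (+ 2))) double (∑-mono big))))))
      where
      S = ∑₂ (λ x y → 𝟙 (not (same ℓ x y)))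
      alg : ∀ p s → p - s + s ≡ p
      alg = solve-∀
      double : ∑ (λ z → ∑ λ w → 𝟙 (not (same ℓ z w))) ≡ + 2 * S
      double = trans (∑₂-double (λ x y → 𝟙 (not (same ℓ x y))) (λ x y → cong (λ b → 𝟙 (not b)) (same-sym ℓ x y)))
        (trans (cong (_+_ (+ 2 * S)) (∑-zero λ x → cong (λ b → 𝟙 (not b)) (≡ᵇ-refl (ℓ x)))) (ℤₚ.+-identityʳ (+ 2 * S)))
    -- Some `z` has at most one point outside its block. If there is none, the partition has one
    -- block; if there is one, that point is the singleton.
    ... | no ¬big with Finₚ.¬∀⟶∃¬ d _ (λ z → + 2 ℤₚ.≤? ∑ (λ w → 𝟙 (not (same ℓ z w)))) ¬big
    ...   | z , less with Finₚ.any? (λ w → ¬? (ℓ w ℕₚ.≟ ℓ z))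
    ...     | no none = constant λ x y → trans (eq x) (sym (eq y))
      where
      eq : ∀ x → ℓ x ≡ ℓ z
      eq x with ℓ x ℕₚ.≟ ℓ z
      ... | yes p = p
      ... | no n = ⊥-elim (none (x , n))
    ...     | yes (w , ℓw) = point w ((λ x e → lone x e (x Finₚ.≟ w)) , λ x y x≢ y≢ → trans (eq x x≢) (sym (eq y y≢)))
      where
      ns : ∀ x → ¬ ℓ x ≡ ℓ z → same ℓ z x ≡ false
      ns x n with same ℓ z x in e
      ... | true = ⊥-elim (n (sym (≡ᵇ⇒≡ e)))
      ... | false = refl
      eq : ∀ x → ¬ x ≡ w → ℓ x ≡ ℓ z
      eq x x≢ with ℓ x ℕₚ.≟ ℓ z
      ... | yes p = p
      ... | no n = ⊥-elim (less (subst (_≤ ∑ (λ w → 𝟙 (not (same ℓ z w)))) (trans (∑-+ (λ y → 𝟙 (y == w) * 1ℤ) (λ y → 𝟙 (y == x) * 1ℤ)) (cong₂ _+_ (∑-δ w (λ _ → 1ℤ)) (∑-δ x (λ _ → 1ℤ))))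
          (∑-mono λ y → le y (y Finₚ.≟ w) (y Finₚ.≟ x))))
        where
        le : ∀ y → Dec (y ≡ w) → Dec (y ≡ x) → 𝟙 (y == w) * 1ℤ + 𝟙 (y == x) * 1ℤ ≤ 𝟙 (not (same ℓ z y))
        le y (yes refl) (yes refl) = ⊥-elim (x≢ refl)
        le y (yes refl) (no m) rewrite ==-refl y | ≢⇒== m | ns y ℓw = ℤₚ.≤-refl
        le y (no m) (yes refl) rewrite ==-refl y | ≢⇒== m | ns y n = ℤₚ.≤-refl
        le y (no m) (no k) rewrite ≢⇒== m | ≢⇒== k = 𝟙≥0 (not (same ℓ z y))
      lone : ∀ x → ℓ x ≡ ℓ w → Dec (x ≡ w) → x ≡ w
      lone x e (yes p) = p
      lone x e (no n) = ⊥-elim (ℓw (trans (sym e) (eq x n)))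

    cf : (Fin d → ℕ) → Map d → ℤ → ℤ
    cf ℓ σ k = coef (es ℓ σ) k

    keys : ∀ ℓ σ → All (λ tk → Σ[ c ∈ Map d ] proj₂ tk ≡ ct ℓ c) (es ℓ σ)
    keys ℓ σ = proj₁ (proj₂ (spectral′ ℓ σ))

    cf-above : ∀ ℓ σ k → K ℓ < k → cf ℓ σ k ≡ 0ℤ
    cf-above ℓ σ k h = coef-none (All.map (λ (c , e) e′ → ℤₚ.<-irrefl refl (ℤₚ.<-≤-trans h (subst (_≤ K ℓ) (trans (sym e) e′) (ct≤K ℓ c)))) (keys ℓ σ))

    -- Keys are values of `ct ℓ`. The colouring with all colours 0 gives C(d,2) and every other one
    -- at most C(d,2) - d, which is C(d-1,2) - 1. So the one-block partition contributes nothing at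
    -- C(d-1,2) either.
    cf-const-gap : ∀ ℓ σ k → (∀ x y → ℓ x ≡ ℓ y) → #pairs d < k + + d → ¬ k ≡ #pairs d → cf ℓ σ k ≡ 0ℤ
    cf-const-gap ℓ σ k const h ne = coef-none (All.map (λ (c , e) e′ → go c (trans (sym e) e′) (Finₚ.all? λ x → toℕ (c x) ℕₚ.≟ 0)) (keys ℓ σ))
      where
      go : ∀ c → ct ℓ c ≡ k → ¬ Dec (∀ x → toℕ (c x) ≡ 0)
      go c e (yes z) = ne (trans (sym e) (ct-zero ℓ c z const))
      go c e (no n) with Finₚ.¬∀⟶∃¬ d _ (λ x → toℕ (c x) ℕₚ.≟ 0) n
      ... | y₀ , pos = ℤₚ.<-irrefl refl (ℤₚ.<-≤-trans h (subst (λ t → t + + d ≤ #pairs d) e (ct-gap ℓ c y₀ pos)))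

    isConst-yes : ∀ (ℓ : Fin d → ℕ) → (∀ x y → ℓ x ≡ ℓ y) → isConst ℓ ≡ true
    isConst-yes ℓ h = ⇒refines {q = λ _ _ → true} λ {x} {y} _ → h x y

    isConst-no : ∀ (ℓ : Fin d → ℕ) → (¬ (∀ x y → ℓ x ≡ ℓ y)) → isConst ℓ ≡ false
    isConst-no ℓ n with isConst ℓ in e
    ... | true = ⊥-elim (n λ x y → refines⇒ {q = λ _ _ → true} e {x} {y} refl)
    ... | false = refl

    module _ (2≤d : 2 ℕ.≤ d) where

      -- D′ = D - (d - 1) is the number of pairs not containing a given point.
      D D′ : ℤ
      D = #pairs d
      D′ = D - (+ d - 1ℤ)

      D′<D : D′ < D
      D′<D = subst (D′ <_) (ℤₚ.+-identityʳ D) (ℤₚ.+-monoʳ-< D (ℤₚ.neg-mono-< (positive d 2≤d)))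
        where
        positive : ∀ d → 2 ℕ.≤ d → 0ℤ < + d - 1ℤ
        positive (suc (suc d)) (s≤s (s≤s z≤n)) = +<+ (s≤s z≤n)

      D<D′+d : D < D′ + + d
      D<D′+d = subst (D <_) (alg D (+ d)) (subst (_< D + 1ℤ) (ℤₚ.+-identityʳ D) (ℤₚ.+-monoʳ-< D (+<+ (s≤s z≤n))))
        where alg : ∀ D d → D + 1ℤ ≡ D - (d - 1ℤ) + d
              alg = solve-∀

      small-below : ∀ {ℓ : Fin d → ℕ} → K ℓ + + d ≤ D → K ℓ < D′
      small-below {ℓ} h = ℤₚ.≰⇒> λ le → ℤₚ.<-irrefl refl (ℤₚ.<-≤-trans D<D′+d (ℤₚ.≤-trans (ℤₚ.+-monoˡ-≤ (+ d) le) h))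

      other : ∀ w → ∃[ w′ ] ¬ w′ ≡ w
      other w = go d 2≤d w
        where
        go : ∀ d → 2 ℕ.≤ d → (w : Fin d) → ∃[ w′ ] ¬ w′ ≡ w
        go (suc (suc d)) (s≤s (s≤s z≤n)) zero = suc zero , λ ()
        go (suc (suc d)) (s≤s (s≤s z≤n)) (suc w) = zero , λ ()

      point-not-const : ∀ {ℓ w} → IsPoint ℓ w → ¬ (∀ x y → ℓ x ≡ ℓ y)
      point-not-const {ℓ} {w} (lone , _) h = proj₂ (other w) (lone (proj₁ (other w)) (h (proj₁ (other w)) w))

      cf-top : ∀ ℓ σ → Perm σ → cf ℓ σ D ≡ 𝟙 (isConst ℓ)
      cf-top ℓ σ P with kind ℓ
      ... | constant h = trans (cong (cf ℓ σ) (sym (K-const ℓ h))) (trans (top-coef ℓ h σ P) (cong 𝟙 (sym (isConst-yes ℓ h))))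
      ... | point w h = trans (cf-above ℓ σ D (subst (_< D) (sym (K-point ℓ w h)) D′<D)) (cong 𝟙 (sym (isConst-no ℓ (point-not-const {ℓ} {w} h))))
      ... | small h = trans (cf-above ℓ σ D (ℤₚ.<-trans (small-below {ℓ} h) D′<D)) (cong 𝟙 (sym (isConst-no ℓ λ c →
                        ℤₚ.<-irrefl (K-const ℓ c) (ℤₚ.<-trans (small-below {ℓ} h) D′<D))))

      cf-between : ∀ ℓ σ k → D′ < k → ¬ k ≡ D → cf ℓ σ k ≡ 0ℤ
      cf-between ℓ σ k h ne with kind ℓ
      ... | constant c = cf-const-gap ℓ σ k c (ℤₚ.<-trans D<D′+d (ℤₚ.+-monoˡ-< (+ d) h)) ne
      ... | point w p = cf-above ℓ σ k (subst (_< k) (sym (K-point ℓ w p)) h)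
      ... | small s = cf-above ℓ σ k (ℤₚ.<-trans (small-below {ℓ} s) h)

      -- For `d ≥ 3` at most one `x` satisfies `isPoint x ℓ`, so the sum has at most one nonzero
      -- term. For `d = 2` the discrete partition would be counted at both of its points.
      cf-point : 3 ℕ.≤ d → ∀ ℓ σ → Perm σ → cf ℓ σ D′ ≡ ∑ λ x → 𝟙 (isPoint x ℓ) * (𝟙 (σ x == x) * + d)
      cf-point 3≤d ℓ σ P with kind ℓ
      ... | constant c = trans (cf-const-gap ℓ σ D′ c D<D′+d (λ e → ℤₚ.<-irrefl e D′<D)) (sym (∑-zero λ x →
                        cong (λ b → 𝟙 b * (𝟙 (σ x == x) * + d)) (not-point x (isPoint x ℓ) refl)))
        where
        not-point : ∀ x b → isPoint x ℓ ≡ b → b ≡ false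
        not-point x false _ = refl
        not-point x true e = ⊥-elim (point-not-const {ℓ} {x} (isPoint⇒ e) c)
      ... | small s = trans (cf-above ℓ σ D′ (small-below {ℓ} s)) (sym (∑-zero λ x →
                        cong (λ b → 𝟙 b * (𝟙 (σ x == x) * + d)) (not-point x (isPoint x ℓ) refl)))
        where
        not-point : ∀ x b → isPoint x ℓ ≡ b → b ≡ false
        not-point x false _ = refl
        not-point x true e = ⊥-elim (ℤₚ.<-irrefl (K-point ℓ x (isPoint⇒ e)) (small-below {ℓ} s))
      ... | point w p = trans (cong (cf ℓ σ) (sym (K-point ℓ w p))) (trans (point-coef ℓ w p σ P) (sym (trans (∑-cong λ x →
                          cong (λ b → 𝟙 b * (𝟙 (σ x == x) * + d)) (⇔→≡ {isPoint x ℓ} {x == w} (λ e → ≡⇒== (unique x (isPoint⇒ e) (x Finₚ.≟ w))) (λ e → subst (λ y → isPoint y ℓ ≡ true) (sym (==⇒≡ e)) (⇒isPoint (proj₂ (other w)) p))))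
                          (∑-δ w (λ x → 𝟙 (σ x == x) * + d)))))
        where
        third : ∀ (u v : Fin d) → ∃[ z ] ¬ z ≡ u × ¬ z ≡ v
        third = go d 3≤d
          where
          go : ∀ d → 3 ℕ.≤ d → (u v : Fin d) → ∃[ z ] ¬ z ≡ u × ¬ z ≡ v
          go (suc (suc (suc d))) (s≤s (s≤s (s≤s z≤n))) zero zero = suc zero , (λ ()) , λ ()
          go (suc (suc (suc d))) (s≤s (s≤s (s≤s z≤n))) zero (suc zero) = suc (suc zero) , (λ ()) , λ ()
          go (suc (suc (suc d))) (s≤s (s≤s (s≤s z≤n))) zero (suc (suc v)) = suc zero , (λ ()) , λ ()
          go (suc (suc (suc d))) (s≤s (s≤s (s≤s z≤n))) (suc zero) zero = suc (suc zero) , (λ ()) , λ ()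
          go (suc (suc (suc d))) (s≤s (s≤s (s≤s z≤n))) (suc (suc u)) zero = suc zero , (λ ()) , λ ()
          go (suc (suc (suc d))) (s≤s (s≤s (s≤s z≤n))) (suc u) (suc v) = zero , (λ ()) , λ ()
        unique : ∀ x → IsPoint ℓ x → Dec (x ≡ w) → x ≡ w
        unique x q (yes e) = e
        unique x q (no n) with third x w
        ... | z , z≢x , z≢w = ⊥-elim (z≢w (proj₁ p z (proj₂ q z w z≢x (n ∘ sym))))

  fixed-blk : ∀ μ → All (1 ℕ.≤_) μ → ∑ (λ x → 𝟙 (blk μ x == x)) ≡ + mult μ 1
  fixed-blk [] [] = ∑-empty _
  fixed-blk (m ∷ μ) (1≤m ∷ pos) = trans (∑-split m (λ x → 𝟙 (blk (m ∷ μ) x == x))) (trans (cong₂ _+_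
      (trans (∑-cong λ i → cong 𝟙 (⇔→≡ (λ e → ≡⇒== (Finₚ.↑ˡ-injective (sum μ) (cyc i) i (trans (sym (blk-ˡ m μ i)) (==⇒≡ {x = blk (m ∷ μ) (i ↑ˡ sum μ)} e))))
          (λ e → ≡⇒== (trans (blk-ˡ m μ i) (cong (_↑ˡ sum μ) (==⇒≡ {x = cyc i} e)))))) (one m 1≤m))
      (trans (∑-cong λ j → cong 𝟙 (⇔→≡ (λ e → ≡⇒== (Finₚ.↑ʳ-injective m (blk μ j) j (trans (sym (blk-ʳ m μ j)) (==⇒≡ {x = blk (m ∷ μ) (m ↑ʳ j)} e))))
          (λ e → ≡⇒== (trans (blk-ʳ m μ j) (cong (m ↑ʳ_) (==⇒≡ {x = blk μ j} e)))))) (fixed-blk μ pos))) (sym (mult-∷ m μ 1)))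
    where
    cyc-moves : ∀ n (i : Fin (suc (suc n))) → ¬ cyc i ≡ i
    cyc-moves n = top-cases _ (λ e → 0≢ (trans (sym (cyc-top (suc n))) e)) (λ j e → ℕₚ.1+n≢n (trans (sym (cong toℕ (cyc-inject j))) (trans (cong toℕ e) (Finₚ.toℕ-inject₁ j))))
      where
      0≢ : ¬ zero ≡ fromℕ (suc n)
      0≢ ()
    one : ∀ m → 1 ℕ.≤ m → ∑ (λ (i : Fin m) → 𝟙 (cyc i == i)) ≡ 𝟙 (m ≡ᵇ 1)
    one (suc zero) _ = trans (∑-suc {0} (λ i → 𝟙 (cyc i == i))) (trans (cong (_+_ (𝟙 (cyc {1} zero == zero))) (∑-empty _)) refl)
    one (suc (suc n)) _ = ∑-zero λ i → cong 𝟙 (≢⇒== (cyc-moves n i))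

  -- The connected count

  iter-cong : ∀ {d} {σ τ : Map d} → (∀ x → σ x ≡ τ x) → ∀ k x → iter σ k x ≡ iter τ k x
  iter-cong h zero x = refl
  iter-cong {σ = σ} h (suc k) x = trans (cong σ (iter-cong h k x)) (h _)

  inClass-cong : ∀ {d} μ {σ τ : Map d} → (∀ x → σ x ≡ τ x) → inClass d μ σ ≡ inClass d μ τ
  inClass-cong {d} μ {σ} {τ} h = go (upTo d)
    where
    go : ∀ is → allL is (λ i → countF (λ x → orbitLen σ x ≡ᵇ suc i) ≡ᵇ (suc i ℕ.* mult μ (suc i))) ≡
                allL is (λ i → countF (λ x → orbitLen τ x ≡ᵇ suc i) ≡ᵇ (suc i ℕ.* mult μ (suc i)))
    go [] = refl
    go (i ∷ is) = cong₂ _∧_ (cong (_≡ᵇ (suc i ℕ.* mult μ (suc i))) (ℤₚ.+-injective (trans (countF-sum (λ x → orbitLen σ x ≡ᵇ suc i))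
      (trans (∑-cong λ x → cong (λ l → 𝟙 (l ≡ᵇ suc i)) (firstFrom-cong (λ k → cong (_== x) (iter-cong h k x)) 1 d)) (sym (countF-sum (λ x → orbitLen τ x ≡ᵇ suc i))))))) (go is)

  preserves-sw : ∀ {d} (ℓ : Fin d → ℕ) x y → preserves ℓ (sw x y) ≡ same ℓ x y
  preserves-sw ℓ x y = ⇔→≡ (λ h → ≡⇒≡ᵇ (trans (sym (preserves⇒ ℓ (sw x y) h x)) (cong ℓ (sw-l x y))))
    (λ h → ⇒preserves ℓ (sw x y) (sw-label ℓ (≡ᵇ⇒≡ {ℓ x} h)))

  module _ {d : ℕ} (2≤d : 2 ℕ.≤ d) where

    C₂ : Map d → Bool
    C₂ = inClass d (transpositionType d)

    words : (Fin d → ℕ) → ℕ → Map d → ℤ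
    words ℓ n σ = ∑ᴸ (tuples d n) λ τs → 𝟙 (allL τs C₂) * (𝟙 (allL τs (preserves ℓ)) * 𝟙 (isId (prodPerm (σ ∷ τs))))

    -- Absorbing the first letter τ into σ leaves the product unchanged and turns the sum over
    -- tuples into the recursion of `cw`; a swap preserves ℓ exactly when its two points share a
    -- block.
    words-cw : ∀ ℓ n σ → words ℓ n σ ≡ cw ℓ n σ
    words-cw ℓ zero σ = trans (ℤₚ.+-identityʳ _) (trans (ℤₚ.*-identityˡ (1ℤ * 𝟙 (isId σ))) (ℤₚ.*-identityˡ (𝟙 (isId σ))))
    words-cw ℓ (suc n) σ = begin
      words ℓ (suc n) σ
        ≡⟨ ∑ᴸ-concatMap (λ τ → List.map (τ ∷_) (tuples d n)) (perms d) (λ τs → 𝟙 (allL τs C₂) * (𝟙 (allL τs (preserves ℓ)) * 𝟙 (isId (prodPerm (σ ∷ τs))))) ⟩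
      ∑ᴸ (perms d) (λ τ → ∑ᴸ (List.map (τ ∷_) (tuples d n)) λ τs → 𝟙 (allL τs C₂) * (𝟙 (allL τs (preserves ℓ)) * 𝟙 (isId (prodPerm (σ ∷ τs)))))
        ≡⟨ ∑ᴸ-cong (perms d) (λ τ → trans (∑ᴸ-map (τ ∷_) (tuples d n) (λ τs → 𝟙 (allL τs C₂) * (𝟙 (allL τs (preserves ℓ)) * 𝟙 (isId (prodPerm (σ ∷ τs))))))
             (trans (∑ᴸ-cong (tuples d n) λ τs → head τ τs) (trans (∑ᴸ-*ˡ (𝟙 (C₂ τ) * 𝟙 (preserves ℓ τ)) (tuples d n) (λ τs → 𝟙 (allL τs C₂) * (𝟙 (allL τs (preserves ℓ)) * 𝟙 (isId (prodPerm ((σ ∘ τ) ∷ τs))))))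
               (trans (cong (𝟙 (C₂ τ) * 𝟙 (preserves ℓ τ) *_) (words-cw ℓ n (σ ∘ τ))) (ℤₚ.*-assoc (𝟙 (C₂ τ)) (𝟙 (preserves ℓ τ)) (cw ℓ n (σ ∘ τ))))))) ⟩
      ∑ᴸ (perms d) (λ τ → 𝟙 (C₂ τ) * F τ)
        ≡⟨ perms-sum d (λ τ → 𝟙 (C₂ τ) * F τ) (λ h → cong₂ (λ b z → 𝟙 b * z) (inClass-cong (transpositionType d) h) (F-ext h)) ⟩
      ∑ₚ (λ τ → 𝟙 (C₂ τ) * F τ)
        ≡⟨ transposition-sum d 2≤d F F-ext ⟩
      ∑₂ (λ x y → F (sw x y))
        ≡⟨ ∑₂-cong (λ x y _ → cong (λ b → 𝟙 b * cw ℓ n (σ ∘ sw x y)) (preserves-sw ℓ x y)) ⟩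
      cw ℓ (suc n) σ ∎
      where
      F : Map d → ℤ
      F τ = 𝟙 (preserves ℓ τ) * cw ℓ n (σ ∘ τ)
      F-ext : Ext F
      F-ext h = cong₂ (λ b z → 𝟙 b * z) (preserves-cong ℓ h) (cw-ext ℓ n (λ x → cong σ (h x)))
      alg : ∀ a b c d i → a * b * (c * d * i) ≡ a * c * (b * (d * i))
      alg = solve-∀
      head : ∀ τ τs → 𝟙 (C₂ τ ∧ allL τs C₂) * (𝟙 (preserves ℓ τ ∧ allL τs (preserves ℓ)) * 𝟙 (isId (prodPerm (σ ∷ τ ∷ τs)))) ≡
             𝟙 (C₂ τ) * 𝟙 (preserves ℓ τ) * (𝟙 (allL τs C₂) * (𝟙 (allL τs (preserves ℓ)) * 𝟙 (isId (prodPerm ((σ ∘ τ) ∷ τs)))))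
      head τ τs = trans (cong₂ (λ a b → a * (b * 𝟙 (isId (prodPerm (σ ∷ τ ∷ τs))))) (𝟙-∧ (C₂ τ) (allL τs C₂)) (𝟙-∧ (preserves ℓ τ) (allL τs (preserves ℓ))))
        (alg (𝟙 (C₂ τ)) (𝟙 (allL τs C₂)) (𝟙 (preserves ℓ τ)) (𝟙 (allL τs (preserves ℓ))) (𝟙 (isId (prodPerm ((σ ∘ τ) ∷ τs)))))

    connected : ℕ → Map d → ℤ
    connected n σ = ∑ᴸ (tuples d n) λ τs → 𝟙 (allL τs C₂) * (𝟙 (isId (prodPerm (σ ∷ τs))) * 𝟙 (isTransitive (σ ∷ τs)))

    expansion : Weighted d → ℕ → Map d → ℤ
    expansion L n σ = ∑ᴸ L λ (w , ℓ) → w * cw ℓ n σ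

    expansion-ext : ∀ L n → Ext (expansion L n)
    expansion-ext L n h = ∑ᴸ-cong L λ (w , ℓ) → cong (w *_) (cw-ext ℓ n h)

    connected-expansion : ∀ L → Moebius L → ∀ n σ → Perm σ → connected n σ ≡ expansion L n σ
    connected-expansion L M n σ P = begin
      connected n σ
        ≡⟨ ∑ᴸ-cong (tuples d n) (λ τs → trans (cong (λ z → 𝟙 (allL τs C₂) * (𝟙 (isId (prodPerm (σ ∷ τs))) * z)) (transitive-weigh (σ ∷ τs) L M))
             (trans (sym (ℤₚ.*-assoc (𝟙 (allL τs C₂)) (𝟙 (isId (prodPerm (σ ∷ τs)))) (weigh L (λ ℓ → allL (σ ∷ τs) (preserves ℓ)))))
               (trans (sym (∑ᴸ-*ˡ (𝟙 (allL τs C₂) * 𝟙 (isId (prodPerm (σ ∷ τs)))) L (λ (w , ℓ) → w * 𝟙 (allL (σ ∷ τs) (preserves ℓ)))))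
                 (∑ᴸ-cong L λ (w , ℓ) → trans (cong (λ z → 𝟙 (allL τs C₂) * 𝟙 (isId (prodPerm (σ ∷ τs))) * (w * z)) (𝟙-∧ (preserves ℓ σ) (allL τs (preserves ℓ))))
                   (alg (𝟙 (allL τs C₂)) (𝟙 (isId (prodPerm (σ ∷ τs)))) w (𝟙 (preserves ℓ σ)) (𝟙 (allL τs (preserves ℓ)))))))) ⟩
      ∑ᴸ (tuples d n) (λ τs → ∑ᴸ L λ (w , ℓ) → w * 𝟙 (preserves ℓ σ) * (𝟙 (allL τs C₂) * (𝟙 (allL τs (preserves ℓ)) * 𝟙 (isId (prodPerm (σ ∷ τs))))))
        ≡⟨ ∑ᴸ-∑ᴸ (tuples d n) L (λ τs (w , ℓ) → w * 𝟙 (preserves ℓ σ) * (𝟙 (allL τs C₂) * (𝟙 (allL τs (preserves ℓ)) * 𝟙 (isId (prodPerm (σ ∷ τs)))))) ⟩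
      ∑ᴸ L (λ (w , ℓ) → ∑ᴸ (tuples d n) λ τs → w * 𝟙 (preserves ℓ σ) * (𝟙 (allL τs C₂) * (𝟙 (allL τs (preserves ℓ)) * 𝟙 (isId (prodPerm (σ ∷ τs))))))
        ≡⟨ ∑ᴸ-cong L (λ (w , ℓ) → trans (∑ᴸ-*ˡ (w * 𝟙 (preserves ℓ σ)) (tuples d n) (λ τs → 𝟙 (allL τs C₂) * (𝟙 (allL τs (preserves ℓ)) * 𝟙 (isId (prodPerm (σ ∷ τs))))))
             (trans (cong (w * 𝟙 (preserves ℓ σ) *_) (words-cw ℓ n σ)) (trans (ℤₚ.*-assoc w (𝟙 (preserves ℓ σ)) (cw ℓ n σ)) (cong (w *_) (drop ℓ (preserves ℓ σ) refl))))) ⟩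
      expansion L n σ ∎
      where
      alg : ∀ a i w p b → a * i * (w * (p * b)) ≡ w * p * (a * (b * i))
      alg = solve-∀
      drop : ∀ ℓ b → preserves ℓ σ ≡ b → 𝟙 b * cw ℓ n σ ≡ cw ℓ n σ
      drop ℓ true e = ℤₚ.*-identityˡ (cw ℓ n σ)
      drop ℓ false e = sym (cw-zero ℓ n σ (trans (cong (isPerm σ ∧_) e) (∧-false (isPerm σ))))
        where ∧-false : ∀ a → a ∧ false ≡ false
              ∧-false true = refl
              ∧-false false = refl

    -- Conjugation replaces the weighted list `L` by its pullback. Both lists have the Möbius
    -- property, and both expansions therefore equal `connected n σ`, which does not mention a list.
    expansion-conj : ∀ L → Moebius L → ∀ n σ → Perm σ → ∀ {π} (P : Perm π) → expansion L n (π ∘ σ ∘ Perm.inv P) ≡ expansion L n σ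
    expansion-conj L M n σ S {π} P = begin
      expansion L n (π ∘ σ ∘ Perm.inv P)
        ≡⟨ ∑ᴸ-cong L (λ (w , ℓ) → cong (w *_) (cw-conj ℓ n σ P)) ⟩
      ∑ᴸ L (λ (w , ℓ) → w * cw (ℓ ∘ π) n σ)
        ≡⟨ sym (∑ᴸ-map (λ (w , ℓ) → w , ℓ ∘ π) L (λ (w , ℓ) → w * cw ℓ n σ)) ⟩
      expansion (pullback π L) n σ
        ≡⟨ sym (connected-expansion (pullback π L) (pullback-moebius L P M) n σ S) ⟩
      connected n σ
        ≡⟨ connected-expansion L M n σ S ⟩
      expansion L n σ ∎

    tuple-count : ∀ L → Moebius L → ∀ μ n → + length (filterᵇ (goodTuple d μ) (tuples d (suc n))) ≡ ∑ₚ (λ σ → 𝟙 (inClass d μ σ) * expansion L n σ)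
    tuple-count L M μ n = begin
      + length (filterᵇ (goodTuple d μ) (tuples d (suc n)))
        ≡⟨ length-filter (goodTuple d μ) (tuples d (suc n)) ⟩
      ∑ᴸ (tuples d (suc n)) (λ τs → 𝟙 (goodTuple d μ τs))
        ≡⟨ ∑ᴸ-concatMap (λ τ → List.map (τ ∷_) (tuples d n)) (perms d) (λ τs → 𝟙 (goodTuple d μ τs)) ⟩
      ∑ᴸ (perms d) (λ σ → ∑ᴸ (List.map (σ ∷_) (tuples d n)) λ τs → 𝟙 (goodTuple d μ τs))
        ≡⟨ ∑ᴸ-cong (perms d) (λ σ → trans (∑ᴸ-map (σ ∷_) (tuples d n) (λ τs → 𝟙 (goodTuple d μ τs))) (trans (∑ᴸ-cong (tuples d n) (split σ))
             (∑ᴸ-*ˡ (𝟙 (inClass d μ σ)) (tuples d n) (λ τs → 𝟙 (allL τs C₂) * (𝟙 (isId (prodPerm (σ ∷ τs))) * 𝟙 (isTransitive (σ ∷ τs))))))) ⟩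
      ∑ᴸ (perms d) (λ σ → 𝟙 (inClass d μ σ) * connected n σ)
        ≡⟨ ∑ᴸ-filter isPerm (allMaps d d) (λ σ → 𝟙 (inClass d μ σ) * connected n σ) ⟩
      ∑ᴸ (allMaps d d) (λ σ → 𝟙 (isPerm σ) * (𝟙 (inClass d μ σ) * connected n σ))
        ≡⟨ ∑ᴸ-cong (allMaps d d) (λ σ → 𝟙-guard (isPerm σ) λ e → cong (𝟙 (inClass d μ σ) *_) (connected-expansion L M n σ (toPerm (isPerm⇒Inj {σ = σ} e)))) ⟩
      ∑ᴸ (allMaps d d) (λ σ → 𝟙 (isPerm σ) * (𝟙 (inClass d μ σ) * expansion L n σ))
        ≡⟨ allMaps-sum d d (λ σ → 𝟙 (isPerm σ) * (𝟙 (inClass d μ σ) * expansion L n σ))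
             (Ext-perm {F = λ σ → 𝟙 (inClass d μ σ) * expansion L n σ} (λ h → cong₂ (λ b z → 𝟙 b * z) (inClass-cong μ h) (expansion-ext L n h))) ⟩
      ∑ₚ (λ σ → 𝟙 (inClass d μ σ) * expansion L n σ) ∎
      where
      split : ∀ σ τs → 𝟙 (goodTuple d μ (σ ∷ τs)) ≡ 𝟙 (inClass d μ σ) * (𝟙 (allL τs C₂) * (𝟙 (isId (prodPerm (σ ∷ τs))) * 𝟙 (isTransitive (σ ∷ τs))))
      split σ τs = trans (𝟙-∧ (inClass d μ σ) _) (cong (𝟙 (inClass d μ σ) *_) (trans (𝟙-∧ (allL τs C₂) _) (cong (𝟙 (allL τs C₂) *_) (𝟙-∧ (isId (prodPerm (σ ∷ τs))) (isTransitive (σ ∷ τs))))))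

    expE : Weighted d → Map d → Exp
    expE L σ = concatMap (λ (w , ℓ) → scale w (es ℓ σ)) L

    expE-eval : ∀ L σ n → eval (expE L σ) n ≡ #perms {d} * expansion L n σ
    expE-eval L σ n = trans (∑ᴸ-concatMap (λ (w , ℓ) → scale w (es ℓ σ)) L (λ (t , k) → t * k ^ n))
      (trans (∑ᴸ-cong L λ (w , ℓ) → trans (eval-scale w (es ℓ σ) n) (trans (cong (w *_) (sym (es-eval ℓ σ n))) (alg w (#perms {d}) (cw ℓ n σ)))) (∑ᴸ-*ˡ (#perms {d}) L (λ (w , ℓ) → w * cw ℓ n σ)))
      where alg : ∀ a b c → a * (b * c) ≡ b * (a * c)
            alg = solve-∀

    expE-coef : ∀ L σ k → coef (expE L σ) k ≡ ∑ᴸ L λ (w , ℓ) → w * cf ℓ σ k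
    expE-coef L σ k = trans (∑ᴸ-concatMap (λ (w , ℓ) → scale w (es ℓ σ)) L (λ (t , κ) → 𝟙 (κ ==ᶻ k) * t)) (∑ᴸ-cong L λ (w , ℓ) → coef-scale w (es ℓ σ) k)

    expE-top : ∀ L → Moebius L → ∀ σ → Perm σ → coef (expE L σ) (D 2≤d) ≡ 1ℤ
    expE-top L M σ P = trans (expE-coef L σ (D 2≤d)) (trans (∑ᴸ-cong L λ (w , ℓ) → cong (w *_) (cf-top 2≤d ℓ σ P)) (weigh-const L M))

    expE-between : ∀ L σ k → D′ 2≤d < k → ¬ k ≡ D 2≤d → coef (expE L σ) k ≡ 0ℤ
    expE-between L σ k a b = trans (expE-coef L σ k) (∑ᴸ-zero L λ (w , ℓ) → trans (cong (w *_) (cf-between 2≤d ℓ σ k a b)) (ℤₚ.*-zeroʳ w))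

    expE-second : 3 ℕ.≤ d → ∀ L → Moebius L → ∀ σ → Perm σ → coef (expE L σ) (D′ 2≤d) ≡ - (+ d * ∑ λ x → 𝟙 (σ x == x))
    expE-second 3≤d L M σ P = begin
      coef (expE L σ) (D′ 2≤d)
        ≡⟨ trans (expE-coef L σ (D′ 2≤d)) (∑ᴸ-cong L λ (w , ℓ) → trans (cong (w *_) (cf-point 2≤d 3≤d ℓ σ P)) (sym (∑-*ˡ w (λ x → 𝟙 (isPoint x ℓ) * (𝟙 (σ x == x) * + d))))) ⟩
      ∑ᴸ L (λ (w , ℓ) → ∑ λ x → w * (𝟙 (isPoint x ℓ) * (𝟙 (σ x == x) * + d)))
        ≡⟨ ∑ᴸ-∑ L (λ (w , ℓ) x → w * (𝟙 (isPoint x ℓ) * (𝟙 (σ x == x) * + d))) ⟩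
      ∑ (λ x → ∑ᴸ L λ (w , ℓ) → w * (𝟙 (isPoint x ℓ) * (𝟙 (σ x == x) * + d)))
        ≡⟨ ∑-cong (λ x → trans (∑ᴸ-cong L λ (w , ℓ) → sym (ℤₚ.*-assoc w (𝟙 (isPoint x ℓ)) (𝟙 (σ x == x) * + d))) (trans (∑ᴸ-*ʳ (𝟙 (σ x == x) * + d) L (λ (w , ℓ) → w * 𝟙 (isPoint x ℓ)))
             (trans (cong (_* (𝟙 (σ x == x) * + d)) (weigh-point L M x (proj₁ (other 2≤d x)) (proj₂ (other 2≤d x)))) (alg (𝟙 (σ x == x)) (+ d))))) ⟩
      ∑ (λ x → - (+ d) * 𝟙 (σ x == x))
        ≡⟨ trans (∑-*ˡ (- (+ d)) (λ x → 𝟙 (σ x == x))) (sym (ℤₚ.neg-distribˡ-* (+ d) (∑ λ x → 𝟙 (σ x == x)))) ⟩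
      - (+ d * ∑ λ x → 𝟙 (σ x == x)) ∎
      where alg : ∀ a d → (- 1ℤ) * (a * d) ≡ - d * a
            alg = solve-∀

    -- Negating all keys multiplies the function of `n` by (-1)^n, and multiplying by `sgn σ`
    -- compensates this by `cw-sgn`; uniqueness of coefficients does the rest.
    expE-parity : ∀ L σ → Perm σ → ∀ k → sgn σ * coef (expE L σ) (- k) ≡ coef (expE L σ) k
    expE-parity L σ P k = trans (cong (sgn σ *_) (sym (coef-negKey E k))) (trans (sym (coef-scale (sgn σ) (negKey E) k)) (coef-unique (scale (sgn σ) (negKey E)) E agree k))
      where
      E = expE L σ
      alg : ∀ s p n f → s * (p * (n * f)) ≡ n * (p * s * f)
      alg = solve-∀
      alg₂ : ∀ p s w c → p * s * (w * c) ≡ w * (p * s * c)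
      alg₂ = solve-∀
      agree : ∀ n → eval (scale (sgn σ) (negKey E)) n ≡ eval E n
      agree n = begin
        eval (scale (sgn σ) (negKey E)) n
          ≡⟨ trans (eval-scale (sgn σ) (negKey E) n) (cong (sgn σ *_) (trans (eval-negKey E n) (cong ((- 1ℤ) ^ n *_) (expE-eval L σ n)))) ⟩
        sgn σ * ((- 1ℤ) ^ n * (#perms {d} * expansion L n σ))
          ≡⟨ alg (sgn σ) ((- 1ℤ) ^ n) (#perms {d}) (expansion L n σ) ⟩
        #perms {d} * ((- 1ℤ) ^ n * sgn σ * expansion L n σ)
          ≡⟨ cong (#perms {d} *_) (trans (sym (∑ᴸ-*ˡ ((- 1ℤ) ^ n * sgn σ) L (λ (w , ℓ) → w * cw ℓ n σ))) (∑ᴸ-cong L λ (w , ℓ) →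
               trans (alg₂ ((- 1ℤ) ^ n) (sgn σ) w (cw ℓ n σ)) (cong (w *_) (cw-sgn ℓ n σ P)))) ⟩
        #perms {d} * expansion L n σ
          ≡⟨ sym (expE-eval L σ n) ⟩
        eval E n ∎

  -- The coefficients of the theorem.

  bounded : ∀ (es : Exp) → ∃[ M ] All (λ tk → ∣ proj₂ tk ∣ ℕ.≤ M) es
  bounded [] = 0 , []
  bounded ((t , κ) ∷ es) with bounded es
  ... | M , h = ∣ κ ∣ ℕ.+ M , ℕₚ.m≤m+n ∣ κ ∣ M ∷ All.map (λ le → ℕₚ.≤-trans le (ℕₚ.m≤n+m M ∣ κ ∣)) h

  0^suc : ∀ n → 1 ℕ.≤ n → 0ℤ ^ n ≡ 0ℤ
  0^suc (suc n) _ = ℤₚ.*-zeroˡ (0ℤ ^ n)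

  -- The terms of keys k and - k agree, and those of keys outside [-B , B] vanish.
  symmetric-eval : ∀ E s B → (∀ k → s * coef E (- k) ≡ coef E k) → (∀ k → B ℕ.< k → coef E (+ k) ≡ 0ℤ) →
    ∀ n → 1 ℕ.≤ n → (- 1ℤ) ^ n * s ≡ 1ℤ → eval E n ≡ + 2 * sumℤ B (λ k → coef E (+ k) * (+ k) ^ n)
  symmetric-eval E s B par above n 1≤n one = begin
    eval E n
      ≡⟨ eval-coef M E (All.map (λ le → ℕₚ.≤-trans le (ℕₚ.m≤m+n _ B)) (proj₂ (bounded E))) n ⟩
    sumℤ M (λ k → coef E (+ k) * (+ k) ^ n + coef E (- (+ k)) * (- (+ k)) ^ n) + coef E 0ℤ * 0ℤ ^ n
      ≡⟨ cong₂ _+_ (trans (sumℤ-cong M pair) (sumℤ-*ˡ M (+ 2) f)) (trans (cong (coef E 0ℤ *_) (0^suc n 1≤n)) (ℤₚ.*-zeroʳ (coef E 0ℤ))) ⟩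
    + 2 * sumℤ M f + 0ℤ
      ≡⟨ trans (ℤₚ.+-identityʳ _) (cong (+ 2 *_) (sumℤ-trunc B M f (ℕₚ.m≤n+m B (proj₁ (bounded E))) λ k a _ → cong (_* (+ k) ^ n) (above k a))) ⟩
    + 2 * sumℤ B f ∎
    where
    M = proj₁ (bounded E) ℕ.+ B
    f : ℕ → ℤ
    f k = coef E (+ k) * (+ k) ^ n
    alg : ∀ s c p k → s * c * (p * k) ≡ p * s * (c * k)
    alg = solve-∀
    alg₂ : ∀ x → x + 1ℤ * x ≡ + 2 * x
    alg₂ = solve-∀
    pair : ∀ k → coef E (+ k) * (+ k) ^ n + coef E (- (+ k)) * (- (+ k)) ^ n ≡ + 2 * f k
    pair k = trans (cong (_+_ (f k)) (trans (cong₂ _*_ (sym (trans (cong (λ z → s * coef E z) (sym (ℤₚ.neg-involutive (+ k)))) (par (- (+ k))))) (neg-^ (+ k) n))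
        (trans (alg s (coef E (+ k)) ((- 1ℤ) ^ n) ((+ k) ^ n)) (cong (_* f k) one)))) (alg₂ (f k))

  D-nat : ∀ {d} (2≤d : 2 ℕ.≤ d) → D 2≤d ≡ + (d C 2)
  D-nat {d} 2≤d = #pairs-C d

  D′-nat : ∀ {d} (2≤d : 2 ℕ.≤ d) → D′ 2≤d ≡ + ((d ∸ 1) C 2)
  D′-nat {suc d} (s≤s h) = trans (cong (_- (+ suc d - 1ℤ)) (#pairs-suc d)) (trans (alg (+ d) (#pairs d)) (#pairs-C d))
    where alg : ∀ d p → d + p - ((1ℤ + d) - 1ℤ) ≡ p
          alg = solve-∀

  moebius-labelings : ∀ d → 2 ℕ.≤ d → Moebius (labelings d)
  moebius-labelings (suc d) _ = labelings-moebius d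

  ≤-sum : ∀ μ → All (ℕ._≤ sum μ) μ
  ≤-sum [] = []
  ≤-sum (m ∷ μ) = ℕₚ.m≤m+n m (sum μ) ∷ All.map (λ le → ℕₚ.≤-trans le (ℕₚ.m≤n+m (sum μ) m)) (≤-sum μ)

  -- By `inversions-blk` the inversions of `blk μ` number d - l, so together with the 2g + d - 2 + l
  -- branch points they make 2g + 2d - 2, an even number. Thus the parity factor in `symmetric-eval`
  -- is 1.
  numBranch-even : ∀ μ → All (1 ℕ.≤_) μ → 2 ℕ.≤ sum μ → ∀ g → (- 1ℤ) ^ numBranch (sum μ) μ g * sgn (blk μ) ≡ 1ℤ
  numBranch-even μ pos 2≤d g = go (inversions (blk μ)) (inversions≥0 (blk μ)) (inversions-blk μ pos)
    where
    d = sum μ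
    go : ∀ i → 0ℤ ≤ i → i + + length μ ≡ + d → (- 1ℤ) ^ numBranch d μ g * (- 1ℤ) ^ ∣ i ∣ ≡ 1ℤ
    go (+ i) _ e = trans (sym (ℤₚ.^-distribˡ-+-* (- 1ℤ) (numBranch d μ g) i)) (trans (cong ((- 1ℤ) ^_) even) (-1^-+2 0 (g ℕ.+ (d ∸ 2) ℕ.+ 1)))
      where
      alg : ∀ g d l i → 2 ℕ.* g ℕ.+ d ℕ.+ l ℕ.+ i ≡ 2 ℕ.* g ℕ.+ d ℕ.+ (i ℕ.+ l)
      alg = solveℕ-∀
      alg₂ : ∀ g e → 2 ℕ.* g ℕ.+ e ℕ.+ (2 ℕ.+ e) ≡ 2 ℕ.* (g ℕ.+ e ℕ.+ 1)
      alg₂ = solveℕ-∀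
      even : numBranch d μ g ℕ.+ i ≡ 2 ℕ.* (g ℕ.+ (d ∸ 2) ℕ.+ 1)
      even = trans (alg g (d ∸ 2) (length μ) i) (trans (cong (2 ℕ.* g ℕ.+ (d ∸ 2) ℕ.+_) (trans (ℤₚ.+-injective e) (sym (ℕₚ.m+[n∸m]≡n 2≤d)))) (alg₂ g (d ∸ 2)))

  -- The content of the theorem in integers: `formula` has the denominators d! and μ_1⋯μ_l cleared,
  -- so rational numbers enter only afterwards.
  record Coefficients (d : ℕ) (μ : List ℕ) : Set where
    field
      cof : ℕ → ℤ
      formula : ∀ g → + (autSize d μ ℕ.* hurwitzCount d μ g ℕ.* product μ) ≡ + 2 * sumℤ (d C 2) (λ k → cof k * (+ k) ^ numBranch d μ g)
      gap : ∀ k → (d ∸ 1) C 2 ℕ.< k → k ℕ.< d C 2 → cof k ≡ 0ℤ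
      top : cof (d C 2) ≡ 1ℤ
      second : 3 ℕ.≤ d → cof ((d ∸ 1) C 2) ≡ - (+ (d ℕ.* mult μ 1))

  -- The coefficients are those of `expE` at the single representative `blk μ`. The factor `#perms`
  -- that `class-sum` produces is the one that `expE-eval` absorbs, which is why they come out as
  -- integers.
  coefficients : ∀ μ → 2 ℕ.≤ sum μ → All (1 ℕ.≤_) μ → Coefficients (sum μ) μ
  coefficients μ 2≤d pos = record
    { cof = λ k → coef E (+ k)
    ; formula = formula
    ; gap = λ k a b → expE-between 2≤d L σ (+ k) (subst (_< + k) (sym (D′-nat 2≤d)) (+<+ a)) (λ e → ℕₚ.<⇒≢ b (ℤₚ.+-injective (trans e (D-nat 2≤d))))
    ; top = trans (cong (coef E) (sym (D-nat 2≤d))) (expE-top 2≤d L M σ P)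
    ; second = λ 3≤d → trans (cong (coef E) (sym (D′-nat 2≤d))) (trans (expE-second 2≤d 3≤d L M σ P)
        (cong -_ (trans (cong (+ d *_) (fixed-blk μ pos)) (sym (ℤₚ.pos-* d (mult μ 1))))))
    }
    where
    d = sum μ
    σ = blk μ
    P = toPerm (blk-inj μ)
    L = labelings d
    M = moebius-labelings d 2≤d
    E = expE 2≤d L σ
    n≥1 : ∀ μ → 2 ℕ.≤ sum μ → ∀ g → 1 ℕ.≤ numBranch (sum μ) μ g
    n≥1 (m ∷ μ) _ g = ℕₚ.≤-trans (s≤s z≤n) (ℕₚ.m≤n+m (suc (length μ)) _)
    D′≤D : ∀ k → d C 2 ℕ.< k → D′ 2≤d < + k
    D′≤D k h = ℤₚ.<-trans (D′<D 2≤d) (subst (_< + k) (sym (D-nat 2≤d)) (+<+ h))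
    alg : ∀ a c p → a ℕ.* c ℕ.* p ≡ a ℕ.* p ℕ.* c
    alg = solveℕ-∀
    formula : ∀ g → + (autSize d μ ℕ.* hurwitzCount d μ g ℕ.* product μ) ≡ + 2 * sumℤ (d C 2) (λ k → coef E (+ k) * (+ k) ^ numBranch d μ g)
    formula g = begin
      + (autSize d μ ℕ.* hurwitzCount d μ g ℕ.* product μ)
        ≡⟨ trans (cong +_ (trans (alg (autSize d μ) (hurwitzCount d μ g) (product μ)) (cong (ℕ._* hurwitzCount d μ g) (aut-product d μ pos (≤-sum μ))))) (ℤₚ.pos-* (zf μ) (hurwitzCount d μ g)) ⟩
      + zf μ * + hurwitzCount d μ g
        ≡⟨ cong (+ zf μ *_) (tuple-count 2≤d L M μ n) ⟩
      + zf μ * ∑ₚ (λ σ → 𝟙 (inClass d μ σ) * expansion 2≤d L n σ)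
        ≡⟨ class-sum μ (expansion 2≤d L n) (expansion-ext 2≤d L n) pos (λ Q → expansion-conj 2≤d L M n σ P Q) ⟩
      #perms {d} * expansion 2≤d L n σ
        ≡⟨ sym (expE-eval 2≤d L σ n) ⟩
      eval E n
        ≡⟨ symmetric-eval E (sgn σ) (d C 2) (expE-parity 2≤d L σ P)
             (λ k h → expE-between 2≤d L σ (+ k) (D′≤D k h) (λ e → ℕₚ.<⇒≢ h (sym (ℤₚ.+-injective (trans e (D-nat 2≤d)))))) n (n≥1 μ 2≤d g) (numBranch-even μ pos 2≤d g) ⟩
      + 2 * sumℤ (d C 2) (λ k → coef E (+ k) * (+ k) ^ n) ∎
      where n = numBranch d μ g

-- Passage to rational numbers and the error term.

module HurwitzAsymptotics where
  open import Data.Empty using (⊥-elim)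
  open import Data.Integer.Base as ℤ using (ℤ; +_; -[1+_]; -_; 0ℤ; 1ℤ; ∣_∣)
  import Data.Integer.Properties as ℤₚ
  open import Data.Integer.Tactic.RingSolver using (solve-∀)
  open import Data.List.Base using (List; []; _∷_; length)
  open import Data.List.Relation.Unary.All using (All; []; _∷_)
  open import Data.Nat.Base as ℕ using (ℕ; zero; suc; _∸_; z≤n; s≤s; _!)
  open import Data.Nat.Combinatorics using (_C_; nCk+nC[k+1]≡[n+1]C[k+1]; nC1≡n)
  open import Data.Nat.ListAction using (product)
  import Data.Nat.Properties as ℕₚ
  open import Data.Nat.Tactic.RingSolver using () renaming (solve-∀ to solveℕ-∀)
  open import Data.Rational as ℚ using (ℚ; _/_; toℚᵘ)
  import Data.Rational.Properties as ℚₚ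
  open import Data.Rational.Unnormalised.Base as ℚᵘ using (mkℚᵘ; *≡*; _≃_)
  import Data.Rational.Unnormalised.Properties as ℚᵘₚ
  open import Defs
  open import Relation.Binary.PropositionalEquality
  open HurwitzNumbers using (sumℤ; sumℤ-trunc; Coefficients; 0^suc)

  -- Identities between rationals are checked on unnormalised fractions, where they become integer
  -- identities free of common divisors.
  /≃ : ∀ a n → toℚᵘ (a / suc n) ≃ mkℚᵘ a n
  /≃ a n = ℚₚ.toℚᵘ-fromℚᵘ (mkℚᵘ a n)

  frac-eq : ∀ a b n m .{{_ : ℕ.NonZero n}} .{{_ : ℕ.NonZero m}} → a ℤ.* + m ≡ b ℤ.* + n → a // n ≡ b // m
  frac-eq a b (suc n) (suc m) e = ℚₚ.fromℚᵘ-cong {mkℚᵘ a n} {mkℚᵘ b m} (*≡* e)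

  /≡// : ∀ a n .{{_ : ℕ.NonZero n}} → a / n ≡ a // n
  /≡// a (suc n) = refl

  frac-* : ∀ a b n → (a // n) ℚ.* fromℤ b ≡ (a ℤ.* b) // n
  frac-* a b zero = ℚₚ.*-zeroˡ (fromℤ b)
  frac-* a b (suc n) = ℚₚ.toℚᵘ-injective (ℚᵘₚ.≃-trans (ℚₚ.toℚᵘ-homo-* (a / suc n) (b / 1))
    (ℚᵘₚ.≃-trans (ℚᵘₚ.*-cong (/≃ a n) (/≃ b 0)) (ℚᵘₚ.≃-trans (*≡* (cong (λ k → (a ℤ.* b) ℤ.* + k) (sym (ℕₚ.*-identityʳ (suc n))))) (ℚᵘₚ.≃-sym (/≃ (a ℤ.* b) n)))))

  fromℤ-+ : ∀ a b → fromℤ (a ℤ.+ b) ≡ fromℤ a ℚ.+ fromℤ b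
  fromℤ-+ a b = ℚₚ.toℚᵘ-injective (ℚᵘₚ.≃-sym (ℚᵘₚ.≃-trans (ℚₚ.toℚᵘ-homo-+ (a / 1) (b / 1))
    (ℚᵘₚ.≃-trans (ℚᵘₚ.+-cong (/≃ a 0) (/≃ b 0)) (ℚᵘₚ.≃-trans (*≡* (alg a b)) (ℚᵘₚ.≃-sym (/≃ (a ℤ.+ b) 0))))))
    where alg : ∀ a b → (a ℤ.* 1ℤ ℤ.+ b ℤ.* 1ℤ) ℤ.* 1ℤ ≡ (a ℤ.+ b) ℤ.* (1ℤ ℤ.* 1ℤ)
          alg = solve-∀

  fromℤ-neg : ∀ a → fromℤ (ℤ.- a) ≡ ℚ.- fromℤ a
  fromℤ-neg a = ℚₚ.toℚᵘ-injective (ℚᵘₚ.≃-trans (/≃ (ℤ.- a) 0) (ℚᵘₚ.≃-sym (ℚᵘₚ.≃-trans (ℚₚ.toℚᵘ-homo‿- (a / 1)) (ℚᵘₚ.-‿cong (/≃ a 0)))))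

  fromℤ-- : ∀ a b → fromℤ (a ℤ.- b) ≡ fromℤ a ℚ.- fromℤ b
  fromℤ-- a b = trans (fromℤ-+ a (ℤ.- b)) (cong (fromℤ a ℚ.+_) (fromℤ-neg b))

  fromℤ-* : ∀ a b → fromℤ (a ℤ.* b) ≡ fromℤ a ℚ.* fromℤ b
  fromℤ-* a b = sym (frac-* a b 1)

  sumFrom1-fromℤ : ∀ n f → sumFrom1 n (λ k → fromℤ (f k)) ≡ fromℤ (sumℤ n f)
  sumFrom1-fromℤ zero f = refl
  sumFrom1-fromℤ (suc n) f = trans (cong (ℚ._+ fromℤ (f (suc n))) (sumFrom1-fromℤ n f)) (sym (fromℤ-+ (sumℤ n f) (f (suc n))))

  fromℤ-mono : ∀ {a b} → a ℤ.≤ b → fromℤ a ℚ.≤ fromℤ b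
  fromℤ-mono {a} {b} h = ℚₚ.toℚᵘ-cancel-≤ (ℚᵘₚ.≤-respˡ-≃ (ℚᵘₚ.≃-sym (/≃ a 0)) (ℚᵘₚ.≤-respʳ-≃ (ℚᵘₚ.≃-sym (/≃ b 0)) (ℚᵘ.*≤* (ℤₚ.*-monoʳ-≤-nonNeg (+ 1) h))))

  ∣fromℤ∣ : ∀ a → ℚ.∣ fromℤ a ∣ ≡ fromℤ (+ ℤ.∣ a ∣)
  ∣fromℤ∣ (+ n) = ℚₚ.0≤p⇒∣p∣≡p (fromℤ-mono {+ 0} {+ n} (ℤ.+≤+ z≤n))
  ∣fromℤ∣ -[1+ n ] = trans (cong ℚ.∣_∣ (fromℤ-neg (+ suc n))) (trans (ℚₚ.∣-p∣≡∣p∣ (fromℤ (+ suc n))) (ℚₚ.0≤p⇒∣p∣≡p (fromℤ-mono {+ 0} {+ suc n} (ℤ.+≤+ z≤n))))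

  *-distribˡ-- : ∀ q a b → q ℚ.* (a ℚ.- b) ≡ q ℚ.* a ℚ.- q ℚ.* b
  *-distribˡ-- q a b = trans (ℚₚ.*-distribˡ-+ q a (ℚ.- b)) (cong (q ℚ.* a ℚ.+_) (sym (ℚₚ.neg-distribʳ-* q b)))

  ∣^∣ : ∀ a n → ℤ.∣ a ℤ.^ n ∣ ≡ ℤ.∣ a ∣ ℕ.^ n
  ∣^∣ a zero = refl
  ∣^∣ a (suc n) = trans (ℤₚ.abs-* a (a ℤ.^ n)) (cong (ℤ.∣ a ∣ ℕ.*_) (∣^∣ a n))

  norm : ℕ → (ℕ → ℤ) → ℕ
  norm zero c = 0
  norm (suc M) c = norm M c ℕ.+ ℤ.∣ c (suc M) ∣

  power-sum-bound : ∀ M B (c : ℕ → ℤ) n → M ℕ.≤ B → ℤ.∣ sumℤ M (λ k → c k ℤ.* (+ k) ℤ.^ n) ∣ ℕ.≤ norm M c ℕ.* B ℕ.^ n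
  power-sum-bound zero B c n _ = z≤n
  power-sum-bound (suc M) B c n le = begin
    ℤ.∣ S ℤ.+ t ∣
      ≤⟨ ℤₚ.∣i+j∣≤∣i∣+∣j∣ S t ⟩
    ℤ.∣ S ∣ ℕ.+ ℤ.∣ t ∣
      ≡⟨ cong (ℤ.∣ S ∣ ℕ.+_) (trans (ℤₚ.abs-* (c (suc M)) ((+ suc M) ℤ.^ n)) (cong (ℤ.∣ c (suc M) ∣ ℕ.*_) (∣^∣ (+ suc M) n))) ⟩
    ℤ.∣ S ∣ ℕ.+ ℤ.∣ c (suc M) ∣ ℕ.* suc M ℕ.^ n
      ≤⟨ ℕₚ.+-mono-≤ (power-sum-bound M B c n (ℕₚ.≤-trans (ℕₚ.n≤1+n M) le)) (ℕₚ.*-monoʳ-≤ ℤ.∣ c (suc M) ∣ (ℕₚ.^-monoˡ-≤ n le)) ⟩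
    norm M c ℕ.* B ℕ.^ n ℕ.+ ℤ.∣ c (suc M) ∣ ℕ.* B ℕ.^ n
      ≡⟨ sym (ℕₚ.*-distribʳ-+ (B ℕ.^ n) (norm M c) ℤ.∣ c (suc M) ∣) ⟩
    norm (suc M) c ℕ.* B ℕ.^ n ∎
    where
    open ℕₚ.≤-Reasoning
    S = sumℤ M (λ k → c k ℤ.* (+ k) ℤ.^ n)
    t = c (suc M) ℤ.* (+ suc M) ℤ.^ n

  C₂-suc : ∀ n → suc n C 2 ≡ n ℕ.+ n C 2
  C₂-suc n = trans (sym (nCk+nC[k+1]≡[n+1]C[k+1] n 1)) (cong (ℕ._+ n C 2) (nC1≡n n))

  -- For `d ≥ 3` the gap leaves only the two leading keys, whose terms cancel exactly against the
  -- main terms, and the keys up to `(d ∸ 1) C 2 ∸ 1`, whose coefficients are collected in `norm`.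
  remainder : ∀ d → 2 ℕ.≤ d → ∀ m (c : ℕ → ℤ) →
    (∀ k → (d ∸ 1) C 2 ℕ.< k → k ℕ.< d C 2 → c k ≡ 0ℤ) → c (d C 2) ≡ 1ℤ →
    (3 ℕ.≤ d → c ((d ∸ 1) C 2) ≡ - (+ (d ℕ.* m))) → ∀ n → 1 ℕ.≤ n →
    ∣ sumℤ (d C 2) (λ k → c k ℤ.* (+ k) ℤ.^ n) ℤ.- ((+ (d C 2)) ℤ.^ n ℤ.- + (d ℕ.* m) ℤ.* (+ ((d ∸ 1) C 2)) ℤ.^ n) ∣
      ℕ.≤ norm ((d ∸ 1) C 2 ∸ 1) c ℕ.* ∣ ((+ ((d ∸ 1) C 2)) ℤ.- 1ℤ) ℤ.^ n ∣
  -- For `d = 2` the sum has one term and the lower base is 0, whose power vanishes because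
  -- `1 ℕ.≤ n`. The main terms are exact, matching the bound, whose factor `norm` is 0.
  remainder (suc (suc zero)) (s≤s (s≤s z≤n)) m c gap top second n 1≤n = ℕₚ.≤-reflexive (cong ∣_∣ (begin
    (0ℤ ℤ.+ c 1 ℤ.* 1ℤ ℤ.^ n) ℤ.- (1ℤ ℤ.^ n ℤ.- + (2 ℕ.* m) ℤ.* 0ℤ ℤ.^ n)
      ≡⟨ cong₂ (λ a b → (0ℤ ℤ.+ a ℤ.* 1ℤ ℤ.^ n) ℤ.- (1ℤ ℤ.^ n ℤ.- + (2 ℕ.* m) ℤ.* b)) top (0^suc n 1≤n) ⟩
    (0ℤ ℤ.+ 1ℤ ℤ.* 1ℤ ℤ.^ n) ℤ.- (1ℤ ℤ.^ n ℤ.- + (2 ℕ.* m) ℤ.* 0ℤ)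
      ≡⟨ alg (1ℤ ℤ.^ n) (+ (2 ℕ.* m)) ⟩
    0ℤ ∎))
    where
    open ≡-Reasoning
    alg : ∀ x m → (0ℤ ℤ.+ 1ℤ ℤ.* x) ℤ.- (x ℤ.- m ℤ.* 0ℤ) ≡ 0ℤ
    alg = solve-∀
  remainder (suc (suc (suc k))) _ m c gap top second n 1≤n = go (d′ C 2) refl
    where
    open ≡-Reasoning
    d′ = suc (suc k)
    f : ℕ → ℤ
    f j = c j ℤ.* (+ j) ℤ.^ n
    positive : 1 ℕ.≤ d′ C 2
    positive = subst (1 ℕ.≤_) (sym (C₂-suc (suc k))) (s≤s z≤n)
    bigD : suc d′ C 2 ≡ suc (suc k ℕ.+ d′ C 2)
    bigD = C₂-suc d′
    split : sumℤ (suc d′ C 2) f ≡ sumℤ (d′ C 2) f ℤ.+ (+ (suc d′ C 2)) ℤ.^ n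
    split = begin
      sumℤ (suc d′ C 2) f
        ≡⟨ cong (λ D → sumℤ D f) bigD ⟩
      sumℤ (suc k ℕ.+ d′ C 2) f ℤ.+ f (suc (suc k ℕ.+ d′ C 2))
        ≡⟨ cong₂ ℤ._+_ (sumℤ-trunc (d′ C 2) (suc k ℕ.+ d′ C 2) f (ℕₚ.m≤n+m (d′ C 2) (suc k))
             (λ j a b → cong (ℤ._* (+ j) ℤ.^ n) (gap j a (subst (j ℕ.<_) (sym bigD) (s≤s b)))))
             (trans (cong f (sym bigD)) (trans (cong (ℤ._* (+ (suc d′ C 2)) ℤ.^ n) top) (ℤₚ.*-identityˡ ((+ (suc d′ C 2)) ℤ.^ n)))) ⟩
      sumℤ (d′ C 2) f ℤ.+ (+ (suc d′ C 2)) ℤ.^ n ∎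
    go : ∀ D′ → d′ C 2 ≡ D′ →
      ∣ sumℤ (suc d′ C 2) f ℤ.- ((+ (suc d′ C 2)) ℤ.^ n ℤ.- + (suc d′ ℕ.* m) ℤ.* (+ (d′ C 2)) ℤ.^ n) ∣
        ℕ.≤ norm (d′ C 2 ∸ 1) c ℕ.* ∣ ((+ (d′ C 2)) ℤ.- 1ℤ) ℤ.^ n ∣
    go zero e = ⊥-elim (ℕₚ.<-irrefl (sym e) positive)
    -- With the lower binomial coefficient written as `suc b`, the base of the error term is `b`,
    -- the largest of the remaining keys.
    go (suc b) e = subst₂ ℕ._≤_ (cong ∣_∣ (sym exact)) (cong₂ (λ D x → norm (D ∸ 1) c ℕ.* x) (sym e)
        (sym (trans (cong (λ D → ∣ (+ D ℤ.- 1ℤ) ℤ.^ n ∣) e) (∣^∣ (+ b) n)))) (power-sum-bound b b c n ℕₚ.≤-refl)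
      where
      alg : ∀ s m x y → (s ℤ.+ (ℤ.- m) ℤ.* y ℤ.+ x) ℤ.- (x ℤ.- m ℤ.* y) ≡ s
      alg = solve-∀
      exact : sumℤ (suc d′ C 2) f ℤ.- ((+ (suc d′ C 2)) ℤ.^ n ℤ.- + (suc d′ ℕ.* m) ℤ.* (+ (d′ C 2)) ℤ.^ n) ≡ sumℤ b f
      exact = begin
        sumℤ (suc d′ C 2) f ℤ.- (X ℤ.- + (suc d′ ℕ.* m) ℤ.* Y)
          ≡⟨ cong (ℤ._- (X ℤ.- + (suc d′ ℕ.* m) ℤ.* Y)) (trans split (cong (ℤ._+ X) (trans (cong (λ D → sumℤ D f) e) (cong (λ z → sumℤ b f ℤ.+ z)
               (trans (cong f (sym e)) (cong (ℤ._* Y) (second (s≤s (s≤s (s≤s z≤n)))))))))) ⟩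
        (sumℤ b f ℤ.+ (ℤ.- (+ (suc d′ ℕ.* m))) ℤ.* Y ℤ.+ X) ℤ.- (X ℤ.- + (suc d′ ℕ.* m) ℤ.* Y)
          ≡⟨ alg (sumℤ b f) (+ (suc d′ ℕ.* m)) X Y ⟩
        sumℤ b f ∎
        where
        X = (+ (suc d′ C 2)) ℤ.^ n
        Y = (+ (d′ C 2)) ℤ.^ n

  exponent : ∀ d → 2 ℕ.≤ d → ∀ μ g → d ℕ.+ 2 ℕ.* g ∸ 2 ℕ.+ length μ ≡ numBranch d μ g
  exponent (suc (suc d)) (s≤s (s≤s z≤n)) μ g = cong (ℕ._+ length μ) (ℕₚ.+-comm d (2 ℕ.* g))

  product≢0 : ∀ {μ} → All (1 ℕ.≤_) μ → ℕ.NonZero (product μ)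
  product≢0 [] = _
  product≢0 {m ∷ μ} (h ∷ hs) = ℕₚ.m*n≢0 m (product μ) {{ℕ.>-nonZero h}} {{product≢0 hs}}

  module Hurwitz (d : ℕ) (2≤d : 2 ℕ.≤ d) (μ : List ℕ) (pos : All (1 ℕ.≤_) μ) (nonempty : 1 ℕ.≤ length μ) (coefs : Coefficients d μ) where
    open Coefficients coefs

    private instance
      d!≢0 : ℕ.NonZero (d !)
      d!≢0 = d ℕₚ.!≢0
      P≢0 : ℕ.NonZero (product μ)
      P≢0 = product≢0 pos
      dP≢0 : ℕ.NonZero (d ! ℕ.* product μ)
      dP≢0 = ℕₚ.m*n≢0 (d !) (product μ)

    e : ℕ → ℕ
    e g = d ℕ.+ 2 ℕ.* g ∸ 2 ℕ.+ length μ

    S : ℕ → ℤ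
    S g = sumℤ (d C 2) (λ k → cof k ℤ.* (+ k) ℤ.^ e g)

    Q : ℚ
    Q = (+ 2) // (d ! ℕ.* product μ)

    hurwitz-sum : ∀ g → hurwitz d μ g ≡ Q ℚ.* fromℤ (S g)
    hurwitz-sum g = trans (/≡// (+ Ac) (d !)) (trans (frac-eq (+ Ac) (+ 2 ℤ.* S g) (d !) (d ! ℕ.* product μ) cross) (sym (frac-* (+ 2) (S g) (d ! ℕ.* product μ))))
      where
      open ≡-Reasoning
      Ac = autSize d μ ℕ.* hurwitzCount d μ g
      alg : ∀ a f p → a ℕ.* (f ℕ.* p) ≡ a ℕ.* p ℕ.* f
      alg = solveℕ-∀
      cross : + Ac ℤ.* + (d ! ℕ.* product μ) ≡ (+ 2 ℤ.* S g) ℤ.* + (d !)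
      cross = begin
        + Ac ℤ.* + (d ! ℕ.* product μ)
          ≡⟨ trans (sym (ℤₚ.pos-* Ac (d ! ℕ.* product μ))) (trans (cong +_ (alg Ac (d !) (product μ))) (ℤₚ.pos-* (Ac ℕ.* product μ) (d !))) ⟩
        + (Ac ℕ.* product μ) ℤ.* + (d !)
          ≡⟨ cong (ℤ._* + (d !)) (trans (formula g) (cong (λ n → + 2 ℤ.* sumℤ (d C 2) (λ k → cof k ℤ.* (+ k) ℤ.^ n)) (sym (exponent d 2≤d μ g)))) ⟩
        (+ 2 ℤ.* S g) ℤ.* + (d !) ∎

    expansion-formula : ∀ g → hurwitz d μ g ≡ Q ℚ.* sumFrom1 (d C 2) (λ k → fromℤ (cof k ℤ.* (+ k) ℤ.^ e g))
    expansion-formula g = trans (hurwitz-sum g) (cong (Q ℚ.*_) (sym (sumFrom1-fromℤ (d C 2) (λ k → cof k ℤ.* (+ k) ℤ.^ e g))))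

    second-coefficient : (+ (2 ℕ.* mult μ 1)) // ((d ∸ 1) ! ℕ.* product μ) ≡ Q ℚ.* fromℤ (+ (d ℕ.* mult μ 1))
    second-coefficient = trans (cross d 2≤d) (sym (frac-* (+ 2) (+ (d ℕ.* mult μ 1)) (d ! ℕ.* product μ)))
      where
      alg : ∀ m d f p → (2 ℕ.* m) ℕ.* (d ℕ.* f ℕ.* p) ≡ 2 ℕ.* (d ℕ.* m) ℕ.* (f ℕ.* p)
      alg = solveℕ-∀
      cross : ∀ d → 2 ℕ.≤ d → (+ (2 ℕ.* mult μ 1)) // ((d ∸ 1) ! ℕ.* product μ) ≡ (+ 2 ℤ.* + (d ℕ.* mult μ 1)) // (d ! ℕ.* product μ)
      cross (suc d) _ = frac-eq (+ (2 ℕ.* mult μ 1)) (+ 2 ℤ.* + (suc d ℕ.* mult μ 1)) (d ! ℕ.* product μ) (suc d ! ℕ.* product μ)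
        {{ℕₚ.m*n≢0 (d !) (product μ) {{d ℕₚ.!≢0}}}} {{ℕₚ.m*n≢0 (suc d !) (product μ) {{suc d ℕₚ.!≢0}}}}
        (trans (sym (ℤₚ.pos-* (2 ℕ.* mult μ 1) (suc d ! ℕ.* product μ))) (trans (cong +_ (alg (mult μ 1) (suc d) (d !) (product μ)))
          (trans (ℤₚ.pos-* (2 ℕ.* (suc d ℕ.* mult μ 1)) (d ! ℕ.* product μ)) (cong (ℤ._* + (d ! ℕ.* product μ)) (ℤₚ.pos-* 2 (suc d ℕ.* mult μ 1))))))

    M : ℕ
    M = norm ((d ∸ 1) C 2 ∸ 1) cof

    bound : ∀ g →
      ℚ.∣ hurwitz d μ g ℚ.-
        ((Q ℚ.* fromℤ ((+ (d C 2)) ℤ.^ e g)) ℚ.-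
          (((+ (2 ℕ.* mult μ 1)) // ((d ∸ 1) ! ℕ.* product μ)) ℚ.* fromℤ ((+ ((d ∸ 1) C 2)) ℤ.^ e g))) ∣
        ℚ.≤ (ℚ.∣ Q ∣ ℚ.* fromℤ (+ M)) ℚ.* ℚ.∣ fromℤ (((+ ((d ∸ 1) C 2)) ℤ.- 1ℤ) ℤ.^ e g) ∣
    bound g = begin
      ℚ.∣ hurwitz d μ g ℚ.- (Q ℚ.* fromℤ X ℚ.- q₂ ℚ.* fromℤ Y) ∣
        ≡⟨ cong ℚ.∣_∣ collect ⟩
      ℚ.∣ Q ℚ.* fromℤ R ∣
        ≡⟨ trans (ℚₚ.∣p*q∣≡∣p∣*∣q∣ Q (fromℤ R)) (cong (ℚ.∣ Q ∣ ℚ.*_) (∣fromℤ∣ R)) ⟩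
      ℚ.∣ Q ∣ ℚ.* fromℤ (+ ∣ R ∣)
        ≤⟨ ℚₚ.*-monoˡ-≤-nonNeg ℚ.∣ Q ∣ {{ℚₚ.∣-∣-nonNeg Q}} (fromℤ-mono (ℤ.+≤+ (remainder d 2≤d (mult μ 1) cof gap top second (e g) (ℕₚ.≤-trans nonempty (ℕₚ.m≤n+m (length μ) (d ℕ.+ 2 ℕ.* g ∸ 2)))))) ⟩
      ℚ.∣ Q ∣ ℚ.* fromℤ (+ (M ℕ.* ∣ Z ∣))
        ≡⟨ trans (cong (λ z → ℚ.∣ Q ∣ ℚ.* fromℤ z) (ℤₚ.pos-* M ∣ Z ∣)) (trans (cong (ℚ.∣ Q ∣ ℚ.*_) (fromℤ-* (+ M) (+ ∣ Z ∣)))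
             (trans (sym (ℚₚ.*-assoc ℚ.∣ Q ∣ (fromℤ (+ M)) (fromℤ (+ ∣ Z ∣)))) (cong ((ℚ.∣ Q ∣ ℚ.* fromℤ (+ M)) ℚ.*_) (sym (∣fromℤ∣ Z))))) ⟩
      (ℚ.∣ Q ∣ ℚ.* fromℤ (+ M)) ℚ.* ℚ.∣ fromℤ Z ∣ ∎
      where
      open ℚₚ.≤-Reasoning
      X = (+ (d C 2)) ℤ.^ e g
      Y = (+ ((d ∸ 1) C 2)) ℤ.^ e g
      Z = ((+ ((d ∸ 1) C 2)) ℤ.- 1ℤ) ℤ.^ e g
      m = + (d ℕ.* mult μ 1)
      R = S g ℤ.- (X ℤ.- m ℤ.* Y)
      q₂ = (+ (2 ℕ.* mult μ 1)) // ((d ∸ 1) ! ℕ.* product μ)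
      collect : hurwitz d μ g ℚ.- (Q ℚ.* fromℤ X ℚ.- q₂ ℚ.* fromℤ Y) ≡ Q ℚ.* fromℤ R
      collect = sym (trans (cong (Q ℚ.*_) (fromℤ-- (S g) (X ℤ.- m ℤ.* Y))) (trans (*-distribˡ-- Q (fromℤ (S g)) (fromℤ (X ℤ.- m ℤ.* Y)))
        (cong₂ ℚ._-_ (sym (hurwitz-sum g)) (trans (cong (Q ℚ.*_) (fromℤ-- X (m ℤ.* Y))) (trans (*-distribˡ-- Q (fromℤ X) (fromℤ (m ℤ.* Y)))
          (cong (λ z → Q ℚ.* fromℤ X ℚ.- z) (trans (cong (Q ℚ.*_) (fromℤ-* m Y)) (trans (sym (ℚₚ.*-assoc Q (fromℤ m) (fromℤ Y))) (cong (ℚ._* fromℤ Y) (sym second-coefficient))))))))))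

open import Defs
open import Data.Nat as ℕ using (ℕ; suc; _+_; _*_; _∸_; _!)
open import Data.Nat.Combinatorics using (_C_)
open import Data.Nat.ListAction using (product)
open import Data.List using (List; length)
open import Data.Integer as ℤ using (ℤ; +_; -_)
open import Data.Rational as ℚ using (ℚ; ∣_∣)
open import Data.Product using (_×_; Σ-syntax)
open import Relation.Binary.PropositionalEquality using (_≡_)
open import Data.List using (_∷_)
open import Data.Nat using (s≤s; z≤n)
open import Data.Nat.ListAction using (sum)
open import Data.Product using (_,_)
open import Relation.Binary.PropositionalEquality using (refl)
open HurwitzNumbers using (Coefficients; coefficients)
open HurwitzAsymptotics using (module Hurwitz)

theorem1p3 : ∀ (d : ℕ) → 2 ℕ.≤ d → ∀ (μ : List ℕ) → IsPartition d μ →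
    (Σ[ coef ∈ (ℕ → ℤ) ] (
    (∀ (g : ℕ) → hurwitz d μ g ≡
    (((+ 2) // (d ! * product μ)) ℚ.*
    sumFrom1 (d C 2) (λ k → fromℤ (coef k ℤ.* ((+ k) ℤ.^ (d + 2 * g ∸ 2 + length μ))))))
    × (∀ (k : ℕ) → (d ∸ 1) C 2 ℕ.< k → k ℕ.< d C 2 → coef k ≡ + 0)
    × coef (d C 2) ≡ + 1
    × (3 ℕ.≤ d → coef ((d ∸ 1) C 2) ≡ - (+ (d * mult μ 1)))))
    × (Σ[ K ∈ ℚ ] Σ[ g₀ ∈ ℕ ] ∀ (g : ℕ) → g₀ ℕ.≤ g →
    ∣ hurwitz d μ g ℚ.-
    ((((+ 2) // (d ! * product μ)) ℚ.* fromℤ ((+ (d C 2)) ℤ.^ (d + 2 * g ∸ 2 + length μ)))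
    ℚ.- (((+ (2 * mult μ 1)) // ((d ∸ 1) ! * product μ))
    ℚ.* fromℤ ((+ ((d ∸ 1) C 2)) ℤ.^ (d + 2 * g ∸ 2 + length μ)))) ∣
    ℚ.≤ K ℚ.* ∣ fromℤ (((+ ((d ∸ 1) C 2)) ℤ.- (+ 1)) ℤ.^ (d + 2 * g ∸ 2 + length μ)) ∣)
theorem1p3 d 2≤d μ (pos , _ , refl) =
    (cof , expansion-formula , gap , top , second)
  -- The constant is the prefactor times the sum of the absolute values of the coefficients below
  -- C(d-1,2). It comes from an exact finite sum, so the estimate holds from genus 0 on.
  , (∣ Q ∣ ℚ.* fromℤ (+ M) , 0 , λ g _ → bound g)
  where
  length>0 : ∀ ν → 2 ℕ.≤ sum ν → 1 ℕ.≤ length ν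
  length>0 (_ ∷ _) _ = s≤s z≤n
  coefs = coefficients μ 2≤d pos
  open Coefficients coefs
  open Hurwitz d 2≤d μ pos (length>0 μ 2≤d) coefs
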